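{- Let $2\leq d\leq 10$ and consider the equation \[ (x+1)^2+(x+2)^2+\cdots+(x+d)^2=y^n \] in integers $x,y$ and $n\geq 2$. The only solutions $(d,x,y,n)$ with $n\geq 3$ are \[ (2,-1,\pm 1,2r),\quad (2,-2,\pm 1,2r),\quad (2,-1,1,2r+1),\quad (2,-2,1,2r+1),\quad (2,118,\pm 13,4),\quad (2,-121,\pm 13,4), \] where $r$ is an integer (with the exponent $n$ being at least $3$). The only solutions with $n=2$ form the infinite family with $d=2$ and \[ 2x+3+y\sqrt{2}=\pm(1+\sqrt{2})^{2r+1},\qquad r\in\mathbb{Z}. \] -}

module Defs where

open import Data.Nat as ℕ using (ℕ; zero; suc)
open import Data.Integer using (ℤ; +_; -[1+_]; _+_; _*_; -_; _^_)
open import Data.Product using (_×_; _,_)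

sumSq : ℕ → ℤ → ℤ
sumSq zero    x = + 0
sumSq (suc d) x = sumSq d x + (x + + suc d) ^ 2

-- Elements a + b√2 of ℤ[√2], represented as pairs (a , b).
ℤ√2 : Set
ℤ√2 = ℤ × ℤ

_·_ : ℤ√2 → ℤ√2 → ℤ√2
(a , b) · (c , e) = (a * c + + 2 * (b * e)) , (a * e + b * c)

neg : ℤ√2 → ℤ√2
neg (a , b) = (- a) , (- b)

ε : ℤ√2
ε = + 1 , + 1

ε⁻¹ : ℤ√2
ε⁻¹ = -[1+ 0 ] , + 1

powℕ : ℤ√2 → ℕ → ℤ√2
powℕ u zero    = + 1 , + 0
powℕ u (suc k) = u · powℕ u k

εpow : ℤ → ℤ√2
εpow (+ k)      = powℕ ε k
εpow -[1+ k ]   = powℕ ε⁻¹ (suc k)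

-- Completing the square turns d = 2, 3, 6 into X² + 1 = 2yⁿ, 3X² + 2 = yⁿ and 3X² + 35 = 2yⁿ; every other d, and
-- even n for d = 3 and 6, fails modulo a small number.
--
-- For pX² + q = c yⁿ with n = 2m + 1, the binary quadratic form with coefficients pcy, pX, yⁿ⁻¹ has determinant pq,
-- hence a small value, which congruences force to be 1. A vector representing 1 factors X√p + √-q in ℤ[√-pq] and
-- yields γ of norm y² and an integer h with Re γᵐ + p h Im γᵐ = ±1. Congruences and the 2-adic expansion of γᵐ leave
-- only y = 1, for p = q = 1.
--
-- For X² + 1 = 2y⁴ the same factorisation gives y = A² + B² with Re (A + Bi)⁴ + Im (A + Bi)⁴ = ±1, a quartic Thue
-- equation. Multiplying A + Bi by 3 - 2i, which comes from the known solution, makes (u + vi)⁴ = ρ + σi with ρ / σ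
-- extremely close to 239. The Padé approximants p / q of the fourth root recover v / u from ρ / σ up to an explicit
-- error. Replacing ρ / σ by 239 turns the error v q - u p into an integer of absolute value below 1 if u ≥ 30, and
-- its vanishing for two consecutive approximants is impossible.
--
-- The case n = 2, d = 2 is the negative Pell equation, solved by descent along 1 + √2.
module Submission where

open import Data.Nat as ℕ using (ℕ; zero; suc; s≤s; z≤n)
import Data.Nat.Properties as ℕ
open import Data.Integer as ℤ using (ℤ)
import Data.Integer.Properties as ℤ
open import Data.Empty using (⊥; ⊥-elim)
open import Data.Product using (_×_; _,_; proj₁; proj₂; ∃; ∃₂)
open import Data.Sum using (_⊎_; inj₁; inj₂; [_,_]′)
open import Relation.Binary.PropositionalEquality
open import Relation.Nullary using (contradiction; yes; no)

-- The rings ℤ[√-6] and ℤ[√-105] lack unique factorisation. A form that takes the value 1 belongs to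
-- the principal class, so excluding the other small values by congruences stands in for a class
-- group computation. For X² + 1 = 2y⁴ congruences alone cannot succeed, as y = 1 and y = 13 occur;
-- an effective approximation argument has to replace them. Since (3 - 2i)⁴ = -119 - 120i and 120 ·
-- 239 - 119 = 119 · 239 + 120 = 13⁴, the Thue equation becomes |ρ - 239σ| = 13⁴, independent of the
-- size of u + vi. A recurrence with leading coefficient (s + 2)(s + 1) would only give rational
-- approximants. As coefficients of integral power series they are integers, growing by at most 17 ·
-- 240 per step, while the exact remainder gains a factor 59 per step. Replacing ρ/σ by 239 costs a
-- relative error of order v⁻⁴, and 2 · 17 · 240 < 59³ keeps it harmless as the index grows. Sizes,
-- signs and the dependence on the argument are read off the recurrences in ℕ, so no real analysis
-- enters.

module Arith where

  open import Data.Integer using (+_; -[1+_]; _+_; _*_; -_; _-_; _^_; ∣_∣)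
  open import Data.Integer.Tactic.RingSolver using (solve-∀)

  no-multiple : ∀ m r x → .{{ℕ.NonZero r}} → r ℕ.< m → + m * x ≡ + r → ⊥
  no-multiple m r x r<m e with ∣ x ∣ in eq | trans (sym (ℤ.abs-* (+ m) x)) (cong ∣_∣ e)
  ... | zero | h = ℕ.≢-nonZero⁻¹ r (trans (sym h) (ℕ.*-zeroʳ m))
  ... | suc k | h = ℕ.<⇒≱ r<m (ℕ.≤-trans (ℕ.m≤m*n m (suc k)) (ℕ.≤-reflexive h))

  nonneg : ∀ a (z : ℤ) b → .{{ℕ.NonZero a}} → + a * z ≡ + b → z ≡ + ∣ z ∣
  nonneg a (+ k) b e = refl
  nonneg (suc a) (-[1+ k ]) b ()

  IsSign : ℤ → Set
  IsSign e = e ≡ + 1 ⊎ e ≡ -[1+ 0 ]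

  sign-square : ∀ {x} → IsSign x → x * x ≡ + 1
  sign-square (inj₁ refl) = refl
  sign-square (inj₂ refl) = refl

  sign-* : ∀ {e x} → IsSign e → IsSign (e * x) → IsSign x
  sign-* {x = x} (inj₁ refl) (inj₁ h) = inj₁ (trans (sym (ℤ.*-identityˡ x)) h)
  sign-* {x = x} (inj₁ refl) (inj₂ h) = inj₂ (trans (sym (ℤ.*-identityˡ x)) h)
  sign-* {x = x} (inj₂ refl) (inj₁ h) = inj₂ (trans (eq x) (cong (-[1+ 0 ] *_) h))
    where
    eq : ∀ x → x ≡ -[1+ 0 ] * (-[1+ 0 ] * x)
    eq = solve-∀
  sign-* {x = x} (inj₂ refl) (inj₂ h) = inj₁ (trans (eq x) (cong (-[1+ 0 ] *_) h))
    where
    eq : ∀ x → x ≡ -[1+ 0 ] * (-[1+ 0 ] * x)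
    eq = solve-∀

  -1^ : ∀ n → IsSign (-[1+ 0 ] ^ n)
  -1^ zero = inj₁ refl
  -1^ (suc n) with -1^ n
  ... | inj₁ e = inj₂ (cong (-[1+ 0 ] *_) e)
  ... | inj₂ e = inj₁ (cong (-[1+ 0 ] *_) e)

  2^≢0 : ∀ s → (+ 2) ^ s ≢ + 0
  2^≢0 (suc s) e with ℤ.i*j≡0⇒i≡0∨j≡0 (+ 2) e
  ... | inj₂ h = 2^≢0 s h

  -- Turns a 2-adic expansion of a power into an exact equation: -1 is excluded modulo 4, and 1
  -- leaves a vanishing product with a nonzero power of 2.
  1+4·2^s : ∀ s N → IsSign (+ 1 + + 4 * (+ 2) ^ s * N) → N ≡ + 0
  1+4·2^s s N (inj₁ e) with ℤ.i*j≡0⇒i≡0∨j≡0 (+ 4 * (+ 2) ^ s) (trans (eq ((+ 2) ^ s) N) (cong (_- + 1) e))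
    where
    eq : ∀ p N → + 4 * p * N ≡ + 1 + + 4 * p * N - + 1
    eq = solve-∀
  ... | inj₂ h = h
  ... | inj₁ h with ℤ.i*j≡0⇒i≡0∨j≡0 (+ 4) h
  ... | inj₂ h′ = contradiction h′ (2^≢0 s)
  1+4·2^s s N (inj₂ e) = ⊥-elim (no-multiple 4 2 (- ((+ 2) ^ s * N)) (s≤s (s≤s (s≤s z≤n))) (trans (eq ((+ 2) ^ s) N) (cong (λ x → + 1 - x) e)))
    where
    eq : ∀ p N → + 4 * - (p * N) ≡ + 1 - (+ 1 + + 4 * p * N)
    eq = solve-∀

  even≢odd : ∀ x → + 2 * x ≢ + 1
  even≢odd x = no-multiple 2 1 x (s≤s (s≤s z≤n))

  pow-square : ∀ y m → (y * y) ^ m ≡ y ^ m * y ^ m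
  pow-square y zero = refl
  pow-square y (suc m) = trans (cong (y * y *_) (pow-square y m)) (eq y (y ^ m))
    where
    eq : ∀ y p → y * y * (p * p) ≡ y * p * (y * p)
    eq = solve-∀

  nonZero-^ : ∀ k m → ℤ.NonZero ((+ suc k * + suc k) ^ m)
  nonZero-^ k m = ℤ.≢-nonZero (go m)
    where
    go : ∀ m → (+ suc k * + suc k) ^ m ≢ + 0
    go (suc m) e with ℤ.i*j≡0⇒i≡0∨j≡0 (+ suc k * + suc k) e
    ... | inj₂ h = go m h

-- Reduction of positive definite binary quadratic forms

module SmallValues where

  open import Data.Nat.Induction using (<-rec)
  import Data.Nat.Tactic.RingSolver as ℕR
  open import Data.Integer using (+_; -[1+_]; _+_; _*_; -_; _-_; ∣_∣)
  open import Data.Integer.DivMod using (_%ℕ_; _/ℕ_; a≡a%ℕn+[a/ℕn]*n; n%ℕd<d)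
  open import Data.Integer.Tactic.RingSolver using (solve-∀)
  open Arith

  square≡ : ∀ i → i * i ≡ + (∣ i ∣ ℕ.* ∣ i ∣)
  square≡ (+ n) = sym (ℤ.pos-* n n)
  square≡ -[1+ n ] = refl

  balanced : ∀ A → .{{ℕ.NonZero A}} → ∀ B → ∃ λ m → ∃ λ B′ → B ≡ B′ + m * + A × 2 ℕ.* ∣ B′ ∣ ℕ.≤ A
  balanced A B with 2 ℕ.* (B %ℕ A) ℕ.≤? A
  ... | yes h = B /ℕ A , + (B %ℕ A) , a≡a%ℕn+[a/ℕn]*n B A , h
  ... | no ¬h = B /ℕ A + + 1 , + (B %ℕ A) - + A , trans (a≡a%ℕn+[a/ℕn]*n B A) (eq (+ (B %ℕ A)) (B /ℕ A) (+ A)) , bound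
    where
    r = B %ℕ A
    r≤A : r ℕ.≤ A
    r≤A = ℕ.<⇒≤ (n%ℕd<d B A)
    eq : ∀ r q a → r + q * a ≡ r - a + (q + + 1) * a
    eq = solve-∀
    bound : 2 ℕ.* ∣ + r - + A ∣ ℕ.≤ A
    bound = begin
      2 ℕ.* ∣ + r - + A ∣ ≡⟨ cong (2 ℕ.*_) (trans (cong ∣_∣ (ℤ.m-n≡m⊖n r A)) (ℤ.∣⊖∣-≤ r≤A)) ⟩
      2 ℕ.* (A ℕ.∸ r) ≡⟨ ℕ.*-distribˡ-∸ 2 A r ⟩
      2 ℕ.* A ℕ.∸ 2 ℕ.* r ≤⟨ ℕ.∸-monoʳ-≤ (2 ℕ.* A) (ℕ.<⇒≤ (ℕ.≰⇒> ¬h)) ⟩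
      2 ℕ.* A ℕ.∸ A ≡⟨ cong (ℕ._∸ A) (cong (A ℕ.+_) (ℕ.+-identityʳ A)) ⟩
      A ℕ.+ A ℕ.∸ A ≡⟨ ℕ.m+n∸n≡m A A ⟩
      A ∎
      where open ℕ.≤-Reasoning

  -- Gauss's convention with an even middle coefficient, so that the determinant is AC - B².
  form : (A B C s v : ℤ) → ℤ
  form A B C s v = A * (s * s) + + 2 * (B * (s * v)) + C * (v * v)

  -- `bound` is the classical minimum k ≤ √(4D/3). `bezout` makes the representation primitive,
  -- which is what later excludes the values 4 and 9 for determinant 105.
  record SmallValue (D : ℕ) (A B C : ℤ) : Set where
    constructor small
    field
      s v g h : ℤ
      k : ℕ
      bezout : g * s + h * v ≡ + 1
      value : form A B C s v ≡ + k
      positive : 1 ℕ.≤ k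
      bound : 3 ℕ.* (k ℕ.* k) ℕ.≤ 4 ℕ.* D

  -- Gauss reduction by descent on the leading coefficient. If 3A² > 4D, shift B to B′ with 2|B′| ≤
  -- A; the new last coefficient satisfies 4AC′ = 4D + 4B′² < 3A² + A², so C′ < A, and the
  -- equivalent form (C′, -B′, A) takes over.
  smallValue : ∀ D → .{{ℕ.NonZero D}} → ∀ A → 1 ℕ.≤ A → ∀ B C → + A * C - B * B ≡ + D → SmallValue D (+ A) B C
  smallValue D = <-rec (λ A → 1 ℕ.≤ A → ∀ B C → + A * C - B * B ≡ + D → SmallValue D (+ A) B C) step
    where
    step : ∀ A → (∀ {A′} → A′ ℕ.< A → 1 ℕ.≤ A′ → ∀ B C → + A′ * C - B * B ≡ + D → SmallValue D (+ A′) B C) →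
      1 ℕ.≤ A → ∀ B C → + A * C - B * B ≡ + D → SmallValue D (+ A) B C
    step A ih 1≤A B C det with 3 ℕ.* (A ℕ.* A) ℕ.≤? 4 ℕ.* D
    ... | yes h = small (+ 1) (+ 0) (+ 1) (+ 0) A refl (eq (+ A) B C) 1≤A h
      where
      eq : ∀ A B C → A * (+ 1 * + 1) + + 2 * (B * (+ 1 * + 0)) + C * (+ 0 * + 0) ≡ A
      eq = solve-∀
    ... | no ¬h with balanced A {{ℕ.>-nonZero 1≤A}} B
    ... | m , B′ , refl , 2B′≤A = descend (ih c<A 1≤c (- B′) (+ A) det′)
      where
      instance
        A≢0 : ℕ.NonZero A
        A≢0 = ℕ.>-nonZero 1≤A
      -- The coefficient of v² after the substitution s ↦ s - mv, which turns B into B′.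
      C′ = + A * (m * m) - + 2 * ((B′ + m * + A) * m) + C
      AC′ : + A * C′ ≡ + (D ℕ.+ ∣ B′ ∣ ℕ.* ∣ B′ ∣)
      AC′ = trans (eq (+ A) B′ m C) (cong₂ _+_ det (square≡ B′))
        where
        eq : ∀ A B m C → A * (A * (m * m) - + 2 * ((B + m * A) * m) + C) ≡ A * C - (B + m * A) * (B + m * A) + B * B
        eq = solve-∀
      c = ∣ C′ ∣
      C′≡ : C′ ≡ + c
      C′≡ = nonneg A C′ _ AC′
      Ac : A ℕ.* c ≡ D ℕ.+ ∣ B′ ∣ ℕ.* ∣ B′ ∣
      Ac = ℤ.+-injective (trans (ℤ.pos-* A c) (trans (cong (+ A *_) (sym C′≡)) AC′))
      1≤c : 1 ℕ.≤ c
      1≤c = ℕ.n≢0⇒n>0 λ e → ℕ.≢-nonZero⁻¹ D (ℕ.m+n≡0⇒m≡0 D (trans (sym Ac) (trans (cong (A ℕ.*_) e) (ℕ.*-zeroʳ A))))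
      c<A : c ℕ.< A
      c<A = ℕ.*-cancelˡ-< (4 ℕ.* A) c A (begin-strict
        4 ℕ.* A ℕ.* c ≡⟨ trans (ℕ.*-assoc 4 A c) (cong (4 ℕ.*_) Ac) ⟩
        4 ℕ.* (D ℕ.+ ∣ B′ ∣ ℕ.* ∣ B′ ∣) ≡⟨ eq₁ D ∣ B′ ∣ ⟩
        4 ℕ.* D ℕ.+ 2 ℕ.* ∣ B′ ∣ ℕ.* (2 ℕ.* ∣ B′ ∣) <⟨ ℕ.+-mono-<-≤ (ℕ.≰⇒> ¬h) (ℕ.*-mono-≤ 2B′≤A 2B′≤A) ⟩
        3 ℕ.* (A ℕ.* A) ℕ.+ A ℕ.* A ≡⟨ eq₂ A ⟩
        4 ℕ.* A ℕ.* A ∎)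
        where
        open ℕ.≤-Reasoning
        eq₁ : ∀ D b → 4 ℕ.* (D ℕ.+ b ℕ.* b) ≡ 4 ℕ.* D ℕ.+ 2 ℕ.* b ℕ.* (2 ℕ.* b)
        eq₁ = ℕR.solve-∀
        eq₂ : ∀ A → 3 ℕ.* (A ℕ.* A) ℕ.+ A ℕ.* A ≡ 4 ℕ.* A ℕ.* A
        eq₂ = ℕR.solve-∀
      det′ : + c * + A - - B′ * - B′ ≡ + D
      det′ = trans (cong (λ x → x * + A - - B′ * - B′) (sym C′≡)) (trans (eq (+ A) B′ m C) det)
        where
        eq : ∀ A B m C → (A * (m * m) - + 2 * ((B + m * A) * m) + C) * A - - B * - B ≡ A * C - (B + m * A) * (B + m * A)
        eq = solve-∀
      descend : SmallValue D (+ c) (- B′) (+ A) → SmallValue D (+ A) (B′ + m * + A) C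
      -- Undoes the exchange of the variables and then the shift by m; the Bezout coefficients
      -- follow the inverse substitution.
      descend (small s v g h k prim val pos bnd) = small (v + m * s) (- s) h (m * h - g) k
        (trans (eq₁ s v g h m) prim)
        (trans (eq₂ (+ A) B′ m C s v) (trans (cong (λ x → form x (- B′) (+ A) s v) C′≡) val)) pos bnd
        where
        eq₁ : ∀ s v g h m → h * (v + m * s) + (m * h - g) * - s ≡ g * s + h * v
        eq₁ = solve-∀
        eq₂ : ∀ A B m C s v → A * ((v + m * s) * (v + m * s)) + + 2 * ((B + m * A) * ((v + m * s) * - s)) + C * (- s * - s)
          ≡ (A * (m * m) - + 2 * ((B + m * A) * m) + C) * (s * s) + + 2 * (- B * (s * v)) + A * (v * v)
        eq₂ = solve-∀

-- Polynomial congruences decided on residues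

module Congruences where

  import Data.Nat.DivMod as ℕ
  import Data.Nat.Divisibility as ℕ∣
  open import Data.Nat.Primality using (Prime; euclidsLemma)
  open import Data.Integer using (+_; -[1+_]; _+_; _*_; -_; _-_; _^_; ∣_∣)
  open import Data.Integer.DivMod using (_%ℕ_; _/ℕ_; a≡a%ℕn+[a/ℕn]*n; n%ℕd<d)
  open import Data.Integer.Tactic.RingSolver using (solve-∀)
  open import Data.Bool using (Bool; true; _∧_; _∨_; not; T)
  open import Data.Fin as Fin using (Fin; zero; suc)
  open import Data.Vec as Vec using (Vec; []; _∷_; lookup; map)
  open import Data.Unit using (tt)
  open Arith

  infixl 6 _:+_
  infixl 7 _:*_
  -- Only natural coefficients and no subtraction, so that residues are computed in ℕ. A congruence
  -- f ≡ g modulo m is therefore stated as m ∣ f + (m - 1) g.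
  data Expr (n : ℕ) : Set where
    var : Fin n → Expr n
    # : ℕ → Expr n
    _:+_ _:*_ : Expr n → Expr n → Expr n

  ⟦_⟧ : ∀ {n} → Expr n → Vec ℤ n → ℤ
  ⟦ var i ⟧ ρ = lookup ρ i
  ⟦ # k ⟧ ρ = + k
  ⟦ e :+ f ⟧ ρ = ⟦ e ⟧ ρ + ⟦ f ⟧ ρ
  ⟦ e :* f ⟧ ρ = ⟦ e ⟧ ρ * ⟦ f ⟧ ρ

  evalℕ : ∀ {n} → Expr n → Vec ℕ n → ℕ
  evalℕ (var i) ρ = lookup ρ i
  evalℕ (# k) ρ = k
  evalℕ (e :+ f) ρ = evalℕ e ρ ℕ.+ evalℕ f ρ
  evalℕ (e :* f) ρ = evalℕ e ρ ℕ.* evalℕ f ρ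

  infix 4 _∣ᶻ_
  _∣ᶻ_ : ℕ → ℤ → Set
  m ∣ᶻ x = ∃ λ u → x ≡ + m * u

  module _ (m : ℕ) .{{_ : ℕ.NonZero m}} where

    residue : ℤ → ℕ
    residue x = x %ℕ m

    eval-residue : ∀ {n} (e : Expr n) ρ → ∃ λ t → ⟦ e ⟧ ρ ≡ + evalℕ e (map residue ρ) + + m * t
    eval-residue (var i) ρ = go i ρ
      where
      go : ∀ {n} (i : Fin n) ρ → ∃ λ t → lookup ρ i ≡ + lookup (map residue ρ) i + + m * t
      go zero (x ∷ ρ) = x /ℕ m , trans (a≡a%ℕn+[a/ℕn]*n x m) (cong (λ y → + (x %ℕ m) + y) (ℤ.*-comm (x /ℕ m) (+ m)))
      go (suc i) (x ∷ ρ) = go i ρ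
    eval-residue (# k) ρ = + 0 , eq (+ k) (+ m)
      where
      eq : ∀ k m → k ≡ k + m * + 0
      eq = solve-∀
    eval-residue (e :+ f) ρ with eval-residue e ρ | eval-residue f ρ
    ... | t , p | u , q = t + u , trans (cong₂ _+_ p q) (eq (+ evalℕ e (map residue ρ)) (+ evalℕ f (map residue ρ)) (+ m) t u)
      where
      eq : ∀ a b m t u → a + m * t + (b + m * u) ≡ a + b + m * (t + u)
      eq = solve-∀
    eval-residue (e :* f) ρ with eval-residue e ρ | eval-residue f ρ
    ... | t , p | u , q = a * u + t * b + + m * (t * u) , trans (cong₂ _*_ p q) (trans (eq a b (+ m) t u) (cong (λ x → x + + m * (a * u + t * b + + m * (t * u))) (sym (ℤ.pos-* (evalℕ e (map residue ρ)) (evalℕ f (map residue ρ))))))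
      where
      a = + evalℕ e (map residue ρ)
      b = + evalℕ f (map residue ρ)
      eq : ∀ a b m t u → (a + m * t) * (b + m * u) ≡ a * b + m * (a * u + t * b + m * (t * u))
      eq = solve-∀

    zero? : ∀ {n} → Expr n → Vec ℕ n → Bool
    zero? e ρ = (evalℕ e ρ ℕ.% m) ℕ.≡ᵇ 0

    below : ℕ → (ℕ → Bool) → Bool
    below zero g = true
    below (suc k) g = g k ∧ below k g

    check : ∀ n → (Vec ℕ n → Bool) → Bool
    check zero f = f []
    check (suc n) f = below m (λ r → check n (λ ρ → f (r ∷ ρ)))

    private
      ∧-left : ∀ a {b} → T (a ∧ b) → T a
      ∧-left true h = tt
      ∧-right : ∀ a {b} → T (a ∧ b) → T b
      ∧-right true h = h

      below-all : ∀ k (g : ℕ → Bool) → T (below k g) → ∀ r → r ℕ.< k → T (g r)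
      below-all (suc k) g h r r<k with r ℕ.≟ k
      ... | yes refl = ∧-left (g k) h
      ... | no r≢k = below-all k g (∧-right (g k) h) r (ℕ.≤∧≢⇒< (ℕ.≤-pred r<k) r≢k)

      check-residue : ∀ n f → T (check n f) → ∀ ρ → T (f (map residue ρ))
      check-residue zero f h [] = h
      check-residue (suc n) f h (x ∷ ρ) = check-residue n _ (below-all m (λ r → check n (λ ρ → f (r ∷ ρ))) h (x %ℕ m) (n%ℕd<d x m)) ρ

      zero⇒∣ : ∀ {n} (e : Expr n) ρ → T (zero? e (map residue ρ)) → m ∣ᶻ ⟦ e ⟧ ρ
      zero⇒∣ e ρ h with eval-residue e ρ
      ... | t , p = + (N ℕ./ m) + t , trans p (trans (cong (λ x → + x + + m * t) N≡) (trans (cong (_+ + m * t) (ℤ.pos-* (N ℕ./ m) m)) (eq (+ (N ℕ./ m)) (+ m) t)))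
        where
        N = evalℕ e (map residue ρ)
        N≡ : N ≡ N ℕ./ m ℕ.* m
        N≡ = trans (ℕ.m≡m%n+[m/n]*n N m) (cong (ℕ._+ N ℕ./ m ℕ.* m) (ℕ.≡ᵇ⇒≡ (N ℕ.% m) 0 h))
        eq : ∀ q m t → q * m + m * t ≡ m * (q + t)
        eq = solve-∀

      ∣⇒zero : ∀ {n} (e : Expr n) ρ → m ∣ᶻ ⟦ e ⟧ ρ → T (zero? e (map residue ρ))
      ∣⇒zero e ρ (u , h) with eval-residue e ρ
      ... | t , p = ℕ.≡⇒≡ᵇ (N ℕ.% m) 0 (ℕ∣.n∣m⇒m%n≡0 N m (ℕ∣.divides ∣ u - t ∣ (trans (cong ∣_∣ N≡) (trans (ℤ.abs-* (+ m) (u - t)) (ℕ.*-comm m ∣ u - t ∣)))))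
        where
        N = evalℕ e (map residue ρ)
        eq : ∀ N m t → N ≡ N + m * t - m * t
        eq = solve-∀
        eq′ : ∀ m u t → m * u - m * t ≡ m * (u - t)
        eq′ = solve-∀
        N≡ : + N ≡ + m * (u - t)
        N≡ = trans (eq (+ N) (+ m) t) (trans (cong (_- + m * t) (trans (sym p) h)) (eq′ (+ m) u t))

      implies-T : ∀ a b → T (not a ∨ b) → T a → T b
      implies-T true b h _ = h

    -- Proof by evaluation: the argument of type `T (check n …)` reduces to the unit type exactly
    -- when all tuples of residues pass, so callers write `_` for it.
    implies : ∀ {n} (e d : Expr n) → T (check n (λ ρ → not (zero? e ρ) ∨ zero? d ρ)) → ∀ ρ → m ∣ᶻ ⟦ e ⟧ ρ → m ∣ᶻ ⟦ d ⟧ ρ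
    implies {n} e d ok ρ h = zero⇒∣ d ρ (implies-T (zero? e (map residue ρ)) (zero? d (map residue ρ)) (check-residue n _ ok ρ) (∣⇒zero e ρ h))

    never : ∀ {n} (e : Expr n) → T (check n (λ ρ → not (zero? e ρ))) → ∀ ρ → m ∣ᶻ ⟦ e ⟧ ρ → ⊥
    never {n} e ok ρ h = not-T (zero? e (map residue ρ)) (check-residue n _ ok ρ) (∣⇒zero e ρ h)
      where
      not-T : ∀ a → T (not a) → T a → ⊥
      not-T true ()

  ∣ᶻ⇒∣ : ∀ {m x} → m ∣ᶻ x → m ℕ∣.∣ ∣ x ∣
  ∣ᶻ⇒∣ {m} (u , e) = ℕ∣.divides ∣ u ∣ (trans (cong ∣_∣ e) (trans (ℤ.abs-* (+ m) u) (ℕ.*-comm m ∣ u ∣)))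

  ∣⇒∣ᶻ : ∀ {m} x → m ℕ∣.∣ ∣ x ∣ → m ∣ᶻ x
  ∣⇒∣ᶻ {m} (+ n) (ℕ∣.divides q e) = + q , trans (cong +_ e) (trans (ℤ.pos-* q m) (ℤ.*-comm (+ q) (+ m)))
  ∣⇒∣ᶻ {m} -[1+ n ] (ℕ∣.divides q e) = - + q , trans (cong (λ k → - + k) e) (trans (cong -_ (trans (ℤ.pos-* q m) (ℤ.*-comm (+ q) (+ m)))) (ℤ.neg-distribʳ-* (+ m) (+ q)))

  prime-∣-* : ∀ {p} → Prime p → ∀ x y → p ∣ᶻ x * y → p ∣ᶻ x ⊎ p ∣ᶻ y
  prime-∣-* {p} pr x y h with euclidsLemma ∣ x ∣ ∣ y ∣ pr (subst (p ℕ∣.∣_) (ℤ.abs-* x y) (∣ᶻ⇒∣ {p} {x * y} h))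
  ... | inj₁ d = inj₁ (∣⇒∣ᶻ x d)
  ... | inj₂ d = inj₂ (∣⇒∣ᶻ y d)

  prime-∣-^ : ∀ {p} → Prime p → ∀ x n → p ∣ᶻ x ^ n → p ∣ᶻ x
  prime-∣-^ {p} pr x zero h = ∣⇒∣ᶻ x (ℕ∣.∣-trans (∣ᶻ⇒∣ {p} {+ 1} h) (ℕ∣.1∣ ∣ x ∣))
  prime-∣-^ pr x (suc n) h = [ (λ d → d) , prime-∣-^ pr x n ]′ (prime-∣-* pr x (x ^ n) h)

-- Units, coprimality and odd squares

module Units where

  open import Data.Integer using (+_; -[1+_]; _+_; _*_; -_; _-_; ∣_∣)
  open import Data.Integer.Tactic.RingSolver using (solve-∀)
  open Arith
  open SmallValues
  open Congruences
  open import Data.Fin using (zero)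
  open import Data.Vec using (_∷_; [])

  unit-sign : ∀ x y → x * y ≡ + 1 → IsSign x
  unit-sign x y e with ∣ x ∣ in eq | ℕ.m*n≡1⇒m≡1 ∣ x ∣ ∣ y ∣ (trans (sym (ℤ.abs-* x y)) (cong ∣_∣ e))
  unit-sign (+ _) y e | _ | refl = inj₁ (cong +_ eq)
  unit-sign -[1+ n ] y e | _ | refl = inj₂ (cong -[1+_] (ℕ.suc-injective eq))

  ∣∣≡1 : ∀ x → ∣ x ∣ ≡ 1 → IsSign x
  ∣∣≡1 (+ _) refl = inj₁ refl
  ∣∣≡1 -[1+ 0 ] refl = inj₂ refl

  -- Determines the units of norm 1 in ℤ[√-D]: two nonzero coordinates would give a norm of at least
  -- 2, and a unit on the imaginary axis exists only for D = 1.
  sum-of-squares : ∀ D x y → 1 ℕ.≤ D → x * x + + D * (y * y) ≡ + 1 → y ≡ + 0 × IsSign x ⊎ x ≡ + 0 × IsSign y × D ≡ 1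
  sum-of-squares D x y 1≤D e with ∣ x ∣ in eqx | ∣ y ∣ in eqy | nat
    where
    nat : ∣ x ∣ ℕ.* ∣ x ∣ ℕ.+ D ℕ.* (∣ y ∣ ℕ.* ∣ y ∣) ≡ 1
    nat = ℤ.+-injective (trans (cong₂ _+_ (sym (square≡ x)) (trans (ℤ.pos-* D (∣ y ∣ ℕ.* ∣ y ∣)) (cong (+ D *_) (sym (square≡ y))))) e)
  ... | a | zero | n = inj₁ (ℤ.∣i∣≡0⇒i≡0 eqy , ∣∣≡1 x (trans eqx (ℕ.m*n≡1⇒m≡1 a a (trans (sym (trans (cong (a ℕ.* a ℕ.+_) (ℕ.*-zeroʳ D)) (ℕ.+-identityʳ (a ℕ.* a)))) n))))
  ... | zero | suc b | n = inj₂ (ℤ.∣i∣≡0⇒i≡0 eqx , ∣∣≡1 y (trans eqy (ℕ.m*n≡1⇒m≡1 (suc b) (suc b) (ℕ.m*n≡1⇒n≡1 D (suc b ℕ.* suc b) n))) , ℕ.m*n≡1⇒m≡1 D (suc b ℕ.* suc b) n)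
  ... | suc a | suc b | n = contradiction n λ n → ℕ.<⇒≢ (ℕ.+-mono-≤ {1} {suc a ℕ.* suc a} {1} (s≤s z≤n) (ℕ.*-mono-≤ {1} {D} {1} {suc b ℕ.* suc b} 1≤D (s≤s z≤n))) (sym n)

  Coprime : ℤ → ℤ → Set
  Coprime m y = ∃₂ λ k l → k * m + l * y ≡ + 1

  coprime-* : ∀ {m n y} → Coprime m y → Coprime n y → Coprime (m * n) y
  coprime-* {m} {n} {y} (k , l , h) (k′ , l′ , h′) = k * k′ , k * m * l′ + l * (k′ * n) + l * l′ * y , trans (eq k l k′ l′ m n y) (cong₂ _*_ h h′)
    where
    eq : ∀ k l k′ l′ m n y → k * k′ * (m * n) + (k * m * l′ + l * (k′ * n) + l * l′ * y) * y ≡ (k * m + l * y) * (k′ * n + l′ * y)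
    eq = solve-∀

  positive : ∀ y z n → y * (z * z) ≡ + suc n → ∃ λ k → y ≡ + suc k
  positive (+ zero) z n e = contradiction (trans (sym e) (ℤ.*-zeroˡ (z * z))) λ ()
  positive (+ suc k) z n e = k , refl
  positive -[1+ k ] z n e = contradiction (trans (sym (cong (-[1+ k ] *_) (square≡ z))) e) (go (∣ z ∣ ℕ.* ∣ z ∣))
    where
    go : ∀ s → -[1+ k ] * + s ≢ + suc n
    go zero e with trans (sym e) (ℤ.*-zeroʳ -[1+ k ])
    ... | ()
    go (suc s) ()

  odd-square : ∀ t → ∃ λ w → (+ 1 + + 2 * t) * (+ 1 + + 2 * t) ≡ + 1 + + 8 * w
  odd-square t = half (implies 2 (# 0) (var zero :* var zero :+ var zero) _ (t ∷ []) (+ 0 , refl))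
    where
    eq : ∀ t → (+ 1 + + 2 * t) * (+ 1 + + 2 * t) ≡ + 1 + + 4 * (t * t + t)
    eq = solve-∀
    eq′ : ∀ w → + 1 + + 4 * (+ 2 * w) ≡ + 1 + + 8 * w
    eq′ = solve-∀
    half : 2 ∣ᶻ t * t + t → ∃ λ w → (+ 1 + + 2 * t) * (+ 1 + + 2 * t) ≡ + 1 + + 8 * w
    half (w , h) = w , trans (eq t) (trans (cong (λ x → + 1 + + 4 * x) h) (eq′ w))

  odd-square′ : ∀ {x} → (∃ λ t → x ≡ + 1 + + 2 * t) → ∃ λ w → x * x ≡ + 1 + + 8 * w
  odd-square′ (t , e) = proj₁ (odd-square t) , trans (cong₂ _*_ e e) (proj₂ (odd-square t))

  odd⇒ : ∀ {x} → 2 ∣ᶻ x + + 1 → ∃ λ t → x ≡ + 1 + + 2 * t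
  odd⇒ {x} (u , h) = u - + 1 , trans (eq x) (trans (cong (_- + 1) h) (eq′ u))
    where
    eq : ∀ x → x ≡ x + + 1 - + 1
    eq = solve-∀
    eq′ : ∀ u → + 2 * u - + 1 ≡ + 1 + + 2 * (u - + 1)
    eq′ = solve-∀

  coprime-2 : ∀ {y} → (∃ λ t → y ≡ + 1 + + 2 * t) → Coprime (+ 2) y
  coprime-2 (t , h) = - t , + 1 , trans (cong (λ w → - t * + 2 + + 1 * w) h) (eq t)
    where
    eq : ∀ t → - t * + 2 + + 1 * (+ 1 + + 2 * t) ≡ + 1
    eq = solve-∀

  coprime-8 : ∀ {y} → (∃ λ w → y * y ≡ + 1 + + 8 * w) → Coprime (+ 8) y
  coprime-8 {y} (w , h) = - w , y , trans (cong (λ x → - w * + 8 + x) h) (eq w)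
    where
    eq : ∀ w → - w * + 8 + (+ 1 + + 8 * w) ≡ + 1
    eq = solve-∀

-- Integrality of the coefficients of (1 - 8z)^(-1/4)

module Binomials where

  open import Data.Nat
  open import Data.Nat.Properties
  open import Data.Nat.Divisibility
  open import Data.Nat.Induction using (<-rec)
  open import Data.Nat.Tactic.RingSolver

  halve : ∀ n → ∃ λ j → n ≡ 2 * j ⊎ n ≡ 1 + 2 * j
  halve zero = 0 , inj₁ refl
  halve (suc n) with halve n
  ... | j , inj₁ e = j , inj₂ (cong suc e)
  ... | j , inj₂ e = suc j , inj₁ (trans (cong suc e) (eq j))
    where
    eq : ∀ j → 2 + 2 * j ≡ 2 * suc j
    eq = solve-∀

  -- The Pochhammer symbol e (e + 1) ⋯ (e + n - 1).
  rising : ℕ → ℕ → ℕ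
  rising e zero = 1
  rising e (suc n) = e * rising (suc e) n

  rising-last : ∀ e n → rising e (suc n) ≡ rising e n * (e + n)
  rising-last e zero = eq e
    where
    eq : ∀ e → e * 1 ≡ 1 * (e + 0)
    eq = solve-∀
  rising-last e (suc n) = trans (cong (e *_) (rising-last (suc e) n)) (eq e (rising (suc e) n) n)
    where
    eq : ∀ e r n → e * (r * (suc e + n)) ≡ e * r * (e + suc n)
    eq = solve-∀

  -- Pascal's rule cleared of denominators: the rising factorial of e + 1 of length n + 1 is that of
  -- e plus n + 1 times the one of e + 1 of length n, and both terms are divisible by induction.
  !∣rising : ∀ n e → n ! ∣ rising e n
  !∣rising zero e = ∣-refl
  !∣rising (suc n) zero = (suc n !) ∣0
  !∣rising (suc n) (suc e) = subst (suc n ! ∣_)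
    (sym (trans (rising-last (suc e) n) (eq (rising (suc e) n) e n)))
    (∣m∣n⇒∣m+n (!∣rising (suc n) e) (*-monoʳ-∣ (suc n) (!∣rising n (suc e))))
    where
    eq : ∀ r e n → r * (suc e + n) ≡ e * r + suc n * r
    eq = solve-∀

  -- The product 1 · 3 ⋯ (2j - 1), the odd contribution to (2j)!.
  odds : ℕ → ℕ
  odds zero = 1
  odds (suc j) = (1 + 2 * j) * odds j

  double! : ∀ j → (2 * j) ! ≡ 2 ^ j * (j ! * odds j)
  double! zero = refl
  double! (suc j) = trans (cong _! (eq₁ j)) (trans (cong (λ x → (2 + 2 * j) * ((1 + 2 * j) * x)) (double! j)) (eq₂ j (2 ^ j) (j !) (odds j)))
    where
    eq₁ : ∀ j → 2 * suc j ≡ 2 + 2 * j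
    eq₁ = solve-∀
    eq₂ : ∀ j p f o → (2 + 2 * j) * ((1 + 2 * j) * (p * (f * o))) ≡ 2 * p * (suc j * f * ((1 + 2 * j) * o))
    eq₂ = solve-∀

  Odd : ℕ → Set
  Odd m = ∃ λ l → m ≡ 1 + 2 * l

  odd-* : ∀ {m n} → Odd m → Odd n → Odd (m * n)
  odd-* (k , refl) (l , refl) = k + l + 2 * k * l , eq k l
    where
    eq : ∀ k l → (1 + 2 * k) * (1 + 2 * l) ≡ 1 + 2 * (k + l + 2 * k * l)
    eq = solve-∀

  odds-odd : ∀ j → Odd (odds j)
  odds-odd zero = 0 , refl
  odds-odd (suc j) = odd-* (j , refl) (odds-odd j)

  -- Says that 2 divides n! at most n times, with m as the odd part of n!.
  OddPart : ℕ → Set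
  OddPart n = ∃ λ m → Odd m × n ! ∣ 2 ^ n * m × m ∣ n !

  oddPart-double : ∀ j → OddPart j → OddPart (2 * j)
  oddPart-double j (m , o , d , d′) = m * odds j , odd-* o (odds-odd j) ,
    subst₂ _∣_ (sym (double! j)) (trans (eq (2 ^ j) m (odds j)) (cong (_* (m * odds j)) pow))
      (*-monoʳ-∣ (2 ^ j) (*-monoˡ-∣ (odds j) d)) ,
    subst (m * odds j ∣_) (sym (double! j)) (∣n⇒∣m*n (2 ^ j) (*-monoˡ-∣ (odds j) d′))
    where
    eq : ∀ p m o → p * (p * m * o) ≡ p * p * (m * o)
    eq = solve-∀
    pow : 2 ^ j * 2 ^ j ≡ 2 ^ (2 * j)
    pow = trans (sym (^-distribˡ-+-* 2 j j)) (cong (λ x → 2 ^ (j + x)) (sym (+-identityʳ j)))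

  -- Legendre's count by halving: (2j)! = 2^j · j! · `odds j` reduces 2j to j, and a further factor
  -- 2j + 1 is odd.
  oddPart : ∀ n → OddPart n
  oddPart = <-rec OddPart step
    where
    step : ∀ n → (∀ {i} → i < n → OddPart i) → OddPart n
    step zero ih = 1 , (0 , refl) , ∣-refl , ∣-refl
    step (suc n) ih with halve n
    ... | j , inj₁ refl with oddPart-double j (ih (s≤s (m≤n*m j 2)))
    ... | m , o , d , d′ = (1 + 2 * j) * m , odd-* (j , refl) o ,
      subst (suc (2 * j) ! ∣_) (eq j (2 ^ (2 * j)) m) (*-monoʳ-∣ (suc (2 * j)) (∣n⇒∣m*n 2 d)) ,
      *-monoʳ-∣ (1 + 2 * j) d′
      where
      eq : ∀ j p m → (1 + 2 * j) * (2 * (p * m)) ≡ 2 * p * ((1 + 2 * j) * m)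
      eq = solve-∀
    step (suc n) ih | j , inj₂ refl = subst OddPart (eq j) (oddPart-double (suc j) (ih (s≤s (s≤s (m≤n*m j 2)))))
      where
      eq : ∀ j → 2 * suc j ≡ 2 + 2 * j
      eq = solve-∀

  -- The product 1 · 5 ⋯ (4n - 3), that is, 4^n times the rising factorial of 1/4.
  quarters : ℕ → ℕ
  quarters zero = 1
  quarters (suc n) = (4 * n + 1) * quarters n

  -- 4 is invertible modulo an odd number m = 2l + 1, with inverse (l + 1)².
  rising-quarters : ∀ l n → ∃ λ q → 4 ^ n * rising (suc l * suc l) n ≡ quarters n + (1 + 2 * l) * q
  rising-quarters l zero = 0 , eq l
    where
    eq : ∀ l → 1 ≡ 1 + (1 + 2 * l) * 0
    eq = solve-∀
  rising-quarters l (suc n) with rising-quarters l n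
  ... | q , h = (4 * n + 1) * q + (3 + 2 * l) * (quarters n + (1 + 2 * l) * q) , (begin
    4 * 4 ^ n * rising e (suc n) ≡⟨ cong (4 * 4 ^ n *_) (rising-last e n) ⟩
    4 * 4 ^ n * (rising e n * (e + n)) ≡⟨ eq₁ (4 ^ n) (rising e n) (e + n) ⟩
    4 * (e + n) * (4 ^ n * rising e n) ≡⟨ cong (4 * (e + n) *_) h ⟩
    4 * (e + n) * (quarters n + (1 + 2 * l) * q) ≡⟨ eq₂ l n (quarters n) q ⟩
    (4 * n + 1) * quarters n + (1 + 2 * l) * ((4 * n + 1) * q + (3 + 2 * l) * (quarters n + (1 + 2 * l) * q)) ∎)
    where
    open ≡-Reasoning
    e = suc l * suc l
    eq₁ : ∀ p r x → 4 * p * (r * x) ≡ 4 * x * (p * r)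
    eq₁ = solve-∀
    eq₂ : ∀ l n x q → 4 * (suc l * suc l + n) * (x + (1 + 2 * l) * q)
      ≡ (4 * n + 1) * x + (1 + 2 * l) * ((4 * n + 1) * q + (3 + 2 * l) * (x + (1 + 2 * l) * q))
    eq₂ = solve-∀

  -- Modulo the odd part m of n! the number 4 has an inverse, and m divides the rising factorial of
  -- that inverse, hence `quarters n`. The factor 2^n takes care of the prime 2.
  !∣quarters : ∀ n → n ! ∣ 2 ^ n * quarters n
  !∣quarters n with oddPart n
  ... | m , (l , refl) , d , d′ = ∣-trans d (*-monoʳ-∣ (2 ^ n) m∣quarters)
    where
    m∣sum : 1 + 2 * l ∣ quarters n + (1 + 2 * l) * proj₁ (rising-quarters l n)
    m∣sum = subst (1 + 2 * l ∣_) (proj₂ (rising-quarters l n)) (∣n⇒∣m*n (4 ^ n) (∣-trans d′ (!∣rising n _)))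
    m∣quarters : 1 + 2 * l ∣ quarters n
    m∣quarters = ∣m+n∣m⇒∣n (subst (1 + 2 * l ∣_) (+-comm (quarters n) _) m∣sum) (m∣m*n _)

  -- The coefficients of (1 - 8z)^(-1/4).
  binomial : ℕ → ℕ
  binomial n = quotient (!∣quarters n)

  binomial-suc : ∀ n → suc n * binomial (suc n) ≡ 2 * (4 * n + 1) * binomial n
  binomial-suc n = *-cancelʳ-≡ _ _ (n !) {{n !≢0}} (begin
    suc n * binomial (suc n) * n ! ≡⟨ eq₁ (suc n) (binomial (suc n)) (n !) ⟩
    binomial (suc n) * (suc n * n !) ≡⟨ sym (_∣_.equality (!∣quarters (suc n))) ⟩
    2 * 2 ^ n * ((4 * n + 1) * quarters n) ≡⟨ eq₂ (2 ^ n) n (quarters n) ⟩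
    2 * (4 * n + 1) * (2 ^ n * quarters n) ≡⟨ cong (2 * (4 * n + 1) *_) (_∣_.equality (!∣quarters n)) ⟩
    2 * (4 * n + 1) * (binomial n * n !) ≡⟨ sym (*-assoc (2 * (4 * n + 1)) (binomial n) (n !)) ⟩
    2 * (4 * n + 1) * binomial n * n ! ∎)
    where
    open ≡-Reasoning
    eq₁ : ∀ a b c → a * b * c ≡ b * (a * c)
    eq₁ = solve-∀
    eq₂ : ∀ p n x → 2 * p * ((4 * n + 1) * x) ≡ 2 * (4 * n + 1) * (p * x)
    eq₂ = solve-∀

  binomial-0 : binomial 0 ≡ 1
  binomial-0 = trans (sym (*-identityʳ (binomial 0))) (sym (_∣_.equality (!∣quarters 0)))

-- The ring ℤ[√-D] with a ring solver

module QuadraticRing (D : ℤ) where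

  open import Data.Integer using (+_; _+_; _*_; -_; _-_)
  open import Data.Integer.Properties using (+-*-commutativeRing) renaming (_≟_ to _≟ℤ_)
  open import Data.Integer.Tactic.RingSolver
  open import Relation.Binary.PropositionalEquality.Algebra using (isMagma)
  open import Algebra.Bundles
  open import Data.Maybe using (Maybe; just; nothing)
  import Algebra.Solver.Ring
  open import Algebra.Solver.Ring.AlmostCommutativeRing

  infix 5 _+√_
  -- `a +√ b` stands for a + b√-D, so a positive D gives an imaginary quadratic ring.
  record Z√ : Set where
    no-eta-equality
    pattern
    constructor _+√_
    field re im : ℤ
  open Z√ public

  ext : ∀ {x y} → re x ≡ re y → im x ≡ im y → x ≡ y
  ext {a +√ b} {c +√ d} refl refl = refl

  infixl 6 _⊕_
  infixl 7 _⊗_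
  infix 8 ⊝_
  opaque
    _⊕_ _⊗_ : Z√ → Z√ → Z√
    x ⊕ y = re x + re y +√ im x + im y
    x ⊗ y = re x * re y - D * (im x * im y) +√ re x * im y + im x * re y
    ⊝_ : Z√ → Z√
    ⊝ x = - re x +√ - im x

    re-⊕ : ∀ x y → re (x ⊕ y) ≡ re x + re y
    re-⊕ x y = refl
    im-⊕ : ∀ x y → im (x ⊕ y) ≡ im x + im y
    im-⊕ x y = refl
    re-⊗ : ∀ x y → re (x ⊗ y) ≡ re x * re y - D * (im x * im y)
    re-⊗ x y = refl
    im-⊗ : ∀ x y → im (x ⊗ y) ≡ re x * im y + im x * re y
    im-⊗ x y = refl
    re-⊝ : ∀ x → re (⊝ x) ≡ - re x
    re-⊝ x = refl
    im-⊝ : ∀ x → im (⊝ x) ≡ - im x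
    im-⊝ x = refl

  ι : ℤ → Z√
  ι a = a +√ + 0

  private
    module L where
      assoc+ : ∀ a b c → (a + b) + c ≡ a + (b + c)
      assoc+ = solve-∀
      assoc-re : ∀ D a b c d e f → (a * c - D * (b * d)) * e - D * ((a * d + b * c) * f) ≡ a * (c * e - D * (d * f)) - D * (b * (c * f + d * e))
      assoc-re = solve-∀
      assoc-im : ∀ D a b c d e f → (a * c - D * (b * d)) * f + (a * d + b * c) * e ≡ a * (c * f + d * e) + b * (c * e - D * (d * f))
      assoc-im = solve-∀
      comm-re : ∀ D a b c d → a * c - D * (b * d) ≡ c * a - D * (d * b)
      comm-re = solve-∀
      comm-im : ∀ a b c d → a * d + b * c ≡ c * b + d * a
      comm-im = solve-∀
      comm+ : ∀ a b → a + b ≡ b + a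
      comm+ = solve-∀
      id+ : ∀ a → + 0 + a ≡ a
      id+ = solve-∀
      id-re : ∀ D a b → + 1 * a - D * (+ 0 * b) ≡ a
      id-re = solve-∀
      id-im : ∀ a b → + 1 * b + + 0 * a ≡ b
      id-im = solve-∀
      dist-re : ∀ D a b c d e f → a * (c + e) - D * (b * (d + f)) ≡ (a * c - D * (b * d)) + (a * e - D * (b * f))
      dist-re = solve-∀
      dist-im : ∀ a b c d e f → a * (d + f) + b * (c + e) ≡ (a * d + b * c) + (a * f + b * e)
      dist-im = solve-∀
      neg-re : ∀ D a b c d → (- a) * c - D * ((- b) * d) ≡ - (a * c - D * (b * d))
      neg-re = solve-∀
      neg-im : ∀ a b c d → (- a) * d + (- b) * c ≡ - (a * d + b * c)
      neg-im = solve-∀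
      neg+ : ∀ a c → - a + - c ≡ - (a + c)
      neg+ = solve-∀
      zero-re : ∀ D a b → a * + 0 - D * (b * + 0) ≡ + 0
      zero-re = solve-∀
      zero-im : ∀ a b → a * + 0 + b * + 0 ≡ + 0
      zero-im = solve-∀
      hom-re : ∀ D a b → a * b ≡ a * b - D * (+ 0 * + 0)
      hom-re = solve-∀
      hom-im : ∀ a b → + 0 ≡ a * + 0 + + 0 * b
      hom-im = solve-∀

  ⊕-assoc : ∀ x y z → (x ⊕ y) ⊕ z ≡ x ⊕ (y ⊕ z)
  ⊕-assoc x y z = ext r i
    where
    r : re ((x ⊕ y) ⊕ z) ≡ re (x ⊕ (y ⊕ z))
    r rewrite re-⊕ (x ⊕ y) z | re-⊕ x y | re-⊕ x (y ⊕ z) | re-⊕ y z = L.assoc+ (re x) (re y) (re z)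
    i : im ((x ⊕ y) ⊕ z) ≡ im (x ⊕ (y ⊕ z))
    i rewrite im-⊕ (x ⊕ y) z | im-⊕ x y | im-⊕ x (y ⊕ z) | im-⊕ y z = L.assoc+ (im x) (im y) (im z)

  ⊕-comm : ∀ x y → x ⊕ y ≡ y ⊕ x
  ⊕-comm x y = ext r i
    where
    r : re (x ⊕ y) ≡ re (y ⊕ x)
    r rewrite re-⊕ x y | re-⊕ y x = L.comm+ (re x) (re y)
    i : im (x ⊕ y) ≡ im (y ⊕ x)
    i rewrite im-⊕ x y | im-⊕ y x = L.comm+ (im x) (im y)

  ⊗-assoc : ∀ x y z → (x ⊗ y) ⊗ z ≡ x ⊗ (y ⊗ z)
  ⊗-assoc x y z = ext r i
    where
    r : re ((x ⊗ y) ⊗ z) ≡ re (x ⊗ (y ⊗ z))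
    r rewrite re-⊗ (x ⊗ y) z | re-⊗ x y | im-⊗ x y | re-⊗ x (y ⊗ z) | re-⊗ y z | im-⊗ y z
      = L.assoc-re D (re x) (im x) (re y) (im y) (re z) (im z)
    i : im ((x ⊗ y) ⊗ z) ≡ im (x ⊗ (y ⊗ z))
    i rewrite im-⊗ (x ⊗ y) z | re-⊗ x y | im-⊗ x y | im-⊗ x (y ⊗ z) | re-⊗ y z | im-⊗ y z
      = L.assoc-im D (re x) (im x) (re y) (im y) (re z) (im z)

  ⊗-comm : ∀ x y → x ⊗ y ≡ y ⊗ x
  ⊗-comm x y = ext r i
    where
    r : re (x ⊗ y) ≡ re (y ⊗ x)
    r rewrite re-⊗ x y | re-⊗ y x = L.comm-re D (re x) (im x) (re y) (im y)
    i : im (x ⊗ y) ≡ im (y ⊗ x)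
    i rewrite im-⊗ x y | im-⊗ y x = L.comm-im (re x) (im x) (re y) (im y)

  ⊕-identityˡ : ∀ x → ι (+ 0) ⊕ x ≡ x
  ⊕-identityˡ x = ext (trans (re-⊕ (ι (+ 0)) x) (L.id+ (re x))) (trans (im-⊕ (ι (+ 0)) x) (L.id+ (im x)))

  ⊕-identityʳ : ∀ x → x ⊕ ι (+ 0) ≡ x
  ⊕-identityʳ x = trans (⊕-comm x (ι (+ 0))) (⊕-identityˡ x)

  ⊗-identityˡ : ∀ x → ι (+ 1) ⊗ x ≡ x
  ⊗-identityˡ x = ext (trans (re-⊗ (ι (+ 1)) x) (L.id-re D (re x) (im x))) (trans (im-⊗ (ι (+ 1)) x) (L.id-im (re x) (im x)))

  ⊗-identityʳ : ∀ x → x ⊗ ι (+ 1) ≡ x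
  ⊗-identityʳ x = trans (⊗-comm x (ι (+ 1))) (⊗-identityˡ x)

  ⊗-distribˡ-⊕ : ∀ x y z → x ⊗ (y ⊕ z) ≡ x ⊗ y ⊕ x ⊗ z
  ⊗-distribˡ-⊕ x y z = ext r i
    where
    r : re (x ⊗ (y ⊕ z)) ≡ re (x ⊗ y ⊕ x ⊗ z)
    r rewrite re-⊗ x (y ⊕ z) | re-⊕ y z | im-⊕ y z | re-⊕ (x ⊗ y) (x ⊗ z) | re-⊗ x y | re-⊗ x z
      = L.dist-re D (re x) (im x) (re y) (im y) (re z) (im z)
    i : im (x ⊗ (y ⊕ z)) ≡ im (x ⊗ y ⊕ x ⊗ z)
    i rewrite im-⊗ x (y ⊕ z) | re-⊕ y z | im-⊕ y z | im-⊕ (x ⊗ y) (x ⊗ z) | im-⊗ x y | im-⊗ x z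
      = L.dist-im (re x) (im x) (re y) (im y) (re z) (im z)

  ⊗-distribʳ-⊕ : ∀ x y z → (y ⊕ z) ⊗ x ≡ y ⊗ x ⊕ z ⊗ x
  ⊗-distribʳ-⊕ x y z = trans (⊗-comm (y ⊕ z) x) (trans (⊗-distribˡ-⊕ x y z) (cong₂ _⊕_ (⊗-comm x y) (⊗-comm x z)))

  ⊗-zeroʳ : ∀ x → x ⊗ ι (+ 0) ≡ ι (+ 0)
  ⊗-zeroʳ x = ext (trans (re-⊗ x (ι (+ 0))) (L.zero-re D (re x) (im x))) (trans (im-⊗ x (ι (+ 0))) (L.zero-im (re x) (im x)))

  ⊗-zeroˡ : ∀ x → ι (+ 0) ⊗ x ≡ ι (+ 0)
  ⊗-zeroˡ x = trans (⊗-comm (ι (+ 0)) x) (⊗-zeroʳ x)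

  ⊝-distribˡ-⊗ : ∀ x y → ⊝ x ⊗ y ≡ ⊝ (x ⊗ y)
  ⊝-distribˡ-⊗ x y = ext r i
    where
    r : re (⊝ x ⊗ y) ≡ re (⊝ (x ⊗ y))
    r rewrite re-⊗ (⊝ x) y | re-⊝ x | im-⊝ x | re-⊝ (x ⊗ y) | re-⊗ x y = L.neg-re D (re x) (im x) (re y) (im y)
    i : im (⊝ x ⊗ y) ≡ im (⊝ (x ⊗ y))
    i rewrite im-⊗ (⊝ x) y | re-⊝ x | im-⊝ x | im-⊝ (x ⊗ y) | im-⊗ x y = L.neg-im (re x) (im x) (re y) (im y)

  ⊝-⊕-comm : ∀ x y → ⊝ x ⊕ ⊝ y ≡ ⊝ (x ⊕ y)
  ⊝-⊕-comm x y = ext r i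
    where
    r : re (⊝ x ⊕ ⊝ y) ≡ re (⊝ (x ⊕ y))
    r rewrite re-⊕ (⊝ x) (⊝ y) | re-⊝ x | re-⊝ y | re-⊝ (x ⊕ y) | re-⊕ x y = L.neg+ (re x) (re y)
    i : im (⊝ x ⊕ ⊝ y) ≡ im (⊝ (x ⊕ y))
    i rewrite im-⊕ (⊝ x) (⊝ y) | im-⊝ x | im-⊝ y | im-⊝ (x ⊕ y) | im-⊕ x y = L.neg+ (im x) (im y)

  ι-⊕ : ∀ a b → ι (a + b) ≡ ι a ⊕ ι b
  ι-⊕ a b = ext (sym (re-⊕ (ι a) (ι b))) (sym (im-⊕ (ι a) (ι b)))

  ι-⊗ : ∀ a b → ι (a * b) ≡ ι a ⊗ ι b
  ι-⊗ a b = ext (trans (L.hom-re D a b) (sym (re-⊗ (ι a) (ι b)))) (trans (L.hom-im a b) (sym (im-⊗ (ι a) (ι b))))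

  ι-⊝ : ∀ a → ι (- a) ≡ ⊝ ι a
  ι-⊝ a = ext (sym (re-⊝ (ι a))) (sym (im-⊝ (ι a)))

  almostCommutativeRing : AlmostCommutativeRing _ _
  almostCommutativeRing = record
    { Carrier = Z√ ; _≈_ = _≡_ ; _+_ = _⊕_ ; _*_ = _⊗_ ; -_ = ⊝_ ; 0# = ι (+ 0) ; 1# = ι (+ 1)
    ; isAlmostCommutativeRing = record
      { isCommutativeSemiring = record
        { isSemiring = record
          { isSemiringWithoutAnnihilatingZero = record
            { +-isCommutativeMonoid = record
              { isMonoid = record
                { isSemigroup = record
                  { isMagma = isMagma _⊕_
                  ; assoc = ⊕-assoc }
                ; identity = ⊕-identityˡ , ⊕-identityʳ }
              ; comm = ⊕-comm }
            ; *-cong = cong₂ _⊗_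
            ; *-assoc = ⊗-assoc
            ; *-identity = ⊗-identityˡ , ⊗-identityʳ
            ; distrib = ⊗-distribˡ-⊕ , ⊗-distribʳ-⊕ }
          ; zero = ⊗-zeroˡ , ⊗-zeroʳ }
        ; *-comm = ⊗-comm }
      ; -‿cong = cong ⊝_
      ; -‿*-distribˡ = ⊝-distribˡ-⊗
      ; -‿+-comm = ⊝-⊕-comm } }

  ι-homomorphism : CommutativeRing.rawRing +-*-commutativeRing -Raw-AlmostCommutative⟶ almostCommutativeRing
  ι-homomorphism = record
    { ⟦_⟧ = ι ; +-homo = ι-⊕ ; *-homo = ι-⊗ ; -‿homo = ι-⊝ ; 0-homo = refl ; 1-homo = refl }

  private
    dec : ∀ a b → Maybe (ι a ≡ ι b)
    dec a b with a ≟ℤ b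
    ... | yes p = just (cong ι p)
    ... | no _ = nothing

  open Algebra.Solver.Ring _ almostCommutativeRing ι-homomorphism dec public using (solve; con; _:+_; _:*_; :-_; _:-_; _:=_)

-- Power series, their differential equations and diagonal recurrences

module PowerSeries (D : ℤ) where

  open import Data.Integer using (+_; -[1+_])
  open QuadraticRing D

  𝟘 : Z√
  𝟘 = ι (+ 0)

  ι-suc : ∀ n → ι (+ suc n) ≡ ι (+ 1) ⊕ ι (+ n)
  ι-suc n = ι-⊕ (+ 1) (+ n)

  ⊖-zero : ∀ {x y} → x ≡ y → x ⊕ ⊝ y ≡ 𝟘
  ⊖-zero {x} refl = solve 1 (λ x → x :+ :- x := con (+ 0)) refl x

  ⊖-cancel : ∀ {x y} → x ⊕ ⊝ y ≡ 𝟘 → x ≡ y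
  ⊖-cancel {x} {y} h = trans (solve 2 (λ x y → x := (x :+ :- y) :+ y) refl x y) (trans (cong (_⊕ y) h) (⊕-identityˡ y))

  -- Power series are sequences of coefficients, shifted by two places so that
  -- the coefficients of z⁻² and z⁻¹ exist and vanish.
  Series : Set
  Series = ℕ → Z√

  -- For f = (1 - az)^(-μ) (1 - 4βz)^(l/4) this is the coefficient of z^(j-1) in
  -- (1 - az) (1 - 4βz) f′ - (a μ (1 - 4βz) - β l (1 - az)) f.
  ode : (a β μ l J f₀ f₁ f₂ : Z√) → Z√
  ode a β μ l J f₀ f₁ f₂ =
    J ⊗ f₂
    ⊕ ⊝ (((a ⊕ ι (+ 4) ⊗ β) ⊗ (J ⊕ ι -[1+ 0 ]) ⊕ a ⊗ μ ⊕ ⊝ (β ⊗ l)) ⊗ f₁)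
    ⊕ ⊝ (a ⊗ β ⊗ (l ⊕ ⊝ (ι (+ 4) ⊗ μ) ⊕ ⊝ (ι (+ 4) ⊗ (J ⊕ ι -[1+ 1 ]))) ⊗ f₀)

  private
    Ode : ∀ {n} (a β μ l J f₀ f₁ f₂ : _) → _
    Ode {n} a β μ l J f₀ f₁ f₂ =
      J :* f₂
      :+ :- (((a :+ con {n} (+ 4) :* β) :* (J :+ con -[1+ 0 ]) :+ a :* μ :+ :- (β :* l)) :* f₁)
      :+ :- (a :* β :* (l :+ :- (con (+ 4) :* μ) :+ :- (con (+ 4) :* (J :+ con -[1+ 1 ]))) :* f₀)

  record Solution (a b μ l : Z√) (f : Series) : Set where
    field
      at₀ : f 0 ≡ 𝟘
      at₁ : f 1 ≡ 𝟘
      rec : ∀ j → ode a b μ l (ι (+ j)) (f j) (f (suc j)) (f (suc (suc j))) ≡ 𝟘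
  open Solution

  mul : Z√ → Series → Series
  mul b f zero = f 0
  mul b f (suc k) = f (suc k) ⊕ ⊝ (b ⊗ f k)

  div : Z√ → Series → Series
  div a f zero = 𝟘
  div a f (suc k) = f (suc k) ⊕ a ⊗ div a f k

  -- A factor 1 - 4βz raises the exponent l/4 by 1. The equation of the product at j + 1 is that of
  -- f at j + 1 minus 4β times that of f at j.
  mul-solution : ∀ {a β μ l f} → Solution a β μ l f → Solution a β μ (l ⊕ ι (+ 4)) (mul (ι (+ 4) ⊗ β) f)
  mul-solution {a} {β} {μ} {l} {f} S = record { at₀ = at₀ S ; at₁ = z ; rec = r }
    where
    b = ι (+ 4) ⊗ β
    z : f 1 ⊕ ⊝ (b ⊗ f 0) ≡ 𝟘
    z rewrite at₀ S | at₁ S = solve 1 (λ b → con (+ 0) :+ :- (b :* con (+ 0)) := con (+ 0)) refl b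
    r : ∀ j → ode a β μ (l ⊕ ι (+ 4)) (ι (+ j)) (mul b f j) (mul b f (suc j)) (mul b f (suc (suc j))) ≡ 𝟘
    r zero rewrite z | at₀ S = solve 5 (λ a β μ l x → Ode a β μ (l :+ con (+ 4)) (con (+ 0)) (con (+ 0)) (con (+ 0)) x := con (+ 0)) refl a β μ l (f 2 ⊕ ⊝ (b ⊗ f 1))
    r (suc j) rewrite ι-suc j = trans
      (solve 9 (λ a β μ l J f₀ f₁ f₂ f₃ →
        let b = con (+ 4) :* β in
        Ode a β μ (l :+ con (+ 4)) (con (+ 1) :+ J) (f₁ :+ :- (b :* f₀)) (f₂ :+ :- (b :* f₁)) (f₃ :+ :- (b :* f₂))
        := Ode a β μ l (con (+ 1) :+ J) f₁ f₂ f₃ :+ :- (b :* Ode a β μ l J f₀ f₁ f₂))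
        refl a β μ l (ι (+ j)) (f j) (f (suc j)) (f (suc (suc j))) (f (suc (suc (suc j)))))
      (trans (cong₂ (λ x y → x ⊕ ⊝ (b ⊗ y)) (subst (λ J → ode a β μ l J (f (suc j)) (f (suc (suc j))) (f (suc (suc (suc j)))) ≡ 𝟘) (ι-suc j) (rec S (suc j))) (rec S j))
        (solve 1 (λ b → con (+ 0) :+ :- (b :* con (+ 0)) := con (+ 0)) refl b))

  -- A factor 1/(1 - az) raises μ by 1. The left side for the quotient at j + 1 is that of f at j +
  -- 1 plus a times that of the quotient at j, so it vanishes by induction.
  div-solution : ∀ {a β μ l f} → Solution a β μ l f → Solution a β (ι (+ 1) ⊕ μ) l (div a f)
  div-solution {a} {β} {μ} {l} {f} S = record { at₀ = refl ; at₁ = z ; rec = r }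
    where
    g = div a f
    z : f 1 ⊕ a ⊗ 𝟘 ≡ 𝟘
    z rewrite at₁ S = solve 1 (λ a → con (+ 0) :+ a :* con (+ 0) := con (+ 0)) refl a
    r : ∀ j → ode a β (ι (+ 1) ⊕ μ) l (ι (+ j)) (g j) (g (suc j)) (g (suc (suc j))) ≡ 𝟘
    r zero rewrite z = solve 5 (λ a β μ l x → Ode a β (con (+ 1) :+ μ) l (con (+ 0)) (con (+ 0)) (con (+ 0)) x := con (+ 0)) refl a β μ l (f 2 ⊕ a ⊗ 𝟘)
    r (suc j) rewrite ι-suc j = trans
      (solve 9 (λ a β μ l J g₀ f₁ f₂ f₃ →
        let g₁ = f₁ :+ a :* g₀ ; g₂ = f₂ :+ a :* g₁ ; g₃ = f₃ :+ a :* g₂ in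
        Ode a β (con (+ 1) :+ μ) l (con (+ 1) :+ J) g₁ g₂ g₃
        := Ode a β μ l (con (+ 1) :+ J) f₁ f₂ f₃ :+ a :* Ode a β (con (+ 1) :+ μ) l J g₀ g₁ g₂)
        refl a β μ l (ι (+ j)) (g j) (f (suc j)) (f (suc (suc j))) (f (suc (suc (suc j)))))
      (trans (cong₂ (λ x y → x ⊕ a ⊗ y) (subst (λ J → ode a β μ l J (f (suc j)) (f (suc (suc j))) (f (suc (suc (suc j)))) ≡ 𝟘) (ι-suc j) (rec S (suc j))) (r j))
        (solve 1 (λ a → con (+ 0) :+ a :* con (+ 0) := con (+ 0)) refl a))

  div-cong : ∀ a {f g : Series} → (∀ k → f k ≡ g k) → ∀ k → div a f k ≡ div a g k
  div-cong a e zero = refl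
  div-cong a e (suc k) = cong₂ (λ x y → x ⊕ a ⊗ y) (e (suc k)) (div-cong a e k)

  div-mul : ∀ a b {f : Series} → f 0 ≡ 𝟘 → ∀ k → div a (mul b f) k ≡ mul b (div a f) k
  div-mul a b e zero = refl
  div-mul a b {f} e (suc zero) rewrite e =
    solve 3 (λ a b x → (x :+ :- (b :* con (+ 0))) :+ a :* con (+ 0) := (x :+ a :* con (+ 0)) :+ :- (b :* con (+ 0))) refl a b (f 1)
  div-mul a b {f} e (suc (suc k)) = trans
    (cong (λ x → f (suc (suc k)) ⊕ ⊝ (b ⊗ f (suc k)) ⊕ a ⊗ x) (div-mul a b {f} e (suc k)))
    (solve 5 (λ a b x y z → x :+ :- (b :* y) :+ a :* ((y :+ a :* z) :+ :- (b :* z)) := (x :+ a :* (y :+ a :* z)) :+ :- (b :* (y :+ a :* z)))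
      refl a b (f (suc (suc k))) (f (suc k)) (div a f k))

  div⁻¹ : ∀ a (f : Series) k → f (suc k) ≡ div a f (suc k) ⊕ ⊝ (a ⊗ div a f k)
  div⁻¹ a f k = solve 3 (λ a x y → x := (x :+ a :* y) :+ :- (a :* y)) refl a (f (suc k)) (div a f k)

  pad : (ℕ → Z√) → Series
  pad c zero = 𝟘
  pad c (suc zero) = 𝟘
  pad c (suc (suc n)) = c n

  -- The hypothesis is the first-order recurrence for the coefficients of (1 - 4βz)^(l/4). Its
  -- multiple by 1 - az is the second-order equation with μ = 0, which puts c into the family that
  -- division by 1 - az preserves.
  pad-solution : ∀ {a β l c} →
    (∀ n → ι (+ suc n) ⊗ c (suc n) ≡ β ⊗ (ι (+ 4) ⊗ ι (+ n) ⊕ ⊝ l) ⊗ c n) → Solution a β 𝟘 l (pad c)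
  pad-solution {a} {β} {l} {c} h = record { at₀ = refl ; at₁ = refl ; rec = r }
    where
    first : (J x y : Z√) → Z√
    first J x y = (ι (+ 1) ⊕ J) ⊗ y ⊕ ⊝ (β ⊗ (ι (+ 4) ⊗ J ⊕ ⊝ l) ⊗ x)
    h′ : ∀ n → first (ι (+ n)) (c n) (c (suc n)) ≡ 𝟘
    h′ n = ⊖-zero (trans (cong (λ x → x ⊗ c (suc n)) (sym (ι-suc n))) (h n))
    r : ∀ j → ode a β 𝟘 l (ι (+ j)) (pad c j) (pad c (suc j)) (c j) ≡ 𝟘
    r zero = solve 4 (λ a β l x → Ode a β (con (+ 0)) l (con (+ 0)) (con (+ 0)) (con (+ 0)) x := con (+ 0)) refl a β l (c 0)
    r (suc zero) = trans
      (solve 5 (λ a β l x y → Ode a β (con (+ 0)) l (con (+ 1)) (con (+ 0)) x y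
         := (con (+ 1) :+ con (+ 0)) :* y :+ :- (β :* (con (+ 4) :* con (+ 0) :+ :- l) :* x)) refl a β l (c 0) (c 1)) (h′ 0)
    r (suc (suc n)) rewrite ι-suc (suc n) | ι-suc n = trans
      (solve 7 (λ a β l J x y w →
         Ode a β (con (+ 0)) l (con (+ 1) :+ (con (+ 1) :+ J)) x y w
         := ((con (+ 1) :+ (con (+ 1) :+ J)) :* w :+ :- (β :* (con (+ 4) :* (con (+ 1) :+ J) :+ :- l) :* y))
            :+ :- (a :* ((con (+ 1) :+ J) :* y :+ :- (β :* (con (+ 4) :* J :+ :- l) :* x))))
        refl a β l (ι (+ n)) (c n) (c (suc n)) (c (suc (suc n))))
      (trans (cong₂ (λ x y → x ⊕ ⊝ (a ⊗ y))
          (subst (λ J → first J (c (suc n)) (c (suc (suc n))) ≡ 𝟘) (ι-suc n) (h′ (suc n))) (h′ n))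
        (solve 1 (λ a → con (+ 0) :+ :- (a :* con (+ 0)) := con (+ 0)) refl a))

  muls divs : Z√ → ℕ → Series → Series
  muls b zero f = f
  muls b (suc n) f = mul b (muls b n f)
  divs a zero f = f
  divs a (suc n) f = div a (divs a n f)

  muls-solution : ∀ {a β μ l f} n → Solution a β μ l f → Solution a β μ (l ⊕ ι (+ 4) ⊗ ι (+ n)) (muls (ι (+ 4) ⊗ β) n f)
  muls-solution {l = l} zero S = subst (λ x → Solution _ _ _ x _) (solve 1 (λ l → l := l :+ con (+ 4) :* con (+ 0)) refl l) S
  muls-solution {l = l} (suc n) S = subst (λ x → Solution _ _ _ x _)
    (trans (solve 2 (λ l n → l :+ con (+ 4) :* n :+ con (+ 4) := l :+ con (+ 4) :* (con (+ 1) :+ n)) refl l (ι (+ n)))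
      (cong (λ x → l ⊕ ι (+ 4) ⊗ x) (sym (ι-suc n))))
    (mul-solution (muls-solution n S))

  divs-solution : ∀ {a β l f} n → Solution a β 𝟘 l f → Solution a β (ι (+ n)) l (divs a n f)
  divs-solution zero S = S
  divs-solution {a} {β} {l} {f} (suc n) S = subst (λ x → Solution a β x l (divs a (suc n) f)) (sym (ι-suc n)) (div-solution (divs-solution n S))

  divs-at₀ : ∀ a n {f : Series} → f 0 ≡ 𝟘 → divs a n f 0 ≡ 𝟘
  divs-at₀ a zero e = e
  divs-at₀ a (suc n) e = refl

  divs-mul : ∀ a b n {f : Series} → f 0 ≡ 𝟘 → ∀ k → divs a n (mul b f) k ≡ mul b (divs a n f) k
  divs-mul a b zero e k = refl
  divs-mul a b (suc n) {f} e k = trans (div-cong a (divs-mul a b n {f} e) k) (div-mul a b {divs a n f} (divs-at₀ a n {f} e) k)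

  -- The coefficients of z^s in (1 - az)^(-s-1) (1 - 4βz)^(s + l/4) and in
  -- (1 - az)^(-s-1) (1 - 4βz)^(l/4) both satisfy three-term recurrences in s.
  module Diagonal (a β : Z√) (c : ℕ → Z√) where
    b : Z√
    b = ι (+ 4) ⊗ β

    upper lower : ℕ → Z√
    upper s = divs a (suc s) (muls b s (pad c)) (2 ℕ.+ s)
    lower s = divs a (suc s) (pad c) (2 ℕ.+ s)

    module _ (s : ℕ) (f : Series) where
      private
        g = divs a (3 ℕ.+ s) f

      first-difference : divs a (2 ℕ.+ s) f (3 ℕ.+ s) ≡ g (3 ℕ.+ s) ⊕ ⊝ (a ⊗ g (2 ℕ.+ s))
      first-difference = div⁻¹ a (divs a (2 ℕ.+ s) f) (2 ℕ.+ s)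

      first-difference′ : divs a (2 ℕ.+ s) f (2 ℕ.+ s) ≡ g (2 ℕ.+ s) ⊕ ⊝ (a ⊗ g (1 ℕ.+ s))
      first-difference′ = div⁻¹ a (divs a (2 ℕ.+ s) f) (1 ℕ.+ s)

      second-difference : divs a (1 ℕ.+ s) f (2 ℕ.+ s) ≡ (g (2 ℕ.+ s) ⊕ ⊝ (a ⊗ g (1 ℕ.+ s))) ⊕ ⊝ (a ⊗ (g (1 ℕ.+ s) ⊕ ⊝ (a ⊗ g s)))
      second-difference = trans (div⁻¹ a (divs a (1 ℕ.+ s) f) (1 ℕ.+ s))
        (cong₂ (λ x y → x ⊕ ⊝ (a ⊗ y)) first-difference′ (div⁻¹ a (divs a (2 ℕ.+ s) f) s))

    private
      muls-at₀ : ∀ n → muls b n (pad c) 0 ≡ 𝟘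
      muls-at₀ zero = refl
      muls-at₀ (suc n) = muls-at₀ n

      module Odes {l f} (s : ℕ) (sol : Solution a β (ι (+ (3 ℕ.+ s))) l f) where
        μ S : Z√
        S = ι (+ s)
        μ = ι (+ 1) ⊕ (ι (+ 1) ⊕ (ι (+ 1) ⊕ S))
        sol′ : Solution a β μ l f
        sol′ = subst (λ x → Solution a β x l f)
          (trans (ι-suc (2 ℕ.+ s)) (cong (ι (+ 1) ⊕_) (trans (ι-suc (1 ℕ.+ s)) (cong (ι (+ 1) ⊕_) (ι-suc s))))) sol
        ode₀ : ode a β μ l S (f s) (f (1 ℕ.+ s)) (f (2 ℕ.+ s)) ≡ 𝟘
        ode₀ = rec sol′ s
        ode₁ : ode a β μ l (ι (+ 1) ⊕ S) (f (1 ℕ.+ s)) (f (2 ℕ.+ s)) (f (3 ℕ.+ s)) ≡ 𝟘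
        ode₁ = subst (λ J → ode a β μ l J _ _ _ ≡ 𝟘) (ι-suc s) (rec sol′ (1 ℕ.+ s))
        ode₂ : ode a β μ l (ι (+ 1) ⊕ (ι (+ 1) ⊕ S)) (f (2 ℕ.+ s)) (f (3 ℕ.+ s)) (f (4 ℕ.+ s)) ≡ 𝟘
        ode₂ = subst (λ J → ode a β μ l J _ _ _ ≡ 𝟘) (trans (ι-suc (1 ℕ.+ s)) (cong (ι (+ 1) ⊕_) (ι-suc s))) (rec sol′ (2 ℕ.+ s))

    -- The three values are coefficients of (1 - 4βz)² g, (1 - az)(1 - 4βz) g and (1 - az)² g for
    -- one series g = (1 - az)^(-s-3) (1 - 4βz)^(s-1/4). In terms of five consecutive coefficients
    -- of g, the recurrence is an explicit combination of three instances of its differential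
    -- equation, as in creative telescoping.
    upper-recurrence : (∀ n → ι (+ suc n) ⊗ c (suc n) ≡ β ⊗ (ι (+ 4) ⊗ ι (+ n) ⊕ ⊝ ι -[1+ 0 ]) ⊗ c n) → ∀ s →
      let S = ι (+ s) in
      (S ⊕ ι (+ 2)) ⊗ (S ⊕ ι (+ 1)) ⊗ upper (2 ℕ.+ s)
        ⊕ ⊝ ((ι (+ 2) ⊗ S ⊕ ι (+ 3)) ⊗ (S ⊕ ι (+ 1)) ⊗ (ι (+ 2) ⊗ a ⊕ ⊝ (ι (+ 4) ⊗ β)) ⊗ upper (1 ℕ.+ s))
        ⊕ (ι (+ 4) ⊗ S ⊕ ι (+ 3)) ⊗ (ι (+ 4) ⊗ S ⊕ ι (+ 5)) ⊗ (β ⊗ β) ⊗ upper s ≡ 𝟘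
    upper-recurrence h s = begin
      combine (upper (2 ℕ.+ s)) (upper (1 ℕ.+ s)) (upper s)
        ≡⟨ cong₂ (λ x y → combine x y (upper s)) e₂ e₁ ⟩
      combine ((g (4 ℕ.+ s) ⊕ ⊝ (b ⊗ g (3 ℕ.+ s))) ⊕ ⊝ (b ⊗ (g (3 ℕ.+ s) ⊕ ⊝ (b ⊗ g (2 ℕ.+ s)))))
        ((g (3 ℕ.+ s) ⊕ ⊝ (a ⊗ g (2 ℕ.+ s))) ⊕ ⊝ (b ⊗ (g (2 ℕ.+ s) ⊕ ⊝ (a ⊗ g (1 ℕ.+ s))))) (upper s)
        ≡⟨ cong (combine _ _) (second-difference s f) ⟩
      combine _ _ _ ≡⟨ solve 8 (λ S a β g₀ g₁ g₂ g₃ g₄ →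
           let b = con (+ 4) :* β ; μ = con (+ 1) :+ (con (+ 1) :+ (con (+ 1) :+ S)) ; l = con -[1+ 0 ] :+ con (+ 4) :* S in
           (S :+ con (+ 2)) :* (S :+ con (+ 1)) :* ((g₄ :+ :- (b :* g₃)) :+ :- (b :* (g₃ :+ :- (b :* g₂))))
           :+ :- ((con (+ 2) :* S :+ con (+ 3)) :* (S :+ con (+ 1)) :* (con (+ 2) :* a :+ :- (con (+ 4) :* β)) :* ((g₃ :+ :- (a :* g₂)) :+ :- (b :* (g₂ :+ :- (a :* g₁)))))
           :+ (con (+ 4) :* S :+ con (+ 3)) :* (con (+ 4) :* S :+ con (+ 5)) :* (β :* β) :* ((g₂ :+ :- (a :* g₁)) :+ :- (a :* (g₁ :+ :- (a :* g₀))))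
           := (S :+ con (+ 1)) :* Ode a β μ l (con (+ 1) :+ (con (+ 1) :+ S)) g₂ g₃ g₄
              :+ (β :+ :- (a :* (con (+ 2) :* S :+ con (+ 2)))) :* Ode a β μ l (con (+ 1) :+ S) g₁ g₂ g₃
              :+ (con (+ 4) :* S :+ con (+ 3)) :* (a :* β) :* Ode a β μ l S g₀ g₁ g₂)
           refl S a β (g s) (g (1 ℕ.+ s)) (g (2 ℕ.+ s)) (g (3 ℕ.+ s)) (g (4 ℕ.+ s)) ⟩
      (S ⊕ ι (+ 1)) ⊗ ode a β O.μ l (ι (+ 1) ⊕ (ι (+ 1) ⊕ S)) (g (2 ℕ.+ s)) (g (3 ℕ.+ s)) (g (4 ℕ.+ s))
        ⊕ (β ⊕ ⊝ (a ⊗ (ι (+ 2) ⊗ S ⊕ ι (+ 2)))) ⊗ ode a β O.μ l (ι (+ 1) ⊕ S) (g (1 ℕ.+ s)) (g (2 ℕ.+ s)) (g (3 ℕ.+ s))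
        ⊕ (ι (+ 4) ⊗ S ⊕ ι (+ 3)) ⊗ (a ⊗ β) ⊗ ode a β O.μ l S (g s) (g (1 ℕ.+ s)) (g (2 ℕ.+ s))
        ≡⟨ cong₂ (λ w z → (S ⊕ ι (+ 1)) ⊗ w ⊕ (β ⊕ ⊝ (a ⊗ (ι (+ 2) ⊗ S ⊕ ι (+ 2)))) ⊗ z ⊕ (ι (+ 4) ⊗ S ⊕ ι (+ 3)) ⊗ (a ⊗ β) ⊗ ode a β O.μ l S (g s) (g (1 ℕ.+ s)) (g (2 ℕ.+ s))) O.ode₂ O.ode₁ ⟩
      (S ⊕ ι (+ 1)) ⊗ 𝟘 ⊕ (β ⊕ ⊝ (a ⊗ (ι (+ 2) ⊗ S ⊕ ι (+ 2)))) ⊗ 𝟘 ⊕ (ι (+ 4) ⊗ S ⊕ ι (+ 3)) ⊗ (a ⊗ β) ⊗ ode a β O.μ l S (g s) (g (1 ℕ.+ s)) (g (2 ℕ.+ s))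
        ≡⟨ cong (λ w → (S ⊕ ι (+ 1)) ⊗ 𝟘 ⊕ (β ⊕ ⊝ (a ⊗ (ι (+ 2) ⊗ S ⊕ ι (+ 2)))) ⊗ 𝟘 ⊕ (ι (+ 4) ⊗ S ⊕ ι (+ 3)) ⊗ (a ⊗ β) ⊗ w) O.ode₀ ⟩
      (S ⊕ ι (+ 1)) ⊗ 𝟘 ⊕ (β ⊕ ⊝ (a ⊗ (ι (+ 2) ⊗ S ⊕ ι (+ 2)))) ⊗ 𝟘 ⊕ (ι (+ 4) ⊗ S ⊕ ι (+ 3)) ⊗ (a ⊗ β) ⊗ 𝟘
        ≡⟨ solve 3 (λ x y z → x :* con (+ 0) :+ y :* con (+ 0) :+ z :* con (+ 0) := con (+ 0)) refl _ _ _ ⟩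
      𝟘 ∎
      where
      open ≡-Reasoning
      S = ι (+ s)
      f = muls b s (pad c)
      g = divs a (3 ℕ.+ s) f
      l = ι -[1+ 0 ] ⊕ ι (+ 4) ⊗ S
      module O = Odes s (divs-solution {a} {β} (3 ℕ.+ s) (muls-solution s (pad-solution {a} h)))
      combine : (x y z : Z√) → Z√
      combine x y z = (S ⊕ ι (+ 2)) ⊗ (S ⊕ ι (+ 1)) ⊗ x
        ⊕ ⊝ ((ι (+ 2) ⊗ S ⊕ ι (+ 3)) ⊗ (S ⊕ ι (+ 1)) ⊗ (ι (+ 2) ⊗ a ⊕ ⊝ (ι (+ 4) ⊗ β)) ⊗ y)
        ⊕ (ι (+ 4) ⊗ S ⊕ ι (+ 3)) ⊗ (ι (+ 4) ⊗ S ⊕ ι (+ 5)) ⊗ (β ⊗ β) ⊗ z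
      e₂ : upper (2 ℕ.+ s) ≡ (g (4 ℕ.+ s) ⊕ ⊝ (b ⊗ g (3 ℕ.+ s))) ⊕ ⊝ (b ⊗ (g (3 ℕ.+ s) ⊕ ⊝ (b ⊗ g (2 ℕ.+ s))))
      e₂ = trans (divs-mul a b (3 ℕ.+ s) {mul b f} (muls-at₀ s) (4 ℕ.+ s))
        (cong₂ (λ x y → x ⊕ ⊝ (b ⊗ y)) (divs-mul a b (3 ℕ.+ s) {f} (muls-at₀ s) (4 ℕ.+ s)) (divs-mul a b (3 ℕ.+ s) {f} (muls-at₀ s) (3 ℕ.+ s)))
      e₁ : upper (1 ℕ.+ s) ≡ (g (3 ℕ.+ s) ⊕ ⊝ (a ⊗ g (2 ℕ.+ s))) ⊕ ⊝ (b ⊗ (g (2 ℕ.+ s) ⊕ ⊝ (a ⊗ g (1 ℕ.+ s))))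
      e₁ = trans (divs-mul a b (2 ℕ.+ s) {f} (muls-at₀ s) (3 ℕ.+ s))
        (cong₂ (λ x y → x ⊕ ⊝ (b ⊗ y)) (first-difference s f) (first-difference′ s f))

    -- The same device with g = (1 - az)^(-s-3) (1 - 4βz)^(-1/2), whose multiples by 1, 1 - az and
    -- (1 - az)² carry the three values. Writing a = 4u avoids denominators in the multipliers.
    lower-recurrence : ∀ u → a ≡ ι (+ 4) ⊗ u →
      (∀ n → ι (+ suc n) ⊗ c (suc n) ≡ β ⊗ (ι (+ 4) ⊗ ι (+ n) ⊕ ⊝ ι -[1+ 1 ]) ⊗ c n) → ∀ s →
      let S = ι (+ s) in
      (S ⊕ ι (+ 2)) ⊗ (S ⊕ ι (+ 1)) ⊗ (u ⊕ ⊝ β) ⊗ lower (2 ℕ.+ s)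
        ⊕ ι (+ 2) ⊗ (ι (+ 2) ⊗ S ⊕ ι (+ 3)) ⊗ (S ⊕ ι (+ 1)) ⊗ (ι -[1+ 3 ] ⊗ u ⊗ u ⊕ ι (+ 4) ⊗ u ⊗ β ⊕ β ⊗ β) ⊗ lower (1 ℕ.+ s)
        ⊕ ⊝ (ι (+ 4) ⊗ (ι (+ 4) ⊗ S ⊕ ι (+ 3)) ⊗ (ι (+ 4) ⊗ S ⊕ ι (+ 5)) ⊗ u ⊗ (β ⊗ β) ⊗ lower s) ≡ 𝟘
    lower-recurrence u refl h s = begin
      combine (lower (2 ℕ.+ s)) (lower (1 ℕ.+ s)) (lower s)
        ≡⟨ cong₂ (combine _) (first-difference s (pad c)) (second-difference s (pad c)) ⟩
      combine _ _ _ ≡⟨ solve 8 (λ S u β g₀ g₁ g₂ g₃ g₄ →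
           let a = con (+ 4) :* u ; μ = con (+ 1) :+ (con (+ 1) :+ (con (+ 1) :+ S)) ; l = con -[1+ 1 ] in
           (S :+ con (+ 2)) :* (S :+ con (+ 1)) :* (u :+ :- β) :* g₄
           :+ con (+ 2) :* (con (+ 2) :* S :+ con (+ 3)) :* (S :+ con (+ 1)) :* (con -[1+ 3 ] :* u :* u :+ con (+ 4) :* u :* β :+ β :* β) :* (g₃ :+ :- (a :* g₂))
           :+ :- (con (+ 4) :* (con (+ 4) :* S :+ con (+ 3)) :* (con (+ 4) :* S :+ con (+ 5)) :* u :* (β :* β) :* ((g₂ :+ :- (a :* g₁)) :+ :- (a :* (g₁ :+ :- (a :* g₀)))))
           := (S :+ con (+ 1)) :* (u :+ :- β) :* Ode a β μ l (con (+ 1) :+ (con (+ 1) :+ S)) g₂ g₃ g₄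
              :+ (con -[1+ 7 ] :* (S :+ con (+ 1)) :* u :* u :+ con (+ 2) :* (con (+ 6) :* S :+ con (+ 7)) :* u :* β) :* Ode a β μ l (con (+ 1) :+ S) g₁ g₂ g₃
              :+ con -[1+ 7 ] :* (con (+ 4) :* S :+ con (+ 5)) :* u :* u :* β :* Ode a β μ l S g₀ g₁ g₂)
           refl S u β (g s) (g (1 ℕ.+ s)) (g (2 ℕ.+ s)) (g (3 ℕ.+ s)) (g (4 ℕ.+ s)) ⟩
      x ⊗ ode a β O.μ l (ι (+ 1) ⊕ (ι (+ 1) ⊕ S)) (g (2 ℕ.+ s)) (g (3 ℕ.+ s)) (g (4 ℕ.+ s))
        ⊕ y ⊗ ode a β O.μ l (ι (+ 1) ⊕ S) (g (1 ℕ.+ s)) (g (2 ℕ.+ s)) (g (3 ℕ.+ s))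
        ⊕ z ⊗ ode a β O.μ l S (g s) (g (1 ℕ.+ s)) (g (2 ℕ.+ s))
        ≡⟨ cong₂ (λ w v → x ⊗ w ⊕ y ⊗ v ⊕ z ⊗ ode a β O.μ l S (g s) (g (1 ℕ.+ s)) (g (2 ℕ.+ s))) O.ode₂ O.ode₁ ⟩
      x ⊗ 𝟘 ⊕ y ⊗ 𝟘 ⊕ z ⊗ ode a β O.μ l S (g s) (g (1 ℕ.+ s)) (g (2 ℕ.+ s))
        ≡⟨ cong (λ w → x ⊗ 𝟘 ⊕ y ⊗ 𝟘 ⊕ z ⊗ w) O.ode₀ ⟩
      x ⊗ 𝟘 ⊕ y ⊗ 𝟘 ⊕ z ⊗ 𝟘
        ≡⟨ solve 3 (λ x y z → x :* con (+ 0) :+ y :* con (+ 0) :+ z :* con (+ 0) := con (+ 0)) refl x y z ⟩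
      𝟘 ∎
      where
      open ≡-Reasoning
      S = ι (+ s)
      g = divs a (3 ℕ.+ s) (pad c)
      l = ι -[1+ 1 ]
      module O = Odes s (divs-solution {a} {β} (3 ℕ.+ s) (pad-solution {a} h))
      x = (S ⊕ ι (+ 1)) ⊗ (u ⊕ ⊝ β)
      y = ι -[1+ 7 ] ⊗ (S ⊕ ι (+ 1)) ⊗ u ⊗ u ⊕ ι (+ 2) ⊗ (ι (+ 6) ⊗ S ⊕ ι (+ 7)) ⊗ u ⊗ β
      z = ι -[1+ 7 ] ⊗ (ι (+ 4) ⊗ S ⊕ ι (+ 5)) ⊗ u ⊗ u ⊗ β
      combine : (x y z : Z√) → Z√
      combine x y z = (S ⊕ ι (+ 2)) ⊗ (S ⊕ ι (+ 1)) ⊗ (u ⊕ ⊝ β) ⊗ x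
        ⊕ ι (+ 2) ⊗ (ι (+ 2) ⊗ S ⊕ ι (+ 3)) ⊗ (S ⊕ ι (+ 1)) ⊗ (ι -[1+ 3 ] ⊗ u ⊗ u ⊕ ι (+ 4) ⊗ u ⊗ β ⊕ β ⊗ β) ⊗ y
        ⊕ ⊝ (ι (+ 4) ⊗ (ι (+ 4) ⊗ S ⊕ ι (+ 3)) ⊗ (ι (+ 4) ⊗ S ⊕ ι (+ 5)) ⊗ u ⊗ (β ⊗ β) ⊗ z)

-- Conjugation, norm, and divisibility by powers

module Divisibility (D : ℤ) where

  open import Data.Integer using (+_; _+_; _*_; -_; _-_; _^_)
  open import Data.Integer.Tactic.RingSolver using (solve-∀)
  open QuadraticRing D

  opaque
    conj : Z√ → Z√
    conj z = re z +√ - im z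

    re-conj : ∀ z → re (conj z) ≡ re z
    re-conj z = refl
    im-conj : ∀ z → im (conj z) ≡ - im z
    im-conj z = refl

  opaque
    norm : Z√ → ℤ
    norm z = re z * re z + D * (im z * im z)

    norm≡ : ∀ z → norm z ≡ re z * re z + D * (im z * im z)
    norm≡ z = refl

  conj-⊗ : ∀ x y → conj (x ⊗ y) ≡ conj x ⊗ conj y
  conj-⊗ x y = ext r i
    where
    eq₁ : ∀ D a b c d → a * c - D * (b * d) ≡ a * c - D * (- b * - d)
    eq₁ = solve-∀
    eq₂ : ∀ a b c d → - (a * d + b * c) ≡ a * - d + - b * c
    eq₂ = solve-∀
    r : re (conj (x ⊗ y)) ≡ re (conj x ⊗ conj y)
    r rewrite re-conj (x ⊗ y) | re-⊗ x y | re-⊗ (conj x) (conj y) | re-conj x | re-conj y | im-conj x | im-conj y = eq₁ D (re x) (im x) (re y) (im y)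
    i : im (conj (x ⊗ y)) ≡ im (conj x ⊗ conj y)
    i rewrite im-conj (x ⊗ y) | im-⊗ x y | im-⊗ (conj x) (conj y) | re-conj x | re-conj y | im-conj x | im-conj y = eq₂ (re x) (im x) (re y) (im y)

  ⊗-conj : ∀ z → z ⊗ conj z ≡ ι (norm z)
  ⊗-conj z = ext r i
    where
    eq₁ : ∀ D a b → a * a - D * (b * - b) ≡ a * a + D * (b * b)
    eq₁ = solve-∀
    eq₂ : ∀ a b → a * - b + b * a ≡ + 0
    eq₂ = solve-∀
    r : re (z ⊗ conj z) ≡ norm z
    r rewrite norm≡ z | re-⊗ z (conj z) | re-conj z | im-conj z = eq₁ D (re z) (im z)
    i : im (z ⊗ conj z) ≡ + 0
    i rewrite im-⊗ z (conj z) | re-conj z | im-conj z = eq₂ (re z) (im z)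

  ⊕-conj : ∀ z → z ⊕ conj z ≡ ι (+ 2 * re z)
  ⊕-conj z = ext r i
    where
    eq₁ : ∀ a → a + a ≡ + 2 * a
    eq₁ = solve-∀
    r : re (z ⊕ conj z) ≡ + 2 * re z
    r rewrite re-⊕ z (conj z) | re-conj z = eq₁ (re z)
    i : im (z ⊕ conj z) ≡ + 0
    i rewrite im-⊕ z (conj z) | im-conj z = ℤ.+-inverseʳ (im z)

  norm-⊗ : ∀ x y → norm (x ⊗ y) ≡ norm x * norm y
  norm-⊗ x y rewrite norm≡ (x ⊗ y) | norm≡ x | norm≡ y | re-⊗ x y | im-⊗ x y = eq D (re x) (im x) (re y) (im y)
    where
    eq : ∀ D a b c d → (a * c - D * (b * d)) * (a * c - D * (b * d)) + D * ((a * d + b * c) * (a * d + b * c))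
      ≡ (a * a + D * (b * b)) * (c * c + D * (d * d))
    eq = solve-∀

  infixr 8 _⊛_
  _⊛_ : Z√ → ℕ → Z√
  z ⊛ zero = ι (+ 1)
  z ⊛ suc n = z ⊗ z ⊛ n

  norm-⊛ : ∀ z n → norm (z ⊛ n) ≡ norm z ^ n
  norm-⊛ z zero = trans (norm≡ (ι (+ 1))) (eq D)
    where
    eq : ∀ D → + 1 * + 1 + D * (+ 0 * + 0) ≡ + 1
    eq = solve-∀
  norm-⊛ z (suc n) = trans (norm-⊗ z (z ⊛ n)) (cong (norm z *_) (norm-⊛ z n))

  -- If g and the conjugate of t generate the unit ideal, then a power of g dividing
  -- the norm of t divides t.
  module _ (g t : Z√) (k l : ℤ) (unit : k * (+ 2 * re (g ⊗ t)) + l * norm g ≡ + 1) where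
    private
      A B : Z√
      A = ι k ⊗ t ⊕ ι l ⊗ conj g
      B = ι k ⊗ conj g

      -- The trace of g t is g t plus its conjugate and the norm of g is g times its conjugate, so
      -- the integer identity `unit` rearranges into a combination of g and `conj t`.
      bezout : A ⊗ g ⊕ B ⊗ conj t ≡ ι (+ 1)
      bezout = begin
        A ⊗ g ⊕ B ⊗ conj t
          ≡⟨ solve 6 (λ k l g t g′ t′ → (k :* t :+ l :* g′) :* g :+ k :* g′ :* t′ := k :* (g :* t :+ g′ :* t′) :+ l :* (g :* g′)) refl (ι k) (ι l) g t (conj g) (conj t) ⟩
        ι k ⊗ (g ⊗ t ⊕ conj g ⊗ conj t) ⊕ ι l ⊗ (g ⊗ conj g)
          ≡⟨ cong₂ (λ x y → ι k ⊗ x ⊕ ι l ⊗ y) (trans (cong (g ⊗ t ⊕_) (sym (conj-⊗ g t))) (⊕-conj (g ⊗ t))) (⊗-conj g) ⟩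
        ι k ⊗ ι (+ 2 * re (g ⊗ t)) ⊕ ι l ⊗ ι (norm g) ≡⟨ cong₂ _⊕_ (sym (ι-⊗ k _)) (sym (ι-⊗ l _)) ⟩
        ι (k * (+ 2 * re (g ⊗ t))) ⊕ ι (l * norm g) ≡⟨ sym (ι-⊕ _ _) ⟩
        ι (k * (+ 2 * re (g ⊗ t)) + l * norm g) ≡⟨ cong ι unit ⟩
        ι (+ 1) ∎
        where open ≡-Reasoning

      -- In a product of such identities one term contains all factors g; every other term contains
      -- `conj t`.
      bezout-power : ∀ n → ∃₂ λ A B → A ⊗ g ⊛ n ⊕ B ⊗ conj t ≡ ι (+ 1)
      bezout-power zero = ι (+ 1) , ι (+ 0) , solve 1 (λ t → con (+ 1) :* con (+ 1) :+ con (+ 0) :* t := con (+ 1)) refl (conj t)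
      bezout-power (suc n) with bezout-power n
      ... | A′ , B′ , e = A ⊗ A′ , (A ⊗ g ⊗ B′ ⊕ B ⊗ A′ ⊗ g ⊛ n ⊕ B ⊗ B′ ⊗ conj t) ,
        trans (solve 7 (λ A B A′ B′ g gn t → A :* A′ :* (g :* gn) :+ (A :* g :* B′ :+ B :* A′ :* gn :+ B :* B′ :* t) :* t
          := (A :* g :+ B :* t) :* (A′ :* gn :+ B′ :* t)) refl A B A′ B′ g (g ⊛ n) (conj t))
        (trans (cong₂ _⊗_ bezout e) (⊗-identityˡ (ι (+ 1))))

    power-divides : ∀ n h → t ⊗ conj t ≡ g ⊛ n ⊗ h → ∃ λ κ → t ≡ g ⊛ n ⊗ κ
    power-divides n h e with bezout-power n
    ... | A , B , e′ = A ⊗ t ⊕ B ⊗ h , (begin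
      t ≡⟨ sym (⊗-identityˡ t) ⟩
      ι (+ 1) ⊗ t ≡⟨ cong (_⊗ t) (sym e′) ⟩
      (A ⊗ g ⊛ n ⊕ B ⊗ conj t) ⊗ t ≡⟨ solve 5 (λ A B gn t t′ → (A :* gn :+ B :* t′) :* t := gn :* (A :* t) :+ B :* (t :* t′)) refl A B (g ⊛ n) t (conj t) ⟩
      g ⊛ n ⊗ (A ⊗ t) ⊕ B ⊗ (t ⊗ conj t) ≡⟨ cong (λ x → g ⊛ n ⊗ (A ⊗ t) ⊕ B ⊗ x) e ⟩
      g ⊛ n ⊗ (A ⊗ t) ⊕ B ⊗ (g ⊛ n ⊗ h) ≡⟨ solve 5 (λ A B gn t h → gn :* (A :* t) :+ B :* (gn :* h) := gn :* (A :* t :+ B :* h)) refl A B (g ⊛ n) t h ⟩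
      g ⊛ n ⊗ (A ⊗ t ⊕ B ⊗ h) ∎)
      where open ≡-Reasoning

    -- Equal norms say that t times its conjugate is g^n times the conjugate of g^n, so g^n divides
    -- t; comparing norms again leaves a cofactor of norm 1.
    power-up-to-unit : ∀ n → .{{ℤ.NonZero (norm g ^ n)}} → norm t ≡ norm g ^ n → ∃ λ κ → t ≡ g ⊛ n ⊗ κ × norm κ ≡ + 1
    power-up-to-unit n {{nz}} e = proj₁ p , proj₂ p , cancel
      where
      h′ : t ⊗ conj t ≡ g ⊛ n ⊗ conj (g ⊛ n)
      h′ = trans (⊗-conj t) (trans (cong ι (trans e (sym (norm-⊛ g n)))) (sym (⊗-conj (g ⊛ n))))
      p = power-divides n (conj (g ⊛ n)) h′
      κ = proj₁ p
      h″ : norm g ^ n * norm κ ≡ norm g ^ n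
      h″ = begin
        norm g ^ n * norm κ ≡⟨ cong (_* norm κ) (sym (norm-⊛ g n)) ⟩
        norm (g ⊛ n) * norm κ ≡⟨ sym (norm-⊗ (g ⊛ n) κ) ⟩
        norm (g ⊛ n ⊗ κ) ≡⟨ cong norm (sym (proj₂ p)) ⟩
        norm t ≡⟨ e ⟩
        norm g ^ n ∎
        where open ≡-Reasoning
      cancel : norm κ ≡ + 1
      cancel = ℤ.*-cancelˡ-≡ (norm g ^ n) (norm κ) (+ 1) {{nz}} (trans h″ (sym (ℤ.*-identityʳ (norm g ^ n))))

-- Powers modulo an integer and 2-adically

module Powers (D : ℤ) where

  open import Data.Nat.Induction using (<-rec)
  open import Data.Integer using (+_; _+_; _*_; -_; _-_; _^_)
  open import Data.Integer.Tactic.RingSolver using (solve-∀)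
  open Binomials using (halve)
  open Arith
  open QuadraticRing D
  open PowerSeries D using (ι-suc)
  open Divisibility D

  ⊛-+ : ∀ x m n → x ⊛ (m ℕ.+ n) ≡ x ⊛ m ⊗ x ⊛ n
  ⊛-+ x zero n = sym (⊗-identityˡ (x ⊛ n))
  ⊛-+ x (suc m) n = trans (cong (x ⊗_) (⊛-+ x m n)) (sym (⊗-assoc x (x ⊛ m) (x ⊛ n)))

  ⊛-* : ∀ x m n → x ⊛ (n ℕ.* m) ≡ (x ⊛ m) ⊛ n
  ⊛-* x m zero = refl
  ⊛-* x m (suc n) = trans (⊛-+ x m (n ℕ.* m)) (cong (x ⊛ m ⊗_) (⊛-* x m n))

  ⊛-⊗ : ∀ x y n → (x ⊗ y) ⊛ n ≡ x ⊛ n ⊗ y ⊛ n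
  ⊛-⊗ x y zero = sym (⊗-identityˡ (ι (+ 1)))
  ⊛-⊗ x y (suc n) = trans (cong (x ⊗ y ⊗_) (⊛-⊗ x y n))
    (solve 4 (λ x y p q → x :* y :* (p :* q) := x :* p :* (y :* q)) refl x y (x ⊛ n) (y ⊛ n))

  ι-⊛ : ∀ k n → ι k ⊛ n ≡ ι (k ^ n)
  ι-⊛ k zero = refl
  ι-⊛ k (suc n) = trans (cong (ι k ⊗_) (ι-⊛ k n)) (sym (ι-⊗ k (k ^ n)))

  ⊛-congruence : ∀ N x y n → ∃ λ t → (x ⊕ N ⊗ y) ⊛ n ≡ x ⊛ n ⊕ N ⊗ t
  ⊛-congruence N x y zero = ι (+ 0) , solve 1 (λ N → con (+ 1) := con (+ 1) :+ N :* con (+ 0)) refl N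
  ⊛-congruence N x y (suc n) with ⊛-congruence N x y n
  ... | t , e = x ⊗ t ⊕ y ⊗ x ⊛ n ⊕ y ⊗ N ⊗ t , trans (cong ((x ⊕ N ⊗ y) ⊗_) e)
    (solve 5 (λ N x y p t → (x :+ N :* y) :* (p :+ N :* t) := x :* p :+ N :* (x :* t :+ y :* p :+ y :* N :* t)) refl N x y (x ⊛ n) t)

  2-part : ∀ n → 1 ℕ.≤ n → ∃₂ λ s l → n ≡ 2 ℕ.^ s ℕ.* (1 ℕ.+ 2 ℕ.* l)
  2-part = <-rec (λ n → 1 ℕ.≤ n → ∃₂ λ s l → n ≡ 2 ℕ.^ s ℕ.* (1 ℕ.+ 2 ℕ.* l)) step
    where
    step : ∀ n → (∀ {i} → i ℕ.< n → 1 ℕ.≤ i → ∃₂ λ s l → i ≡ 2 ℕ.^ s ℕ.* (1 ℕ.+ 2 ℕ.* l)) → 1 ℕ.≤ n → ∃₂ λ s l → n ≡ 2 ℕ.^ s ℕ.* (1 ℕ.+ 2 ℕ.* l)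
    step n ih 1≤n with halve n
    ... | l , inj₂ refl = 0 , l , sym (ℕ.*-identityˡ (1 ℕ.+ 2 ℕ.* l))
    ... | zero , inj₁ refl = contradiction 1≤n λ ()
    ... | suc j , inj₁ refl with ih (s≤s (ℕ.≤-trans (ℕ.≤-reflexive (sym (ℕ.+-identityʳ (suc j)))) (ℕ.m≤n+m (suc j ℕ.+ 0) j))) (s≤s z≤n)
    ... | s , l , e = suc s , l , trans (cong (2 ℕ.*_) e) (sym (ℕ.*-assoc 2 (2 ℕ.^ s) (1 ℕ.+ 2 ℕ.* l)))

  -- The 2-adic expansion of a power, to second order in z.
  private
    odd-power : ∀ z o → ∃ λ t → (ι (+ 1) ⊕ ι (+ 4) ⊗ z) ⊛ o ≡ ι (+ 1) ⊕ ι (+ 4) ⊗ (ι (+ o) ⊗ z ⊕ ι (+ 2) ⊗ (z ⊗ z) ⊗ t)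
    odd-power z zero = ι (+ 0) , solve 1 (λ z → con (+ 1) := con (+ 1) :+ con (+ 4) :* (con (+ 0) :* z :+ con (+ 2) :* (z :* z) :* con (+ 0))) refl z
    odd-power z (suc o) with odd-power z o
    ... | t , e = ι (+ 2) ⊗ ι (+ o) ⊕ t ⊕ ι (+ 4) ⊗ z ⊗ t , trans (cong ((ι (+ 1) ⊕ ι (+ 4) ⊗ z) ⊗_) e)
      (trans (solve 3 (λ z o t → (con (+ 1) :+ con (+ 4) :* z) :* (con (+ 1) :+ con (+ 4) :* (o :* z :+ con (+ 2) :* (z :* z) :* t))
          := con (+ 1) :+ con (+ 4) :* ((con (+ 1) :+ o) :* z :+ con (+ 2) :* (z :* z) :* (con (+ 2) :* o :+ t :+ con (+ 4) :* z :* t))) refl z (ι (+ o)) t)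
        (cong (λ x → ι (+ 1) ⊕ ι (+ 4) ⊗ (x ⊗ z ⊕ ι (+ 2) ⊗ (z ⊗ z) ⊗ (ι (+ 2) ⊗ ι (+ o) ⊕ t ⊕ ι (+ 4) ⊗ z ⊗ t))) (sym (ι-suc o))))

    double : ∀ z o t s → (ι (+ 1) ⊕ ι (+ 4) ⊗ z) ⊛ o ≡ ι (+ 1) ⊕ ι (+ 4) ⊗ (ι (+ o) ⊗ z ⊕ ι (+ 2) ⊗ (z ⊗ z) ⊗ t) →
      ∃ λ t → (ι (+ 1) ⊕ ι (+ 4) ⊗ z) ⊛ (2 ℕ.^ s ℕ.* o) ≡ ι (+ 1) ⊕ ι (+ 4 * (+ 2) ^ s) ⊗ (ι (+ o) ⊗ z ⊕ ι (+ 2) ⊗ (z ⊗ z) ⊗ t)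
    double z o t zero e = t , trans (cong ((ι (+ 1) ⊕ ι (+ 4) ⊗ z) ⊛_) (ℕ.*-identityˡ o)) e
    double z o t (suc s) e with double z o t s e
    ... | t′ , e′ = t″ , trans (cong ((ι (+ 1) ⊕ ι (+ 4) ⊗ z) ⊛_) (ℕ.*-assoc 2 (2 ℕ.^ s) o))
      (trans (⊛-* (ι (+ 1) ⊕ ι (+ 4) ⊗ z) (2 ℕ.^ s ℕ.* o) 2) (trans (cong (λ x → x ⊗ (x ⊗ ι (+ 1))) (trans e′ (cong (λ x → ι (+ 1) ⊕ x ⊗ (ι (+ o) ⊗ z ⊕ ι (+ 2) ⊗ (z ⊗ z) ⊗ t′)) (ι-⊗ (+ 4) ((+ 2) ^ s)))))
        (trans (solve 4 (λ z o t p → let Z = con (+ 1) :+ con (+ 4) :* p :* (o :* z :+ con (+ 2) :* (z :* z) :* t) in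
          Z :* (Z :* con (+ 1))
          := con (+ 1) :+ con (+ 4) :* (con (+ 2) :* p) :* (o :* z :+ con (+ 2) :* (z :* z) :*
            (t :+ p :* ((o :+ con (+ 2) :* z :* t) :* (o :+ con (+ 2) :* z :* t))))) refl z (ι (+ o)) t′ (ι ((+ 2) ^ s)))
          (cong (λ x → ι (+ 1) ⊕ x ⊗ (ι (+ o) ⊗ z ⊕ ι (+ 2) ⊗ (z ⊗ z) ⊗ t″)) (sym (trans (ι-⊗ (+ 4) ((+ 2) ^ suc s)) (cong (ι (+ 4) ⊗_) (ι-⊗ (+ 2) ((+ 2) ^ s)))))))))
      where
      o′ = ι (+ o) ⊕ ι (+ 2) ⊗ z ⊗ t′
      t″ = t′ ⊕ ι ((+ 2) ^ s) ⊗ (o′ ⊗ o′)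

  -- Write n = 2^s o with o odd. The power o produces the linear term o z, and each squaring doubles
  -- the correction while its square disappears into t. The explicit factor z² in the remainder
  -- matters when z is a multiple of an unknown integer that is to be divided out.
  2-adic : ∀ z n → 1 ℕ.≤ n → ∃₂ λ s l → ∃ λ t →
    (ι (+ 1) ⊕ ι (+ 4) ⊗ z) ⊛ n ≡ ι (+ 1) ⊕ ι (+ 4 * (+ 2) ^ s) ⊗ (ι (+ (1 ℕ.+ 2 ℕ.* l)) ⊗ z ⊕ ι (+ 2) ⊗ (z ⊗ z) ⊗ t)
  2-adic z n 1≤n = proj₁ p , proj₁ (proj₂ p) , proj₁ d , trans (cong ((ι (+ 1) ⊕ ι (+ 4) ⊗ z) ⊛_) (proj₂ (proj₂ p))) (proj₂ d)
    where
    p = 2-part n 1≤n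
    o = odd-power z (1 ℕ.+ 2 ℕ.* proj₁ (proj₂ p))
    d = double z (1 ℕ.+ 2 ℕ.* proj₁ (proj₂ p)) (proj₁ o) (proj₁ p) (proj₂ o)

  -- With P = p h, the quantity Re γᵐ + p h Im γᵐ of the factorisation. It is ℤ-linear but not
  -- multiplicative, so powers have to be expanded before it is applied.
  module Functional (P : ℤ) where
    opaque
      φ : Z√ → ℤ
      φ z = re z + P * im z
      φ≡ : ∀ z → φ z ≡ re z + P * im z
      φ≡ z = refl

    φ-⊕ : ∀ x y → φ (x ⊕ y) ≡ φ x + φ y
    φ-⊕ x y rewrite φ≡ (x ⊕ y) | φ≡ x | φ≡ y | re-⊕ x y | im-⊕ x y = eq P (re x) (re y) (im x) (im y)
      where
      eq : ∀ P a b c d → a + b + P * (c + d) ≡ a + P * c + (b + P * d)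
      eq = solve-∀

    φ-ι⊗ : ∀ k x → φ (ι k ⊗ x) ≡ k * φ x
    φ-ι⊗ k x rewrite φ≡ (ι k ⊗ x) | φ≡ x | re-⊗ (ι k) x | im-⊗ (ι k) x = eq D P k (re x) (im x)
      where
      eq : ∀ D P k a b → k * a - D * (+ 0 * b) + P * (k * b + + 0 * a) ≡ k * (a + P * b)
      eq = solve-∀

    φ-ι : ∀ k → φ (ι k) ≡ k
    φ-ι k rewrite φ≡ (ι k) = eq k P
      where
      eq : ∀ k P → k + P * + 0 ≡ k
      eq = solve-∀

    -- A sign equal to 1 + 4 · 2^s N forces N = 0. The conclusion is a parity obstruction whenever
    -- `φ z` is odd.
    φ-2-adic : ∀ z n → 1 ℕ.≤ n → IsSign (φ ((ι (+ 1) ⊕ ι (+ 4) ⊗ z) ⊛ n)) →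
      ∃₂ λ l t → + (1 ℕ.+ 2 ℕ.* l) * φ z + + 2 * φ (z ⊗ z ⊗ t) ≡ + 0
    φ-2-adic z n 1≤n hyp = conclude (2-adic z n 1≤n)
      where
      expand : ∀ s o t → φ (ι (+ 1) ⊕ ι (+ 4 * (+ 2) ^ s) ⊗ (ι o ⊗ z ⊕ ι (+ 2) ⊗ (z ⊗ z) ⊗ t)) ≡ + 1 + + 4 * (+ 2) ^ s * (o * φ z + + 2 * φ (z ⊗ z ⊗ t))
      expand s o t = begin
        φ (ι (+ 1) ⊕ ι q ⊗ (ι o ⊗ z ⊕ ι (+ 2) ⊗ (z ⊗ z) ⊗ t)) ≡⟨ φ-⊕ (ι (+ 1)) (ι q ⊗ (ι o ⊗ z ⊕ ι (+ 2) ⊗ (z ⊗ z) ⊗ t)) ⟩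
        φ (ι (+ 1)) + φ (ι q ⊗ (ι o ⊗ z ⊕ ι (+ 2) ⊗ (z ⊗ z) ⊗ t))
          ≡⟨ cong₂ _+_ (φ-ι (+ 1)) (φ-ι⊗ q (ι o ⊗ z ⊕ ι (+ 2) ⊗ (z ⊗ z) ⊗ t)) ⟩
        + 1 + q * φ (ι o ⊗ z ⊕ ι (+ 2) ⊗ (z ⊗ z) ⊗ t)
          ≡⟨ cong (λ x → + 1 + q * x) (trans (φ-⊕ (ι o ⊗ z) (ι (+ 2) ⊗ (z ⊗ z) ⊗ t))
            (cong₂ _+_ (φ-ι⊗ o z) (trans (cong φ (⊗-assoc (ι (+ 2)) (z ⊗ z) t)) (φ-ι⊗ (+ 2) (z ⊗ z ⊗ t))))) ⟩
        + 1 + q * (o * φ z + + 2 * φ (z ⊗ z ⊗ t)) ∎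
        where
        open ≡-Reasoning
        q = + 4 * (+ 2) ^ s
      conclude : (∃₂ λ s l → ∃ λ t → (ι (+ 1) ⊕ ι (+ 4) ⊗ z) ⊛ n ≡ ι (+ 1) ⊕ ι (+ 4 * (+ 2) ^ s) ⊗ (ι (+ (1 ℕ.+ 2 ℕ.* l)) ⊗ z ⊕ ι (+ 2) ⊗ (z ⊗ z) ⊗ t)) →
        ∃₂ λ l t → + (1 ℕ.+ 2 ℕ.* l) * φ z + + 2 * φ (z ⊗ z ⊗ t) ≡ + 0
      conclude (s , l , t , e) = l , t , 1+4·2^s s _ (subst IsSign (trans (cong φ e) (expand s (+ (1 ℕ.+ 2 ℕ.* l)) t)) hyp)

-- Powers of γ in ℤ[√-6], for 3X² + 2 = yⁿ

module Functional6 where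

  open import Data.Integer using (+_; _+_; _*_; -_; _-_; _^_)
  open import Data.Integer.Tactic.RingSolver using (solve-∀)
  open Arith
  open SmallValues
  open Binomials using (halve)
  open QuadraticRing (+ 6)
  open Divisibility (+ 6)
  open Powers (+ 6)

  module _ (h k : ℤ) (h² : h * h ≡ + 1 + + 8 * k) where
    open Functional (+ 3 * h)

    η : Z√
    η = + 0 +√ h

    η² : η ⊗ η ≡ ⊝ (ι (+ 6) ⊗ (ι (+ 1) ⊕ ι (+ 8) ⊗ ι k))
    η² = trans (ext (trans (re-⊗ η η) (eq₁ (+ 6) h)) (trans (im-⊗ η η) (eq₂ h)))
      (trans (cong (λ x → ι (- (+ 6 * x))) h²) (trans (ι-⊝ (+ 6 * (+ 1 + + 8 * k))) (cong ⊝_ (trans (ι-⊗ (+ 6) (+ 1 + + 8 * k))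
        (cong (ι (+ 6) ⊗_) (trans (ι-⊕ (+ 1) (+ 8 * k)) (cong (ι (+ 1) ⊕_) (ι-⊗ (+ 8) k))))))))
      where
      eq₁ : ∀ D h → + 0 * + 0 - D * (h * h) ≡ - (D * (h * h))
      eq₁ = solve-∀
      eq₂ : ∀ h → + 0 * h + h * + 0 ≡ + 0
      eq₂ = solve-∀

    φη : φ η ≡ + 3 + + 24 * k
    φη = trans (φ≡ η) (trans (eq h) (trans (cong (+ 3 *_) h²) (eq′ k)))
      where
      eq : ∀ h → + 0 + + 3 * h * h ≡ + 3 * (h * h)
      eq = solve-∀
      eq′ : ∀ k → + 3 * (+ 1 + + 8 * k) ≡ + 3 + + 24 * k
      eq′ = solve-∀

    -- From y = 3h² + 2 and h² = 1 + 8k, the element (y - 4) + 2h√-6 is 1 + 24k + 2η = 1 + 2g, and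
    -- its square is 1 + 4z.
    g γ z : Z√
    g = ι (+ 12 * k) ⊕ η
    γ = ι (+ 1) ⊕ ι (+ 2) ⊗ g
    z = g ⊕ g ⊗ g

    -- Since 3 divides both 6 and the coefficient 3h, only real parts count modulo 3, and that of γ
    -- is 1. This fixes the sign.
    φ-mod3 : ∀ m → ∃ λ r → φ (γ ⊛ m) ≡ (+ 1) ^ m + + 3 * r
    φ-mod3 m = let (r , e) = go m in r + h * im (γ ⊛ m) , trans (φ≡ (γ ⊛ m)) (trans (cong (_+ + 3 * h * im (γ ⊛ m)) e) (eq ((+ 1) ^ m) r h (im (γ ⊛ m))))
      where
      eq : ∀ e r h y → e + + 3 * r + + 3 * h * y ≡ e + + 3 * (r + h * y)
      eq = solve-∀
      eq′ : ∀ e f E r I J → (e + + 3 * f) * (E + + 3 * r) - + 6 * (I * J) ≡ e * E + + 3 * (e * r + f * (E + + 3 * r) - + 2 * (I * J))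
      eq′ = solve-∀
      re-γ : re γ ≡ + 1 + + 3 * (+ 8 * k)
      re-γ = trans (re-⊕ (ι (+ 1)) (ι (+ 2) ⊗ g)) (trans (cong (λ x → + 1 + x) (trans (re-⊗ (ι (+ 2)) g)
        (trans (cong (λ x → + 2 * x - + 6 * (+ 0 * im g)) (re-⊕ (ι (+ 12 * k)) η)) (eq″ k (im g))))) refl)
        where
        eq″ : ∀ k y → + 2 * (+ 12 * k + + 0) - + 6 * (+ 0 * y) ≡ + 3 * (+ 8 * k)
        eq″ = solve-∀
      go : ∀ m → ∃ λ r → re (γ ⊛ m) ≡ (+ 1) ^ m + + 3 * r
      go zero = + 0 , refl
      go (suc m) with go m
      ... | r , e = + 1 * r + (+ 8 * k) * ((+ 1) ^ m + + 3 * r) - + 2 * (im γ * im (γ ⊛ m)) ,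
        trans (re-⊗ γ (γ ⊛ m)) (trans (cong₂ (λ x y → x * y - + 6 * (im γ * im (γ ⊛ m))) re-γ e) (eq′ (+ 1) (+ 8 * k) ((+ 1) ^ m) r (im γ) (im (γ ⊛ m))))

    φg : φ g ≡ + 36 * k + + 3
    φg = trans (φ-⊕ (ι (+ 12 * k)) η) (trans (cong₂ _+_ (φ-ι (+ 12 * k)) φη) (eq k))
      where
      eq : ∀ k → + 12 * k + (+ 3 + + 24 * k) ≡ + 36 * k + + 3
      eq = solve-∀

    φγ : φ γ ≡ + 7 + + 72 * k
    φγ = trans (φ-⊕ (ι (+ 1)) (ι (+ 2) ⊗ g)) (trans (cong₂ _+_ (φ-ι (+ 1)) (trans (φ-ι⊗ (+ 2) g) (cong (+ 2 *_) φg))) (eq k))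
      where
      eq : ∀ k → + 1 + + 2 * (+ 36 * k + + 3) ≡ + 7 + + 72 * k
      eq = solve-∀

    φz : φ z ≡ + 1 + + 2 * (+ 360 * (k * k) + + 30 * k - + 2)
    φz = trans (φ-⊕ g (g ⊗ g)) (trans (cong₂ _+_ φg φgg) (eq k))
      where
      eq : ∀ k → + 36 * k + + 3 + (+ 12 * k * (+ 12 * k) + (+ 24 * k * (+ 3 + + 24 * k) + - (+ 6 * (+ 1 + + 8 * k))))
        ≡ + 1 + + 2 * (+ 360 * (k * k) + + 30 * k - + 2)
      eq = solve-∀
      gg : g ⊗ g ≡ ι (+ 12 * k * (+ 12 * k)) ⊕ (ι (+ 24 * k) ⊗ η ⊕ ι (- (+ 6 * (+ 1 + + 8 * k))))
      gg = trans (cong (λ x → (x ⊕ η) ⊗ (x ⊕ η)) (ι-⊗ (+ 12) k))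
        (trans (solve 2 (λ K η → (con (+ 12) :* K :+ η) :* (con (+ 12) :* K :+ η) := con (+ 12) :* K :* (con (+ 12) :* K) :+ (con (+ 24) :* K :* η :+ η :* η)) refl (ι k) η)
        (cong₂ _⊕_ (sym (trans (ι-⊗ (+ 12 * k) (+ 12 * k)) (cong₂ _⊗_ (ι-⊗ (+ 12) k) (ι-⊗ (+ 12) k))))
          (cong₂ _⊕_ (cong (_⊗ η) (sym (ι-⊗ (+ 24) k))) (trans η² (sym (trans (ι-⊝ (+ 6 * (+ 1 + + 8 * k))) (cong ⊝_ (trans (ι-⊗ (+ 6) (+ 1 + + 8 * k)) (cong (ι (+ 6) ⊗_) (trans (ι-⊕ (+ 1) (+ 8 * k)) (cong (ι (+ 1) ⊕_) (ι-⊗ (+ 8) k))))))))))))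
      φgg : φ (g ⊗ g) ≡ + 12 * k * (+ 12 * k) + (+ 24 * k * (+ 3 + + 24 * k) + - (+ 6 * (+ 1 + + 8 * k)))
      φgg = trans (cong φ gg) (trans (φ-⊕ _ _) (cong₂ _+_ (φ-ι (+ 12 * k * (+ 12 * k))) (trans (φ-⊕ _ _) (cong₂ _+_ (trans (φ-ι⊗ (+ 24 * k) η) (cong (+ 24 * k *_) φη)) (φ-ι (- (+ 6 * (+ 1 + + 8 * k))))))))

    γ-even : ∀ M → γ ⊛ (M ℕ.* 2) ≡ (ι (+ 1) ⊕ ι (+ 4) ⊗ z) ⊛ M
    γ-even M = trans (⊛-* γ 2 M) (cong (_⊛ M) (solve 1 (λ g → (con (+ 1) :+ con (+ 2) :* g) :* ((con (+ 1) :+ con (+ 2) :* g) :* con (+ 1)) := con (+ 1) :+ con (+ 4) :* (g :+ g :* g)) refl g))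

    φ≡1 : ∀ m → IsSign (φ (γ ⊛ m)) → φ (γ ⊛ m) ≡ + 1
    φ≡1 m (inj₁ e) = e
    φ≡1 m (inj₂ e) = ⊥-elim (no-multiple 3 2 (- r) (s≤s (s≤s (s≤s z≤n))) (trans (eq r) (trans (cong (λ x → + 1 - (x + + 3 * r)) (sym (ℤ.^-zeroˡ m))) (cong (λ x → + 1 - x) (trans (sym (proj₂ (φ-mod3 m))) e)))))
      where
      r = proj₁ (φ-mod3 m)
      eq : ∀ r → + 3 * - r ≡ + 1 - (+ 1 + + 3 * r)
      eq = solve-∀

    -- γ² ≡ 1 modulo 4, so the value is congruent to `φ γ` = 7 + 72k, that is, to 3 modulo 4.
    odd-case : ∀ M → φ (γ ⊛ (1 ℕ.+ M ℕ.* 2)) ≡ + 1 → ⊥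
    odd-case M hyp = no-multiple 4 2 (- φ (γ ⊗ t) - + 18 * k - + 1) (s≤s (s≤s (s≤s z≤n))) (trans (eq k (φ (γ ⊗ t))) (cong (λ x → + 3 - x) (trans (sym value) hyp)))
      where
      c = ⊛-congruence (ι (+ 4)) (ι (+ 1)) z M
      t = proj₁ c
      eq : ∀ k x → + 4 * (- x - + 18 * k - + 1) ≡ + 3 - (+ 7 + + 72 * k + + 4 * x)
      eq = solve-∀
      value : φ (γ ⊛ (1 ℕ.+ M ℕ.* 2)) ≡ + 7 + + 72 * k + + 4 * φ (γ ⊗ t)
      value = begin
        φ (γ ⊗ γ ⊛ (M ℕ.* 2)) ≡⟨ cong (λ y → φ (γ ⊗ y)) (trans (γ-even M) (trans (proj₂ c) (cong (_⊕ ι (+ 4) ⊗ t) (trans (ι-⊛ (+ 1) M) (cong ι (ℤ.^-zeroˡ M)))))) ⟩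
        φ (γ ⊗ (ι (+ 1) ⊕ ι (+ 4) ⊗ t)) ≡⟨ cong φ (solve 2 (λ γ t → γ :* (con (+ 1) :+ con (+ 4) :* t) := γ :+ con (+ 4) :* (γ :* t)) refl γ t) ⟩
        φ (γ ⊕ ι (+ 4) ⊗ (γ ⊗ t)) ≡⟨ trans (φ-⊕ γ (ι (+ 4) ⊗ (γ ⊗ t))) (cong₂ _+_ φγ (φ-ι⊗ (+ 4) (γ ⊗ t))) ⟩
        + 7 + + 72 * k + + 4 * φ (γ ⊗ t) ∎
        where open ≡-Reasoning

    -- `φ z` is odd, and so is its multiple by 1 + 2l, which cannot cancel an even number.
    even-case : ∀ M → 1 ℕ.≤ M → IsSign (φ (γ ⊛ (M ℕ.* 2))) → ⊥
    even-case M 1≤M hyp = conclude (φ-2-adic z M 1≤M (subst (λ x → IsSign (φ x)) (γ-even M) hyp))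
      where
      odd : ∀ l → + (1 ℕ.+ 2 ℕ.* l) ≡ + 1 + + 2 * + l
      odd l = cong (λ y → + 1 + y) (ℤ.pos-* 2 l)
      eq : ∀ l y x → + 2 * - (l + y + + 2 * l * y + x) ≡ + 1 - ((+ 1 + + 2 * l) * (+ 1 + + 2 * y) + + 2 * x)
      eq = solve-∀
      conclude : (∃₂ λ l t → + (1 ℕ.+ 2 ℕ.* l) * φ z + + 2 * φ (z ⊗ z ⊗ t) ≡ + 0) → ⊥
      conclude (l , t , e) = even≢odd (- (+ l + y + + 2 * + l * y + x)) (trans (eq (+ l) y x) (cong (λ x → + 1 - x) (trans (sym (cong₂ (λ a b → a * b + + 2 * x) (odd l) φz)) e)))
        where
        y = + 360 * (k * k) + + 30 * k - + 2
        x = φ (z ⊗ z ⊗ t)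

    no-power : ∀ m → 1 ℕ.≤ m → IsSign (φ (γ ⊛ m)) → ⊥
    no-power m 1≤m hyp with halve m
    ... | M , inj₂ refl = odd-case M (subst (λ n → φ (γ ⊛ (1 ℕ.+ n)) ≡ + 1) (ℕ.*-comm 2 M) (φ≡1 (1 ℕ.+ 2 ℕ.* M) hyp))
    ... | zero , inj₁ refl = contradiction 1≤m λ ()
    ... | suc M , inj₁ refl = even-case (suc M) (s≤s z≤n) (subst (λ n → IsSign (φ (γ ⊛ n))) (ℕ.*-comm 2 (suc M)) hyp)

-- From a value of the form to a factorisation in ℤ[√-pq]

module Representation (p q c e : ℤ) (ce : c ℤ.* e ≡ ℤ.+ 2) where
  open import Data.Integer using (+_; _*_)

  open import Data.Integer using (_+_; -_; _-_; _^_)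
  open import Data.Integer.Tactic.RingSolver using (solve-∀)
  open Arith
  open SmallValues
  open QuadraticRing (p * q)
  open Divisibility (p * q)

  -- Used with `via`: a hypothesis x = y enters a ring identity as an added multiple k (x - y), with
  -- k written out.
  zero-combination : ∀ {x y : ℤ} → x ≡ y → ∀ k → k * (x - y) ≡ + 0
  zero-combination {x} refl k = eq k x
    where
    eq : ∀ k x → k * (x - x) ≡ + 0
    eq = solve-∀

  via : ∀ {x y z : ℤ} → x ≡ y + z → z ≡ + 0 → x ≡ y
  via {y = y} h refl = trans h (ℤ.+-identityʳ y)

  -- Completing the square in the form p c y s² + 2 p X s b + Y b² of determinant p q.
  module Value (X y Y s b k : ℤ) (equation : p * (X * X) + q ≡ c * (y * Y)) (value : form (p * c * y) (p * X) Y s b ≡ k) where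
    a : ℤ
    a = X * b + c * (y * s)

    a-b : p * (a * a) + q * (b * b) ≡ c * (y * k)
    a-b = trans (via (eq p q c X y Y s b) (zero-combination equation (b * b))) (cong (λ k → c * (y * k)) value)
      where
      eq : ∀ p q c X y Y s b → p * ((X * b + c * (y * s)) * (X * b + c * (y * s))) + q * (b * b)
        ≡ c * (y * (p * c * y * (s * s) + + 2 * (p * X * (s * b)) + Y * (b * b))) + b * b * (p * (X * X) + q - c * (y * Y))
      eq = solve-∀

    -- No y is left. When Y is a square, this is the relation that decides by congruences which
    -- values k the form can take.
    eliminate : (p * (X * X) + q) * k ≡ (p * (a * a) + q * (b * b)) * Y
    eliminate = trans (cong (_* k) equation) (trans (eq c y Y k) (cong (_* Y) (sym a-b)))
      where
      eq : ∀ c y Y k → c * (y * Y) * k ≡ c * (y * k) * Y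
      eq = solve-∀

  module Factor (X y Y s b : ℤ) (equation : p * (X * X) + q ≡ c * (y * Y)) (value : form (p * c * y) (p * X) Y s b ≡ + 1)
    (k₀ l₀ : ℤ) (coprime : k₀ * (+ 2 * e * q) + l₀ * y ≡ + 1) where
    open Value X y Y s b (+ 1) equation value public

    -- γ is (a√p + b√-q)² / c, rewritten with p a² + q b² = c y and 2/c = e, so its norm is y². τ is
    -- the quotient of X√p + √-q by a√p + b√-q: `X≡` and `1≡` are the two coordinates of that
    -- product.
    γ τ : Z√
    γ = (y - e * q * (b * b)) +√ e * (a * b)
    τ = (Y * b + p * X * s) +√ s

    X≡ : a * re τ - q * b * im τ ≡ X
    X≡ = via (via (eq p q c X y Y s b) (zero-combination equation (- (b * s)))) (zero-combination value X)
      where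
      eq : ∀ p q c X y Y s b → (X * b + c * (y * s)) * (Y * b + p * X * s) - q * b * s
        ≡ X + X * (p * c * y * (s * s) + + 2 * (p * X * (s * b)) + Y * (b * b) - + 1) + - (b * s) * (p * (X * X) + q - c * (y * Y))
      eq = solve-∀

    1≡ : b * re τ + p * a * im τ ≡ + 1
    1≡ = trans (eq p c X y Y s b) value
      where
      eq : ∀ p c X y Y s b → b * (Y * b + p * X * s) + p * (X * b + c * (y * s)) * s ≡ p * c * y * (s * s) + + 2 * (p * X * (s * b)) + Y * (b * b)
      eq = solve-∀

    norm-τ : norm τ ≡ Y
    norm-τ = trans (norm≡ τ) (via (via (eq p q c X y Y s b) (zero-combination equation (p * (s * s)))) (zero-combination value Y))
      where
      eq : ∀ p q c X y Y s b → (Y * b + p * X * s) * (Y * b + p * X * s) + p * q * (s * s)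
        ≡ Y + Y * (p * c * y * (s * s) + + 2 * (p * X * (s * b)) + Y * (b * b) - + 1) + p * (s * s) * (p * (X * X) + q - c * (y * Y))
      eq = solve-∀

    norm-γ : norm γ ≡ y * y
    norm-γ = trans (norm≡ γ) (via (via (eq p q c e y a b) (zero-combination ce (e * q * (b * b) * y))) (zero-combination a-b (e * e * q * (b * b))))
      where
      eq : ∀ p q c e y a b → (y - e * q * (b * b)) * (y - e * q * (b * b)) + p * q * (e * (a * b) * (e * (a * b)))
        ≡ y * y + e * e * q * (b * b) * (p * (a * a) + q * (b * b) - c * (y * + 1)) + e * q * (b * b) * y * (c * e - + 2)
      eq = solve-∀

    re-γτ : re (γ ⊗ τ) ≡ y * (Y * b + p * X * s) - e * q * b
    re-γτ = trans (re-⊗ γ τ) (via (eq p q c e X y Y s b) (zero-combination value (- (e * q * b))))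
      where
      eq : ∀ p q c e X y Y s b → (y - e * q * (b * b)) * (Y * b + p * X * s) - p * q * (e * ((X * b + c * (y * s)) * b) * s)
        ≡ y * (Y * b + p * X * s) - e * q * b + - (e * q * b) * (p * c * y * (s * s) + + 2 * (p * X * (s * b)) + Y * (b * b) - + 1)
      eq = solve-∀

    private
      W β η K L : ℤ
      W = Y * b + p * X * s
      β = + 2 * p * X * s + Y * b
      η = p * c * (s * s)
      K = - (k₀ * β)
      L = + 2 * W * k₀ * β + + 2 * (e * q) * k₀ * η + l₀ * b * β + l₀ * y * η

      -- Modulo y the number 2 re(γτ) is -2eqb. Here b is invertible because the value 1 of the form
      -- reads bβ + yη = 1, and 2eq is invertible by hypothesis; the identity is the product of
      -- these two.
      linear : K * (+ 2 * (y * W - e * q * b)) + L * y ≡ + 1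
      linear = trans (eq k₀ l₀ (e * q) b W y β η) (trans (cong₂ _*_ (trans (cong (λ x → k₀ * x + l₀ * y) (eq₁ e q)) coprime) (trans (eq₂ p c X y Y s b) value)) refl)
        where
        eq : ∀ k₀ l₀ E b W y β η → - (k₀ * β) * (+ 2 * (y * W - E * b)) + (+ 2 * W * k₀ * β + + 2 * E * k₀ * η + l₀ * b * β + l₀ * y * η) * y
          ≡ (k₀ * (+ 2 * E) + l₀ * y) * (b * β + y * η)
        eq = solve-∀
        eq₁ : ∀ e q → + 2 * (e * q) ≡ + 2 * e * q
        eq₁ = solve-∀
        eq₂ : ∀ p c X y Y s b → b * (+ 2 * p * X * s + Y * b) + y * (p * c * (s * s)) ≡ p * c * y * (s * s) + + 2 * (p * X * (s * b)) + Y * (b * b)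
        eq₂ = solve-∀

    -- The square of `linear`, which trades y for y² = `norm γ`.
    unit : (K * K * (+ 2 * re (γ ⊗ τ)) + + 2 * K * L * y) * (+ 2 * re (γ ⊗ τ)) + L * L * norm γ ≡ + 1
    unit = trans (cong₂ (λ z N → (K * K * (+ 2 * z) + + 2 * K * L * y) * (+ 2 * z) + L * L * N) re-γτ norm-γ)
      (trans (eq K L y (y * W - e * q * b)) (cong (λ x → x * x) linear))
      where
      eq : ∀ K L y z → (K * K * (+ 2 * z) + + 2 * K * L * y) * (+ 2 * z) + L * L * (y * y) ≡ (K * (+ 2 * z) + L * y) * (K * (+ 2 * z) + L * y)
      eq = solve-∀

    power : ∀ m → ℤ.NonZero (norm γ ^ m) → Y ≡ norm γ ^ m → ∃ λ κ → τ ≡ γ ⊛ m ⊗ κ × norm κ ≡ + 1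
    power m nz Y≡ = power-up-to-unit γ τ (K * K * (+ 2 * re (γ ⊗ τ)) + + 2 * K * L * y) (L * L) unit m {{nz}} (trans norm-τ Y≡)

    -- im γ is a multiple of b, and this persists in powers. Inserted into `1≡` it makes b a divisor
    -- of 1.
    im-power : ∀ m → ∃ λ w → im (γ ⊛ m) ≡ b * w
    im-power zero = + 0 , sym (ℤ.*-zeroʳ b)
    im-power (suc m) with im-power m
    ... | w , h = re γ * w + e * a * re (γ ⊛ m) , trans (im-⊗ γ (γ ⊛ m)) (trans (cong (λ x → re γ * x + e * (a * b) * re (γ ⊛ m)) h) (eq (re γ) b w e a (re (γ ⊛ m))))
      where
      eq : ∀ r b w e a x → r * (b * w) + e * (a * b) * x ≡ b * (r * w + e * a * x)
      eq = solve-∀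

-- The factorisation when ±1 are the only units

module RealUnits (p q c e : ℤ) (ce : c ℤ.* e ≡ ℤ.+ 2) (D : ℕ) (D≡ : p ℤ.* q ≡ ℤ.+ D) (2≤D : 2 ℕ.≤ D) where
  open import Data.Integer using (+_; _*_)

  open import Data.Integer using (_+_; -_; _-_; _^_)
  open import Data.Integer.Tactic.RingSolver using (solve-∀)
  open Arith
  open SmallValues
  open Units
  open QuadraticRing (p * q)
  open Divisibility (p * q)
  open Representation p q c e ce

  -- γ depends on a and b only through b² and ab, so b² = 1 leaves the single parameter h = ab.
  reduce : ∀ y a b m → p * (a * a) + q * (b * b) ≡ c * (y * + 1) →
    b * b ≡ + 1 × IsSign (re (((y - e * q * (b * b)) +√ e * (a * b)) ⊛ m) + p * (a * b) * im (((y - e * q * (b * b)) +√ e * (a * b)) ⊛ m)) →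
    ∃ λ h → p * (h * h) + q ≡ c * y × IsSign (re (((y - e * q) +√ e * h) ⊛ m) + p * h * im (((y - e * q) +√ e * h) ⊛ m))
  reduce y a b m a-b (b² , sgn) = a * b ,
    trans (eq p a b q) (trans (cong (λ x → p * (a * a) * x + q) b²) (trans (eq′ (p * (a * a)) q) (trans (cong (λ x → p * (a * a) + q * x) (sym b²)) (trans a-b (cong (c *_) (ℤ.*-identityʳ y)))))) ,
    subst (λ x → IsSign (re (((y - x) +√ e * (a * b)) ⊛ m) + p * (a * b) * im (((y - x) +√ e * (a * b)) ⊛ m))) (trans (cong (e * q *_) b²) (ℤ.*-identityʳ (e * q))) sgn
    where
    eq : ∀ p a b q → p * (a * b * (a * b)) + q ≡ p * (a * a) * (b * b) + q
    eq = solve-∀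
    eq′ : ∀ x q → x * + 1 + q ≡ x + q * + 1
    eq′ = solve-∀

  module _ (X y Y s b : ℤ) (equation : p * (X * X) + q ≡ c * (y * Y)) (value : form (p * c * y) (p * X) Y s b ≡ + 1)
    (cop : Coprime (+ 2 * e * q) y) (m : ℕ) (nz : ℤ.NonZero ((y * y) ^ m)) (Y≡ : Y ≡ (y * y) ^ m) where
    open Factor X y Y s b equation value (proj₁ cop) (proj₁ (proj₂ cop)) (proj₂ (proj₂ cop))

    private
      γ^m = γ ⊛ m

      norm-unit : ∀ κ → norm κ ≡ + 1 → im κ ≡ + 0 × IsSign (re κ)
      norm-unit κ h with sum-of-squares D (re κ) (im κ) (ℕ.<⇒≤ 2≤D) (trans (cong (λ d → re κ * re κ + d * (im κ * im κ)) (sym D≡)) (trans (sym (norm≡ κ)) h))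
      ... | inj₁ r = r
      ... | inj₂ (_ , _ , D≡1) = contradiction 2≤D (ℕ.<⇒≱ (ℕ.≤-reflexive (cong suc D≡1)))

      -- With τ = γᵐκ and κ = ±1, `1≡` becomes κ (b re γᵐ + p a im γᵐ) = 1. Since b divides the
      -- second term too, b = ±1, and multiplying by b produces the functional with h = ab.
      conclude : (∃ λ κ → τ ≡ γ^m ⊗ κ × norm κ ≡ + 1) → (∃ λ w → im γ^m ≡ b * w) → b * b ≡ + 1 × IsSign (re γ^m + p * (a * b) * im γ^m)
      conclude (κ , τ≡ , nκ) (w , im≡) = b² , subst IsSign value₂ (sign-* b-sign (subst IsSign (sym bbv) v-sign))
        where
        κ₁ = re κ
        v = b * re γ^m + p * a * im γ^m
        im0 = proj₁ (norm-unit κ nκ)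
        re-τ : re τ ≡ κ₁ * re γ^m
        re-τ = trans (cong re τ≡) (trans (re-⊗ γ^m κ) (trans (cong (λ x → re γ^m * κ₁ - p * q * (im γ^m * x)) im0) (eq (re γ^m) κ₁ (p * q) (im γ^m))))
          where
          eq : ∀ r k D i → r * k - D * (i * + 0) ≡ k * r
          eq = solve-∀
        im-τ : im τ ≡ κ₁ * im γ^m
        im-τ = trans (cong im τ≡) (trans (im-⊗ γ^m κ) (trans (cong (λ x → re γ^m * x + im γ^m * κ₁) im0) (eq (re γ^m) κ₁ (im γ^m))))
          where
          eq : ∀ r k i → r * + 0 + i * k ≡ k * i
          eq = solve-∀
        κv : κ₁ * v ≡ + 1
        κv = trans (eq κ₁ b (re γ^m) (p * a) (im γ^m)) (trans (sym (cong₂ (λ x y → b * x + p * a * y) re-τ im-τ)) 1≡)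
          where
          eq : ∀ k b r P i → k * (b * r + P * i) ≡ b * (k * r) + P * (k * i)
          eq = solve-∀
        v-sign : IsSign v
        v-sign = unit-sign v κ₁ (trans (ℤ.*-comm v κ₁) κv)
        b-sign : IsSign b
        b-sign = unit-sign b (κ₁ * (re γ^m + p * a * w)) (trans (eq κ₁ b (re γ^m) (p * a) w) (trans (cong (λ x → κ₁ * (b * re γ^m + p * a * x)) (sym im≡)) κv))
          where
          eq : ∀ k b r P w → b * (k * (r + P * w)) ≡ k * (b * r + P * (b * w))
          eq = solve-∀
        b² : b * b ≡ + 1
        b² = sign-square b-sign
        bbv : b * (b * v) ≡ v
        bbv = trans (sym (ℤ.*-assoc b b v)) (trans (cong (_* v) b²) (ℤ.*-identityˡ v))
        value₂ : b * v ≡ re γ^m + p * (a * b) * im γ^m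
        value₂ = trans (eq b (re γ^m) p a (im γ^m)) (trans (cong (λ x → x * re γ^m + p * (a * b) * im γ^m) b²) (cong (_+ p * (a * b) * im γ^m) (ℤ.*-identityˡ (re γ^m))))
          where
          eq : ∀ b r p a i → b * (b * r + p * a * i) ≡ b * b * r + p * (a * b) * i
          eq = solve-∀

    reduced : ∃ λ h → p * (h * h) + q ≡ c * y × IsSign (re (((y - e * q) +√ e * h) ⊛ m) + p * h * im (((y - e * q) +√ e * h) ⊛ m))
    reduced = reduce y a b m a-b (conclude (power m (subst (λ x → ℤ.NonZero (x ^ m)) (sym norm-γ) nz) (trans Y≡ (cong (_^ m) (sym norm-γ)))) (im-power m))

-- No solutions for d = 3

module Equation6 where

  open import Data.Integer using (+_; _+_; _*_; -_; _-_; _^_)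
  open import Data.Integer.Tactic.RingSolver using (solve-∀)
  open import Data.Fin using (zero; suc)
  open import Data.Vec using (_∷_; [])
  open Arith
  open SmallValues
  open Congruences
  open Units
  open QuadraticRing (+ 6) hiding (_:+_; _:*_)
  open Divisibility (+ 6)
  open Powers (+ 6)
  module R = RealUnits (+ 3) (+ 2) (+ 1) (+ 2) refl 6 refl (s≤s (s≤s z≤n))
  module Rep6 = Representation (+ 3) (+ 2) (+ 1) (+ 2) refl

  private
    x₀ x₁ x₂ : ∀ {n} → Expr (suc (suc (suc n)))
    x₀ = var zero
    x₁ = var (suc zero)
    x₂ = var (suc (suc zero))

  module _ (X y : ℤ) (k m : ℕ) (y≡ : y ≡ + suc k) (equation : + 3 * (X * X) + + 2 ≡ + 1 * (y * (y * y) ^ suc m)) where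
    private
      Y z : ℤ
      Y = (y * y) ^ suc m
      z = y ^ suc m

      y-odd : ∃ λ t → y ≡ + 1 + + 2 * t
      y-odd = half (implies 4 (# 3 :* (x₀ :* x₀) :+ # 2 :+ # 3 :* (x₁ :* (x₁ :* x₁) :* x₂)) (# 2 :* (x₁ :+ # 1)) _ (X ∷ y ∷ (y * y) ^ m ∷ [])
          (y * (y * y) * (y * y) ^ m , trans (cong (_+ + 3 * (y * (y * y) * (y * y) ^ m)) equation) (eq y ((y * y) ^ m))))
        where
        eq : ∀ y p → + 1 * (y * (y * y * p)) + + 3 * (y * (y * y) * p) ≡ + 4 * (y * (y * y) * p)
        eq = solve-∀
        half : 4 ∣ᶻ + 2 * (y + + 1) → ∃ λ t → y ≡ + 1 + + 2 * t
        half (u , h) = odd⇒ (u , ℤ.*-cancelˡ-≡ (+ 2) (y + + 1) (+ 2 * u) (trans h (eq′ u)))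
          where
          eq′ : ∀ u → + 4 * u ≡ + 2 * (+ 2 * u)
          eq′ = solve-∀

      A≡ : + (3 ℕ.* suc k) ≡ + 3 * y
      A≡ = trans (ℤ.pos-* 3 (suc k)) (cong (+ 3 *_) (sym y≡))
      A≡′ : + (3 ℕ.* suc k) ≡ + 3 * + 1 * y
      A≡′ = A≡

      det : + (3 ℕ.* suc k) * Y - + 3 * X * (+ 3 * X) ≡ + 6
      det = trans (cong (λ a → a * Y - + 3 * X * (+ 3 * X)) A≡) (trans (eq y Y X) (trans (cong (λ x → + 3 * x - + 3 * X * (+ 3 * X)) (sym equation)) (eq′ X)))
        where
        eq : ∀ y Y X → + 3 * y * Y - + 3 * X * (+ 3 * X) ≡ + 3 * (+ 1 * (y * Y)) - + 3 * X * (+ 3 * X)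
        eq = solve-∀
        eq′ : ∀ X → + 3 * (+ 3 * (X * X) + + 2) - + 3 * X * (+ 3 * X) ≡ + 6
        eq′ = solve-∀

      -- `eliminate` gives 2(3X² + 2) = (3a² + 2b²) z², which modulo 3 makes 2 the square of bz. As
      -- 3k² ≤ 24 leaves k ≤ 2, only 1 remains.
      not-two : ∀ s b → form (+ 3 * + 1 * y) (+ 3 * X) Y s b ≡ + 2 → ⊥
      not-two s b value = never 3 ((# 3 :* (x₀ :* x₀) :+ # 2) :* # 2 :+ # 2 :* ((# 3 :* (x₁ :* x₁) :+ # 2 :* (x₂ :* x₂)) :* (x₃ :* x₃))) _ (X ∷ V.a ∷ b ∷ z ∷ [])
          (w , trans (cong (_+ + 2 * w′) (trans V.eliminate (cong ((+ 3 * (V.a * V.a) + + 2 * (b * b)) *_) (pow-square y (suc m))))) (eq w′))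
        where
        x₃ : Expr 4
        x₃ = var (suc (suc (suc zero)))
        module V = Rep6.Value X y Y s b (+ 2) equation value
        w′ = (+ 3 * (V.a * V.a) + + 2 * (b * b)) * (z * z)
        w = w′
        eq : ∀ w → w + + 2 * w ≡ + 3 * w
        eq = solve-∀

      represents-one : SmallValue 6 (+ (3 ℕ.* suc k)) (+ 3 * X) Y → ∃₂ λ s b → form (+ 3 * + 1 * y) (+ 3 * X) Y s b ≡ + 1
      represents-one (small s v g h 1 prim val pos bnd) = s , v , trans (cong (λ A → form A (+ 3 * X) Y s v) (sym A≡′)) val
      represents-one (small s v g h 2 prim val pos bnd) = ⊥-elim (not-two s v (trans (cong (λ A → form A (+ 3 * X) Y s v) (sym A≡′)) val))
      represents-one (small s v g h (suc (suc (suc k))) prim val pos bnd) =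
        contradiction (ℕ.≤-trans (ℕ.*-monoʳ-≤ 3 (ℕ.*-mono-≤ (ℕ.m≤m+n 3 k) (ℕ.m≤m+n 3 k))) bnd) (ℕ.<⇒≱ {24} {27} (ℕ.≤ᵇ⇒≤ 25 27 _))

      module _ (h : ℤ) (e : + 3 * (h * h) + + 2 ≡ + 1 * y)
        (sgn : IsSign (re (((y - + 2 * + 2) +√ + 2 * h) ⊛ suc m) + + 3 * h * im (((y - + 2 * + 2) +√ + 2 * h) ⊛ suc m))) where
        open Functional (+ 3 * h) using (φ; φ≡)

        G : Z√
        G = (y - + 2 * + 2) +√ + 2 * h

        h-odd : ∃ λ t → h ≡ + 1 + + 2 * t
        h-odd = odd⇒ (implies 2 (# 3 :* (var {1} zero :* var zero) :+ # 1) (var zero :+ # 1) _ (h ∷ []) (proj₁ y-odd , trans (eq (h * h)) (trans (cong (_- + 1) (trans e (trans (ℤ.*-identityˡ y) (proj₂ y-odd)))) (eq′ (proj₁ y-odd)))))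
          where
          eq : ∀ x → + 3 * x + + 1 ≡ + 3 * x + + 2 - + 1
          eq = solve-∀
          eq′ : ∀ t → + 1 + + 2 * t - + 1 ≡ + 2 * t
          eq′ = solve-∀

        finish′ : (∃ λ j → h * h ≡ + 1 + + 8 * j) → ⊥
        finish′ (j , h²) = Functional6.no-power h j h² (suc m) (s≤s z≤n) (subst IsSign (trans (sym (φ≡ (G ⊛ suc m))) (cong (λ x → φ (x ⊛ suc m)) G≡)) sgn)
          where
          g = ι (+ 12 * j) ⊕ (+ 0 +√ h)
          G≡ : G ≡ ι (+ 1) ⊕ ι (+ 2) ⊗ g
          G≡ = ext (sym (trans (re-⊕ (ι (+ 1)) (ι (+ 2) ⊗ g)) (trans (cong (λ x → + 1 + x) (re-⊗ (ι (+ 2)) g)) (trans (cong (λ x → + 1 + (+ 2 * x - + 6 * (+ 0 * im g))) (re-⊕ (ι (+ 12 * j)) (+ 0 +√ h)))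
                (trans (eq j (im g)) (trans (cong (λ x → + 3 * x + + 2 - + 4) (sym h²)) (cong (_- + 4) (trans e (ℤ.*-identityˡ y)))))))))
              (sym (trans (im-⊕ (ι (+ 1)) (ι (+ 2) ⊗ g)) (trans (cong (λ x → + 0 + x) (im-⊗ (ι (+ 2)) g)) (trans (cong (λ x → + 0 + (+ 2 * x + + 0 * re g)) (im-⊕ (ι (+ 12 * j)) (+ 0 +√ h))) (eq′ h (re g))))))
            where
            eq : ∀ j i → + 1 + (+ 2 * (+ 12 * j + + 0) - + 6 * (+ 0 * i)) ≡ + 3 * (+ 1 + + 8 * j) + + 2 - + 4
            eq = solve-∀
            eq′ : ∀ h r → + 0 + (+ 2 * (+ 0 + h) + + 0 * r) ≡ + 2 * h
            eq′ = solve-∀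

        finish : ⊥
        finish = finish′ (odd-square′ h-odd)

    no-solution-6 : ⊥
    no-solution-6 = go (represents-one (smallValue 6 (3 ℕ.* suc k) (s≤s z≤n) (+ 3 * X) Y det))
      where
      go : (∃₂ λ s b → form (+ 3 * + 1 * y) (+ 3 * X) Y s b ≡ + 1) → ⊥
      go (s , b , value) = go′ (R.reduced X y Y s b equation value (coprime-8 (odd-square′ y-odd)) (suc m) (subst (λ x → ℤ.NonZero ((x * x) ^ suc m)) (sym y≡) (nonZero-^ k (suc m))) refl)
        where
        go′ : (∃ λ h → + 3 * (h * h) + + 2 ≡ + 1 * y × IsSign (re (((y - + 2 * + 2) +√ + 2 * h) ⊛ suc m) + + 3 * h * im (((y - + 2 * + 2) +√ + 2 * h) ⊛ suc m))) → ⊥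
        go′ (h , e , sgn) = finish h e sgn

-- Powers of γ in ℤ[√-105], for 3X² + 35 = 2yⁿ

module Functional105 where

  open import Data.Integer using (+_; -[1+_]; _+_; _*_; -_; _-_; _^_)
  open import Data.Integer.DivMod using (_%ℕ_; _/ℕ_; a≡a%ℕn+[a/ℕn]*n; n%ℕd<d)
  open import Data.Integer.Tactic.RingSolver using (solve-∀)
  open Arith
  open SmallValues
  open Binomials using (halve)
  open QuadraticRing (+ 105)
  open Divisibility (+ 105)
  open Powers (+ 105)

  -1^even : ∀ M → -[1+ 0 ] ^ (M ℕ.* 2) ≡ + 1
  -1^even zero = refl
  -1^even (suc M) = cong (λ x → -[1+ 0 ] * (-[1+ 0 ] * x)) (-1^even M)

  square-mod3 : ∀ x → ∃ λ y → x * x ≡ + 3 * y ⊎ x * x ≡ + 1 + + 3 * y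
  square-mod3 x with x %ℕ 3 | x /ℕ 3 | a≡a%ℕn+[a/ℕn]*n x 3 | n%ℕd<d x 3
  ... | 0 | q | refl | _ = + 3 * q * q , inj₁ (eq q)
    where
    eq : ∀ q → (+ 0 + q * + 3) * (+ 0 + q * + 3) ≡ + 3 * (+ 3 * q * q)
    eq = solve-∀
  ... | 1 | q | refl | _ = + 2 * q + + 3 * q * q , inj₂ (eq q)
    where
    eq : ∀ q → (+ 1 + q * + 3) * (+ 1 + q * + 3) ≡ + 1 + + 3 * (+ 2 * q + + 3 * q * q)
    eq = solve-∀
  ... | 2 | q | refl | _ = + 1 + + 4 * q + + 3 * q * q , inj₂ (eq q)
    where
    eq : ∀ q → (+ 2 + q * + 3) * (+ 2 + q * + 3) ≡ + 1 + + 3 * (+ 1 + + 4 * q + + 3 * q * q)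
    eq = solve-∀
  ... | suc (suc (suc _)) | q | _ | s≤s (s≤s (s≤s ()))

  square-mod4 : ∀ x → ∃ λ y → x * x ≡ + 4 * y ⊎ x * x ≡ + 1 + + 4 * y
  square-mod4 x with x %ℕ 2 | x /ℕ 2 | a≡a%ℕn+[a/ℕn]*n x 2 | n%ℕd<d x 2
  ... | 0 | q | refl | _ = q * q , inj₁ (eq q)
    where
    eq : ∀ q → (+ 0 + q * + 2) * (+ 0 + q * + 2) ≡ + 4 * (q * q)
    eq = solve-∀
  ... | 1 | q | refl | _ = q + q * q , inj₂ (eq q)
    where
    eq : ∀ q → (+ 1 + q * + 2) * (+ 1 + q * + 2) ≡ + 1 + + 4 * (q + q * q)
    eq = solve-∀
  ... | suc (suc _) | q | _ | s≤s (s≤s ())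

  -- A positive odd number congruent to 2 mod 3 divides no z² + 3.
  no-minus-three : ∀ j → (∀ i → j ≢ -[1+ i ]) → ∀ Z x → (+ 5 + + 12 * j) * x ≡ Z * Z + + 3 → ⊥
  no-minus-three -[1+ i ] j≥0 Z x e = j≥0 i refl
  no-minus-three (+ j) j≥0 Z x e = conclude (smallValue 3 N (s≤s z≤n) Z x (trans (cong (λ y → y * x - Z * Z) N≡) (trans (cong (_- Z * Z) e) (eq (Z * Z)))))
    where
    N = 5 ℕ.+ 12 ℕ.* j
    N≡ : + N ≡ + 5 + + 12 * + j
    N≡ = cong (λ y → + 5 + y) (ℤ.pos-* 12 j)
    eq : ∀ y → y + + 3 - y ≡ + 3
    eq = solve-∀
    -- N times the value of the form completes the square, with determinant 3 as the coefficient of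
    -- v².
    complete-square : ∀ s v k → form (+ N) Z x s v ≡ + k → (+ 5 + + 12 * + j) * + k ≡ (+ N * s + Z * v) * (+ N * s + Z * v) + + 3 * (v * v)
    complete-square s v k val = trans (cong₂ _*_ (sym N≡) (sym val)) (trans (eq₁ (+ N) Z x s v) (trans (cong (λ y → (+ N * s + Z * v) * (+ N * s + Z * v) + (y - Z * Z) * (v * v)) (trans (cong (_* x) N≡) e)) (eq₂ ((+ N * s + Z * v) * (+ N * s + Z * v)) (Z * Z) (v * v))))
      where
      eq₁ : ∀ N Z x s v → N * (N * (s * s) + + 2 * (Z * (s * v)) + x * (v * v)) ≡ (N * s + Z * v) * (N * s + Z * v) + (N * x - Z * Z) * (v * v)
      eq₁ = solve-∀
      eq₂ : ∀ a z v → a + (z + + 3 - z) * v ≡ a + + 3 * v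
      eq₂ = solve-∀
    -- The left side is 2 modulo 3, while the right side is a square modulo 3.
    case₁ : ∀ u v → (+ 5 + + 12 * + j) * + 1 ≡ u * u + + 3 * (v * v) → ⊥
    case₁ u v h with square-mod3 u
    ... | y , inj₁ e = no-multiple 3 2 (y + v * v - + 1 - + 4 * + j) (s≤s (s≤s (s≤s z≤n))) (trans (eq′ y (v * v) (+ j)) (trans (cong (λ z → z + + 3 * (v * v) - + 3 - + 12 * + j) (sym e)) (trans (cong (λ z → z - + 3 - + 12 * + j) (sym h)) (eq″ (+ j)))))
      where
      eq′ : ∀ y v j → + 3 * (y + v - + 1 - + 4 * j) ≡ + 3 * y + + 3 * v - + 3 - + 12 * j
      eq′ = solve-∀
      eq″ : ∀ j → (+ 5 + + 12 * j) * + 1 - + 3 - + 12 * j ≡ + 2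
      eq″ = solve-∀
    ... | y , inj₂ e = no-multiple 3 1 (y + v * v - + 1 - + 4 * + j) (s≤s (s≤s z≤n)) (trans (eq′ y (v * v) (+ j)) (trans (cong (λ z → z + + 3 * (v * v) - + 4 - + 12 * + j) (sym e)) (trans (cong (λ z → z - + 4 - + 12 * + j) (sym h)) (eq″ (+ j)))))
      where
      eq′ : ∀ y v j → + 3 * (y + v - + 1 - + 4 * j) ≡ + 1 + + 3 * y + + 3 * v - + 4 - + 12 * j
      eq′ = solve-∀
      eq″ : ∀ j → (+ 5 + + 12 * j) * + 1 - + 4 - + 12 * j ≡ + 1
      eq″ = solve-∀
    -- The left side is 2 modulo 4, while u² + 3v² is 0, 1 or 3 modulo 4.
    case₂ : ∀ u v → (+ 5 + + 12 * + j) * + 2 ≡ u * u + + 3 * (v * v) → ⊥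
    case₂ u v h with square-mod4 u | square-mod4 v
    ... | a , p | b , q = residue p q
      where
      sum : ∀ {U V} → u * u ≡ U → v * v ≡ V → (+ 5 + + 12 * + j) * + 2 ≡ U + + 3 * V
      sum p q = trans h (cong₂ (λ x y → x + + 3 * y) p q)
      residue : u * u ≡ + 4 * a ⊎ u * u ≡ + 1 + + 4 * a → v * v ≡ + 4 * b ⊎ v * v ≡ + 1 + + 4 * b → ⊥
      residue (inj₁ p) (inj₁ q) = no-multiple 4 2 (a + + 3 * b - + 2 - + 6 * + j) (s≤s (s≤s (s≤s z≤n))) (trans (eq′ a b (+ j)) (trans (cong (λ z → z - + 8 - + 24 * + j) (sym (sum p q))) (eq″ (+ j))))
        where
        eq′ : ∀ a b j → + 4 * (a + + 3 * b - + 2 - + 6 * j) ≡ + 4 * a + + 3 * (+ 4 * b) - + 8 - + 24 * j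
        eq′ = solve-∀
        eq″ : ∀ j → (+ 5 + + 12 * j) * + 2 - + 8 - + 24 * j ≡ + 2
        eq″ = solve-∀
      residue (inj₂ p) (inj₁ q) = no-multiple 4 1 (a + + 3 * b - + 2 - + 6 * + j) (s≤s (s≤s z≤n)) (trans (eq′ a b (+ j)) (trans (cong (λ z → z - + 9 - + 24 * + j) (sym (sum p q))) (eq″ (+ j))))
        where
        eq′ : ∀ a b j → + 4 * (a + + 3 * b - + 2 - + 6 * j) ≡ + 1 + + 4 * a + + 3 * (+ 4 * b) - + 9 - + 24 * j
        eq′ = solve-∀
        eq″ : ∀ j → (+ 5 + + 12 * j) * + 2 - + 9 - + 24 * j ≡ + 1
        eq″ = solve-∀
      residue (inj₁ p) (inj₂ q) = no-multiple 4 3 (a + + 3 * b - + 1 - + 6 * + j) (s≤s (s≤s (s≤s (s≤s z≤n)))) (trans (eq′ a b (+ j)) (trans (cong (λ z → z - + 7 - + 24 * + j) (sym (sum p q))) (eq″ (+ j))))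
        where
        eq′ : ∀ a b j → + 4 * (a + + 3 * b - + 1 - + 6 * j) ≡ + 4 * a + + 3 * (+ 1 + + 4 * b) - + 7 - + 24 * j
        eq′ = solve-∀
        eq″ : ∀ j → (+ 5 + + 12 * j) * + 2 - + 7 - + 24 * j ≡ + 3
        eq″ = solve-∀
      residue (inj₂ p) (inj₂ q) = no-multiple 4 2 (a + + 3 * b - + 1 - + 6 * + j) (s≤s (s≤s (s≤s z≤n))) (trans (eq′ a b (+ j)) (trans (cong (λ z → z - + 8 - + 24 * + j) (sym (sum p q))) (eq″ (+ j))))
        where
        eq′ : ∀ a b j → + 4 * (a + + 3 * b - + 1 - + 6 * j) ≡ + 1 + + 4 * a + + 3 * (+ 1 + + 4 * b) - + 8 - + 24 * j
        eq′ = solve-∀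
        eq″ : ∀ j → (+ 5 + + 12 * j) * + 2 - + 8 - + 24 * j ≡ + 2
        eq″ = solve-∀
    conclude : SmallValue 3 (+ N) Z x → ⊥
    conclude (small s v g h 1 prim val pos bnd) = case₁ (+ N * s + Z * v) v (complete-square s v 1 val)
    conclude (small s v g h 2 prim val pos bnd) = case₂ (+ N * s + Z * v) v (complete-square s v 2 val)
    conclude (small s v g h (suc (suc (suc k))) prim val pos bnd) = ℕ.<⇒≱ {12} {27} (ℕ.≤ᵇ⇒≤ 13 27 _) (ℕ.≤-trans (ℕ.*-monoʳ-≤ 3 (ℕ.*-mono-≤ (ℕ.m≤m+n 3 k) (ℕ.m≤m+n 3 k))) bnd)

  module _ (h k : ℤ) (h² : h * h ≡ + 1 + + 8 * k) where
    open Functional (+ 3 * h)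

    η : Z√
    η = + 0 +√ h

    η² : η ⊗ η ≡ ⊝ (ι (+ 105) ⊗ (ι (+ 1) ⊕ ι (+ 8) ⊗ ι k))
    η² = trans (ext (trans (re-⊗ η η) (eq₁ (+ 105) h)) (trans (im-⊗ η η) (eq₂ h)))
      (trans (cong (λ x → ι (- (+ 105 * x))) h²) (trans (ι-⊝ (+ 105 * (+ 1 + + 8 * k))) (cong ⊝_ (trans (ι-⊗ (+ 105) (+ 1 + + 8 * k))
        (cong (ι (+ 105) ⊗_) (trans (ι-⊕ (+ 1) (+ 8 * k)) (cong (ι (+ 1) ⊕_) (ι-⊗ (+ 8) k))))))))
      where
      eq₁ : ∀ D h → + 0 * + 0 - D * (h * h) ≡ - (D * (h * h))
      eq₁ = solve-∀
      eq₂ : ∀ h → + 0 * h + h * + 0 ≡ + 0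
      eq₂ = solve-∀

    φη : φ η ≡ + 3 + + 24 * k
    φη = trans (φ≡ η) (trans (eq h) (trans (cong (+ 3 *_) h²) (eq′ k)))
      where
      eq : ∀ h → + 0 + + 3 * h * h ≡ + 3 * (h * h)
      eq = solve-∀
      eq′ : ∀ k → + 3 * (+ 1 + + 8 * k) ≡ + 3 + + 24 * k
      eq′ = solve-∀

    -- Here y = (3h² + 35)/2 = 19 + 12k, so γ = (y - 35) + h√-105 has real part 12k - 16. Then γ² =
    -- -1 + 8w and γ⁴ = 1 + 16z′, which suggests splitting the exponent by its class modulo 4.
    γ w z′ : Z√
    γ = ι (+ 12 * k - + 16) ⊕ η
    w = ι (+ 19 - + 153 * k + + 18 * (k * k)) ⊕ ι (+ 3 * k - + 4) ⊗ η
    z′ = ⊝ w ⊕ ι (+ 4) ⊗ (w ⊗ w)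

    -- Again 3 divides 105 and 3h, but now re γ ≡ -1. A value ±1 must therefore be +1 for even and
    -- -1 for odd exponents.
    φ-mod3 : ∀ m → ∃ λ r → φ (γ ⊛ m) ≡ -[1+ 0 ] ^ m + + 3 * r
    φ-mod3 m = let (r , e) = go m in r + h * im (γ ⊛ m) , trans (φ≡ (γ ⊛ m)) (trans (cong (_+ + 3 * h * im (γ ⊛ m)) e) (eq (-[1+ 0 ] ^ m) r h (im (γ ⊛ m))))
      where
      eq : ∀ e r h y → e + + 3 * r + + 3 * h * y ≡ e + + 3 * (r + h * y)
      eq = solve-∀
      eq′ : ∀ e f E r I J → (e + + 3 * f) * (E + + 3 * r) - + 105 * (I * J) ≡ e * E + + 3 * (e * r + f * (E + + 3 * r) - + 35 * (I * J))
      eq′ = solve-∀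
      re-γ : re γ ≡ -[1+ 0 ] + + 3 * (+ 4 * k - + 5)
      re-γ = trans (re-⊕ (ι (+ 12 * k - + 16)) η) (eq″ k)
        where
        eq″ : ∀ k → + 12 * k - + 16 + + 0 ≡ -[1+ 0 ] + + 3 * (+ 4 * k - + 5)
        eq″ = solve-∀
      go : ∀ m → ∃ λ r → re (γ ⊛ m) ≡ -[1+ 0 ] ^ m + + 3 * r
      go zero = + 0 , refl
      go (suc m) with go m
      ... | r , e = -[1+ 0 ] * r + (+ 4 * k - + 5) * (-[1+ 0 ] ^ m + + 3 * r) - + 35 * (im γ * im (γ ⊛ m)) ,
        trans (re-⊗ γ (γ ⊛ m)) (trans (cong₂ (λ x y → x * y - + 105 * (im γ * im (γ ⊛ m))) re-γ e) (eq′ -[1+ 0 ] (+ 4 * k - + 5) (-[1+ 0 ] ^ m) r (im γ) (im (γ ⊛ m))))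

    γ² : γ ⊛ 2 ≡ ι -[1+ 0 ] ⊕ ι (+ 8) ⊗ w
    γ² = trans (cong (λ x → (x ⊕ η) ⊗ ((x ⊕ η) ⊗ ι (+ 1))) (lin 12 -[1+ 15 ]))
      (trans (solve 2 (λ K η → (con (+ 12) :* K :+ con -[1+ 15 ] :+ η) :* ((con (+ 12) :* K :+ con -[1+ 15 ] :+ η) :* con (+ 1))
         := con -[1+ 0 ] :+ con (+ 8) :* (con (+ 19) :+ :- (con (+ 153) :* K) :+ con (+ 18) :* (K :* K) :+ (con (+ 3) :* K :+ con -[1+ 3 ]) :* η)
            :+ (η :* η :+ con (+ 105) :* (con (+ 1) :+ con (+ 8) :* K))) refl (ι k) η)
      (trans (cong₂ (λ x y → ι -[1+ 0 ] ⊕ ι (+ 8) ⊗ x ⊕ (y ⊕ ι (+ 105) ⊗ (ι (+ 1) ⊕ ι (+ 8) ⊗ ι k))) (cong₂ (λ x y → x ⊕ y ⊗ η) (sym quad) (sym (lin 3 -[1+ 3 ]))) η²)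
        (solve 2 (λ x y → x :+ (:- y :+ y) := x) refl (ι -[1+ 0 ] ⊕ ι (+ 8) ⊗ w) (ι (+ 105) ⊗ (ι (+ 1) ⊕ ι (+ 8) ⊗ ι k)))))
      where
      lin : ∀ a b → ι (+ a * k + b) ≡ ι (+ a) ⊗ ι k ⊕ ι b
      lin a b = trans (ι-⊕ (+ a * k) b) (cong (_⊕ ι b) (ι-⊗ (+ a) k))
      quad : ι (+ 19 - + 153 * k + + 18 * (k * k)) ≡ ι (+ 19) ⊕ ⊝ (ι (+ 153) ⊗ ι k) ⊕ ι (+ 18) ⊗ (ι k ⊗ ι k)
      quad = trans (ι-⊕ (+ 19 - + 153 * k) (+ 18 * (k * k))) (cong₂ _⊕_
        (trans (ι-⊕ (+ 19) (- (+ 153 * k))) (cong (ι (+ 19) ⊕_) (trans (ι-⊝ (+ 153 * k)) (cong ⊝_ (ι-⊗ (+ 153) k)))))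
        (trans (ι-⊗ (+ 18) (k * k)) (cong (ι (+ 18) ⊗_) (ι-⊗ k k))))

    γ⁴ : γ ⊛ 4 ≡ ι (+ 1) ⊕ ι (+ 4) ⊗ (ι (+ 4) ⊗ z′)
    γ⁴ = trans (⊛-* γ 2 2) (trans (cong (_⊛ 2) γ²) (solve 1 (λ w → (con -[1+ 0 ] :+ con (+ 8) :* w) :* ((con -[1+ 0 ] :+ con (+ 8) :* w) :* con (+ 1))
      := con (+ 1) :+ con (+ 4) :* (con (+ 4) :* (:- w :+ con (+ 4) :* (w :* w)))) refl w))

    φγ : φ γ ≡ + 36 * k - + 13
    φγ = trans (φ-⊕ (ι (+ 12 * k - + 16)) η) (trans (cong₂ _+_ (φ-ι (+ 12 * k - + 16)) φη) (eq k))
      where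
      eq : ∀ k → + 12 * k - + 16 + (+ 3 + + 24 * k) ≡ + 36 * k - + 13
      eq = solve-∀

    φz′ : φ z′ ≡ + 1 + + 2 * (+ 2 * φ (w ⊗ w) - + 4 + + 120 * k - + 45 * (k * k))
    φz′ = trans (φ-⊕ (⊝ w) (ι (+ 4) ⊗ (w ⊗ w))) (trans (cong₂ _+_ (trans (cong φ (solve 1 (λ w → :- w := con -[1+ 0 ] :* w) refl w)) (trans (φ-ι⊗ -[1+ 0 ] w) (cong (-[1+ 0 ] *_) φw))) (φ-ι⊗ (+ 4) (w ⊗ w))) (eq k (φ (w ⊗ w))))
      where
      φw : φ w ≡ + 19 - + 153 * k + + 18 * (k * k) + (+ 3 * k - + 4) * (+ 3 + + 24 * k)
      φw = trans (φ-⊕ (ι (+ 19 - + 153 * k + + 18 * (k * k))) (ι (+ 3 * k - + 4) ⊗ η)) (cong₂ _+_ (φ-ι (+ 19 - + 153 * k + + 18 * (k * k))) (trans (φ-ι⊗ (+ 3 * k - + 4) η) (cong ((+ 3 * k - + 4) *_) φη)))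
      eq : ∀ k y → -[1+ 0 ] * (+ 19 - + 153 * k + + 18 * (k * k) + (+ 3 * k - + 4) * (+ 3 + + 24 * k)) + + 4 * y ≡ + 1 + + 2 * (+ 2 * y - + 4 + + 120 * k - + 45 * (k * k))
      eq = solve-∀

    γ-even : ∀ M → ∃ λ t → γ ⊛ (M ℕ.* 2) ≡ ι (-[1+ 0 ] ^ M) ⊕ ι (+ 8) ⊗ t
    γ-even M = proj₁ c , trans (⊛-* γ 2 M) (trans (cong (_⊛ M) γ²) (trans (proj₂ c) (cong (_⊕ ι (+ 8) ⊗ proj₁ c) (ι-⊛ -[1+ 0 ] M))))
      where
      c = ⊛-congruence (ι (+ 8)) (ι -[1+ 0 ]) w M

    γ-4 : ∀ M → ∃ λ t → γ ⊛ (M ℕ.* 4) ≡ ι (+ 1) ⊕ ι (+ 16) ⊗ t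
    γ-4 M = proj₁ c , trans (⊛-* γ 4 M) (trans (cong (_⊛ M) (trans γ⁴ (solve 1 (λ z → con (+ 1) :+ con (+ 4) :* (con (+ 4) :* z) := con (+ 1) :+ con (+ 16) :* z) refl z′)))
      (trans (proj₂ c) (cong (_⊕ ι (+ 16) ⊗ proj₁ c) (trans (ι-⊛ (+ 1) M) (cong ι (ℤ.^-zeroˡ M))))))
      where
      c = ⊛-congruence (ι (+ 16)) (ι (+ 1)) z′ M

    φ-mod3-even : ∀ M → φ (γ ⊛ (M ℕ.* 2)) ≢ -[1+ 0 ]
    φ-mod3-even M e = no-multiple 3 2 (- r) (s≤s (s≤s (s≤s z≤n))) (trans (eq r) (cong (λ x → + 1 - x) (trans (cong (_+ + 3 * r) (sym (-1^even M))) (trans (sym (proj₂ (φ-mod3 (M ℕ.* 2)))) e))))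
      where
      r = proj₁ (φ-mod3 (M ℕ.* 2))
      eq : ∀ r → + 3 * - r ≡ + 1 - (+ 1 + + 3 * r)
      eq = solve-∀

    φ-mod3-odd : ∀ M → φ (γ ⊛ (1 ℕ.+ M ℕ.* 2)) ≢ + 1
    φ-mod3-odd M e = no-multiple 3 2 r (s≤s (s≤s (s≤s z≤n))) (trans (eq r) (cong (λ x → + 1 + x) (trans (cong (_+ + 3 * r) (sym (cong (-[1+ 0 ] *_) (-1^even M)))) (trans (sym (proj₂ (φ-mod3 (1 ℕ.+ M ℕ.* 2)))) e))))
      where
      r = proj₁ (φ-mod3 (1 ℕ.+ M ℕ.* 2))
      eq : ∀ r → + 3 * r ≡ + 1 + (-[1+ 0 ] + + 3 * r)
      eq = solve-∀

    -- Exponents divisible by 4 fail 2-adically.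
    case-0 : ∀ M → 1 ℕ.≤ M → IsSign (φ (γ ⊛ (M ℕ.* 4))) → ⊥
    case-0 M 1≤M hyp = conclude (φ-2-adic z M 1≤M (subst (λ x → IsSign (φ x)) (trans (⊛-* γ 4 M) (cong (_⊛ M) γ⁴)) hyp))
      where
      z = ι (+ 4) ⊗ z′
      odd : ∀ l → + (1 ℕ.+ 2 ℕ.* l) ≡ + 1 + + 2 * + l
      odd l = cong (λ y → + 1 + y) (ℤ.pos-* 2 l)
      -- Because z = 4z′, the first-order term is 4 times an odd number and the second-order term a
      -- multiple of 32, which is contradictory modulo 8.
      zzt : ∀ t → φ (z ⊗ z ⊗ t) ≡ + 16 * φ (z′ ⊗ z′ ⊗ t)
      zzt t = trans (cong φ (solve 2 (λ z t → con (+ 4) :* z :* (con (+ 4) :* z) :* t := con (+ 16) :* (z :* z :* t)) refl z′ t)) (φ-ι⊗ (+ 16) (z′ ⊗ z′ ⊗ t))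
      eq : ∀ l y x → + 8 * - (l + y + + 2 * l * y + + 4 * x) ≡ + 4 - ((+ 1 + + 2 * l) * (+ 4 * (+ 1 + + 2 * y)) + + 2 * (+ 16 * x))
      eq = solve-∀
      conclude : (∃₂ λ l t → + (1 ℕ.+ 2 ℕ.* l) * φ z + + 2 * φ (z ⊗ z ⊗ t) ≡ + 0) → ⊥
      conclude (l , t , e) = no-multiple 8 4 (- (+ l + y + + 2 * + l * y + + 4 * x)) (s≤s (s≤s (s≤s (s≤s (s≤s z≤n))))) (trans (eq (+ l) y x) (cong (λ x → + 4 - x)
          (trans (sym (cong₂ _+_ (cong₂ _*_ (odd l) (trans (φ-ι⊗ (+ 4) z′) (cong (+ 4 *_) φz′))) (cong (+ 2 *_) (zzt t)))) e)))
        where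
        y = + 2 * φ (w ⊗ w) - + 4 + + 120 * k - + 45 * (k * k)
        x = φ (z′ ⊗ z′ ⊗ t)

    -- γ² ≡ -1 modulo 8, so an odd power of γ² gives -1 modulo 8 where +1 is required.
    case-2 : ∀ M → φ (γ ⊛ ((1 ℕ.+ M ℕ.* 2) ℕ.* 2)) ≡ + 1 → ⊥
    case-2 M hyp = no-multiple 8 2 (φ t) (s≤s (s≤s (s≤s z≤n))) (trans (eq (φ t)) (cong (λ x → + 1 + x) (trans (sym value) hyp)))
      where
      c = γ-even (1 ℕ.+ M ℕ.* 2)
      t = proj₁ c
      eq : ∀ x → + 8 * x ≡ + 1 + (-[1+ 0 ] + + 8 * x)
      eq = solve-∀
      value : φ (γ ⊛ ((1 ℕ.+ M ℕ.* 2) ℕ.* 2)) ≡ -[1+ 0 ] + + 8 * φ t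
      value = trans (cong φ (proj₂ c)) (trans (φ-⊕ (ι (-[1+ 0 ] ^ (1 ℕ.+ M ℕ.* 2))) (ι (+ 8) ⊗ t)) (cong₂ _+_ (trans (φ-ι (-[1+ 0 ] ^ (1 ℕ.+ M ℕ.* 2))) (cong (-[1+ 0 ] *_) (-1^even M))) (φ-ι⊗ (+ 8) t)))

    -- Modulo 8 the power is -γ, and -`φ γ` = 13 - 36k is 1 modulo 4 where -1 is required.
    case-3 : ∀ M → φ (γ ⊛ (1 ℕ.+ (1 ℕ.+ M ℕ.* 2) ℕ.* 2)) ≡ -[1+ 0 ] → ⊥
    case-3 M hyp = no-multiple 4 2 (+ 9 * k - + 2 * φ (γ ⊗ t) - + 3) (s≤s (s≤s (s≤s z≤n))) (trans (eq k (φ (γ ⊗ t))) (cong (λ x → + 1 - x) (trans (sym value) hyp)))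
      where
      c = γ-even (1 ℕ.+ M ℕ.* 2)
      t = proj₁ c
      eq : ∀ k x → + 4 * (+ 9 * k - + 2 * x - + 3) ≡ + 1 - (-[1+ 0 ] * (+ 36 * k - + 13) + + 8 * x)
      eq = solve-∀
      value : φ (γ ⊗ γ ⊛ ((1 ℕ.+ M ℕ.* 2) ℕ.* 2)) ≡ -[1+ 0 ] * (+ 36 * k - + 13) + + 8 * φ (γ ⊗ t)
      value = trans (cong (λ y → φ (γ ⊗ y)) (trans (proj₂ c) (cong (λ x → ι x ⊕ ι (+ 8) ⊗ t) (cong (-[1+ 0 ] *_) (-1^even M)))))
        (trans (cong φ (solve 2 (λ γ t → γ :* (con -[1+ 0 ] :+ con (+ 8) :* t) := con -[1+ 0 ] :* γ :+ con (+ 8) :* (γ :* t)) refl γ t))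
        (trans (φ-⊕ (ι -[1+ 0 ] ⊗ γ) (ι (+ 8) ⊗ (γ ⊗ t))) (cong₂ _+_ (trans (φ-ι⊗ -[1+ 0 ] γ) (cong (-[1+ 0 ] *_) φγ)) (φ-ι⊗ (+ 8) (γ ⊗ t)))))

    -- Modulo 16 the exponent 4M + 1 forces k ≡ 3 mod 4, and modulo 3k - 4 it makes -3 a square.
    case-1 : ∀ M → φ (γ ⊛ (1 ℕ.+ M ℕ.* 4)) ≡ -[1+ 0 ] → ∃ λ j → k ≡ + 3 + + 4 * j × ∃ λ Z → ∃ λ x → (+ 3 * k - + 4) * x ≡ Z * Z + + 3
    case-1 M hyp = j , k≡ , + 3 * (h * Y) , - (+ 3 * φ s) , (trans (eq₂ (+ 3 * k - + 4) h Y (φ s)) (trans (cong (λ x → + 3 * (+ 3 * (h * Y) * (h * Y) - x)) (trans (sym value₂) hyp)) (eq₃ h Y)))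
      where
      c = γ-4 M
      t = proj₁ c
      j = - (φ (γ ⊗ t) + + 2 * k)
      value : φ (γ ⊗ γ ⊛ (M ℕ.* 4)) ≡ + 36 * k - + 13 + + 16 * φ (γ ⊗ t)
      value = trans (cong (λ y → φ (γ ⊗ y)) (proj₂ c))
        (trans (cong φ (solve 2 (λ γ t → γ :* (con (+ 1) :+ con (+ 16) :* t) := γ :+ con (+ 16) :* (γ :* t)) refl γ t))
        (trans (φ-⊕ γ (ι (+ 16) ⊗ (γ ⊗ t))) (cong₂ _+_ φγ (φ-ι⊗ (+ 16) (γ ⊗ t)))))
      k≡ : k ≡ + 3 + + 4 * j
      k≡ = ℤ.*-cancelˡ-≡ (+ 4) k (+ 3 + + 4 * j) (trans (eq k (φ (γ ⊗ t))) (trans (cong (λ x → + 4 * (+ 3 + + 4 * j) + (x + + 1)) (trans (sym value) hyp)) (ℤ.+-identityʳ (+ 4 * (+ 3 + + 4 * j)))))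
        where
        eq : ∀ k x → + 4 * k ≡ + 4 * (+ 3 + + 4 * - (x + + 2 * k)) + (+ 36 * k - + 13 + + 16 * x + + 1)
        eq = solve-∀
      -- γ = η + 4(3k - 4), so modulo 3k - 4 the power is η^(4M+1) = Y²η, where η² = -Q and Y = Q^M.
      -- Its functional 3(hY)² must be -1, and multiplication by 3 shows (3hY)² ≡ -3.
      N = ι (+ 3 * k - + 4)
      d = ⊛-congruence N η (ι (+ 4)) (1 ℕ.+ M ℕ.* 4)
      s = proj₁ d
      Q = + 105 * (+ 1 + + 8 * k)
      Y = Q ^ M
      γ≡ : γ ≡ η ⊕ N ⊗ ι (+ 4)
      γ≡ = trans (⊕-comm (ι (+ 12 * k - + 16)) η) (cong (η ⊕_) (trans (cong ι (eq k)) (ι-⊗ (+ 3 * k - + 4) (+ 4))))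
        where
        eq : ∀ k → + 12 * k - + 16 ≡ (+ 3 * k - + 4) * + 4
        eq = solve-∀
      η²′ : η ⊗ η ≡ ⊝ ι Q
      η²′ = trans η² (cong ⊝_ (sym (trans (ι-⊗ (+ 105) (+ 1 + + 8 * k)) (cong (ι (+ 105) ⊗_) (trans (ι-⊕ (+ 1) (+ 8 * k)) (cong (ι (+ 1) ⊕_) (ι-⊗ (+ 8) k)))))))
      η⁴ : η ⊛ 4 ≡ ι Q ⊗ ι Q
      η⁴ = trans (solve 1 (λ η → η :* (η :* (η :* (η :* con (+ 1)))) := (η :* η) :* (η :* η)) refl η) (trans (cong (λ x → x ⊗ x) η²′) (solve 1 (λ x → :- x :* :- x := x :* x) refl (ι Q)))
      η-power : η ⊛ (M ℕ.* 4) ≡ ι (Y * Y)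
      η-power = trans (⊛-* η 4 M) (trans (cong (_⊛ M) η⁴) (trans (⊛-⊗ (ι Q) (ι Q) M) (trans (cong₂ _⊗_ (ι-⊛ Q M) (ι-⊛ Q M)) (sym (ι-⊗ Y Y)))))
      value₂ : φ (γ ⊛ (1 ℕ.+ M ℕ.* 4)) ≡ + 3 * (h * Y) * (h * Y) + (+ 3 * k - + 4) * φ s
      value₂ = trans (cong φ (trans (cong (_⊛ (1 ℕ.+ M ℕ.* 4)) γ≡) (proj₂ d)))
        (trans (φ-⊕ (η ⊗ η ⊛ (M ℕ.* 4)) (N ⊗ s)) (cong₂ _+_ (trans (cong φ (trans (cong (η ⊗_) η-power) (⊗-comm η (ι (Y * Y))))) (trans (φ-ι⊗ (Y * Y) η) (trans (cong (Y * Y *_) (φ≡ η)) (eq h Y)))) (φ-ι⊗ (+ 3 * k - + 4) s)))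
        where
        eq : ∀ h Y → Y * Y * (+ 0 + + 3 * h * h) ≡ + 3 * (h * Y) * (h * Y)
        eq = solve-∀
      eq₂ : ∀ N h Y x → N * - (+ 3 * x) ≡ + 3 * (+ 3 * (h * Y) * (h * Y) - (+ 3 * (h * Y) * (h * Y) + N * x))
      eq₂ = solve-∀
      eq₃ : ∀ h Y → + 3 * (+ 3 * (h * Y) * (h * Y) - -[1+ 0 ]) ≡ + 3 * (h * Y) * (+ 3 * (h * Y)) + + 3
      eq₃ = solve-∀

    no-power : ∀ m → 1 ℕ.≤ m → IsSign (φ (γ ⊛ m)) → ⊥
    no-power m 1≤m hyp = go (halve m)
      where
      even : ∀ M → m ≡ M ℕ.* 2 → φ (γ ⊛ (M ℕ.* 2)) ≡ + 1 → ⊥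
      even M e h with halve M
      ... | j , inj₂ refl = case-2 j (subst (λ n → φ (γ ⊛ ((1 ℕ.+ n) ℕ.* 2)) ≡ + 1) (ℕ.*-comm 2 j) h)
      ... | zero , inj₁ refl = contradiction (subst (1 ℕ.≤_) e 1≤m) λ ()
      ... | suc j , inj₁ refl = case-0 (suc j) (s≤s z≤n) (subst (λ n → IsSign (φ (γ ⊛ n))) (trans (cong (ℕ._* 2) (ℕ.*-comm 2 (suc j))) (ℕ.*-assoc (suc j) 2 2)) (inj₁ h))
      odd : ∀ M → φ (γ ⊛ (1 ℕ.+ M ℕ.* 2)) ≡ -[1+ 0 ] → ⊥
      odd M p with halve M
      ... | j , inj₂ refl = case-3 j (subst (λ n → φ (γ ⊛ (1 ℕ.+ (1 ℕ.+ n) ℕ.* 2)) ≡ -[1+ 0 ]) (ℕ.*-comm 2 j) p)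
      ... | j , inj₁ refl = final (case-1 j (subst (λ n → φ (γ ⊛ (1 ℕ.+ n)) ≡ -[1+ 0 ]) (trans (cong (ℕ._* 2) (ℕ.*-comm 2 j)) (ℕ.*-assoc j 2 2)) p))
        where
        final : (∃ λ j → k ≡ + 3 + + 4 * j × ∃ λ Z → ∃ λ x → (+ 3 * k - + 4) * x ≡ Z * Z + + 3) → ⊥
        -- With k = 3 + 4j the modulus 3k - 4 is 5 + 12j. A negative j is impossible because h² = 1
        -- + 8k = 25 + 32j.
        final (j , k≡ , Z , x , e) = no-minus-three j (λ i j≡ → negative i (trans h² (trans (cong (λ k → + 1 + + 8 * k) (trans k≡ (cong (λ j → + 3 + + 4 * j) j≡))) (eq₁ -[1+ i ]))))
            Z x (trans (cong (_* x) (trans (eq j) (cong (λ k → + 3 * k - + 4) (sym k≡)))) e)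
          where
          eq : ∀ j → + 5 + + 12 * j ≡ + 3 * (+ 3 + + 4 * j) - + 4
          eq = solve-∀
          eq₁ : ∀ i → + 1 + + 8 * (+ 3 + + 4 * i) ≡ + 32 * (i + + 1) - + 7
          eq₁ = solve-∀
          negative : ∀ i → h * h ≢ + 32 * (-[1+ i ] + + 1) - + 7
          negative i p = absurd (32 ℕ.* i) (trans (sym (square≡ h)) (trans p (trans (cong (λ y → + 32 * y - + 7) (eq₂ i)) (cong (λ y → y - + 7) (trans (sym (ℤ.neg-distribʳ-* (+ 32) (+ i))) (cong -_ (sym (ℤ.pos-* 32 i))))))))
            where
            eq₂ : ∀ i → -[1+ i ] + + 1 ≡ - + i
            eq₂ zero = refl
            eq₂ (suc i) = refl
            absurd : ∀ {a} b → + a ≢ - + b - + 7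
            absurd zero ()
            absurd (suc b) ()
      go : (∃ λ j → m ≡ 2 ℕ.* j ⊎ m ≡ 1 ℕ.+ 2 ℕ.* j) → ⊥
      go (M , inj₁ e) = go′ (subst (λ n → IsSign (φ (γ ⊛ n))) e′ hyp)
        where
        e′ = trans e (ℕ.*-comm 2 M)
        go′ : IsSign (φ (γ ⊛ (M ℕ.* 2))) → ⊥
        go′ (inj₁ h) = even M e′ h
        go′ (inj₂ h) = φ-mod3-even M h
      go (M , inj₂ e) = go′ (subst (λ n → IsSign (φ (γ ⊛ n))) (trans e (cong suc (ℕ.*-comm 2 M))) hyp)
        where
        go′ : IsSign (φ (γ ⊛ (1 ℕ.+ M ℕ.* 2))) → ⊥
        go′ (inj₁ h) = φ-mod3-odd M h
        go′ (inj₂ h) = odd M h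

-- No solutions for d = 6

module Equation105 where

  open import Data.Nat.Primality using (Prime; prime?)
  open import Data.Integer using (+_; _+_; _*_; -_; _-_; _^_)
  open import Data.Integer.Tactic.RingSolver using (solve-∀)
  open import Data.Fin using (zero; suc)
  open import Data.Vec using (Vec; _∷_; [])
  open import Relation.Nullary.Decidable using (toWitness)
  open Arith
  open SmallValues
  open Congruences
  open Units
  open QuadraticRing (+ 105) hiding (_:+_; _:*_)
  open Divisibility (+ 105)
  open Powers (+ 105)
  module R = RealUnits (+ 3) (+ 35) (+ 2) (+ 1) refl 105 refl (s≤s (s≤s z≤n))
  module R₀ = Representation (+ 3) (+ 35) (+ 2) (+ 1) refl

  prime-2 : Prime 2
  prime-2 = toWitness {a? = prime? 2} _
  prime-3 : Prime 3
  prime-3 = toWitness {a? = prime? 3} _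
  prime-5 : Prime 5
  prime-5 = toWitness {a? = prime? 5} _
  prime-7 : Prime 7
  prime-7 = toWitness {a? = prime? 7} _

  private
    x₀ : ∀ {n} → Expr (1 ℕ.+ n)
    x₀ = var zero
    x₁ : ∀ {n} → Expr (2 ℕ.+ n)
    x₁ = var (suc zero)
    x₂ : ∀ {n} → Expr (3 ℕ.+ n)
    x₂ = var (suc (suc zero))
    x₃ : ∀ {n} → Expr (4 ℕ.+ n)
    x₃ = var (suc (suc (suc zero)))
    x₄ : ∀ {n} → Expr (5 ℕ.+ n)
    x₄ = var (suc (suc (suc (suc zero))))

  common-divisor : ∀ d s b g h → 2 ℕ.≤ d → d ∣ᶻ s → d ∣ᶻ b → g * s + h * b ≡ + 1 → ⊥
  common-divisor d s b g h 2≤d (u , p) (v , q) e = no-multiple d 1 (g * u + h * v) 2≤d (trans (eq (+ d) g h u v) (trans (sym (cong₂ (λ x y → g * x + h * y) p q)) e))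
    where
    eq : ∀ d g h u v → d * (g * u + h * v) ≡ g * (d * u) + h * (d * v)
    eq = solve-∀

  private
    -- The form for y ≡ 3 modulo 4 and odd X, z. Modulo 4 it is (s + b)² + s²; a sum of two squares
    -- is never 3 modulo 4, and it is 0 modulo 4 only if s and b are even.
    e₄ : Expr 5
    e₄ = # 6 :* (# 3 :+ # 4 :* x₀) :* (x₃ :* x₃) :+ # 2 :* (# 3 :* (# 1 :+ # 2 :* x₁) :* (x₃ :* x₄)) :+ (# 1 :+ # 2 :* x₂) :* (# 1 :+ # 2 :* x₂) :* (x₄ :* x₄)

  form-mod4 : ∀ {y X z v} t x u s b → y ≡ + 3 + + 4 * t → X ≡ + 1 + + 2 * x → z ≡ + 1 + + 2 * u →
    + 6 * y * (s * s) + + 2 * (+ 3 * X * (s * b)) + z * z * (b * b) ≡ v → ⟦ e₄ ⟧ (t ∷ x ∷ u ∷ s ∷ b ∷ []) ≡ v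
  form-mod4 {X = X} {z} t x u s b y≡ X≡ z≡ h = trans (sym (trans (cong₂ (λ y X → + 6 * y * (s * s) + + 2 * (+ 3 * X * (s * b)) + z * z * (b * b)) y≡ X≡)
    (cong (λ z → + 6 * (+ 3 + + 4 * t) * (s * s) + + 2 * (+ 3 * (+ 1 + + 2 * x) * (s * b)) + z * z * (b * b)) z≡))) h

  form≢7 : ∀ {y X z} t x u s b → y ≡ + 3 + + 4 * t → X ≡ + 1 + + 2 * x → z ≡ + 1 + + 2 * u →
    + 6 * y * (s * s) + + 2 * (+ 3 * X * (s * b)) + z * z * (b * b) ≢ + 7
  form≢7 t x u s b y≡ X≡ z≡ h = never 4 (e₄ :+ # 1) _ (t ∷ x ∷ u ∷ s ∷ b ∷ []) (+ 2 , cong (_+ + 1) (form-mod4 t x u s b y≡ X≡ z≡ h))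

  form≡4 : ∀ {y X z} t x u s b → y ≡ + 3 + + 4 * t → X ≡ + 1 + + 2 * x → z ≡ + 1 + + 2 * u →
    + 6 * y * (s * s) + + 2 * (+ 3 * X * (s * b)) + z * z * (b * b) ≡ + 4 → 2 ∣ᶻ s × 2 ∣ᶻ b
  form≡4 t x u s b y≡ X≡ z≡ h = half s (implies 4 e₄ (# 2 :* x₃) _ ρ d) , half b (implies 4 e₄ (# 2 :* x₄) _ ρ d)
    where
    ρ = t ∷ x ∷ u ∷ s ∷ b ∷ []
    d : 4 ∣ᶻ ⟦ e₄ ⟧ ρ
    d = + 1 , form-mod4 t x u s b y≡ X≡ z≡ h
    half : ∀ w → 4 ∣ᶻ + 2 * w → 2 ∣ᶻ w
    half w (u , p) = u , ℤ.*-cancelˡ-≡ (+ 2) w (+ 2 * u) (trans p (eq u))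
      where
      eq : ∀ u → + 4 * u ≡ + 2 * (+ 2 * u)
      eq = solve-∀

  module _ (X y : ℤ) (k m : ℕ) (y≡ : y ≡ + suc k) (X-odd : ∃ λ x → X ≡ + 1 + + 2 * x)
    (equation : + 3 * (X * X) + + 35 ≡ + 2 * (y * (y * y) ^ suc m)) where
    private
      Y z : ℤ
      Y = (y * y) ^ suc m
      z = y ^ suc m

      x : ℤ
      x = proj₁ X-odd

      mod8 : 8 ∣ᶻ + 3 * ((+ 1 + + 2 * x) * (+ 1 + + 2 * x)) + + 35 + + 6 * (y * (z * z))
      mod8 = y * (z * z) , trans (cong (λ X → + 3 * (X * X) + + 35 + + 6 * (y * (z * z))) (sym (proj₂ X-odd)))
        (trans (cong (_+ + 6 * (y * (z * z))) (trans equation (cong (λ Y → + 2 * (y * Y)) (pow-square y (suc m))))) (eq (y * (z * z))))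
        where
        eq : ∀ w → + 2 * w + + 6 * w ≡ + 8 * w
        eq = solve-∀

      e8 : Expr 3
      e8 = # 3 :* ((# 1 :+ # 2 :* x₀) :* (# 1 :+ # 2 :* x₀)) :+ # 35 :+ # 6 :* (x₁ :* (x₂ :* x₂))

      -- For odd X the left side of the equation is 6 modulo 8, so y z² ≡ 3 modulo 4. This makes z
      -- odd and y ≡ 3.
      y-mod4 : ∃ λ t → y ≡ + 3 + + 4 * t
      y-mod4 = conclude (implies 8 e8 (# 2 :* (x₁ :+ # 1)) _ (x ∷ y ∷ z ∷ []) mod8)
        where
        conclude : 8 ∣ᶻ + 2 * (y + + 1) → ∃ λ t → y ≡ + 3 + + 4 * t
        conclude (u , h) = u - + 1 , ℤ.*-cancelˡ-≡ (+ 2) y (+ 3 + + 4 * (u - + 1)) (trans (eq y) (trans (cong (_- + 2) h) (eq′ u)))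
          where
          eq : ∀ y → + 2 * y ≡ + 2 * (y + + 1) - + 2
          eq = solve-∀
          eq′ : ∀ u → + 8 * u - + 2 ≡ + 2 * (+ 3 + + 4 * (u - + 1))
          eq′ = solve-∀

      z-odd : ∃ λ t → z ≡ + 1 + + 2 * t
      z-odd = conclude (implies 8 e8 (# 4 :* (x₂ :+ # 1)) _ (x ∷ y ∷ z ∷ []) mod8)
        where
        conclude : 8 ∣ᶻ + 4 * (z + + 1) → ∃ λ t → z ≡ + 1 + + 2 * t
        conclude (u , h) = odd⇒ (u , ℤ.*-cancelˡ-≡ (+ 4) (z + + 1) (+ 2 * u) (trans h (eq′ u)))
          where
          eq′ : ∀ u → + 8 * u ≡ + 4 * (+ 2 * u)
          eq′ = solve-∀

      -- y² divides the right side of the equation. For r = 3, 5, 7 no value 3X² + 35 is a multiple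
      -- of r², so y is prime to 105.
      divisor-square : ∀ r → r ∣ᶻ y → r ℕ.* r ∣ᶻ + 3 * (X * X) + + 35
      divisor-square r (v , h) = + 2 * (v * v * (y * (y * y) ^ m)) , trans equation (trans (eq y ((y * y) ^ m)) (trans (cong (λ w → + 2 * (w * w * (y * (y * y) ^ m))) h) (trans (eq′ (+ r) v (y * (y * y) ^ m)) (cong (_* (+ 2 * (v * v * (y * (y * y) ^ m)))) (sym (ℤ.pos-* r r))))))
        where
        eq : ∀ y p → + 2 * (y * (y * y * p)) ≡ + 2 * (y * y * (y * p))
        eq = solve-∀
        eq′ : ∀ r v w → + 2 * (r * v * (r * v) * w) ≡ r * r * (+ 2 * (v * v * w))
        eq′ = solve-∀

      no-5 : 5 ∣ᶻ y → ⊥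
      no-5 h = never 25 (# 3 :* (x₀ :* x₀) :+ # 35) _ (X ∷ []) (divisor-square 5 h)

      no-7 : 7 ∣ᶻ y → ⊥
      no-7 h = never 49 (# 3 :* (x₀ :* x₀) :+ # 35) _ (X ∷ []) (divisor-square 7 h)

      no-3 : 3 ∣ᶻ y → ⊥
      no-3 h = never 9 (# 3 :* (x₀ :* x₀) :+ # 35) _ (X ∷ []) (divisor-square 3 h)

      no-7∣X : 7 ∣ᶻ X → ⊥
      no-7∣X (u , h) = [ two , [ no-7 , (λ d → [ no-7 , no-7 ]′ (prime-∣-* prime-7 y y (prime-∣-^ prime-7 (y * y) (suc m) d))) ]′ ]′
          (case (prime-∣-* prime-7 (+ 2) (y * Y) (+ 3 * (u * X) + + 5 , trans (sym equation) (trans (cong (λ w → + 3 * (w * X) + + 35) h) (eq u X)))))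
        where
        eq : ∀ u X → + 3 * (+ 7 * u * X) + + 35 ≡ + 7 * (+ 3 * (u * X) + + 5)
        eq = solve-∀
        two : 7 ∣ᶻ + 2 → ⊥
        two (w , h) = no-multiple 7 2 w (s≤s (s≤s (s≤s z≤n))) (sym h)
        case : 7 ∣ᶻ + 2 ⊎ 7 ∣ᶻ y * Y → 7 ∣ᶻ + 2 ⊎ (7 ∣ᶻ y ⊎ 7 ∣ᶻ Y)
        case (inj₁ d) = inj₁ d
        case (inj₂ d) = inj₂ (prime-∣-* prime-7 y Y d)

      coprime : Coprime (+ 70) y
      coprime = coprime-* {+ 10} {+ 7} {y} (coprime-* {+ 2} {+ 5} {y} two five) seven
        where
        two : Coprime (+ 2) y
        two = - (+ 1 + + 2 * proj₁ y-mod4) , + 1 , trans (cong (λ w → - (+ 1 + + 2 * proj₁ y-mod4) * + 2 + + 1 * w) (proj₂ y-mod4)) (eq (proj₁ y-mod4))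
          where
          eq : ∀ t → - (+ 1 + + 2 * t) * + 2 + + 1 * (+ 3 + + 4 * t) ≡ + 1
          eq = solve-∀
        five : Coprime (+ 5) y
        -- Fermat: 5 divides y (y⁴ - 1), written with + 4. The factor y is excluded, and y⁴ ≡ 1 is
        -- itself a Bezout identity.
        five = [ (λ d → ⊥-elim (no-5 d)) , conclude ]′ (prime-∣-* prime-5 y (y * y * y * y + + 4) (implies 5 (# 0) (x₀ :* (x₀ :* x₀ :* x₀ :* x₀ :+ # 4)) _ (y ∷ []) (+ 0 , refl)))
          where
          conclude : 5 ∣ᶻ y * y * y * y + + 4 → Coprime (+ 5) y
          conclude (u , h) = + 1 - u , y * y * y , trans (eq u (y * y * y * y)) (trans (cong (λ w → + 5 * (+ 1 - u) + w - + 4) h) (eq′ u))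
            where
            eq : ∀ u w → (+ 1 - u) * + 5 + w ≡ + 5 * (+ 1 - u) + (w + + 4) - + 4
            eq = solve-∀
            eq′ : ∀ u → + 5 * (+ 1 - u) + + 5 * u - + 4 ≡ + 1
            eq′ = solve-∀
        seven : Coprime (+ 7) y
        seven = [ (λ d → ⊥-elim (no-7 d)) , conclude ]′ (prime-∣-* prime-7 y (y * y * y * y * y * y + + 6) (implies 7 (# 0) (x₀ :* (x₀ :* x₀ :* x₀ :* x₀ :* x₀ :* x₀ :+ # 6)) _ (y ∷ []) (+ 0 , refl)))
          where
          conclude : 7 ∣ᶻ y * y * y * y * y * y + + 6 → Coprime (+ 7) y
          conclude (u , h) = + 1 - u , y * y * y * y * y , trans (eq u (y * y * y * y * y * y)) (trans (cong (λ w → + 7 * (+ 1 - u) + w - + 6) h) (eq′ u))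
            where
            eq : ∀ u w → (+ 1 - u) * + 7 + w ≡ + 7 * (+ 1 - u) + (w + + 6) - + 6
            eq = solve-∀
            eq′ : ∀ u → + 7 * (+ 1 - u) + + 7 * u - + 6 ≡ + 1
            eq′ = solve-∀

      A≡ : + (6 ℕ.* suc k) ≡ + 6 * y
      A≡ = trans (ℤ.pos-* 6 (suc k)) (cong (+ 6 *_) (sym y≡))

      det : + (6 ℕ.* suc k) * Y - + 3 * X * (+ 3 * X) ≡ + 105
      det = trans (cong (λ a → a * Y - + 3 * X * (+ 3 * X)) A≡) (trans (eq y Y X) (trans (cong (λ x → + 3 * x - + 3 * X * (+ 3 * X)) (sym equation)) (eq′ X)))
        where
        eq : ∀ y Y X → + 6 * y * Y - + 3 * X * (+ 3 * X) ≡ + 3 * (+ 2 * (y * Y)) - + 3 * X * (+ 3 * X)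
        eq = solve-∀
        eq′ : ∀ X → + 3 * (+ 3 * (X * X) + + 35) - + 3 * X * (+ 3 * X) ≡ + 105
        eq′ = solve-∀

      F : ℤ → ℤ → ℤ
      F s b = form (+ 6 * y) (+ 3 * X) Y s b

      -- The bound 3k² ≤ 420 leaves k ≤ 11. `eliminate` makes k a square modulo 3, against 2, 5, 8,
      -- 11, and, as 7 does not divide X, a square modulo 7, against 3, 6, 10. The shape of the form
      -- modulo 4 excludes 7; the squares 4 and 9 are excluded by primitivity.
      module Exclude (s b g h : ℤ) (prim : g * s + h * b ≡ + 1) where
        module V (k : ℕ) (value : F s b ≡ + k) where
          open R₀.Value X y Y s b (+ k) equation value public
          eliminate′ : (+ 3 * (X * X) + + 35) * + k ≡ (+ 3 * (a * a) + + 35 * (b * b)) * (z * z)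
          eliminate′ = trans eliminate (cong ((+ 3 * (a * a) + + 35 * (b * b)) *_) (pow-square y (suc m)))

        e₃ e₇ : ℕ → Expr 4
        e₃ k = (# 3 :* (x₀ :* x₀) :+ # 35) :* # k :+ # 2 :* ((# 3 :* (x₁ :* x₁) :+ # 35 :* (x₂ :* x₂)) :* (x₃ :* x₃))
        e₇ k = (# 3 :* (x₀ :* x₀) :+ # 35) :* # k :+ # 6 :* ((# 3 :* (x₁ :* x₁) :+ # 35 :* (x₂ :* x₂)) :* (x₃ :* x₃))

        ρ : ∀ k → F s b ≡ + k → Vec ℤ 4
        ρ k value = X ∷ V.a k value ∷ b ∷ z ∷ []

        mod3 : ∀ k (value : F s b ≡ + k) → 3 ∣ᶻ ⟦ e₃ k ⟧ (ρ k value)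
        mod3 k value = W , trans (cong (_+ + 2 * W) (V.eliminate′ k value)) (eq W)
          where
          W = (+ 3 * (V.a k value * V.a k value) + + 35 * (b * b)) * (z * z)
          eq : ∀ w → w + + 2 * w ≡ + 3 * w
          eq = solve-∀

        mod7 : ∀ k (value : F s b ≡ + k) → 7 ∣ᶻ ⟦ e₇ k ⟧ (ρ k value)
        mod7 k value = W , trans (cong (_+ + 6 * W) (V.eliminate′ k value)) (eq W)
          where
          W = (+ 3 * (V.a k value * V.a k value) + + 35 * (b * b)) * (z * z)
          eq : ∀ w → w + + 6 * w ≡ + 7 * w
          eq = solve-∀

        not-2 : F s b ≢ + 2
        not-2 v = never 3 (e₃ 2) _ (ρ 2 v) (mod3 2 v)
        not-5 : F s b ≢ + 5
        not-5 v = never 3 (e₃ 5) _ (ρ 5 v) (mod3 5 v)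
        not-8 : F s b ≢ + 8
        not-8 v = never 3 (e₃ 8) _ (ρ 8 v) (mod3 8 v)
        not-11 : F s b ≢ + 11
        not-11 v = never 3 (e₃ 11) _ (ρ 11 v) (mod3 11 v)
        not-3 : F s b ≢ + 3
        not-3 v = no-7∣X (implies 7 (e₇ 3) x₀ _ (ρ 3 v) (mod7 3 v))
        not-6 : F s b ≢ + 6
        not-6 v = no-7∣X (implies 7 (e₇ 6) x₀ _ (ρ 6 v) (mod7 6 v))
        not-10 : F s b ≢ + 10
        not-10 v = no-7∣X (implies 7 (e₇ 10) x₀ _ (ρ 10 v) (mod7 10 v))

        F-z² : ∀ k → F s b ≡ k → + 6 * y * (s * s) + + 2 * (+ 3 * X * (s * b)) + z * z * (b * b) ≡ k
        F-z² k = trans (cong (λ W → + 6 * y * (s * s) + + 2 * (+ 3 * X * (s * b)) + W * (b * b)) (sym (pow-square y (suc m))))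

        not-7 : F s b ≢ + 7
        not-7 v = form≢7 (proj₁ y-mod4) x (proj₁ z-odd) s b (proj₂ y-mod4) (proj₂ X-odd) (proj₂ z-odd) (F-z² (+ 7) v)

        not-4 : F s b ≢ + 4
        not-4 v = common-divisor 2 s b g h (s≤s (s≤s z≤n)) (proj₁ evens) (proj₂ evens) prim
          where
          evens = form≡4 (proj₁ y-mod4) x (proj₁ z-odd) s b (proj₂ y-mod4) (proj₂ X-odd) (proj₂ z-odd) (F-z² (+ 4) v)

        -- Modulo 3 the form is (zb)², and 3 does not divide z, so 3 divides b. Then 9 divides 6ys²,
        -- which forces 3 to divide s as well, against primitivity.
        not-9 : F s b ≢ + 9
        not-9 v = [ (λ d → no-3 (prime-∣-^ prime-3 y (suc m) d)) , three∣b ]′ (prime-∣-* prime-3 z b (implies 3 e (x₂ :* x₄) _ (y ∷ X ∷ z ∷ s ∷ b ∷ []) (+ 3 , value)))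
          where
          e : Expr 5
          e = # 6 :* x₀ :* (x₃ :* x₃) :+ # 2 :* (# 3 :* x₁ :* (x₃ :* x₄)) :+ x₂ :* x₂ :* (x₄ :* x₄)
          value : + 6 * y * (s * s) + + 2 * (+ 3 * X * (s * b)) + z * z * (b * b) ≡ + 9
          value = F-z² (+ 9) v
          three∣b : 3 ∣ᶻ b → ⊥
          three∣b (b′ , b≡) = [ no-3 , (λ d → common-divisor 3 s b g h (s≤s (s≤s z≤n)) d (b′ , b≡) prim) ]′
              (prime-∣-* prime-3 y s (implies 3 (# 2 :* (x₀ :* (x₁ :* x₁))) (x₀ :* x₁) _ (y ∷ s ∷ []) (+ 1 - + 2 * (X * (s * b′)) - Y * (b′ * b′) , ℤ.*-cancelˡ-≡ (+ 3) _ _ divided)))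
            where
            eq : ∀ y X Y s b → + 3 * (+ 2 * (y * (s * s))) ≡ + 6 * y * (s * s) + + 2 * (+ 3 * X * (s * (+ 3 * b))) + Y * (+ 3 * b * (+ 3 * b)) - + 18 * (X * (s * b)) - + 9 * (Y * (b * b))
            eq = solve-∀
            eq′ : ∀ X Y s b → + 9 - + 18 * (X * (s * b)) - + 9 * (Y * (b * b)) ≡ + 3 * (+ 3 * (+ 1 - + 2 * (X * (s * b)) - Y * (b * b)))
            eq′ = solve-∀
            divided : + 3 * (+ 2 * (y * (s * s))) ≡ + 3 * (+ 3 * (+ 1 - + 2 * (X * (s * b′)) - Y * (b′ * b′)))
            divided = trans (eq y X Y s b′) (trans (cong (λ w → w - + 18 * (X * (s * b′)) - + 9 * (Y * (b′ * b′))) (trans (sym (cong (λ b → + 6 * y * (s * s) + + 2 * (+ 3 * X * (s * b)) + Y * (b * b)) b≡)) v)) (eq′ X Y s b′))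

      represents-one : SmallValue 105 (+ (6 ℕ.* suc k)) (+ 3 * X) Y → ∃₂ λ s b → form (+ 3 * + 2 * y) (+ 3 * X) Y s b ≡ + 1
      represents-one (small s b g h k prim val pos bnd) = s , b , go k pos bnd (trans (cong (λ A → form A (+ 3 * X) Y s b) (sym A≡)) val)
        where
        open Exclude s b g h prim
        go : ∀ k → 1 ℕ.≤ k → 3 ℕ.* (k ℕ.* k) ℕ.≤ 420 → F s b ≡ + k → F s b ≡ + 1
        go 1 _ _ v = v
        go 2 _ _ v = ⊥-elim (not-2 v)
        go 3 _ _ v = ⊥-elim (not-3 v)
        go 4 _ _ v = ⊥-elim (not-4 v)
        go 5 _ _ v = ⊥-elim (not-5 v)
        go 6 _ _ v = ⊥-elim (not-6 v)
        go 7 _ _ v = ⊥-elim (not-7 v)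
        go 8 _ _ v = ⊥-elim (not-8 v)
        go 9 _ _ v = ⊥-elim (not-9 v)
        go 10 _ _ v = ⊥-elim (not-10 v)
        go 11 _ _ v = ⊥-elim (not-11 v)
        go (suc (suc (suc (suc (suc (suc (suc (suc (suc (suc (suc (suc j)))))))))))) _ bnd v =
          contradiction (ℕ.≤-trans (ℕ.*-monoʳ-≤ 3 (ℕ.*-mono-≤ (ℕ.m≤m+n 12 j) (ℕ.m≤m+n 12 j))) bnd) (ℕ.<⇒≱ {420} {432} (ℕ.≤ᵇ⇒≤ 421 432 _))

      module _ (h : ℤ) (e : + 3 * (h * h) + + 35 ≡ + 2 * y)
        (sgn : IsSign (re (((y - + 1 * + 35) +√ + 1 * h) ⊛ suc m) + + 3 * h * im (((y - + 1 * + 35) +√ + 1 * h) ⊛ suc m))) where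
        open Functional (+ 3 * h) using (φ; φ≡)

        G : Z√
        G = (y - + 1 * + 35) +√ + 1 * h

        h-odd : ∃ λ t → h ≡ + 1 + + 2 * t
        h-odd = odd⇒ (implies 2 (# 3 :* (var {1} zero :* var zero) :+ # 35) (var zero :+ # 1) _ (h ∷ []) (y , e))

        finish′ : (∃ λ j → h * h ≡ + 1 + + 8 * j) → ⊥
        finish′ (j , h²) = Functional105.no-power h j h² (suc m) (s≤s z≤n) (subst IsSign (trans (sym (φ≡ (G ⊛ suc m))) (cong (λ x → φ (x ⊛ suc m)) G≡)) sgn)
          where
          y-value : y ≡ + 19 + + 12 * j
          y-value = ℤ.*-cancelˡ-≡ (+ 2) y (+ 19 + + 12 * j) (trans (sym e) (trans (cong (λ x → + 3 * x + + 35) h²) (eq j)))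
            where
            eq : ∀ j → + 3 * (+ 1 + + 8 * j) + + 35 ≡ + 2 * (+ 19 + + 12 * j)
            eq = solve-∀
          G≡ : G ≡ ι (+ 12 * j - + 16) ⊕ (+ 0 +√ h)
          G≡ = ext (trans (cong (_- + 1 * + 35) y-value) (trans (eq j) (sym (re-⊕ (ι (+ 12 * j - + 16)) (+ 0 +√ h)))))
              (trans (eq′ h) (sym (im-⊕ (ι (+ 12 * j - + 16)) (+ 0 +√ h))))
            where
            eq : ∀ j → + 19 + + 12 * j - + 1 * + 35 ≡ + 12 * j - + 16 + + 0
            eq = solve-∀
            eq′ : ∀ h → + 1 * h ≡ + 0 + h
            eq′ = solve-∀

        finish : ⊥
        finish = finish′ (odd-square′ h-odd)

    no-solution-105 : ⊥
    no-solution-105 = go (represents-one (smallValue 105 (6 ℕ.* suc k) (s≤s z≤n) (+ 3 * X) Y det))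
      where
      go : (∃₂ λ s b → form (+ 3 * + 2 * y) (+ 3 * X) Y s b ≡ + 1) → ⊥
      go (s , b , value) = go′ (R.reduced X y Y s b equation value coprime (suc m) (subst (λ x → ℤ.NonZero ((x * x) ^ suc m)) (sym y≡) (nonZero-^ k (suc m))) refl)
        where
        go′ : (∃ λ h → + 3 * (h * h) + + 35 ≡ + 2 * y × IsSign (re (((y - + 1 * + 35) +√ + 1 * h) ⊛ suc m) + + 3 * h * im (((y - + 1 * + 35) +√ + 1 * h) ⊛ suc m))) → ⊥
        go′ (h , e , sgn) = finish h e sgn

-- Powers of γ in ℤ[i], for X² + 1 = 2yⁿ

module Functional1 where

  open import Data.Integer using (+_; -[1+_]; _+_; _*_; -_; _-_; _^_)
  open import Data.Integer.Tactic.RingSolver using (solve-∀)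
  open Arith
  open Binomials using (halve)
  open QuadraticRing (+ 1)
  open Divisibility (+ 1)
  open Powers (+ 1)

  module _ (h k : ℤ) (h² : h * h ≡ + 1 + + 8 * k) where
    open Functional h

    -- Here y = (h² + 1)/2 = 1 + 4k, γ = (y - 1) + hi and γ² = -(1 + 4z) with z a multiple of k. As
    -- k = 0 is a genuine solution, powers of k have to be divided out instead of reaching a
    -- contradiction.
    η γ w z : Z√
    η = + 0 +√ h
    γ = ι (+ 4 * k) ⊕ η
    w = ι (+ 2 * k - + 1) ⊕ η
    z = ι (-[1+ 1 ] * k) ⊗ w

    η² : η ⊗ η ≡ ⊝ (ι (+ 1) ⊕ ι (+ 8) ⊗ ι k)
    η² = trans (ext (trans (re-⊗ η η) (eq₁ h)) (trans (im-⊗ η η) (eq₂ h)))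
      (trans (cong (λ x → ι (- x)) h²) (trans (ι-⊝ (+ 1 + + 8 * k)) (cong ⊝_ (trans (ι-⊕ (+ 1) (+ 8 * k)) (cong (ι (+ 1) ⊕_) (ι-⊗ (+ 8) k))))))
      where
      eq₁ : ∀ h → + 0 * + 0 - + 1 * (h * h) ≡ - (h * h)
      eq₁ = solve-∀
      eq₂ : ∀ h → + 0 * h + h * + 0 ≡ + 0
      eq₂ = solve-∀

    φη : φ η ≡ + 1 + + 8 * k
    φη = trans (φ≡ η) (trans (ℤ.+-identityˡ (h * h)) h²)

    γ² : γ ⊛ 2 ≡ ι -[1+ 0 ] ⊗ (ι (+ 1) ⊕ ι (+ 4) ⊗ z)
    γ² = trans (cong₂ (λ x y → (x ⊕ η) ⊗ ((y ⊕ η) ⊗ ι (+ 1))) (ι-⊗ (+ 4) k) (ι-⊗ (+ 4) k))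
      (trans (solve 2 (λ K η → (con (+ 4) :* K :+ η) :* ((con (+ 4) :* K :+ η) :* con (+ 1))
         := con -[1+ 0 ] :* (con (+ 1) :+ con (+ 4) :* (con -[1+ 1 ] :* K :* (con (+ 2) :* K :+ con -[1+ 0 ] :+ η))) :+ (η :* η :+ (con (+ 1) :+ con (+ 8) :* K))) refl (ι k) η)
      (trans (cong₂ (λ x y → x ⊕ (y ⊕ (ι (+ 1) ⊕ ι (+ 8) ⊗ ι k)))
          (cong₂ (λ x y → ι -[1+ 0 ] ⊗ (ι (+ 1) ⊕ ι (+ 4) ⊗ (x ⊗ (y ⊕ η)))) (sym (ι-⊗ -[1+ 1 ] k))
            (trans (cong (_⊕ ι -[1+ 0 ]) (sym (ι-⊗ (+ 2) k))) (sym (ι-⊕ (+ 2 * k) -[1+ 0 ]))))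
          η²)
        (solve 2 (λ x y → x :+ (:- y :+ y) := x) refl (ι -[1+ 0 ] ⊗ (ι (+ 1) ⊕ ι (+ 4) ⊗ z)) (ι (+ 1) ⊕ ι (+ 8) ⊗ ι k))))

    γ-even : ∀ M → γ ⊛ (M ℕ.* 2) ≡ ι (-[1+ 0 ] ^ M) ⊗ (ι (+ 1) ⊕ ι (+ 4) ⊗ z) ⊛ M
    γ-even M = trans (⊛-* γ 2 M) (trans (cong (_⊛ M) γ²) (trans (⊛-⊗ (ι -[1+ 0 ]) (ι (+ 1) ⊕ ι (+ 4) ⊗ z) M) (cong (_⊗ (ι (+ 1) ⊕ ι (+ 4) ⊗ z) ⊛ M) (ι-⊛ -[1+ 0 ] M))))

    φz : φ z ≡ -[1+ 1 ] * k * (+ 10 * k)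
    φz = trans (φ-ι⊗ (-[1+ 1 ] * k) w) (cong (-[1+ 1 ] * k *_) (trans (φ-⊕ (ι (+ 2 * k - + 1)) η) (trans (cong₂ _+_ (φ-ι (+ 2 * k - + 1)) φη) (eq k))))
      where
      eq : ∀ k → + 2 * k - + 1 + (+ 1 + + 8 * k) ≡ + 10 * k
      eq = solve-∀

    φγ : φ γ ≡ + 1 + + 12 * k
    φγ = trans (φ-⊕ (ι (+ 4 * k)) η) (trans (cong₂ _+_ (φ-ι (+ 4 * k)) φη) (eq k))
      where
      eq : ∀ k → + 4 * k + (+ 1 + + 8 * k) ≡ + 1 + + 12 * k
      eq = solve-∀

    -- `φ z` = -20k², while the second-order term is a multiple of 8k². The expansion thus says that
    -- 4k² times an odd number is 0.
    even-case : ∀ M → 1 ℕ.≤ M → IsSign (φ (γ ⊛ (M ℕ.* 2))) → k ≡ + 0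
    even-case M 1≤M hyp = conclude (φ-2-adic z M 1≤M sgn)
      where
      sgn : IsSign (φ ((ι (+ 1) ⊕ ι (+ 4) ⊗ z) ⊛ M))
      sgn = sign-* (-1^ M) (subst IsSign (trans (cong φ (γ-even M)) (φ-ι⊗ (-[1+ 0 ] ^ M) ((ι (+ 1) ⊕ ι (+ 4) ⊗ z) ⊛ M))) hyp)
      zzt : ∀ t → φ (z ⊗ z ⊗ t) ≡ (-[1+ 1 ] * k) * (-[1+ 1 ] * k) * φ (w ⊗ w ⊗ t)
      zzt t = trans (cong φ (trans (solve 3 (λ a w t → a :* w :* (a :* w) :* t := a :* a :* (w :* w :* t)) refl (ι (-[1+ 1 ] * k)) w t)
          (cong (_⊗ (w ⊗ w ⊗ t)) (sym (ι-⊗ (-[1+ 1 ] * k) (-[1+ 1 ] * k))))))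
        (φ-ι⊗ ((-[1+ 1 ] * k) * (-[1+ 1 ] * k)) (w ⊗ w ⊗ t))
      odd : ∀ l → + (1 ℕ.+ 2 ℕ.* l) ≡ + 1 + + 2 * + l
      odd l = cong (λ y → + 1 + y) (ℤ.pos-* 2 l)
      eq : ∀ k l x → (+ 1 + + 2 * l) * (-[1+ 1 ] * k * (+ 10 * k)) + + 2 * ((-[1+ 1 ] * k) * (-[1+ 1 ] * k) * x)
        ≡ + 4 * (k * k) * (+ 1 + + 2 * (x - + 3 - + 5 * l))
      eq = solve-∀
      eq′ : ∀ y → + 2 * - y ≡ + 1 - (+ 1 + + 2 * y)
      eq′ = solve-∀
      finish : ∀ y → + 4 * (k * k) * (+ 1 + + 2 * y) ≡ + 0 → k ≡ + 0
      finish y n = [ (λ h → [ (λ k≡0 → k≡0) , (λ k≡0 → k≡0) ]′ (ℤ.i*j≡0⇒i≡0∨j≡0 k {k} (ℤ.*-cancelˡ-≡ (+ 4) (k * k) (+ 0) h)))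
        , (λ h → ⊥-elim (even≢odd (- y) (trans (eq′ y) (cong (λ y → + 1 - y) h)))) ]′ (ℤ.i*j≡0⇒i≡0∨j≡0 (+ 4 * (k * k)) {+ 1 + + 2 * y} n)
      conclude : (∃₂ λ l t → + (1 ℕ.+ 2 ℕ.* l) * φ z + + 2 * φ (z ⊗ z ⊗ t) ≡ + 0) → k ≡ + 0
      conclude (l , t , e) = finish (φ (w ⊗ w ⊗ t) - + 3 - + 5 * + l) (trans (sym (eq k (+ l) (φ (w ⊗ w ⊗ t)))) (trans (sym (cong₂ (λ x y → x + + 2 * y) (cong₂ _*_ (odd l) φz) (zzt t))) e))

    -- Up to sign the value is 1 + 12k - 8kx. If it is 1, then 4k (3 - 2x) = 0 with an odd second
    -- factor; -1 is excluded modulo 4.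
    odd-case : ∀ M → IsSign (φ (γ ⊛ (1 ℕ.+ M ℕ.* 2))) → k ≡ + 0
    odd-case M hyp = finish (sign-* (-1^ M) (subst IsSign value hyp))
      where
      a = -[1+ 7 ] * k
      c = ⊛-congruence (ι a) (ι (+ 1)) w M
      t = proj₁ c
      x = φ (γ ⊗ t)
      power : (ι (+ 1) ⊕ ι (+ 4) ⊗ z) ⊛ M ≡ ι (+ 1) ⊕ ι a ⊗ t
      power = trans (cong (λ y → (ι (+ 1) ⊕ y) ⊛ M) (trans (sym (⊗-assoc (ι (+ 4)) (ι (-[1+ 1 ] * k)) w))
          (cong (_⊗ w) (trans (sym (ι-⊗ (+ 4) (-[1+ 1 ] * k))) (cong ι (eq k))))))
        (trans (proj₂ c) (cong (_⊕ ι a ⊗ t) (trans (ι-⊛ (+ 1) M) (cong ι (ℤ.^-zeroˡ M)))))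
        where
        eq : ∀ k → + 4 * (-[1+ 1 ] * k) ≡ -[1+ 7 ] * k
        eq = solve-∀
      value : φ (γ ⊛ (1 ℕ.+ M ℕ.* 2)) ≡ -[1+ 0 ] ^ M * (+ 1 + + 12 * k + a * x)
      value = begin
        φ (γ ⊗ γ ⊛ (M ℕ.* 2)) ≡⟨ cong (λ y → φ (γ ⊗ y)) (trans (γ-even M) (cong (ι (-[1+ 0 ] ^ M) ⊗_) power)) ⟩
        φ (γ ⊗ (ι (-[1+ 0 ] ^ M) ⊗ (ι (+ 1) ⊕ ι a ⊗ t))) ≡⟨ cong φ (solve 4 (λ γ e a t → γ :* (e :* (con (+ 1) :+ a :* t)) := e :* (γ :+ a :* (γ :* t))) refl γ (ι (-[1+ 0 ] ^ M)) (ι a) t) ⟩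
        φ (ι (-[1+ 0 ] ^ M) ⊗ (γ ⊕ ι a ⊗ (γ ⊗ t))) ≡⟨ φ-ι⊗ (-[1+ 0 ] ^ M) (γ ⊕ ι a ⊗ (γ ⊗ t)) ⟩
        -[1+ 0 ] ^ M * φ (γ ⊕ ι a ⊗ (γ ⊗ t)) ≡⟨ cong (-[1+ 0 ] ^ M *_) (trans (φ-⊕ γ (ι a ⊗ (γ ⊗ t))) (cong₂ _+_ φγ (φ-ι⊗ a (γ ⊗ t)))) ⟩
        -[1+ 0 ] ^ M * (+ 1 + + 12 * k + a * x) ∎
        where open ≡-Reasoning
      finish : IsSign (+ 1 + + 12 * k + a * x) → k ≡ + 0
      finish (inj₁ e) = [ (λ h → ℤ.*-cancelˡ-≡ (+ 4) k (+ 0) h) , (λ odd → ⊥-elim (even≢odd (x - + 1) (trans (eq′ x) (cong (λ y → + 1 - y) odd)))) ]′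
        (ℤ.i*j≡0⇒i≡0∨j≡0 (+ 4 * k) {+ 1 + + 2 * (+ 1 - x)} (trans (eq k x) (cong (_- + 1) e)))
        where
        eq : ∀ k x → + 4 * k * (+ 1 + + 2 * (+ 1 - x)) ≡ + 1 + + 12 * k + -[1+ 7 ] * k * x - + 1
        eq = solve-∀
        eq′ : ∀ x → + 2 * (x - + 1) ≡ + 1 - (+ 1 + + 2 * (+ 1 - x))
        eq′ = solve-∀
      finish (inj₂ e) = ⊥-elim (no-multiple 4 2 (+ 2 * (k * x) - + 3 * k) (s≤s (s≤s (s≤s z≤n))) (trans (eq k x) (cong (λ y → + 1 - y) e)))
        where
        eq : ∀ k x → + 4 * (+ 2 * (k * x) - + 3 * k) ≡ + 1 - (+ 1 + + 12 * k + -[1+ 7 ] * k * x)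
        eq = solve-∀

    gaussian-power : ∀ m → 1 ℕ.≤ m → IsSign (φ (γ ⊛ m)) → k ≡ + 0
    gaussian-power m 1≤m hyp with halve m
    ... | M , inj₂ refl = odd-case M (subst (λ n → IsSign (φ (γ ⊛ (1 ℕ.+ n)))) (ℕ.*-comm 2 M) hyp)
    ... | zero , inj₁ refl = contradiction 1≤m λ ()
    ... | suc M , inj₁ refl = even-case (suc M) (s≤s z≤n) (subst (λ n → IsSign (φ (γ ⊛ n))) (ℕ.*-comm 2 (suc M)) hyp)

-- Estimates for the three-term recurrence in ℕ

module Growth where

  open import Data.Nat
  open import Data.Nat.Properties
  open import Data.Nat.Tactic.RingSolver

  α β γ : ℕ → ℕ
  α s = (s + 2) * (s + 1)
  β s = 8 * (2 * s + 3) * (s + 1)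
  γ s = 4 * (4 * s + 3) * (4 * s + 5)

  -- The Padé recurrence. All coefficients are nonnegative and it is homogeneous when M, n have
  -- degree 1 and X s has degree s; comparison, scaling and growth rest on these two features.
  Recurrence : (M n : ℕ) → (ℕ → ℕ) → Set
  Recurrence M n X = ∀ s → α s * X (2 + s) ≡ β s * M * X (1 + s) + γ s * (n * n) * X s

  α≢0 : ∀ s → NonZero (α s)
  α≢0 s = m*n≢0 (s + 2) (s + 1) {{subst NonZero (+-comm 2 s) _}} {{subst NonZero (+-comm 1 s) _}}

  β≤ : ∀ s → β s ≤ α s * 16
  β≤ s = ≤-trans (m≤m+n (β s) (8 * (s + 1))) (≤-reflexive (eq s))
    where
    eq : ∀ s → 8 * (2 * s + 3) * (s + 1) + 8 * (s + 1) ≡ (s + 2) * (s + 1) * 16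
    eq = solve-∀

  γ≤ : ∀ s → γ s ≤ α s * 64
  γ≤ s = ≤-trans (m≤m+n (γ s) (64 * s + 68)) (≤-reflexive (eq s))
    where
    eq : ∀ s → 4 * (4 * s + 3) * (4 * s + 5) + (64 * s + 68) ≡ (s + 2) * (s + 1) * 64
    eq = solve-∀

  two-step : ∀ {P : ℕ → Set} → P 0 → P 1 → (∀ s → P s → P (1 + s) → P (2 + s)) → ∀ s → P s
  two-step {P} p₀ p₁ step s = proj₁ (both s)
    where
    both : ∀ s → P s × P (1 + s)
    both zero = p₀ , p₁
    both (suc s) = proj₂ (both s) , step s (proj₁ (both s)) (proj₂ (both s))

  homogeneous : ∀ {M n X Y} k → Recurrence M n X → Recurrence (M * k) (n * k) Y →
    Y 0 ≡ X 0 → Y 1 ≡ k * X 1 → ∀ s → Y s ≡ k ^ s * X s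
  homogeneous {M} {n} {X} {Y} k RX RY e₀ e₁ = two-step
    (trans e₀ (sym (+-identityʳ (X 0)))) (trans e₁ (cong (_* X 1) (sym (*-identityʳ k))))
    λ s h₀ h₁ → *-cancelˡ-≡ _ _ (α s) {{α≢0 s}} (begin
      α s * Y (2 + s) ≡⟨ RY s ⟩
      β s * (M * k) * Y (1 + s) + γ s * (n * k * (n * k)) * Y s ≡⟨ cong₂ (λ x y → β s * (M * k) * x + γ s * (n * k * (n * k)) * y) h₁ h₀ ⟩
      β s * (M * k) * (k * k ^ s * X (1 + s)) + γ s * (n * k * (n * k)) * (k ^ s * X s) ≡⟨ eq₁ (β s) (γ s) M n k (k ^ s) (X (1 + s)) (X s) ⟩
      k * (k * k ^ s) * (β s * M * X (1 + s) + γ s * (n * n) * X s) ≡⟨ cong (k * (k * k ^ s) *_) (sym (RX s)) ⟩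
      k * (k * k ^ s) * (α s * X (2 + s)) ≡⟨ eq₂ (k * (k * k ^ s)) (α s) (X (2 + s)) ⟩
      α s * (k * (k * k ^ s) * X (2 + s)) ∎)
    where
    open ≡-Reasoning
    eq₁ : ∀ b c M n k p x y → b * (M * k) * (k * p * x) + c * (n * k * (n * k)) * (p * y) ≡ k * (k * p) * (b * M * x + c * (n * n) * y)
    eq₁ = solve-∀
    eq₂ : ∀ p a x → p * (a * x) ≡ a * (p * x)
    eq₂ = solve-∀

  module _ {M₁ Δ n : ℕ} {X Y : ℕ → ℕ} (RX : Recurrence M₁ n X) (RY : Recurrence (M₁ + Δ) n Y) where
    private
      M₂ = M₁ + Δ

    monotone : X 0 ≤ Y 0 → X 1 ≤ Y 1 → ∀ s → X s ≤ Y s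
    monotone h₀ h₁ = two-step h₀ h₁ λ s i₀ i₁ → *-cancelˡ-≤ (α s) {{α≢0 s}} (begin
      α s * X (2 + s) ≡⟨ RX s ⟩
      β s * M₁ * X (1 + s) + γ s * (n * n) * X s ≤⟨ +-mono-≤ (*-mono-≤ (*-monoʳ-≤ (β s) (m≤m+n M₁ Δ)) i₁) (*-monoʳ-≤ (γ s * (n * n)) i₀) ⟩
      β s * M₂ * Y (1 + s) + γ s * (n * n) * Y s ≡⟨ sym (RY s) ⟩
      α s * Y (2 + s) ∎)
      where open ≤-Reasoning

    -- A polynomial of degree s with nonnegative coefficients has logarithmic derivative at most s.
    lipschitz : Y 0 ≤ X 0 → M₂ * Y 1 ≤ M₂ * X 1 + Δ * Y 1 → ∀ s → M₂ * Y s ≤ M₂ * X s + s * Δ * Y s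
    lipschitz h₀ h₁ = two-step (≤-trans (*-monoʳ-≤ M₂ h₀) (m≤m+n _ 0))
      (≤-trans h₁ (≤-reflexive (cong (λ x → M₂ * X 1 + x * Y 1) (sym (*-identityˡ Δ)))))
      λ s i₀ i₁ → *-cancelˡ-≤ (α s) {{α≢0 s}} (begin
        α s * (M₂ * Y (2 + s)) ≡⟨ eq₁ (α s) M₂ (Y (2 + s)) ⟩
        M₂ * (α s * Y (2 + s)) ≡⟨ cong (M₂ *_) (RY s) ⟩
        M₂ * (β s * M₂ * Y (1 + s) + γ s * (n * n) * Y s) ≡⟨ eq₂ M₁ Δ (β s) (γ s) (n * n) (Y (1 + s)) (Y s) ⟩
        β s * (M₁ * (M₂ * Y (1 + s)) + Δ * (M₂ * Y (1 + s))) + γ s * (n * n) * (M₂ * Y s)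
          ≤⟨ +-mono-≤ (*-monoʳ-≤ (β s) (+-monoˡ-≤ _ (*-monoʳ-≤ M₁ i₁))) (*-monoʳ-≤ (γ s * (n * n)) i₀) ⟩
        β s * (M₁ * (M₂ * X (1 + s) + (1 + s) * Δ * Y (1 + s)) + Δ * (M₂ * Y (1 + s))) + γ s * (n * n) * (M₂ * X s + s * Δ * Y s)
          ≤⟨ m≤m+n _ (β s * ((1 + s) * Δ * Y (1 + s)) * Δ + γ s * (n * n) * (2 * Δ * Y s)) ⟩
        β s * (M₁ * (M₂ * X (1 + s) + (1 + s) * Δ * Y (1 + s)) + Δ * (M₂ * Y (1 + s))) + γ s * (n * n) * (M₂ * X s + s * Δ * Y s)
          + (β s * ((1 + s) * Δ * Y (1 + s)) * Δ + γ s * (n * n) * (2 * Δ * Y s))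
          ≡⟨ eq₃ M₁ Δ (β s) (γ s) (n * n) (X (1 + s)) (X s) (Y (1 + s)) (Y s) s ⟩
        M₂ * (β s * M₁ * X (1 + s) + γ s * (n * n) * X s) + (2 + s) * Δ * (β s * M₂ * Y (1 + s) + γ s * (n * n) * Y s)
          ≡⟨ cong₂ (λ x y → M₂ * x + (2 + s) * Δ * y) (sym (RX s)) (sym (RY s)) ⟩
        M₂ * (α s * X (2 + s)) + (2 + s) * Δ * (α s * Y (2 + s)) ≡⟨ eq₄ (α s) M₂ (X (2 + s)) ((2 + s) * Δ) (Y (2 + s)) ⟩
        α s * (M₂ * X (2 + s) + (2 + s) * Δ * Y (2 + s)) ∎)
      where
      open ≤-Reasoning
      eq₁ : ∀ a m y → a * (m * y) ≡ m * (a * y)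
      eq₁ = solve-∀
      eq₂ : ∀ M Δ b c n y₁ y₀ → (M + Δ) * (b * (M + Δ) * y₁ + c * n * y₀) ≡ b * (M * ((M + Δ) * y₁) + Δ * ((M + Δ) * y₁)) + c * n * ((M + Δ) * y₀)
      eq₂ = solve-∀
      eq₃ : ∀ M Δ b c n x₁ x₀ y₁ y₀ s → b * (M * ((M + Δ) * x₁ + (1 + s) * Δ * y₁) + Δ * ((M + Δ) * y₁)) + c * n * ((M + Δ) * x₀ + s * Δ * y₀)
        + (b * ((1 + s) * Δ * y₁) * Δ + c * n * (2 * Δ * y₀))
        ≡ (M + Δ) * (b * M * x₁ + c * n * x₀) + (2 + s) * Δ * (b * (M + Δ) * y₁ + c * n * y₀)
      eq₃ = solve-∀
      eq₄ : ∀ a m x d y → m * (a * x) + d * (a * y) ≡ a * (m * x + d * y)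
      eq₄ = solve-∀

  -- With β/α ≤ 16 and γ/α ≤ 64 the induction needs 16 · 17M² + 64n² ≤ 17²M², and 17² = 16 · 17 + 17
  -- is exactly what the hypothesis supplies.
  growth : ∀ {M n X} → Recurrence M n X → 64 * (n * n) ≤ 17 * (M * M) → ∀ c K →
    c * X 0 ≤ K → c * X 1 ≤ K * (17 * M) → ∀ s → c * X s ≤ K * (17 * M) ^ s
  growth {M} {n} {X} R h c K h₀ h₁ = two-step
    (≤-trans h₀ (≤-reflexive (sym (*-identityʳ K)))) (≤-trans h₁ (≤-reflexive (cong (K *_) (sym (*-identityʳ (17 * M))))))
    λ s i₀ i₁ → *-cancelˡ-≤ (α s) {{α≢0 s}} (begin
      α s * (c * X (2 + s)) ≡⟨ eq₁ (α s) c (X (2 + s)) ⟩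
      c * (α s * X (2 + s)) ≡⟨ cong (c *_) (R s) ⟩
      c * (β s * M * X (1 + s) + γ s * (n * n) * X s) ≡⟨ eq₂ c (β s) M (X (1 + s)) (γ s) (n * n) (X s) ⟩
      β s * M * (c * X (1 + s)) + γ s * (n * n) * (c * X s)
        ≤⟨ +-mono-≤ (*-mono-≤ (*-monoˡ-≤ M (β≤ s)) i₁) (*-mono-≤ (*-monoˡ-≤ (n * n) (γ≤ s)) i₀) ⟩
      α s * 16 * M * (K * (17 * M * (17 * M) ^ s)) + α s * 64 * (n * n) * (K * (17 * M) ^ s)
        ≡⟨ eq₃ (α s) K M ((17 * M) ^ s) (n * n) ⟩
      α s * K * (17 * M) ^ s * (272 * (M * M) + 64 * (n * n)) ≤⟨ *-monoʳ-≤ (α s * K * (17 * M) ^ s) (+-monoʳ-≤ (272 * (M * M)) h) ⟩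
      α s * K * (17 * M) ^ s * (272 * (M * M) + 17 * (M * M)) ≡⟨ eq₄ (α s) K M ((17 * M) ^ s) ⟩
      α s * (K * (17 * M * (17 * M * (17 * M) ^ s))) ∎)
    where
    open ≤-Reasoning
    eq₁ : ∀ a m y → a * (m * y) ≡ m * (a * y)
    eq₁ = solve-∀
    eq₂ : ∀ c b M x g n y → c * (b * M * x + g * n * y) ≡ b * M * (c * x) + g * n * (c * y)
    eq₂ = solve-∀
    eq₃ : ∀ a K M p n → a * 16 * M * (K * (17 * M * p)) + a * 64 * n * (K * p) ≡ a * K * p * (272 * (M * M) + 64 * n)
    eq₃ = solve-∀
    eq₄ : ∀ a K M p → a * K * p * (272 * (M * M) + 17 * (M * M)) ≡ a * (K * (17 * M * (17 * M * p)))
    eq₄ = solve-∀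

-- Padé approximants of the fourth root

module Pade where

  open import Data.Integer using (+_; -[1+_]; _+_; _*_; -_; _-_)
  open import Data.Integer.Tactic.RingSolver using (solve-∀)
  open Binomials
  open QuadraticRing (+ 1)
  open PowerSeries (+ 1)

  re-ι⊗ : ∀ k z → re (ι k ⊗ z) ≡ k * re z
  re-ι⊗ k z = trans (re-⊗ (ι k) z) (eq k (re z) (im z))
    where
    eq : ∀ k x y → k * x - + 1 * (+ 0 * y) ≡ k * x
    eq = solve-∀

  im-ι⊗ : ∀ k z → im (ι k ⊗ z) ≡ k * im z
  im-ι⊗ k z = trans (im-⊗ (ι k) z) (eq k (re z) (im z))
    where
    eq : ∀ k x y → k * y + + 0 * x ≡ k * y
    eq = solve-∀

  -- P s is the coefficient of z^s in (1 - 4(m + ni)z)^(-s-1) (1 - 8niz)^(s-1/4), hence a Gaussian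
  -- integer. The quotients p/q are the convergents of the continued fraction of tan(θ/4) in terms
  -- of tan θ = n/m, starting with 0 and n/(4m).
  module Approximant (m n : ℤ) where
    private
      x = + 0 +√ n
      a = ι (+ 4) ⊗ (ι m ⊕ x)
      β = ι (+ 2) ⊗ x

      x² : x ⊗ x ≡ ι (- (n * n))
      x² = ext (trans (re-⊗ x x) (eq₁ n)) (trans (im-⊗ x x) (eq₂ n))
        where
        eq₁ : ∀ n → + 0 * + 0 - + 1 * (n * n) ≡ - (n * n)
        eq₁ = solve-∀
        eq₂ : ∀ n → + 0 * n + n * + 0 ≡ + 0
        eq₂ = solve-∀

      pow : ℕ → Z√
      pow zero = ι (+ 1)
      pow (suc k) = x ⊗ pow k

      c : ℕ → Z√
      c k = ι (+ binomial k) ⊗ pow k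

      c-suc : ∀ k → ι (+ suc k) ⊗ c (suc k) ≡ β ⊗ (ι (+ 4) ⊗ ι (+ k) ⊕ ⊝ ι -[1+ 0 ]) ⊗ c k
      c-suc k = begin
        ι (+ suc k) ⊗ (ι (+ binomial (suc k)) ⊗ (x ⊗ pow k))
          ≡⟨ sym (⊗-assoc (ι (+ suc k)) (ι (+ binomial (suc k))) (x ⊗ pow k)) ⟩
        ι (+ suc k) ⊗ ι (+ binomial (suc k)) ⊗ (x ⊗ pow k)
          ≡⟨ cong (_⊗ (x ⊗ pow k)) (trans (sym (ι-⊗ (+ suc k) (+ binomial (suc k)))) (cong ι scalar)) ⟩
        ι (+ 2 * (+ 4 * + k + + 1) * + binomial k) ⊗ (x ⊗ pow k)
          ≡⟨ cong (_⊗ (x ⊗ pow k)) (trans (ι-⊗ (+ 2 * (+ 4 * + k + + 1)) (+ binomial k)) (cong (_⊗ ι (+ binomial k))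
               (trans (ι-⊗ (+ 2) (+ 4 * + k + + 1)) (cong (ι (+ 2) ⊗_) (trans (ι-⊕ (+ 4 * + k) (+ 1)) (cong (_⊕ ι (+ 1)) (ι-⊗ (+ 4) (+ k)))))))) ⟩
        ι (+ 2) ⊗ (ι (+ 4) ⊗ ι (+ k) ⊕ ι (+ 1)) ⊗ ι (+ binomial k) ⊗ (x ⊗ pow k)
          ≡⟨ solve 4 (λ k e x y → con (+ 2) :* (con (+ 4) :* k :+ con (+ 1)) :* e :* (x :* y)
               := (con (+ 2) :* x) :* (con (+ 4) :* k :+ :- con -[1+ 0 ]) :* (e :* y)) refl (ι (+ k)) (ι (+ binomial k)) x (pow k) ⟩
        β ⊗ (ι (+ 4) ⊗ ι (+ k) ⊕ ⊝ ι -[1+ 0 ]) ⊗ c k ∎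
        where
        open ≡-Reasoning
        scalar : + suc k * + binomial (suc k) ≡ + 2 * (+ 4 * + k + + 1) * + binomial k
        scalar = begin
          + suc k * + binomial (suc k) ≡⟨ sym (ℤ.pos-* (suc k) (binomial (suc k))) ⟩
          + (suc k ℕ.* binomial (suc k)) ≡⟨ cong +_ (binomial-suc k) ⟩
          + (2 ℕ.* (4 ℕ.* k ℕ.+ 1) ℕ.* binomial k) ≡⟨ ℤ.pos-* (2 ℕ.* (4 ℕ.* k ℕ.+ 1)) (binomial k) ⟩
          + (2 ℕ.* (4 ℕ.* k ℕ.+ 1)) * + binomial k ≡⟨ cong (_* + binomial k) (ℤ.pos-* 2 (4 ℕ.* k ℕ.+ 1)) ⟩
          + 2 * (+ (4 ℕ.* k) + + 1) * + binomial k ≡⟨ cong (λ y → + 2 * (y + + 1) * + binomial k) (ℤ.pos-* 4 k) ⟩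
          + 2 * (+ 4 * + k + + 1) * + binomial k ∎

      open Diagonal a β c

    P : ℕ → Z√
    P = upper

    p q : ℕ → ℤ
    q s = re (P s)
    p s = im (P s)

    A B C : ℕ → ℤ
    A s = (+ s + + 2) * (+ s + + 1)
    B s = + 8 * (+ 2 * + s + + 3) * (+ s + + 1)
    C s = + 4 * (+ 4 * + s + + 3) * (+ 4 * + s + + 5)

    private
      -- 2a - 4β = 8m and β² = -4n² are real although a and β are not, so real and imaginary part
      -- satisfy the same recurrence.
      P-recurrence : ∀ s → ι (A s) ⊗ P (2 ℕ.+ s) ≡ ι (B s * m) ⊗ P (1 ℕ.+ s) ⊕ ι (C s * (n * n)) ⊗ P s
      P-recurrence s = ⊖-cancel (trans (trans (cong₂ (λ u w → u ⊗ P (2 ℕ.+ s) ⊕ ⊝ w) A-ι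
          (cong₂ (λ u w → u ⊗ P (1 ℕ.+ s) ⊕ w ⊗ P s) B-ι C-ι))
        (trans (solve 6 (λ S m x P₂ P₁ P₀ →
          (S :+ con (+ 2)) :* (S :+ con (+ 1)) :* P₂
          :+ :- (con (+ 8) :* (con (+ 2) :* S :+ con (+ 3)) :* (S :+ con (+ 1)) :* m :* P₁
                :+ con (+ 4) :* (con (+ 4) :* S :+ con (+ 3)) :* (con (+ 4) :* S :+ con (+ 5)) :* :- (x :* x) :* P₀)
          := (S :+ con (+ 2)) :* (S :+ con (+ 1)) :* P₂
             :+ :- ((con (+ 2) :* S :+ con (+ 3)) :* (S :+ con (+ 1)) :* (con (+ 2) :* (con (+ 4) :* (m :+ x)) :+ :- (con (+ 4) :* (con (+ 2) :* x))) :* P₁)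
             :+ (con (+ 4) :* S :+ con (+ 3)) :* (con (+ 4) :* S :+ con (+ 5)) :* ((con (+ 2) :* x) :* (con (+ 2) :* x)) :* P₀)
          refl S (ι m) x (P (2 ℕ.+ s)) (P (1 ℕ.+ s)) (P s))
        (upper-recurrence c-suc s))) refl)
        where
        S = ι (+ s)
        lin : ∀ k l → ι (+ k * + s + + l) ≡ ι (+ k) ⊗ S ⊕ ι (+ l)
        lin k l = trans (ι-⊕ (+ k * + s) (+ l)) (cong (_⊕ ι (+ l)) (ι-⊗ (+ k) (+ s)))
        A-ι : ι (A s) ≡ (S ⊕ ι (+ 2)) ⊗ (S ⊕ ι (+ 1))
        A-ι = trans (ι-⊗ (+ s + + 2) (+ s + + 1)) (cong₂ _⊗_ (ι-⊕ (+ s) (+ 2)) (ι-⊕ (+ s) (+ 1)))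
        B-ι : ι (B s * m) ≡ ι (+ 8) ⊗ (ι (+ 2) ⊗ S ⊕ ι (+ 3)) ⊗ (S ⊕ ι (+ 1)) ⊗ ι m
        B-ι = trans (ι-⊗ (B s) m) (cong (_⊗ ι m) (trans (ι-⊗ (+ 8 * (+ 2 * + s + + 3)) (+ s + + 1))
          (cong₂ _⊗_ (trans (ι-⊗ (+ 8) (+ 2 * + s + + 3)) (cong (ι (+ 8) ⊗_) (lin 2 3))) (ι-⊕ (+ s) (+ 1)))))
        C-ι : ι (C s * (n * n)) ≡ ι (+ 4) ⊗ (ι (+ 4) ⊗ S ⊕ ι (+ 3)) ⊗ (ι (+ 4) ⊗ S ⊕ ι (+ 5)) ⊗ ⊝ (x ⊗ x)
        C-ι = trans (ι-⊗ (C s) (n * n)) (cong₂ _⊗_ (trans (ι-⊗ (+ 4 * (+ 4 * + s + + 3)) (+ 4 * + s + + 5))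
          (cong₂ _⊗_ (trans (ι-⊗ (+ 4) (+ 4 * + s + + 3)) (cong (ι (+ 4) ⊗_) (lin 4 3))) (lin 4 5)))
          (trans (trans (cong ι (sym (ℤ.neg-involutive (n * n)))) (ι-⊝ (- (n * n)))) (cong ⊝_ (sym x²))))

    q-recurrence : ∀ s → A s * q (2 ℕ.+ s) ≡ B s * m * q (1 ℕ.+ s) + C s * (n * n) * q s
    q-recurrence s = begin
      A s * q (2 ℕ.+ s) ≡⟨ sym (re-ι⊗ (A s) (P (2 ℕ.+ s))) ⟩
      re (ι (A s) ⊗ P (2 ℕ.+ s)) ≡⟨ cong re (P-recurrence s) ⟩
      re (ι (B s * m) ⊗ P (1 ℕ.+ s) ⊕ ι (C s * (n * n)) ⊗ P s) ≡⟨ re-⊕ _ _ ⟩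
      re (ι (B s * m) ⊗ P (1 ℕ.+ s)) + re (ι (C s * (n * n)) ⊗ P s) ≡⟨ cong₂ _+_ (re-ι⊗ (B s * m) (P (1 ℕ.+ s))) (re-ι⊗ (C s * (n * n)) (P s)) ⟩
      B s * m * q (1 ℕ.+ s) + C s * (n * n) * q s ∎
      where open ≡-Reasoning

    p-recurrence : ∀ s → A s * p (2 ℕ.+ s) ≡ B s * m * p (1 ℕ.+ s) + C s * (n * n) * p s
    p-recurrence s = begin
      A s * p (2 ℕ.+ s) ≡⟨ sym (im-ι⊗ (A s) (P (2 ℕ.+ s))) ⟩
      im (ι (A s) ⊗ P (2 ℕ.+ s)) ≡⟨ cong im (P-recurrence s) ⟩
      im (ι (B s * m) ⊗ P (1 ℕ.+ s) ⊕ ι (C s * (n * n)) ⊗ P s) ≡⟨ im-⊕ _ _ ⟩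
      im (ι (B s * m) ⊗ P (1 ℕ.+ s)) + im (ι (C s * (n * n)) ⊗ P s) ≡⟨ cong₂ _+_ (im-ι⊗ (B s * m) (P (1 ℕ.+ s))) (im-ι⊗ (C s * (n * n)) (P s)) ⟩
      B s * m * p (1 ℕ.+ s) + C s * (n * n) * p s ∎
      where open ≡-Reasoning

    private
      c₀ : c 0 ≡ ι (+ 1)
      c₀ = trans (cong (λ e → ι (+ e) ⊗ ι (+ 1)) binomial-0) (⊗-identityˡ (ι (+ 1)))

      P₀ : P 0 ≡ ι (+ 1)
      P₀ = trans (solve 2 (λ a c₀ → c₀ :+ a :* (con (+ 0) :+ a :* con (+ 0)) := c₀) refl a (c 0)) c₀

      binomial-1 : binomial 1 ≡ 2
      binomial-1 = trans (sym (ℕ.*-identityˡ (binomial 1))) (trans (binomial-suc 0) (cong (2 ℕ.*_) binomial-0))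

      P₁ : P 1 ≡ ι (+ 8 * m) ⊕ ι (+ 2) ⊗ x
      P₁ = begin
        P 1 ≡⟨ solve 4 (λ a b c₀ c₁ →
          let m₁ = con (+ 0) :+ :- (b :* con (+ 0)) ; m₂ = c₀ :+ :- (b :* con (+ 0)) ; m₃ = c₁ :+ :- (b :* c₀)
              d₁ = m₁ :+ a :* con (+ 0) ; d₂ = m₂ :+ a :* d₁ ; d₃ = m₃ :+ a :* d₂
              e₁ = d₁ :+ a :* con (+ 0) ; e₂ = d₂ :+ a :* e₁ ; e₃ = d₃ :+ a :* e₂ in
          e₃ := c₁ :+ :- (b :* c₀) :+ con (+ 2) :* a :* c₀) refl a (ι (+ 4) ⊗ β) (c 0) (c 1) ⟩
        c 1 ⊕ ⊝ (ι (+ 4) ⊗ β ⊗ c 0) ⊕ ι (+ 2) ⊗ a ⊗ c 0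
          ≡⟨ cong₂ (λ y z → y ⊕ ⊝ (ι (+ 4) ⊗ β ⊗ z) ⊕ ι (+ 2) ⊗ a ⊗ z) (cong (λ e → ι (+ e) ⊗ (x ⊗ ι (+ 1))) binomial-1) c₀ ⟩
        _ ≡⟨ solve 2 (λ m x → con (+ 2) :* (x :* con (+ 1)) :+ :- (con (+ 4) :* (con (+ 2) :* x) :* con (+ 1)) :+ con (+ 2) :* (con (+ 4) :* (m :+ x)) :* con (+ 1)
               := con (+ 8) :* m :+ con (+ 2) :* x) refl (ι m) x ⟩
        ι (+ 8) ⊗ ι m ⊕ ι (+ 2) ⊗ x ≡⟨ cong (_⊕ ι (+ 2) ⊗ x) (sym (ι-⊗ (+ 8) m)) ⟩
        ι (+ 8 * m) ⊕ ι (+ 2) ⊗ x ∎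
        where open ≡-Reasoning

    q-0 : q 0 ≡ + 1
    q-0 = cong re P₀
    p-0 : p 0 ≡ + 0
    p-0 = cong im P₀
    q-1 : q 1 ≡ + 8 * m
    q-1 = trans (cong re P₁) (trans (re-⊕ (ι (+ 8 * m)) (ι (+ 2) ⊗ x)) (trans (cong (λ y → + 8 * m + y) (re-ι⊗ (+ 2) x)) (ℤ.+-identityʳ (+ 8 * m))))
    p-1 : p 1 ≡ + 2 * n
    p-1 = trans (cong im P₁) (trans (im-⊕ (ι (+ 8 * m)) (ι (+ 2) ⊗ x)) (trans (cong (λ y → + 0 + y) (im-ι⊗ (+ 2) x)) (ℤ.+-identityˡ (+ 2 * n))))

-- The exact error at a fourth power

module ExactFormula where

  open import Data.Nat using (_!)
  open import Data.Nat.Divisibility using (_∣_; quotient)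
  open import Data.Nat.Combinatorics using (k![n∸k]!∣n!)
  import Data.Nat.Tactic.RingSolver as ℕR
  open import Data.Integer using (+_; -[1+_]; _+_; _*_; -_; _-_; _^_)
  import Data.Integer.Base as ℤ
  open import Data.Integer.Tactic.RingSolver using (solve-∀)
  open QuadraticRing (+ 1)
  open PowerSeries (+ 1)
  open Pade

  ^-distribʳ : ∀ k x y → (x ℕ.* y) ℕ.^ k ≡ x ℕ.^ k ℕ.* y ℕ.^ k
  ^-distribʳ zero x y = refl
  ^-distribʳ (suc k) x y = trans (cong (x ℕ.* y ℕ.*_) (^-distribʳ k x y)) (eq x y (x ℕ.^ k) (y ℕ.^ k))
    where
    eq : ∀ x y p q → x ℕ.* y ℕ.* (p ℕ.* q) ≡ x ℕ.* p ℕ.* (y ℕ.* q)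
    eq = ℕR.solve-∀

  private
    central∣ : ∀ n → n ! ℕ.* n ! ∣ (2 ℕ.* n) !
    central∣ n = subst (λ k → n ! ℕ.* k ! ∣ (2 ℕ.* n) !) (trans (ℕ.m+n∸m≡n n (n ℕ.+ 0)) (ℕ.+-identityʳ n)) (k![n∸k]!∣n! (ℕ.m≤m+n n (n ℕ.+ 0)))

  -- The coefficients of (1 - 4z)^(-1/2).
  central : ℕ → ℕ
  central n = quotient (central∣ n)

  central-suc : ∀ n → suc n ℕ.* central (suc n) ≡ (4 ℕ.* n ℕ.+ 2) ℕ.* central n
  central-suc n = ℕ.*-cancelʳ-≡ _ _ (suc n ℕ.* (n ! ℕ.* n !)) {{ℕ.m*n≢0 (suc n) (n ! ℕ.* n !) {{_}} {{ℕ.m*n≢0 (n !) (n !) {{n ℕ.!≢0}} {{n ℕ.!≢0}}}}}} (begin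
    suc n ℕ.* central (suc n) ℕ.* (suc n ℕ.* (n ! ℕ.* n !)) ≡⟨ eq₁ n (central (suc n)) (n !) ⟩
    central (suc n) ℕ.* (suc n ! ℕ.* suc n !) ≡⟨ sym (_∣_.equality (central∣ (suc n))) ⟩
    (2 ℕ.* suc n) ! ≡⟨ cong _! (eq₂ n) ⟩
    (2 ℕ.+ 2 ℕ.* n) ! ≡⟨ cong (λ x → (2 ℕ.+ 2 ℕ.* n) ℕ.* ((1 ℕ.+ 2 ℕ.* n) ℕ.* x)) (_∣_.equality (central∣ n)) ⟩
    (2 ℕ.+ 2 ℕ.* n) ℕ.* ((1 ℕ.+ 2 ℕ.* n) ℕ.* (central n ℕ.* (n ! ℕ.* n !))) ≡⟨ eq₃ n (central n) (n ! ℕ.* n !) ⟩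
    (4 ℕ.* n ℕ.+ 2) ℕ.* central n ℕ.* (suc n ℕ.* (n ! ℕ.* n !)) ∎)
    where
    open ≡-Reasoning
    eq₁ : ∀ n c f → suc n ℕ.* c ℕ.* (suc n ℕ.* (f ℕ.* f)) ≡ c ℕ.* (suc n ℕ.* f ℕ.* (suc n ℕ.* f))
    eq₁ = ℕR.solve-∀
    eq₂ : ∀ n → 2 ℕ.* suc n ≡ 2 ℕ.+ 2 ℕ.* n
    eq₂ = ℕR.solve-∀
    eq₃ : ∀ n c f → (2 ℕ.+ 2 ℕ.* n) ℕ.* ((1 ℕ.+ 2 ℕ.* n) ℕ.* (c ℕ.* f)) ≡ (4 ℕ.* n ℕ.+ 2) ℕ.* c ℕ.* (suc n ℕ.* f)
    eq₃ = ℕR.solve-∀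

  central-0 : central 0 ≡ 1
  central-0 = trans (sym (ℕ.*-identityʳ (central 0))) (sym (_∣_.equality (central∣ 0)))

  central-1 : central 1 ≡ 2
  central-1 = trans (sym (ℕ.*-identityˡ (central 1))) (trans (central-suc 0) (cong (2 ℕ.*_) central-0))

  central≤ : ∀ n → central n ℕ.≤ 4 ℕ.^ n
  central≤ zero = ℕ.≤-reflexive central-0
  central≤ (suc n) = ℕ.*-cancelˡ-≤ (suc n) (begin
    suc n ℕ.* central (suc n) ≡⟨ central-suc n ⟩
    (4 ℕ.* n ℕ.+ 2) ℕ.* central n ≤⟨ ℕ.*-mono-≤ (ℕ.+-monoʳ-≤ (4 ℕ.* n) (s≤s (s≤s z≤n))) (central≤ n) ⟩
    (4 ℕ.* n ℕ.+ 4) ℕ.* 4 ℕ.^ n ≡⟨ eq n (4 ℕ.^ n) ⟩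
    suc n ℕ.* (4 ℕ.* 4 ℕ.^ n) ∎)
    where
    open ℕ.≤-Reasoning
    eq : ∀ n p → (4 ℕ.* n ℕ.+ 4) ℕ.* p ≡ suc n ℕ.* (4 ℕ.* p)
    eq = ℕR.solve-∀

  -- N s is the coefficient of z^s in (1 - 4Uz)^(-s-1) (1 - 4wz)^(-1/2). The series are copied over
  -- ℕ, so that nonnegativity is built in.
  module Remainder (U w : ℕ) where
    private
      a = ι (+ 4) ⊗ ι (+ U)
      β = ι (+ w)

      t : ℕ → ℕ
      t k = central k ℕ.* w ℕ.^ k

      c : ℕ → Z√
      c k = ι (+ t k)

      t-suc : ∀ k → suc k ℕ.* t (suc k) ≡ w ℕ.* (4 ℕ.* k ℕ.+ 2) ℕ.* t k
      t-suc k = trans (eq₁ (suc k) (central (suc k)) w (w ℕ.^ k)) (trans (cong (λ x → w ℕ.* (x ℕ.* w ℕ.^ k)) (central-suc k)) (eq₂ w (4 ℕ.* k ℕ.+ 2) (central k) (w ℕ.^ k)))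
        where
        eq₁ : ∀ k c w p → k ℕ.* (c ℕ.* (w ℕ.* p)) ≡ w ℕ.* (k ℕ.* c ℕ.* p)
        eq₁ = ℕR.solve-∀
        eq₂ : ∀ w l c p → w ℕ.* (l ℕ.* c ℕ.* p) ≡ w ℕ.* l ℕ.* (c ℕ.* p)
        eq₂ = ℕR.solve-∀

      c-suc : ∀ k → ι (+ suc k) ⊗ c (suc k) ≡ β ⊗ (ι (+ 4) ⊗ ι (+ k) ⊕ ⊝ ι -[1+ 1 ]) ⊗ c k
      c-suc k = begin
        ι (+ suc k) ⊗ c (suc k) ≡⟨ sym (ι-⊗ (+ suc k) (+ t (suc k))) ⟩
        ι (+ suc k * + t (suc k)) ≡⟨ cong ι (sym (ℤ.pos-* (suc k) (t (suc k)))) ⟩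
        ι (+ (suc k ℕ.* t (suc k))) ≡⟨ cong (λ x → ι (+ x)) (t-suc k) ⟩
        ι (+ (w ℕ.* (4 ℕ.* k ℕ.+ 2) ℕ.* t k)) ≡⟨ cong ι (trans (ℤ.pos-* (w ℕ.* (4 ℕ.* k ℕ.+ 2)) (t k)) (cong (_* + t k)
           (trans (ℤ.pos-* w (4 ℕ.* k ℕ.+ 2)) (cong (λ x → + w * (x + + 2)) (ℤ.pos-* 4 k))))) ⟩
        ι (+ w * (+ 4 * + k + + 2) * + t k) ≡⟨ ι-⊗ (+ w * (+ 4 * + k + + 2)) (+ t k) ⟩
        ι (+ w * (+ 4 * + k + + 2)) ⊗ c k ≡⟨ cong (_⊗ c k) (trans (ι-⊗ (+ w) (+ 4 * + k + + 2)) (cong (β ⊗_) (trans (ι-⊕ (+ 4 * + k) (+ 2)) (cong (_⊕ ι (+ 2)) (ι-⊗ (+ 4) (+ k)))))) ⟩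
        β ⊗ (ι (+ 4) ⊗ ι (+ k) ⊕ ι (+ 2)) ⊗ c k ≡⟨ cong (λ x → β ⊗ (ι (+ 4) ⊗ ι (+ k) ⊕ x) ⊗ c k) (ι-⊝ -[1+ 1 ]) ⟩
        β ⊗ (ι (+ 4) ⊗ ι (+ k) ⊕ ⊝ ι -[1+ 1 ]) ⊗ c k ∎
        where
        open ≡-Reasoning

      divℕ : (ℕ → ℕ) → ℕ → ℕ
      divℕ f zero = 0
      divℕ f (suc k) = f (suc k) ℕ.+ 4 ℕ.* U ℕ.* divℕ f k

      padℕ : ℕ → ℕ
      padℕ zero = 0
      padℕ (suc zero) = 0
      padℕ (suc (suc k)) = t k

      divsℕ : ℕ → ℕ → ℕ
      divsℕ zero = padℕ
      divsℕ (suc n) = divℕ (divsℕ n)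

      pad-ι : ∀ k → pad c k ≡ ι (+ padℕ k)
      pad-ι zero = refl
      pad-ι (suc zero) = refl
      pad-ι (suc (suc k)) = refl

      divs-ι : ∀ n k → divs a n (pad c) k ≡ ι (+ divsℕ n k)
      divs-ι zero k = pad-ι k
      divs-ι (suc n) zero = refl
      divs-ι (suc n) (suc k) = begin
        divs a n (pad c) (suc k) ⊕ a ⊗ divs a (suc n) (pad c) k ≡⟨ cong₂ (λ x y → x ⊕ a ⊗ y) (divs-ι n (suc k)) (divs-ι (suc n) k) ⟩
        ι (+ divsℕ n (suc k)) ⊕ ι (+ 4) ⊗ ι (+ U) ⊗ ι (+ divsℕ (suc n) k)
          ≡⟨ cong (ι (+ divsℕ n (suc k)) ⊕_) (trans (cong (_⊗ ι (+ divsℕ (suc n) k)) (sym (ι-⊗ (+ 4) (+ U)))) (sym (ι-⊗ (+ 4 * + U) (+ divsℕ (suc n) k)))) ⟩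
        ι (+ divsℕ n (suc k)) ⊕ ι (+ 4 * + U * + divsℕ (suc n) k) ≡⟨ sym (ι-⊕ (+ divsℕ n (suc k)) (+ 4 * + U * + divsℕ (suc n) k)) ⟩
        ι (+ divsℕ n (suc k) + + 4 * + U * + divsℕ (suc n) k) ≡⟨ cong (λ x → ι (+ divsℕ n (suc k) + x)) (trans (cong (_* + divsℕ (suc n) k) (sym (ℤ.pos-* 4 U))) (sym (ℤ.pos-* (4 ℕ.* U) (divsℕ (suc n) k)))) ⟩
        ι (+ divsℕ (suc n) (suc k)) ∎
        where open ≡-Reasoning

    N : ℕ → ℕ
    N s = divsℕ (suc s) (2 ℕ.+ s)

    private
      module S = Diagonal a β c

      lower-ι : ∀ s → S.lower s ≡ ι (+ N s)
      lower-ι s = divs-ι (suc s) (2 ℕ.+ s)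

    N-recurrence : ∀ s →
      (+ s + + 2) * (+ s + + 1) * (+ U + - + w) * + N (2 ℕ.+ s)
        + + 2 * (+ 2 * + s + + 3) * (+ s + + 1) * (-[1+ 3 ] * + U * + U + + 4 * + U * + w + + w * + w) * + N (1 ℕ.+ s)
        + - (+ 4 * (+ 4 * + s + + 3) * (+ 4 * + s + + 5) * + U * (+ w * + w) * + N s) ≡ + 0
    N-recurrence s = cong re (trans (sym
      (⊕∼ (⊕∼ (⊗∼ (⊗∼ (⊗∼ (⊕∼ refl refl) (⊕∼ refl refl)) (⊕∼ refl (⊝∼ refl))) (lower-ι (2 ℕ.+ s)))
              (⊗∼ (⊗∼ (⊗∼ (⊗∼ refl (⊕∼ (⊗∼ refl refl) refl)) (⊕∼ refl refl))
                (⊕∼ (⊕∼ (⊗∼ (⊗∼ refl refl) refl) (⊗∼ (⊗∼ refl refl) refl)) (⊗∼ refl refl))) (lower-ι (1 ℕ.+ s))))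
          (⊝∼ (⊗∼ (⊗∼ (⊗∼ (⊗∼ (⊗∼ refl (⊕∼ (⊗∼ refl refl) refl)) (⊕∼ (⊗∼ refl refl) refl)) refl) (⊗∼ refl refl)) (lower-ι s)))))
      (S.lower-recurrence (ι (+ U)) refl c-suc s))
      where
      ⊕∼ : ∀ {x y k l} → x ≡ ι k → y ≡ ι l → x ⊕ y ≡ ι (k + l)
      ⊕∼ {k = k} {l} refl refl = sym (ι-⊕ k l)
      ⊗∼ : ∀ {x y k l} → x ≡ ι k → y ≡ ι l → x ⊗ y ≡ ι (k * l)
      ⊗∼ {k = k} {l} refl refl = sym (ι-⊗ k l)
      ⊝∼ : ∀ {x k} → x ≡ ι k → ⊝ x ≡ ι (- k)
      ⊝∼ {k = k} refl = sym (ι-⊝ k)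

    N-0 : N 0 ≡ 1
    N-0 rewrite ℕ.*-zeroʳ (4 ℕ.* U) | ℕ.*-zeroʳ (4 ℕ.* U) | central-0 = refl

    N-1 : N 1 ≡ 8 ℕ.* U ℕ.+ 2 ℕ.* w
    N-1 = trans (eq U (t 1) (t 0)) (trans (cong₂ (λ x y → x ℕ.* (w ℕ.* 1) ℕ.+ 8 ℕ.* U ℕ.* (y ℕ.* 1)) central-1 central-0) (eq′ U w))
      where
      eq : ∀ U t₁ t₀ → let d₁ = 4 ℕ.* U ℕ.* 0 ; d₂ = t₀ ℕ.+ 4 ℕ.* U ℕ.* d₁ ; d₃ = t₁ ℕ.+ 4 ℕ.* U ℕ.* d₂ in
        d₃ ℕ.+ 4 ℕ.* U ℕ.* (d₂ ℕ.+ 4 ℕ.* U ℕ.* (d₁ ℕ.+ 4 ℕ.* U ℕ.* 0)) ≡ t₁ ℕ.+ 8 ℕ.* U ℕ.* t₀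
      eq = ℕR.solve-∀
      eq′ : ∀ U w → 2 ℕ.* (w ℕ.* 1) ℕ.+ 8 ℕ.* U ℕ.* 1 ≡ 8 ℕ.* U ℕ.+ 2 ℕ.* w
      eq′ = ℕR.solve-∀

    -- The bound 2^n (8U)^k for the coefficient of z^k after n divisions by 1 - 4Uz reproduces
    -- itself: the feedback term 4U · 2^(n+1) (8U)^k equals the bound 2^n (8U)^(k+1) for the other
    -- summand.
    N≤ : w ℕ.≤ U → ∀ s → N s ℕ.≤ 2 ℕ.* (16 ℕ.* U) ℕ.^ s
    N≤ w≤U s = ℕ.≤-trans (bound (suc s) s) (ℕ.≤-reflexive (begin
      2 ℕ.* 2 ℕ.^ s ℕ.* (8 ℕ.* U) ℕ.^ s ≡⟨ ℕ.*-assoc 2 (2 ℕ.^ s) ((8 ℕ.* U) ℕ.^ s) ⟩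
      2 ℕ.* (2 ℕ.^ s ℕ.* (8 ℕ.* U) ℕ.^ s) ≡⟨ cong (2 ℕ.*_) (sym (^-distribʳ s 2 (8 ℕ.* U))) ⟩
      2 ℕ.* (2 ℕ.* (8 ℕ.* U)) ℕ.^ s ≡⟨ cong (λ x → 2 ℕ.* x ℕ.^ s) (eq U) ⟩
      2 ℕ.* (16 ℕ.* U) ℕ.^ s ∎))
      where
      open ≡-Reasoning
      eq : ∀ U → 2 ℕ.* (8 ℕ.* U) ≡ 16 ℕ.* U
      eq = ℕR.solve-∀
      bound : ∀ n k → divsℕ n (2 ℕ.+ k) ℕ.≤ 2 ℕ.^ n ℕ.* (8 ℕ.* U) ℕ.^ k
      bound zero k = ℕ.≤-trans (ℕ.*-mono-≤ (central≤ k) (ℕ.^-monoˡ-≤ k w≤U)) (ℕ.≤-trans (ℕ.≤-reflexive (sym (^-distribʳ k 4 U)))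
        (ℕ.≤-trans (ℕ.^-monoˡ-≤ k (ℕ.*-monoˡ-≤ U {4} {8} (ℕ.m≤m+n 4 4))) (ℕ.≤-reflexive (sym (ℕ.*-identityˡ _)))))
      bound (suc n) zero = ℕ.≤-trans (ℕ.≤-reflexive (trans (cong (λ x → divsℕ n 2 ℕ.+ 4 ℕ.* U ℕ.* x) (one n)) (trans (cong (divsℕ n 2 ℕ.+_) (ℕ.*-zeroʳ (4 ℕ.* U))) (ℕ.+-identityʳ _))))
        (ℕ.≤-trans (bound n zero) (ℕ.*-monoˡ-≤ 1 (ℕ.m≤n*m (2 ℕ.^ n) 2)))
        where
        one : ∀ n → divsℕ (suc n) 1 ≡ 0
        one zero = ℕ.*-zeroʳ (4 ℕ.* U)
        one (suc n) = trans (cong₂ ℕ._+_ (one n) (ℕ.*-zeroʳ (4 ℕ.* U))) refl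
      bound (suc n) (suc k) = ℕ.≤-trans (ℕ.+-mono-≤ (bound n (suc k)) (ℕ.*-monoʳ-≤ (4 ℕ.* U) (bound (suc n) k)))
        (ℕ.≤-reflexive (eq′ U (2 ℕ.^ n) ((8 ℕ.* U) ℕ.^ k)))
        where
        eq′ : ∀ U x y → x ℕ.* (8 ℕ.* U ℕ.* y) ℕ.+ 4 ℕ.* U ℕ.* (2 ℕ.* x ℕ.* y) ≡ 2 ℕ.* x ℕ.* (8 ℕ.* U ℕ.* y)
        eq′ = ℕR.solve-∀

  -- For u + vi with m + ni = (u + vi)⁴ the approximant to the fourth root is exact up
  -- to a closed form: v q - u p = (-4)^s v^(2s+1) N.
  module _ (u v w : ℕ) (u²≡ : u ℕ.* u ≡ w ℕ.+ v ℕ.* v) where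
    private
      open module N = Remainder (u ℕ.* u) w using (N; N-recurrence; N-0; N-1; N≤)
      U V W ρ σ : ℤ
      U = + u * + u
      V = + v * + v
      W = + w
      ρ = -[1+ 3 ] * U * U + + 4 * U * W + W * W
      σ = + 4 * (+ u * + v) * W

      open Approximant ρ σ

      A≢0 : ∀ s → ℤ.NonZero (A s)
      A≢0 s = subst ℤ.NonZero (sym (trans (cong₂ (λ a b → + a * + b) (ℕ.+-comm s 2) (ℕ.+-comm s 1)) (sym (ℤ.pos-* (2 ℕ.+ s) (1 ℕ.+ s))))) _

      U≡ : + (u ℕ.* u) ≡ U
      U≡ = ℤ.pos-* u u
      UWV : U ≡ W + V
      UWV = trans (sym U≡) (trans (cong +_ u²≡) (cong (λ x → W + x) (ℤ.pos-* v v)))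

      L Y : ℕ → ℤ
      L s = + v * q s - + u * p s
      Y s = (-[1+ 3 ] * V) ^ s * + v * + N s

      L-recurrence : ∀ s → A s * L (2 ℕ.+ s) ≡ B s * ρ * L (1 ℕ.+ s) + C s * (σ * σ) * L s
      L-recurrence s = trans (eq₁ (A s) (+ v) (+ u) (q (2 ℕ.+ s)) (p (2 ℕ.+ s))) (trans (cong₂ (λ x y → + v * x - + u * y) (q-recurrence s) (p-recurrence s))
        (eq₂ (+ v) (+ u) (B s * ρ) (C s * (σ * σ)) (q (1 ℕ.+ s)) (p (1 ℕ.+ s)) (q s) (p s)))
        where
        eq₁ : ∀ A v u q p → A * (v * q - u * p) ≡ v * (A * q) - u * (A * p)
        eq₁ = solve-∀
        eq₂ : ∀ v u B C q₁ p₁ q₀ p₀ → v * (B * q₁ + C * q₀) - u * (B * p₁ + C * p₀) ≡ B * (v * q₁ - u * p₁) + C * (v * q₀ - u * p₀)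
        eq₂ = solve-∀

      N-recurrence′ : ∀ s →
        (+ s + + 2) * (+ s + + 1) * V * + N (2 ℕ.+ s)
          + + 2 * (+ 2 * + s + + 3) * (+ s + + 1) * ρ * + N (1 ℕ.+ s)
          + - (+ 4 * (+ 4 * + s + + 3) * (+ 4 * + s + + 5) * U * (W * W) * + N s) ≡ + 0
      N-recurrence′ s = subst₂ (λ x y → (+ s + + 2) * (+ s + + 1) * x * + N (2 ℕ.+ s)
          + + 2 * (+ 2 * + s + + 3) * (+ s + + 1) * (-[1+ 3 ] * y * y + + 4 * y * W + W * W) * + N (1 ℕ.+ s)
          + - (+ 4 * (+ 4 * + s + + 3) * (+ 4 * + s + + 5) * y * (W * W) * + N s) ≡ + 0)
        (trans (cong (λ x → x + - W) (trans U≡ UWV)) (eq W V)) U≡ (N-recurrence s)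
        where
        eq : ∀ W V → W + V + - W ≡ V
        eq = solve-∀

      -- The recurrence of N multiplied by 16V (-4V)^s v; the identity σ² = 16UVW² matches the last
      -- coefficient. With equal initial values, L and Y then coincide.
      Y-recurrence : ∀ s → A s * Y (2 ℕ.+ s) ≡ B s * ρ * Y (1 ℕ.+ s) + C s * (σ * σ) * Y s
      Y-recurrence s = ℤ.i-j≡0⇒i≡j _ _ (trans (eq (+ s) (+ u) (+ v) W ρ ((-[1+ 3 ] * V) ^ s) (+ N (2 ℕ.+ s)) (+ N (1 ℕ.+ s)) (+ N s))
        (trans (cong (λ x → + 16 * V * (-[1+ 3 ] * V) ^ s * + v * x) (N-recurrence′ s)) (ℤ.*-zeroʳ (+ 16 * V * (-[1+ 3 ] * V) ^ s * + v))))
        where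
        eq : ∀ S u v W ρ E n₂ n₁ n₀ →
          (S + + 2) * (S + + 1) * (-[1+ 3 ] * (v * v) * (-[1+ 3 ] * (v * v) * E) * v * n₂)
          - (+ 8 * (+ 2 * S + + 3) * (S + + 1) * ρ * (-[1+ 3 ] * (v * v) * E * v * n₁)
             + + 4 * (+ 4 * S + + 3) * (+ 4 * S + + 5) * (+ 4 * (u * v) * W * (+ 4 * (u * v) * W)) * (E * v * n₀))
          ≡ + 16 * (v * v) * E * v * ((S + + 2) * (S + + 1) * (v * v) * n₂ + + 2 * (+ 2 * S + + 3) * (S + + 1) * ρ * n₁
             + - (+ 4 * (+ 4 * S + + 3) * (+ 4 * S + + 5) * (u * u) * (W * W) * n₀))
        eq = solve-∀

      both : ∀ s → L s ≡ Y s × L (1 ℕ.+ s) ≡ Y (1 ℕ.+ s)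
      both zero = zeroth , first
        where
        zeroth : L 0 ≡ Y 0
        zeroth = trans (cong₂ (λ x y → + v * x - + u * y) q-0 p-0) (trans (eq (+ u) (+ v)) (cong (λ x → + 1 * + v * + x) (sym N-0)))
          where
          eq : ∀ u v → v * + 1 - u * + 0 ≡ + 1 * v * + 1
          eq = solve-∀
        first : L 1 ≡ Y 1
        first = trans (cong₂ (λ x y → + v * x - + u * y) q-1 p-1) (trans (eq (+ u) (+ v) U W) (cong₂ (λ x y → -[1+ 3 ] * x * + 1 * + v * y)
          (trans (cong (λ x → x + - W) UWV) (eq′ W V))
          (trans (cong (λ x → + 8 * x + + 2 * W) (sym U≡)) (trans (cong₂ _+_ (sym (ℤ.pos-* 8 (u ℕ.* u))) (sym (ℤ.pos-* 2 w))) (cong +_ (sym N-1))))))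
          where
          eq : ∀ u v U W → v * (+ 8 * (-[1+ 3 ] * (u * u) * (u * u) + + 4 * (u * u) * W + W * W)) - u * (+ 2 * (+ 4 * (u * v) * W))
            ≡ -[1+ 3 ] * (u * u + - W) * + 1 * v * (+ 8 * (u * u) + + 2 * W)
          eq = solve-∀
          eq′ : ∀ W V → W + V + - W ≡ V
          eq′ = solve-∀
      both (suc s) = proj₂ (both s) , next s (proj₁ (both s)) (proj₂ (both s))
        where
        next : ∀ s → L s ≡ Y s → L (1 ℕ.+ s) ≡ Y (1 ℕ.+ s) → L (2 ℕ.+ s) ≡ Y (2 ℕ.+ s)
        next s h₀ h₁ = ℤ.*-cancelˡ-≡ (A s) (L (2 ℕ.+ s)) (Y (2 ℕ.+ s)) {{A≢0 s}} (trans (L-recurrence s)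
          (trans (cong₂ (λ x y → B s * ρ * x + C s * (σ * σ) * y) h₁ h₀) (sym (Y-recurrence s))))

    exact : ∀ s → + v * q s - + u * p s ≡ (-[1+ 3 ] * V) ^ s * + v * + N s
    exact s = proj₁ (both s)

-- The approximants as natural numbers

module NaturalPade where

  open import Data.Integer using (+_; -[1+_]; _+_; _*_; -_; _-_; _^_; ∣_∣)
  open import Data.Integer.Tactic.RingSolver using (solve-∀)
  open Arith
  open Pade
  open ExactFormula
  open Growth

  module _ (M n : ℕ) where
    open Approximant (+ M) (+ n) hiding (P)

    A≡ : ∀ s → A s ≡ + α s
    A≡ s = sym (ℤ.pos-* (s ℕ.+ 2) (s ℕ.+ 1))
    B≡ : ∀ s → B s ≡ + β s
    B≡ s = trans (cong (λ x → + 8 * (x + + 3) * (+ s + + 1)) (sym (ℤ.pos-* 2 s)))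
      (trans (cong (_* (+ s + + 1)) (sym (ℤ.pos-* 8 (2 ℕ.* s ℕ.+ 3)))) (sym (ℤ.pos-* (8 ℕ.* (2 ℕ.* s ℕ.+ 3)) (s ℕ.+ 1))))
    C≡ : ∀ s → C s ≡ + γ s
    C≡ s = trans (cong₂ (λ x y → + 4 * (x + + 3) * (y + + 5)) (sym (ℤ.pos-* 4 s)) (sym (ℤ.pos-* 4 s)))
      (trans (cong (_* + (4 ℕ.* s ℕ.+ 5)) (sym (ℤ.pos-* 4 (4 ℕ.* s ℕ.+ 3)))) (sym (ℤ.pos-* (4 ℕ.* (4 ℕ.* s ℕ.+ 3)) (4 ℕ.* s ℕ.+ 5))))

    -- Nonnegative initial values stay nonnegative because every coefficient of the recurrence is;
    -- the absolute values then satisfy it in ℕ.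
    module Abs (x : ℕ → ℤ) (x₀ : x 0 ≡ + ∣ x 0 ∣) (x₁ : x 1 ≡ + ∣ x 1 ∣)
      (rec : ∀ s → A s * x (2 ℕ.+ s) ≡ B s * + M * x (1 ℕ.+ s) + C s * (+ n * + n) * x s) where
      private
        rec′ : ∀ s → x s ≡ + ∣ x s ∣ → x (1 ℕ.+ s) ≡ + ∣ x (1 ℕ.+ s) ∣ →
          + α s * x (2 ℕ.+ s) ≡ + (β s ℕ.* M ℕ.* ∣ x (1 ℕ.+ s) ∣ ℕ.+ γ s ℕ.* (n ℕ.* n) ℕ.* ∣ x s ∣)
        rec′ s h₀ h₁ = begin
          + α s * x (2 ℕ.+ s) ≡⟨ cong (_* x (2 ℕ.+ s)) (sym (A≡ s)) ⟩
          A s * x (2 ℕ.+ s) ≡⟨ rec s ⟩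
          B s * + M * x (1 ℕ.+ s) + C s * (+ n * + n) * x s ≡⟨ cong₂ _+_ (cong₂ (λ b y → b * + M * y) (B≡ s) h₁) (cong₂ (λ c y → c * (+ n * + n) * y) (C≡ s) h₀) ⟩
          + β s * + M * + ∣ x (1 ℕ.+ s) ∣ + + γ s * (+ n * + n) * + ∣ x s ∣
            ≡⟨ cong₂ _+_ (trans (cong (_* + ∣ x (1 ℕ.+ s) ∣) (sym (ℤ.pos-* (β s) M))) (sym (ℤ.pos-* (β s ℕ.* M) ∣ x (1 ℕ.+ s) ∣)))
               (trans (cong (_* + ∣ x s ∣) (trans (cong (+ γ s *_) (sym (ℤ.pos-* n n))) (sym (ℤ.pos-* (γ s) (n ℕ.* n))))) (sym (ℤ.pos-* (γ s ℕ.* (n ℕ.* n)) ∣ x s ∣))) ⟩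
          + (β s ℕ.* M ℕ.* ∣ x (1 ℕ.+ s) ∣) + + (γ s ℕ.* (n ℕ.* n) ℕ.* ∣ x s ∣) ∎
          where open ≡-Reasoning

      x≡ : ∀ s → x s ≡ + ∣ x s ∣
      x≡ = two-step x₀ x₁ λ s h₀ h₁ → nonneg (α s) (x (2 ℕ.+ s)) _ {{α≢0 s}} (rec′ s h₀ h₁)

      recurrence : Recurrence M n (λ s → ∣ x s ∣)
      recurrence s = ℤ.+-injective (trans (ℤ.pos-* (α s) ∣ x (2 ℕ.+ s) ∣) (trans (cong (+ α s *_) (sym (x≡ (2 ℕ.+ s)))) (rec′ s (x≡ s) (x≡ (1 ℕ.+ s)))))

    private
      q₁≡ : q 1 ≡ + (8 ℕ.* M)
      q₁≡ = trans q-1 (sym (ℤ.pos-* 8 M))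
      p₁≡ : p 1 ≡ + (2 ℕ.* n)
      p₁≡ = trans p-1 (sym (ℤ.pos-* 2 n))

      abs≡ : ∀ {z k} → z ≡ + k → z ≡ + ∣ z ∣
      abs≡ refl = refl

      module AbsQ = Abs q (abs≡ q-0) (abs≡ q₁≡) q-recurrence
      module AbsP = Abs p (abs≡ p-0) (abs≡ p₁≡) p-recurrence

    opaque
      Q P : ℕ → ℕ
      Q s = ∣ q s ∣
      P s = ∣ p s ∣

      q≡Q : ∀ s → q s ≡ + Q s
      q≡Q = AbsQ.x≡
      p≡P : ∀ s → p s ≡ + P s
      p≡P = AbsP.x≡

      Q-recurrence : Recurrence M n Q
      Q-recurrence = AbsQ.recurrence
      P-recurrence : Recurrence M n P
      P-recurrence = AbsP.recurrence

      Q-0 : Q 0 ≡ 1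
      Q-0 = cong ∣_∣ q-0
      Q-1 : Q 1 ≡ 8 ℕ.* M
      Q-1 = cong ∣_∣ q₁≡
      P-0 : P 0 ≡ 0
      P-0 = cong ∣_∣ p-0
      P-1 : P 1 ≡ 2 ℕ.* n
      P-1 = cong ∣_∣ p₁≡

  -- The exact formula, with M + n i = (u + v i)⁴.
  exact-∣∣ : ∀ u v w R → u ℕ.* u ≡ w ℕ.+ v ℕ.* v → R ℕ.+ 4 ℕ.* w ℕ.* (v ℕ.* v) ℕ.+ 4 ℕ.* (v ℕ.* v) ℕ.* (v ℕ.* v) ≡ w ℕ.* w → ∀ s →
    let σ = 4 ℕ.* (u ℕ.* v) ℕ.* w in
    ∣ + v * + Q R σ s - + u * + P R σ s ∣ ≡ (4 ℕ.* (v ℕ.* v)) ℕ.^ s ℕ.* v ℕ.* Remainder.N (u ℕ.* u) w s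
  exact-∣∣ u v w R e r s = begin
    ∣ + v * + Q R σ s - + u * + P R σ s ∣ ≡⟨ cong₂ (λ x y → ∣ + v * x - + u * y ∣) (sym (q≡Q R σ s)) (sym (p≡P R σ s)) ⟩
    ∣ + v * Approximant.q (+ R) (+ σ) s - + u * Approximant.p (+ R) (+ σ) s ∣
      ≡⟨ cong₂ (λ x y → ∣ + v * Approximant.q x y s - + u * Approximant.p x y s ∣) ρ≡ σ≡ ⟩
    _ ≡⟨ cong ∣_∣ (exact u v w e s) ⟩
    ∣ (-[1+ 3 ] * (+ v * + v)) ^ s * + v * + Remainder.N (u ℕ.* u) w s ∣ ≡⟨ ℤ.abs-* ((-[1+ 3 ] * (+ v * + v)) ^ s * + v) (+ Remainder.N (u ℕ.* u) w s) ⟩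
    ∣ (-[1+ 3 ] * (+ v * + v)) ^ s * + v ∣ ℕ.* Remainder.N (u ℕ.* u) w s ≡⟨ cong (ℕ._* Remainder.N (u ℕ.* u) w s) (trans (ℤ.abs-* ((-[1+ 3 ] * (+ v * + v)) ^ s) (+ v)) (cong (ℕ._* v) (pow s))) ⟩
    (4 ℕ.* (v ℕ.* v)) ℕ.^ s ℕ.* v ℕ.* Remainder.N (u ℕ.* u) w s ∎
    where
    open ≡-Reasoning
    σ = 4 ℕ.* (u ℕ.* v) ℕ.* w
    pow : ∀ s → ∣ (-[1+ 3 ] * (+ v * + v)) ^ s ∣ ≡ (4 ℕ.* (v ℕ.* v)) ℕ.^ s
    pow zero = refl
    pow (suc s) = trans (ℤ.abs-* (-[1+ 3 ] * (+ v * + v)) ((-[1+ 3 ] * (+ v * + v)) ^ s))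
      (cong₂ ℕ._*_ (trans (ℤ.abs-* -[1+ 3 ] (+ v * + v)) (cong (4 ℕ.*_) (ℤ.abs-* (+ v) (+ v)))) (pow s))
    σ≡ : + σ ≡ + 4 * (+ u * + v) * + w
    σ≡ = trans (ℤ.pos-* (4 ℕ.* (u ℕ.* v)) w) (cong (_* + w) (trans (ℤ.pos-* 4 (u ℕ.* v)) (cong (+ 4 *_) (ℤ.pos-* u v))))
    u²≡ : + u * + u ≡ + w + + v * + v
    u²≡ = trans (sym (ℤ.pos-* u u)) (trans (cong +_ e) (cong (λ x → + w + x) (ℤ.pos-* v v)))
    r′ : + R + + 4 * + w * (+ v * + v) + + 4 * (+ v * + v) * (+ v * + v) ≡ + w * + w
    r′ = trans (cong₂ (λ x y → + R + x + y)
        (sym (trans (ℤ.pos-* (4 ℕ.* w) (v ℕ.* v)) (cong₂ _*_ (ℤ.pos-* 4 w) (ℤ.pos-* v v))))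
        (sym (trans (ℤ.pos-* (4 ℕ.* (v ℕ.* v)) (v ℕ.* v)) (cong₂ _*_ (trans (ℤ.pos-* 4 (v ℕ.* v)) (cong (+ 4 *_) (ℤ.pos-* v v))) (ℤ.pos-* v v)))))
      (trans (cong +_ r) (ℤ.pos-* w w))
    ρ≡ : + R ≡ -[1+ 3 ] * (+ u * + u) * (+ u * + u) + + 4 * (+ u * + u) * + w + + w * + w
    ρ≡ = trans (eq₁ (+ R) (+ w) (+ v)) (trans (cong (λ x → x + - (+ 4 * + w * (+ v * + v)) + - (+ 4 * (+ v * + v) * (+ v * + v))) r′)
      (trans (eq₂ (+ w) (+ v)) (cong (λ x → -[1+ 3 ] * x * x + + 4 * x * + w + + w * + w) (sym u²≡))))
      where
      eq₁ : ∀ R w v → R ≡ R + + 4 * w * (v * v) + + 4 * (v * v) * (v * v) + - (+ 4 * w * (v * v)) + - (+ 4 * (v * v) * (v * v))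
      eq₁ = solve-∀
      eq₂ : ∀ w v → w * w + - (+ 4 * w * (v * v)) + - (+ 4 * (v * v) * (v * v))
        ≡ -[1+ 3 ] * (w + v * v) * (w + v * v) + + 4 * (w + v * v) * w + w * w
      eq₂ = solve-∀

-- Numerical constants and the change of argument

module Perturbation where

  open import Data.Nat
  open import Data.Nat.Properties
  open import Data.Nat.Divisibility using (_∣_)
  open import Data.Nat.Tactic.RingSolver
  open import Data.Integer using (+_)
  open import Data.Unit using (tt)
  open Growth
  open NaturalPade
  open ExactFormula

  -- The reference point of the approximation is 239² + 1 = 2 · 13⁴: κ = 239, e₀ = 13⁴ and E = 4 e₀.
  -- For u ≥ u₀ one has w ≥ w₀ and w ≥ c u v, where c = 4 κ - 6.
  opaque
    κ c E K b u₀ w₀ r e₀ : ℕ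
    κ = 239
    c = 950
    E = 114244
    K = 800000000000
    b = 59
    u₀ = 30
    w₀ = 720
    r = 159
    e₀ = 28561

    4κ≡c+6 : 4 * κ ≡ c + 6
    4κ≡c+6 = refl
    E<6uvw : E < 6 * (u₀ * w₀)
    E<6uvw = ≤ᵇ⇒≤ _ _ tt
    E≤159w : E ≤ r * w₀
    E≤159w = ≤ᵇ⇒≤ _ _ tt
    E≤4uvw : E ≤ 4 * (u₀ * (c * u₀))
    E≤4uvw = ≤ᵇ⇒≤ _ _ tt
    E<5w : E < 5 * (c * u₀)
    E<5w = ≤ᵇ⇒≤ _ _ tt
    slope≤ : 2 * (4 * κ + 6 + r) ≤ 17 * κ
    slope≤ = ≤ᵇ⇒≤ _ _ tt
    -- The exact remainder is of order (64u²v²)^s, and σ = 4uvw ≥ 4c u²v²; so b is the gain per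
    -- step, and 59 is the largest integer that c = 950 admits.
    64b≤4c : 64 * b ≤ 4 * c
    64b≤4c = ≤ᵇ⇒≤ _ _ tt
    -- K is 4κc³ rounded down; it makes κσ at least K v⁴, the room for replacing ρ by κσ.
    K≤ : K ≤ 4 * κ * (c * (c * c))
    K≤ = ≤ᵇ⇒≤ _ _ tt
    64≤17κ² : 64 ≤ 17 * (κ * κ)
    64≤17κ² = ≤ᵇ⇒≤ _ _ tt
    -- 4κ is 1 modulo 5, which lets it be cancelled from the factor 5 in the second approximant.
    4κ≡ : 4 * κ ≡ 191 * 5 + 1
    4κ≡ = refl
    b²<16κ : b * b < 4 * (4 * κ)
    b²<16κ = ≤ᵇ⇒≤ _ _ tt
    -- A step from s to s + 1 multiplies s g^s by at most 2g, while the lower bound for v³ gains b³.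
    2g≤b³ : 17 * (κ + 1) * 2 ≤ b * (b * b)
    2g≤b³ = ≤ᵇ⇒≤ _ _ tt
    start₁ : 64 * (4 * 1 * E * (17 * (κ + 1)) ^ 1) < K * 1
    start₁ = ≤ᵇ⇒≤ _ _ tt
    -- A narrow estimate, about 3.24 · 10²² against 3.37 · 10²². The analogue with exponents 3 and 1
    -- is false, so a second approximant is available only for 4v > b².
    start₂ : 64 * (4 * 4 * E * (17 * (κ + 1)) ^ 4) < K * (b * (b * b)) ^ 2
    start₂ = ≤ᵇ⇒≤ _ _ tt
    u₀≡30 : u₀ ≡ 30
    u₀≡30 = refl
    5w₀≤4u₀² : 5 * w₀ ≤ 4 * (u₀ * u₀)
    5w₀≤4u₀² = ≤ᵇ⇒≤ _ _ tt
    1≤u₀ : 1 ≤ u₀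
    1≤u₀ = ≤ᵇ⇒≤ _ _ tt
    1≤w₀ : 1 ≤ w₀
    1≤w₀ = ≤ᵇ⇒≤ _ _ tt
    1≤κ : 1 ≤ κ
    1≤κ = ≤ᵇ⇒≤ _ _ tt
    1≤b : 1 ≤ b
    1≤b = ≤ᵇ⇒≤ _ _ tt
    -- The rotation by 45° multiplies ρ and σ by -4, so the tolerance has to be 4 · 13⁴.
    E≡4e₀ : E ≡ 4 * e₀
    E≡4e₀ = refl
    -- With (3 - 2i)⁴ = -119 - 120i the expression ρ - κσ has the coefficients 120κ - 119 and 119κ +
    -- 120; they agree exactly for κ = 239, and their common value is 13⁴.
    120κ≡ : + 120 ℤ.* + κ ℤ.- + 119 ≡ + e₀
    120κ≡ = refl
    119κ≡ : + 119 ℤ.* + κ ℤ.+ + 120 ≡ + e₀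
    119κ≡ = refl
    E<u₀⁴ : E < u₀ * u₀ * (u₀ * u₀)
    E<u₀⁴ = ≤ᵇ⇒≤ _ _ tt
    2≤b : 2 ≤ b
    2≤b = ≤ᵇ⇒≤ _ _ tt

  -- Growth per step relative to σ: the summand 1 pays for replacing κσ by the larger argument H ≤
  -- (κ + 1)σ.
  g : ℕ
  g = 17 * (κ + 1)

  ∣+-+∣ : ∀ m n → ℤ.∣ + m ℤ.- + n ∣ ≡ ∣ m - n ∣
  ∣+-+∣ m n = trans (cong ℤ.∣_∣ (ℤ.m-n≡m⊖n m n)) (go m n)
    where
    go : ∀ m n → ℤ.∣ m ℤ.⊖ n ∣ ≡ ∣ m - n ∣
    go m n with ≤-total m n
    ... | inj₁ h = trans (ℤ.∣⊖∣-≤ h) (sym (m≤n⇒∣m-n∣≡n∸m h))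
    ... | inj₂ h = trans (cong ℤ.∣_∣ (ℤ.⊖-≥ h)) (sym (trans (∣-∣-comm m n) (m≤n⇒∣m-n∣≡n∸m h)))

  -- Both arguments of the approximant are within E of each other; H is the larger.
  module Near (n : ℕ) where
    ordered : ∀ M Δ s → (M + Δ) * ∣ Q (M + Δ) n s - Q M n s ∣ ≤ s * Δ * Q (M + Δ) n s × (M + Δ) * ∣ P (M + Δ) n s - P M n s ∣ ≤ s * Δ * P (M + Δ) n s
    ordered M Δ s =
      dist (monotone {M} {Δ} {n} (Q-recurrence M n) (Q-recurrence H n) (≤-reflexive Q₀) Q₁ s)
           (lipschitz {M} {Δ} {n} (Q-recurrence M n) (Q-recurrence H n) (≤-reflexive (sym Q₀)) Q₁′ s) ,
      dist (monotone {M} {Δ} {n} (P-recurrence M n) (P-recurrence H n) (≤-reflexive P₀) (≤-reflexive P₁) s)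
           (lipschitz {M} {Δ} {n} (P-recurrence M n) (P-recurrence H n) (≤-reflexive (sym P₀)) (≤-trans (≤-reflexive (cong (H *_) (sym P₁))) (m≤m+n _ _)) s)
      where
      H = M + Δ
      dist : ∀ {x y k} → x ≤ y → H * y ≤ H * x + k → H * ∣ y - x ∣ ≤ k
      dist {x} {y} {k} le h = begin
        H * ∣ y - x ∣ ≡⟨ cong (H *_) (trans (∣-∣-comm y x) (m≤n⇒∣m-n∣≡n∸m le)) ⟩
        H * (y ∸ x) ≡⟨ *-distribˡ-∸ H y x ⟩
        H * y ∸ H * x ≤⟨ ∸-monoˡ-≤ (H * x) h ⟩
        H * x + k ∸ H * x ≡⟨ m+n∸m≡n (H * x) k ⟩
        k ∎
        where open ≤-Reasoning
      Q₀ : Q M n 0 ≡ Q H n 0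
      Q₀ = trans (Q-0 M n) (sym (Q-0 H n))
      Q₁ : Q M n 1 ≤ Q H n 1
      Q₁ = subst₂ _≤_ (sym (Q-1 M n)) (sym (Q-1 H n)) (*-monoʳ-≤ 8 (m≤m+n M Δ))
      Q₁′ : H * Q H n 1 ≤ H * Q M n 1 + Δ * Q H n 1
      Q₁′ rewrite Q-1 M n | Q-1 H n = ≤-reflexive (eq M Δ)
        where
        eq : ∀ M Δ → (M + Δ) * (8 * (M + Δ)) ≡ (M + Δ) * (8 * M) + Δ * (8 * (M + Δ))
        eq = solve-∀
      P₀ : P M n 0 ≡ P H n 0
      P₀ = trans (P-0 M n) (sym (P-0 H n))
      P₁ : P M n 1 ≡ P H n 1
      P₁ = trans (P-1 M n) (sym (P-1 H n))

    Close : (M M′ H : ℕ) → Set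
    Close M M′ H = ∀ s → H * ∣ Q M n s - Q M′ n s ∣ ≤ s * E * Q H n s × H * ∣ P M n s - P M′ n s ∣ ≤ s * E * P H n s

    close-≤ : ∀ {M H} → M ≤ H → H ≤ M + E → ∀ s → H * ∣ Q H n s - Q M n s ∣ ≤ s * E * Q H n s × H * ∣ P H n s - P M n s ∣ ≤ s * E * P H n s
    close-≤ {M} le h with m≤n⇒∃[o]m+o≡n le
    ... | Δ , refl = λ s →
      ≤-trans (proj₁ (ordered M Δ s)) (*-monoˡ-≤ (Q (M + Δ) n s) (*-monoʳ-≤ s Δ≤)) ,
      ≤-trans (proj₂ (ordered M Δ s)) (*-monoˡ-≤ (P (M + Δ) n s) (*-monoʳ-≤ s Δ≤))
      where
      Δ≤ : Δ ≤ E
      Δ≤ = +-cancelˡ-≤ M _ _ h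

    close : ∀ M M′ → M ≤ M′ + E → M′ ≤ M + E → ∃ λ H → M ≤ H × M′ ≤ H × H ≤ M + E × Close M M′ H
    close M M′ h h′ with ≤-total M M′
    ... | inj₂ le = M , ≤-refl , le , m≤m+n M E , close-≤ le h
    ... | inj₁ le = M′ , le , ≤-refl , h′ ,
      λ s → subst (λ x → M′ * x ≤ s * E * Q M′ n s) (∣-∣-comm (Q M′ n s) (Q M n s)) (proj₁ (close-≤ le h′ s)) ,
            subst (λ x → M′ * x ≤ s * E * P M′ n s) (∣-∣-comm (P M′ n s) (P M n s)) (proj₂ (close-≤ le h′ s))

-- Comparison of v/u with the approximants at 239

module Approximation where

  open import Data.Nat
  open import Data.Nat.Properties
  open import Data.Nat.Divisibility using (_∣_)
  open import Data.Nat.Tactic.RingSolver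
  open Growth
  open NaturalPade
  open ExactFormula
  open Perturbation

  -- R = w² - 4wv² - 4v⁴ is the real part of (u + vi)⁴. Being a natural number it confines u + vi,
  -- where v ≤ u, to the angle 22.5°.
  module Sector (u v w R : ℕ) (1≤v : 1 ≤ v) (v≤u : v ≤ u) (u₀≤u : u₀ ≤ u)
    (u² : u * u ≡ w + v * v) (R≡ : R + 4 * w * (v * v) + 4 * (v * v) * (v * v) ≡ w * w) where
    open ≤-Reasoning

    V σ : ℕ
    V = v * v
    σ = 4 * (u * v) * w

    instance
      v≢0 : NonZero v
      v≢0 = >-nonZero 1≤v
      u≢0 : NonZero u
      u≢0 = >-nonZero (≤-trans 1≤u₀ u₀≤u)

    1≤V : 1 ≤ V
    1≤V = *-mono-≤ 1≤v 1≤v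

    4V≤w : 4 * V ≤ w
    4V≤w with 4 * V ≤? w
    ... | yes h = h
    ... | no ¬h = contradiction (begin-strict
      w * w ≤⟨ *-monoʳ-≤ w (<⇒≤ (≰⇒> ¬h)) ⟩
      w * (4 * V) ≡⟨ eq w V ⟩
      4 * w * V <⟨ m<m+n (4 * w * V) (*-mono-≤ {1} {4 * V} (*-mono-≤ {1} {4} (s≤s z≤n) 1≤V) 1≤V) ⟩
      4 * w * V + 4 * V * V ≤⟨ m≤n+m _ R ⟩
      R + (4 * w * V + 4 * V * V) ≡⟨ sym (+-assoc R _ _) ⟩
      R + 4 * w * V + 4 * V * V ≡⟨ R≡ ⟩
      w * w ∎) (<-irrefl refl)
      where
      eq : ∀ w V → w * (4 * V) ≡ 4 * w * V
      eq = solve-∀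

    R≤w² : R ≤ w * w
    R≤w² = ≤-trans (≤-trans (m≤m+n R (4 * w * V)) (m≤m+n _ (4 * V * V))) (≤-reflexive R≡)

    w₀≤w : w₀ ≤ w
    w₀≤w = *-cancelˡ-≤ 5 (begin
      5 * w₀ ≤⟨ 5w₀≤4u₀² ⟩
      4 * (u₀ * u₀) ≤⟨ *-monoʳ-≤ 4 (*-mono-≤ u₀≤u u₀≤u) ⟩
      4 * (u * u) ≡⟨ cong (4 *_) u² ⟩
      4 * (w + V) ≡⟨ *-distribˡ-+ 4 w V ⟩
      4 * w + 4 * V ≤⟨ +-monoʳ-≤ (4 * w) 4V≤w ⟩
      4 * w + w ≡⟨ +-comm (4 * w) w ⟩
      5 * w ∎)

    instance
      w≢0 : NonZero w
      w≢0 = >-nonZero (≤-trans 1≤w₀ w₀≤w)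

    u₀≤uv : u₀ ≤ u * v
    u₀≤uv = ≤-trans u₀≤u (m≤m*n u v)

  module Solution (u v w R : ℕ) (1≤v : 1 ≤ v) (v≤u : v ≤ u) (u₀≤u : u₀ ≤ u)
    (u² : u * u ≡ w + v * v) (R≡ : R + 4 * w * (v * v) + 4 * (v * v) * (v * v) ≡ w * w)
    (near₁ : κ * (4 * (u * v) * w) ≤ R + E) (near₂ : R ≤ κ * (4 * (u * v) * w) + E) where
    open ≤-Reasoning
    open Sector u v w R 1≤v v≤u u₀≤u u² R≡ public

    -- Otherwise w² + 6uvw ≤ 4κuvw = κσ ≤ R + E ≤ w² + E, although 6uvw > E: the 6 in c = 4κ - 6
    -- pays for the tolerance.
    cuv≤w : c * (u * v) ≤ w
    cuv≤w with c * (u * v) ≤? w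
    ... | yes h = h
    ... | no ¬h = contradiction (+-cancelˡ-≤ (w * w) _ _ (begin
      w * w + 6 * (u * v * w) ≤⟨ +-monoˡ-≤ _ (*-monoˡ-≤ w (<⇒≤ (≰⇒> ¬h))) ⟩
      c * (u * v) * w + 6 * (u * v * w) ≡⟨ eq₁ c (u * v) w ⟩
      (c + 6) * (u * v * w) ≡⟨ cong (_* (u * v * w)) (sym 4κ≡c+6) ⟩
      4 * κ * (u * v * w) ≡⟨ eq₂ κ (u * v) w ⟩
      κ * σ ≤⟨ near₁ ⟩
      R + E ≤⟨ +-monoˡ-≤ E R≤w² ⟩
      w * w + E ∎)) (<⇒≱ (<-≤-trans E<6uvw (*-monoʳ-≤ 6 (*-mono-≤ u₀≤uv w₀≤w))))
      where
      eq₁ : ∀ c x w → c * x * w + 6 * (x * w) ≡ (c + 6) * (x * w)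
      eq₁ = solve-∀
      eq₂ : ∀ k x w → 4 * k * (x * w) ≡ k * (4 * x * w)
      eq₂ = solve-∀

    cu₀≤w : c * u₀ ≤ w
    cu₀≤w = ≤-trans (*-monoʳ-≤ c u₀≤uv) cuv≤w

    w≤u² : w ≤ u * u
    w≤u² = ≤-trans (m≤m+n w V) (≤-reflexive (sym u²))

    cv≤u : c * v ≤ u
    cv≤u = *-cancelʳ-≤ (c * v) u u (begin
      c * v * u ≡⟨ eq c v u ⟩
      c * (u * v) ≤⟨ cuv≤w ⟩
      w ≤⟨ w≤u² ⟩
      u * u ∎)
      where
      eq : ∀ c v u → c * v * u ≡ c * (u * v)
      eq = solve-∀

    V≤uv : V ≤ u * v
    V≤uv = *-monoˡ-≤ v v≤u

    -- The converse of `cv≤u`: u/v cannot be much larger than 4κ. It is needed to measure u p in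
    -- terms of v.
    u≤slope : u ≤ (4 * κ + 6 + r) * v
    u≤slope = *-cancelʳ-≤ u ((4 * κ + 6 + r) * v) u (begin
      u * u ≡⟨ u² ⟩
      w + V ≤⟨ +-monoˡ-≤ V w≤ ⟩
      4 * κ * (u * v) + 5 * V + r + V ≡⟨ eq₁ (4 * κ * (u * v)) V r ⟩
      4 * κ * (u * v) + 6 * V + r * 1 ≤⟨ +-mono-≤ (+-monoʳ-≤ (4 * κ * (u * v)) (*-monoʳ-≤ 6 V≤uv)) (*-monoʳ-≤ r (≤-trans 1≤u₀ u₀≤uv)) ⟩
      4 * κ * (u * v) + 6 * (u * v) + r * (u * v) ≡⟨ eq₂ κ u v r ⟩
      (4 * κ + 6 + r) * v * u ∎)
      where
      eq₁ : ∀ x V r → x + 5 * V + r + V ≡ x + 6 * V + r * 1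
      eq₁ = solve-∀
      eq₂ : ∀ k u v r → 4 * k * (u * v) + 6 * (u * v) + r * (u * v) ≡ (4 * k + 6 + r) * v * u
      eq₂ = solve-∀
      w≤ : w ≤ 4 * κ * (u * v) + 5 * V + r
      w≤ = *-cancelʳ-≤ w _ w (begin
        w * w ≡⟨ sym R≡ ⟩
        R + 4 * w * V + 4 * V * V ≤⟨ +-mono-≤ (+-monoˡ-≤ _ near₂) (*-monoˡ-≤ V 4V≤w) ⟩
        κ * σ + E + 4 * w * V + w * V ≤⟨ +-monoˡ-≤ _ (+-monoˡ-≤ _ (+-monoʳ-≤ (κ * σ) (≤-trans E≤159w (*-monoʳ-≤ r w₀≤w)))) ⟩
        κ * σ + r * w + 4 * w * V + w * V ≡⟨ eq₃ κ (u * v) w V r ⟩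
        (4 * κ * (u * v) + 5 * V + r) * w ∎)
        where
        eq₃ : ∀ k x w V r → k * (4 * x * w) + r * w + 4 * w * V + w * V ≡ (4 * k * x + 5 * V + r) * w
        eq₃ = solve-∀

    E≤σ : E ≤ σ
    E≤σ = ≤-trans E≤4uvw (≤-trans (*-monoʳ-≤ 4 (*-mono-≤ u₀≤uv cu₀≤w)) (≤-reflexive (sym (*-assoc 4 (u * v) w))))

    instance
      σ≢0 : NonZero σ
      σ≢0 = m*n≢0 (4 * (u * v)) w {{m*n≢0 4 (u * v) {{_}} {{m*n≢0 u v}}}}

    -- u ≥ cv and w ≥ cuv give uvw ≥ c³v⁴.
    Kv⁴≤κσ : K * (v * v * v * v) ≤ κ * σ
    Kv⁴≤κσ = begin
      K * (v * v * v * v) ≤⟨ *-monoˡ-≤ (v * v * v * v) K≤ ⟩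
      4 * κ * (c * (c * c)) * (v * v * v * v) ≡⟨ eq₁ κ c v ⟩
      4 * κ * (c * v * v * (c * (c * v * v))) ≤⟨ *-monoʳ-≤ (4 * κ) (*-mono-≤ h (≤-trans (*-monoʳ-≤ c h) cuv≤w)) ⟩
      4 * κ * (u * v * w) ≡⟨ eq₂ κ (u * v) w ⟩
      κ * σ ∎
      where
      h : c * v * v ≤ u * v
      h = *-monoˡ-≤ v cv≤u
      eq₁ : ∀ k c v → 4 * k * (c * (c * c)) * (v * v * v * v) ≡ 4 * k * (c * v * v * (c * (c * v * v)))
      eq₁ = solve-∀
      eq₂ : ∀ k x w → 4 * k * (x * w) ≡ k * (4 * x * w)
      eq₂ = solve-∀

    -- |v q - u p| at the exact fourth power is at most half of σ^s.
    module _ (s : ℕ) (v-small : 4 * v ≤ b ^ s) where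
      private
        L = (4 * V) ^ s * v * Remainder.N (u * u) w s

        L≤ : L ≤ 2 * v * (64 * (V * (u * u))) ^ s
        L≤ = begin
          (4 * V) ^ s * v * Remainder.N (u * u) w s ≤⟨ *-monoʳ-≤ ((4 * V) ^ s * v) (Remainder.N≤ (u * u) w w≤u² s) ⟩
          (4 * V) ^ s * v * (2 * (16 * (u * u)) ^ s) ≡⟨ eq ((4 * V) ^ s) v ((16 * (u * u)) ^ s) ⟩
          2 * v * ((4 * V) ^ s * (16 * (u * u)) ^ s) ≡⟨ cong (2 * v *_) (trans (sym (^-distribʳ s (4 * V) (16 * (u * u)))) (cong (_^ s) (eq′ V (u * u)))) ⟩
          2 * v * (64 * (V * (u * u))) ^ s ∎
          where
          eq : ∀ p v n → p * v * (2 * n) ≡ 2 * v * (p * n)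
          eq = solve-∀
          eq′ : ∀ V U → 4 * V * (16 * U) ≡ 64 * (V * U)
          eq′ = solve-∀

        b64≤σ : b * (64 * (V * (u * u))) ≤ σ
        b64≤σ = begin
          b * (64 * (V * (u * u))) ≡⟨ eq b u v ⟩
          64 * b * (u * v * (u * v)) ≤⟨ *-monoˡ-≤ (u * v * (u * v)) 64b≤4c ⟩
          4 * c * (u * v * (u * v)) ≡⟨ eq′ c (u * v) ⟩
          4 * (u * v) * (c * (u * v)) ≤⟨ *-monoʳ-≤ (4 * (u * v)) cuv≤w ⟩
          σ ∎
          where
          eq : ∀ b u v → b * (64 * (v * v * (u * u))) ≡ 64 * b * (u * v * (u * v))
          eq = solve-∀
          eq′ : ∀ c x → 4 * c * (x * x) ≡ 4 * x * (c * x)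
          eq′ = solve-∀

      2L≤σ^s : 2 * L ≤ σ ^ s
      2L≤σ^s = *-cancelˡ-≤ (2 * v) {{m*n≢0 2 v}} (begin
        2 * v * (2 * L) ≡⟨ eq v L ⟩
        4 * v * L ≤⟨ *-mono-≤ v-small L≤ ⟩
        b ^ s * (2 * v * (64 * (V * (u * u))) ^ s) ≡⟨ eq′ (b ^ s) (2 * v) ((64 * (V * (u * u))) ^ s) ⟩
        2 * v * (b ^ s * (64 * (V * (u * u))) ^ s) ≡⟨ cong (2 * v *_) (sym (^-distribʳ s b (64 * (V * (u * u))))) ⟩
        2 * v * (b * (64 * (V * (u * u)))) ^ s ≤⟨ *-monoʳ-≤ (2 * v) (^-monoˡ-≤ s b64≤σ) ⟩
        2 * v * σ ^ s ∎)
        where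
        eq : ∀ v L → 2 * v * (2 * L) ≡ 4 * v * L
        eq = solve-∀
        eq′ : ∀ b v x → b * (v * x) ≡ v * (b * x)
        eq′ = solve-∀

    private
      M = κ * σ
      module C = Near σ
      found = C.close M R near₁ near₂

    H : ℕ
    H = proj₁ found
    M≤H : M ≤ H
    M≤H = proj₁ (proj₂ found)
    close : C.Close M R H
    close = proj₂ (proj₂ (proj₂ (proj₂ found)))

    17H≤gσ : 17 * H ≤ g * σ
    17H≤gσ = begin
      17 * H ≤⟨ *-monoʳ-≤ 17 (H≤ found) ⟩
      17 * (κ * σ + σ) ≡⟨ eq κ σ ⟩
      17 * (κ + 1) * σ ∎
      where
      eq : ∀ k s → 17 * (k * s + s) ≡ 17 * (k + 1) * s
      eq = solve-∀
      H≤ : (f : ∃ λ H → M ≤ H × R ≤ H × H ≤ M + E × C.Close M R H) → proj₁ f ≤ κ * σ + σ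
      H≤ f = ≤-trans (proj₁ (proj₂ (proj₂ (proj₂ f)))) (+-monoʳ-≤ M E≤σ)

    instance
      κ≢0 : NonZero κ
      κ≢0 = >-nonZero 1≤κ
      17H≢0 : NonZero (17 * H)
      17H≢0 = m*n≢0 17 H {{_}} {{>-nonZero (≤-trans (>-nonZero⁻¹ (κ * σ) {{m*n≢0 κ σ}}) M≤H)}}

    64σ²≤17H² : 64 * (σ * σ) ≤ 17 * (H * H)
    64σ²≤17H² = begin
      64 * (σ * σ) ≤⟨ *-monoˡ-≤ (σ * σ) 64≤17κ² ⟩
      17 * (κ * κ) * (σ * σ) ≡⟨ eq κ σ ⟩
      17 * (M * M) ≤⟨ *-monoʳ-≤ 17 (*-mono-≤ M≤H M≤H) ⟩
      17 * (H * H) ∎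
      where
      eq : ∀ k s → 17 * (k * k) * (s * s) ≡ 17 * (k * s * (k * s))
      eq = solve-∀

    vQ≤ : ∀ s → v * Q H σ s ≤ v * (17 * H) ^ s
    vQ≤ = growth {H} {σ} {Q H σ} (Q-recurrence H σ) 64σ²≤17H² v v
      (≤-reflexive (trans (cong (v *_) (Q-0 H σ)) (*-identityʳ v)))
      (*-monoʳ-≤ v (≤-trans (≤-reflexive (Q-1 H σ)) (*-monoˡ-≤ H {8} {17} (m≤m+n 8 9))))

    -- The same growth as for v Q. The initial value 2uσ is compared with 17vκσ, which is where the
    -- upper bound for u/v enters.
    uP≤ : ∀ s → u * P H σ s ≤ v * (17 * H) ^ s
    uP≤ = growth {H} {σ} {P H σ} (P-recurrence H σ) 64σ²≤17H² u v
      (≤-trans (≤-reflexive (trans (cong (u *_) (P-0 H σ)) (*-zeroʳ u))) z≤n)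
      (begin
        u * P H σ 1 ≡⟨ cong (u *_) (P-1 H σ) ⟩
        u * (2 * σ) ≤⟨ *-monoˡ-≤ (2 * σ) u≤slope ⟩
        (4 * κ + 6 + r) * v * (2 * σ) ≡⟨ eq (4 * κ + 6 + r) v σ ⟩
        v * (2 * (4 * κ + 6 + r) * σ) ≤⟨ *-monoʳ-≤ v (*-monoˡ-≤ σ slope≤) ⟩
        v * (17 * κ * σ) ≡⟨ cong (v *_) (*-assoc 17 κ σ) ⟩
        v * (17 * M) ≤⟨ *-monoʳ-≤ v (*-monoʳ-≤ 17 M≤H) ⟩
        v * (17 * H) ∎)
      where
      eq : ∀ k v s → k * v * (2 * s) ≡ v * (2 * k * s)
      eq = solve-∀

    q p : ℕ → ℕ
    q = Q κ 1
    p = P κ 1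

    -- The arguments κσ and σ are proportional to κ and 1, so homogeneity splits off σ^s and leaves
    -- integers that do not depend on u and v.
    Q-scale : ∀ s → Q M σ s ≡ σ ^ s * q s
    Q-scale = homogeneous {κ} {1} {q} {Q M σ} σ (Q-recurrence κ 1) (subst (λ x → Recurrence M x (Q M σ)) (sym (*-identityˡ σ)) (Q-recurrence M σ))
      (trans (Q-0 M σ) (sym (Q-0 κ 1))) (trans (Q-1 M σ) (trans (eq κ σ) (cong (σ *_) (sym (Q-1 κ 1)))))
      where
      eq : ∀ k s → 8 * (k * s) ≡ s * (8 * k)
      eq = solve-∀

    P-scale : ∀ s → P M σ s ≡ σ ^ s * p s
    P-scale = homogeneous {κ} {1} {p} {P M σ} σ (P-recurrence κ 1) (subst (λ x → Recurrence M x (P M σ)) (sym (*-identityˡ σ)) (P-recurrence M σ))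
      (trans (P-0 M σ) (sym (P-0 κ 1))) (trans (P-1 M σ) (trans (*-comm 2 σ) (cong (σ *_) (sym (P-1 κ 1)))))

    -- Triangle inequality through the approximant at (R, σ): there the error is known exactly, and
    -- moving the first argument from κσ to R costs the Lipschitz bound for q and for p.
    scaled : ∀ s → H * (σ ^ s * ∣ v * q s - u * p s ∣) ≤ H * ((4 * V) ^ s * v * Remainder.N (u * u) w s) + s * E * (2 * (v * (17 * H) ^ s))
    scaled s = begin
      H * (σ ^ s * ∣ v * q s - u * p s ∣) ≡⟨ cong (H *_) (trans (*-distribˡ-∣-∣ (σ ^ s) (v * q s) (u * p s))
        (cong₂ ∣_-_∣ (trans (eq (σ ^ s) v (q s)) (cong (v *_) (sym (Q-scale s)))) (trans (eq (σ ^ s) u (p s)) (cong (u *_) (sym (P-scale s)))))) ⟩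
      H * ∣ v * QM - u * PM ∣ ≤⟨ *-monoʳ-≤ H (≤-trans (∣-∣-triangle (v * QM) (v * QR) (u * PM)) (+-monoʳ-≤ _ (∣-∣-triangle (v * QR) (u * PR) (u * PM)))) ⟩
      H * (∣ v * QM - v * QR ∣ + (∣ v * QR - u * PR ∣ + ∣ u * PR - u * PM ∣))
        ≡⟨ cong (H *_) (cong₂ _+_ (sym (*-distribˡ-∣-∣ v QM QR)) (cong₂ _+_ L≡ (trans (sym (*-distribˡ-∣-∣ u PR PM)) (cong (u *_) (∣-∣-comm PR PM))))) ⟩
      H * (v * ∣ QM - QR ∣ + (L + u * ∣ PM - PR ∣)) ≡⟨ eq₂ H v ∣ QM - QR ∣ L u ∣ PM - PR ∣ ⟩
      H * L + (v * (H * ∣ QM - QR ∣) + u * (H * ∣ PM - PR ∣))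
        ≤⟨ +-monoʳ-≤ (H * L) (+-mono-≤ (*-monoʳ-≤ v (proj₁ (close s))) (*-monoʳ-≤ u (proj₂ (close s)))) ⟩
      H * L + (v * (s * E * Q H σ s) + u * (s * E * P H σ s)) ≡⟨ cong (H * L +_) (eq₃ v u (s * E) (Q H σ s) (P H σ s)) ⟩
      H * L + s * E * (v * Q H σ s + u * P H σ s) ≤⟨ +-monoʳ-≤ (H * L) (*-monoʳ-≤ (s * E) (+-mono-≤ (vQ≤ s) (uP≤ s))) ⟩
      H * L + s * E * (v * (17 * H) ^ s + v * (17 * H) ^ s) ≡⟨ cong (λ x → H * L + s * E * x) (eq₄ (v * (17 * H) ^ s)) ⟩
      H * L + s * E * (2 * (v * (17 * H) ^ s)) ∎
      where
      L QM PM QR PR : ℕ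
      L = (4 * V) ^ s * v * Remainder.N (u * u) w s
      QM = Q M σ s
      PM = P M σ s
      QR = Q R σ s
      PR = P R σ s
      L≡ : ∣ v * QR - u * PR ∣ ≡ L
      L≡ = trans (sym (∣+-+∣ (v * QR) (u * PR))) (trans (cong₂ (λ x y → ℤ.∣ x ℤ.- y ∣) (ℤ.pos-* v QR) (ℤ.pos-* u PR)) (exact-∣∣ u v w R u² R≡ s))
      eq : ∀ a v q → a * (v * q) ≡ v * (a * q)
      eq = solve-∀
      eq₂ : ∀ H v x L u y → H * (v * x + (L + u * y)) ≡ H * L + (v * (H * x) + u * (H * y))
      eq₂ = solve-∀
      eq₃ : ∀ v u e x y → v * (e * x) + u * (e * y) ≡ e * (v * x + u * y)
      eq₃ = solve-∀
      eq₄ : ∀ x → x + x ≡ 2 * x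
      eq₄ = solve-∀

    -- A nonzero integer v q - u p would contribute at least 2Hσ^s to twice the inequality `scaled`.
    -- The first hypothesis bounds the exact remainder by Hσ^s, the second makes the perturbation
    -- strictly smaller than Hσ^s.
    vanish : ∀ s → 4 * v ≤ b ^ s → 4 * s * E * g ^ s < K * (v * v * v) → v * q s ≡ u * p s
    vanish s h₁ h₂ with v * q s ≟ u * p s
    ... | yes e = e
    ... | no ≢ = contradiction (begin-strict
      2 * (H * σ ^ s * 1) ≤⟨ *-monoʳ-≤ 2 (*-monoʳ-≤ (H * σ ^ s) 1≤d) ⟩
      2 * (H * σ ^ s * d) ≡⟨ cong (2 *_) (*-assoc H (σ ^ s) d) ⟩
      2 * (H * (σ ^ s * d)) ≤⟨ *-monoʳ-≤ 2 (scaled s) ⟩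
      2 * (H * L + s * E * (2 * (v * (17 * H) ^ s))) ≡⟨ eq₁ H L (s * E) v ((17 * H) ^ s) ⟩
      H * (2 * L) + 4 * (s * E) * v * (17 * H) ^ s ≤⟨ +-mono-≤ (*-monoʳ-≤ H (2L≤σ^s s h₁)) (*-monoʳ-≤ (4 * (s * E) * v) (≤-trans (^-monoˡ-≤ s 17H≤gσ) (≤-reflexive (^-distribʳ s g σ)))) ⟩
      H * σ ^ s + 4 * (s * E) * v * (g ^ s * σ ^ s) ≡⟨ cong (H * σ ^ s +_) (eq₂ s E v (g ^ s) (σ ^ s)) ⟩
      H * σ ^ s + 4 * s * E * g ^ s * v * σ ^ s <⟨ +-monoʳ-< (H * σ ^ s) (*-monoˡ-< (σ ^ s) {{m^n≢0 σ s}} (<-≤-trans (*-monoˡ-< v h₂) Kv⁴≤H)) ⟩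
      H * σ ^ s + H * σ ^ s ≡⟨ eq₃ (H * σ ^ s) ⟩
      2 * (H * σ ^ s * 1) ∎) (<-irrefl refl)
      where
      L d : ℕ
      L = (4 * V) ^ s * v * Remainder.N (u * u) w s
      d = ∣ v * q s - u * p s ∣
      1≤d : 1 ≤ d
      1≤d = n≢0⇒n>0 (λ e → ≢ (∣m-n∣≡0⇒m≡n e))
      Kv⁴≤H : K * (v * v * v) * v ≤ H
      Kv⁴≤H = ≤-trans (≤-reflexive (*-assoc K (v * v * v) v)) (≤-trans Kv⁴≤κσ M≤H)
      eq₁ : ∀ H L e v x → 2 * (H * L + e * (2 * (v * x))) ≡ H * (2 * L) + 4 * e * v * x
      eq₁ = solve-∀
      eq₂ : ∀ s E v g t → 4 * (s * E) * v * (g * t) ≡ 4 * s * E * g * v * t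
      eq₂ = solve-∀
      eq₃ : ∀ x → x + x ≡ 2 * (x * 1)
      eq₃ = solve-∀

-- No solutions with u ≥ 30

module LargeSolutions where

  open import Data.Nat
  open import Data.Nat.Properties
  open import Data.Nat.Divisibility using (_∣_; ∣m+n∣m⇒∣n; n∣m*n; m∣m*n; ∣n⇒∣m*n; ∣⇒≤)
  open import Data.Nat.Tactic.RingSolver
  open Growth
  open NaturalPade
  open ExactFormula
  open Perturbation
  open Approximation

  private
    t : ℕ
    t = b * (b * b)

    step : ∀ s r → 1 ≤ s → 64 * (4 * s * E * g ^ s) < K * t ^ r → 64 * (4 * suc s * E * g ^ suc s) < K * t ^ suc r
    step s r 1≤s h = begin-strict
      64 * (4 * suc s * E * (g * g ^ s)) ≤⟨ *-monoʳ-≤ 64 (*-monoˡ-≤ (g * g ^ s) (*-monoˡ-≤ E (*-monoʳ-≤ 4 (+-monoˡ-≤ s 1≤s)))) ⟩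
      64 * (4 * (s + s) * E * (g * g ^ s)) ≡⟨ eq₁ s E g (g ^ s) ⟩
      g * 2 * (64 * (4 * s * E * g ^ s)) <⟨ *-monoʳ-< (g * 2) h ⟩
      g * 2 * (K * t ^ r) ≤⟨ *-monoˡ-≤ (K * t ^ r) 2g≤b³ ⟩
      t * (K * t ^ r) ≡⟨ eq₂ t K (t ^ r) ⟩
      K * (t * t ^ r) ∎
      where
      open ≤-Reasoning
      instance
        g2≢0 : NonZero (g * 2)
        g2≢0 = m*n≢0 g 2 {{m*n≢0 17 (κ + 1) {{_}} {{subst NonZero (+-comm 1 κ) _}}}}
      eq₁ : ∀ s E g x → 64 * (4 * (s + s) * E * (g * x)) ≡ g * 2 * (64 * (4 * s * E * x))
      eq₁ = solve-∀
      eq₂ : ∀ t K x → t * (K * x) ≡ K * (t * x)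
      eq₂ = solve-∀

    -- The perturbation condition at s = r + 1. The factor 64 and the base t = b³ arise from b^r <
    -- 4v, which gives 64v³ > t^r.
    condition₁ : ∀ r → 64 * (4 * suc r * E * g ^ suc r) < K * t ^ r
    condition₁ zero = start₁
    condition₁ (suc r) = step (suc r) r (s≤s z≤n) (condition₁ r)

    -- The same for the next index s = r + 2 with r = 2 + k; it fails for r = 0 and r = 1.
    condition₂ : ∀ k → 64 * (4 * (4 + k) * E * g ^ (4 + k)) < K * t ^ (2 + k)
    condition₂ zero = start₂
    condition₂ (suc k) = step (4 + k) (2 + k) (s≤s z≤n) (condition₂ k)

    1≤b^ : ∀ n → 1 ≤ b ^ n
    1≤b^ zero = ≤-refl
    1≤b^ (suc n) = *-mono-≤ 1≤b (1≤b^ n)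

    n≤b^n : ∀ n → n ≤ b ^ n
    n≤b^n zero = z≤n
    n≤b^n (suc n) = ≤-trans (+-mono-≤ (1≤b^ n) (n≤b^n n)) (≤-trans (≤-reflexive (cong (b ^ n +_) (sym (+-identityʳ (b ^ n))))) (*-monoˡ-≤ (b ^ n) 2≤b))

    floor-log : ∀ n x → 1 < x → x ≤ b ^ n → ∃ λ r → b ^ r < x × x ≤ b ^ suc r
    floor-log zero x h h′ = contradiction h′ (<⇒≱ h)
    floor-log (suc n) x h h′ with x ≤? b ^ n
    ... | yes le = floor-log n x h le
    ... | no gt = n , ≰⇒> gt , h′

  -- Choose r with b^r < 4v ≤ b^(r+1). The error integer vanishes at s = r + 1, and for r ≥ 2 also
  -- at s = r + 2, which is impossible; for r = 0 and 1 the single vanishing is refuted by explicit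
  -- approximants.
  no-solution : ∀ u v w R → 1 ≤ v → v ≤ u → u₀ ≤ u → u * u ≡ w + v * v → R + 4 * w * (v * v) + 4 * (v * v) * (v * v) ≡ w * w →
    κ * (4 * (u * v) * w) ≤ R + E → R ≤ κ * (4 * (u * v) * w) + E → ⊥
  no-solution u v w R 1≤v v≤u u₀≤u u² R≡ near₁ near₂ with floor-log (4 * v) (4 * v) (*-mono-≤ {2} {4} {1} (s≤s (s≤s z≤n)) 1≤v) (n≤b^n (4 * v))
  ... | r , lower , upper = cases r lower upper
    where
    open module S = Solution u v w R 1≤v v≤u u₀≤u u² R≡ near₁ near₂
    open ≤-Reasoning

    bounded : ∀ r X → b ^ r < 4 * v → 64 * X < K * t ^ r → X < K * (v * v * v)
    bounded r X h h′ = *-cancelˡ-< 64 X _ (begin-strict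
      64 * X <⟨ h′ ⟩
      K * t ^ r ≡⟨ cong (K *_) (trans (^-distribʳ r b (b * b)) (cong (b ^ r *_) (^-distribʳ r b b))) ⟩
      K * (b ^ r * (b ^ r * b ^ r)) ≤⟨ *-monoʳ-≤ K (*-mono-≤ (<⇒≤ h) (*-mono-≤ (<⇒≤ h) (<⇒≤ h))) ⟩
      K * (4 * v * (4 * v * (4 * v))) ≡⟨ eq K v ⟩
      64 * (K * (v * v * v)) ∎)
      where
      eq : ∀ K v → K * (4 * v * (4 * v * (4 * v))) ≡ 64 * (K * (v * v * v))
      eq = solve-∀

    -- Consecutive approximants are independent: as γ s ≠ 0 the recurrence runs backwards, down to s
    -- = 0, where vanishing reads v · 1 = u · 0.
    descend : ∀ s → v * q s ≡ u * p s → v * q (suc s) ≡ u * p (suc s) → ⊥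
    descend zero h₀ h₁ = <⇒≢ 1≤v (sym (trans (sym (*-identityʳ v)) (trans (cong (v *_) (sym (Q-0 κ 1))) (trans h₀ (trans (cong (u *_) (P-0 κ 1)) (*-zeroʳ u))))))
    descend (suc s) h₁ h₂ = descend s (*-cancelˡ-≡ _ _ (γ s) (+-cancelˡ-≡ (β s * κ * (v * q (suc s))) _ _ (begin-equality
      β s * κ * (v * q (suc s)) + γ s * (v * q s) ≡⟨ eq (β s) κ v (q (suc s)) (γ s) (q s) ⟩
      v * (β s * κ * q (suc s) + γ s * (1 * 1) * q s) ≡⟨ cong (v *_) (sym (Q-recurrence κ 1 s)) ⟩
      v * (α s * q (2 + s)) ≡⟨ eq′ v (α s) (q (2 + s)) ⟩
      α s * (v * q (2 + s)) ≡⟨ cong (α s *_) h₂ ⟩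
      α s * (u * p (2 + s)) ≡⟨ sym (eq′ u (α s) (p (2 + s))) ⟩
      u * (α s * p (2 + s)) ≡⟨ cong (u *_) (P-recurrence κ 1 s) ⟩
      u * (β s * κ * p (suc s) + γ s * (1 * 1) * p s) ≡⟨ sym (eq (β s) κ u (p (suc s)) (γ s) (p s)) ⟩
      β s * κ * (u * p (suc s)) + γ s * (u * p s) ≡⟨ cong (λ x → β s * κ * x + γ s * (u * p s)) (sym h₁) ⟩
      β s * κ * (v * q (suc s)) + γ s * (u * p s) ∎))) h₁
      where
      instance
        γ≢0 : NonZero (γ s)
        γ≢0 = m*n≢0 (4 * (4 * s + 3)) (4 * s + 5) {{m*n≢0 4 (4 * s + 3) {{_}} {{subst NonZero (+-comm 3 (4 * s)) _}}}} {{subst NonZero (+-comm 5 (4 * s)) _}}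
      eq : ∀ b k v x g y → b * k * (v * x) + g * (v * y) ≡ v * (b * k * x + g * (1 * 1) * y)
      eq = solve-∀
      eq′ : ∀ v a x → v * (a * x) ≡ a * (v * x)
      eq′ = solve-∀

    -- Vanishing means u = 4κv. Then κσ = u²w = w² + wv², so R lies below κσ by 5wv² + 4v⁴, more
    -- than E.
    first : v * q 1 ≡ u * p 1 → ⊥
    first h = contradiction (+-cancelˡ-≤ (w * w) _ _ (begin
      w * w + 5 * (c * u₀) ≤⟨ +-monoʳ-≤ (w * w) (*-monoʳ-≤ 5 (≤-trans cu₀≤w (≤-trans (≤-reflexive (sym (*-identityʳ w))) (*-monoʳ-≤ w 1≤V)))) ⟩
      w * w + 5 * (w * V) ≤⟨ m≤m+n _ (4 * V * V) ⟩
      w * w + 5 * (w * V) + 4 * V * V ≡⟨ eq₁ w V ⟩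
      (w + V) * w + (4 * w * V + 4 * V * V) ≡⟨ cong (λ x → x * w + (4 * w * V + 4 * V * V)) (sym u²) ⟩
      u * u * w + (4 * w * V + 4 * V * V) ≡⟨ cong (λ x → u * x * w + (4 * w * V + 4 * V * V)) u≡ ⟩
      u * (4 * κ * v) * w + (4 * w * V + 4 * V * V) ≡⟨ cong (_+ (4 * w * V + 4 * V * V)) (eq₂ u κ v w) ⟩
      κ * σ + (4 * w * V + 4 * V * V) ≤⟨ +-monoˡ-≤ _ near₁ ⟩
      R + E + (4 * w * V + 4 * V * V) ≡⟨ eq₃ R E (4 * w * V) (4 * V * V) ⟩
      R + 4 * w * V + 4 * V * V + E ≡⟨ cong (_+ E) R≡ ⟩
      w * w + E ∎)) (<⇒≱ E<5w)
      where
      eq₁ : ∀ w V → w * w + 5 * (w * V) + 4 * V * V ≡ (w + V) * w + (4 * w * V + 4 * V * V)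
      eq₁ = solve-∀
      eq₂ : ∀ u k v w → u * (4 * k * v) * w ≡ k * (4 * (u * v) * w)
      eq₂ = solve-∀
      eq₃ : ∀ R E x y → R + E + (x + y) ≡ R + x + y + E
      eq₃ = solve-∀
      u≡ : u ≡ 4 * κ * v
      u≡ = *-cancelˡ-≡ u (4 * κ * v) 2 (begin-equality
        2 * u ≡⟨ *-comm 2 u ⟩
        u * (2 * 1) ≡⟨ cong (u *_) (sym (P-1 κ 1)) ⟩
        u * p 1 ≡⟨ sym h ⟩
        v * q 1 ≡⟨ cong (v *_) (Q-1 κ 1) ⟩
        v * (8 * κ) ≡⟨ eq v κ ⟩
        2 * (4 * κ * v) ∎)
        where
        eq : ∀ v k → v * (8 * k) ≡ 2 * (4 * k * v)
        eq = solve-∀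

    -- Vanishing means v (16κ² + 5) = 4κu, so 4κ divides 5v and hence v. Then 4v ≥ 16κ > b².
    second : v * q 2 ≡ u * p 2 → 4 * v ≤ b * b → ⊥
    second h small = <-irrefl refl (<-≤-trans b²<16κ (≤-trans (*-monoʳ-≤ 4 (∣⇒≤ m∣v)) small))
      where
      m = 4 * κ
      relation : v * (m * m + 5) ≡ m * u
      relation = *-cancelˡ-≡ _ _ 12 (begin-equality
        12 * (v * (m * m + 5)) ≡⟨ eq₁ v κ ⟩
        v * (24 * κ * (8 * κ) + 60 * (1 * 1) * 1) ≡⟨ cong (v *_) (cong₂ (λ x y → 24 * κ * x + 60 * (1 * 1) * y) (sym (Q-1 κ 1)) (sym (Q-0 κ 1))) ⟩
        v * (24 * κ * q 1 + 60 * (1 * 1) * q 0) ≡⟨ cong (v *_) (sym (Q-recurrence κ 1 0)) ⟩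
        v * (2 * q 2) ≡⟨ eq₂ v (q 2) ⟩
        2 * (v * q 2) ≡⟨ cong (2 *_) h ⟩
        2 * (u * p 2) ≡⟨ sym (eq₂ u (p 2)) ⟩
        u * (2 * p 2) ≡⟨ cong (u *_) (P-recurrence κ 1 0) ⟩
        u * (24 * κ * p 1 + 60 * (1 * 1) * p 0) ≡⟨ cong (u *_) (cong₂ (λ x y → 24 * κ * x + 60 * (1 * 1) * y) (P-1 κ 1) (P-0 κ 1)) ⟩
        u * (24 * κ * (2 * 1) + 60 * (1 * 1) * 0) ≡⟨ eq₃ u κ ⟩
        12 * (m * u) ∎)
        where
        eq₁ : ∀ v k → 12 * (v * (4 * k * (4 * k) + 5)) ≡ v * (24 * k * (8 * k) + 60 * (1 * 1) * 1)
        eq₁ = solve-∀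
        eq₂ : ∀ v x → v * (2 * x) ≡ 2 * (v * x)
        eq₂ = solve-∀
        eq₃ : ∀ u k → u * (24 * k * (2 * 1) + 60 * (1 * 1) * 0) ≡ 12 * (4 * k * u)
        eq₃ = solve-∀
      m∣5v : m ∣ 5 * v
      m∣5v = ∣m+n∣m⇒∣n (subst (m ∣_) (trans (sym relation) (eq v m)) (m∣m*n u)) (m∣m*n (m * v))
        where
        eq : ∀ v m → v * (m * m + 5) ≡ m * (m * v) + 5 * v
        eq = solve-∀
      m∣v : m ∣ v
      m∣v = ∣m+n∣m⇒∣n (subst (m ∣_) (trans (cong (v *_) 4κ≡) (eq v)) (n∣m*n v)) (∣n⇒∣m*n 191 m∣5v)
        where
        eq : ∀ v → v * (191 * 5 + 1) ≡ 191 * (5 * v) + v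
        eq v = trans (*-distribˡ-+ v (191 * 5) 1) (cong₂ _+_ (trans (*-comm v (191 * 5)) (*-assoc 191 5 v)) (*-identityʳ v))

    cases : ∀ r → b ^ r < 4 * v → 4 * v ≤ b ^ suc r → ⊥
    cases zero lo hi = first (vanish 1 hi (bounded 0 _ lo (condition₁ 0)))
    cases (suc zero) lo hi = second (vanish 2 hi (bounded 1 _ lo (condition₁ 1))) (≤-trans hi (≤-reflexive (cong (b *_) (*-identityʳ b))))
    cases (suc (suc k)) lo hi = descend (3 + k)
      (vanish (3 + k) hi (bounded (2 + k) _ lo (condition₁ (2 + k))))
      (vanish (4 + k) (≤-trans hi (≤-trans (≤-reflexive (sym (*-identityˡ _))) (*-monoˡ-≤ (b ^ (3 + k)) 1≤b))) (bounded (2 + k) _ lo (condition₂ k)))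

-- The quartic Thue equation

module Ljunggren where

  import Data.Nat.Tactic.RingSolver as ℕR
  open import Data.Integer using (+_; -[1+_]; _+_; _*_; -_; _-_; ∣_∣)
  open import Data.Integer.Tactic.RingSolver using (solve-∀)
  open import Relation.Nullary.Decidable using (toWitness; _→-dec_; _⊎-dec_)
  open Arith
  open SmallValues using (square≡)
  open Perturbation hiding (b; r)
  open Approximation
  open LargeSolutions

  private
    -- The second alternative is a negative σ, for which ρ - κσ becomes the sum R + κ|σ|.
    Near : (b s w R : ℕ) → ℕ → Set
    Near b s w R E = κ ℕ.* (4 ℕ.* (b ℕ.* s) ℕ.* w) ℕ.≤ R ℕ.+ E × R ℕ.≤ κ ℕ.* (4 ℕ.* (b ℕ.* s) ℕ.* w) ℕ.+ E
      ⊎ R ℕ.+ κ ℕ.* (4 ℕ.* (b ℕ.* s) ℕ.* w) ℕ.≤ E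

    -- Three cases for b ≥ u₀. On the axis s = 0 the real part b⁴ exceeds E; for the wrong sign κ|σ|
    -- alone exceeds E; the remaining one is `no-solution`.
    small-b : ∀ b s w R → s ℕ.≤ b → b ℕ.* b ≡ w ℕ.+ s ℕ.* s → R ℕ.+ 4 ℕ.* w ℕ.* (s ℕ.* s) ℕ.+ 4 ℕ.* (s ℕ.* s) ℕ.* (s ℕ.* s) ≡ w ℕ.* w →
      Near b s w R E → b ℕ.< u₀
    small-b b s w R s≤b b² R≡ near with b ℕ.<? u₀
    ... | yes lt = lt
    ... | no ≮ = ⊥-elim (absurd s s≤b b² R≡ near)
      where
      u₀≤b : u₀ ℕ.≤ b
      u₀≤b = ℕ.≮⇒≥ ≮
      absurd : ∀ s → s ℕ.≤ b → b ℕ.* b ≡ w ℕ.+ s ℕ.* s → R ℕ.+ 4 ℕ.* w ℕ.* (s ℕ.* s) ℕ.+ 4 ℕ.* (s ℕ.* s) ℕ.* (s ℕ.* s) ≡ w ℕ.* w → Near b s w R E → ⊥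
      absurd zero _ b² R≡ near = ℕ.<⇒≱ E<u₀⁴ (ℕ.≤-trans (ℕ.*-mono-≤ (ℕ.*-mono-≤ u₀≤b u₀≤b) (ℕ.*-mono-≤ u₀≤b u₀≤b)) (ℕ.≤-trans (ℕ.≤-reflexive R≡b⁴) R≤E))
        where
        S≡0 : κ ℕ.* (4 ℕ.* (b ℕ.* 0) ℕ.* w) ≡ 0
        S≡0 = eq κ b w
          where
          eq : ∀ k b w → k ℕ.* (4 ℕ.* (b ℕ.* 0) ℕ.* w) ≡ 0
          eq = ℕR.solve-∀
        R≤E : R ℕ.≤ E
        R≤E = [ (λ p → subst (λ x → R ℕ.≤ x ℕ.+ E) S≡0 (proj₂ p)) , (λ p → ℕ.≤-trans (ℕ.m≤m+n R _) p) ]′ near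
        R≡b⁴ : b ℕ.* b ℕ.* (b ℕ.* b) ≡ R
        R≡b⁴ = trans (cong₂ ℕ._*_ b² b²) (trans (eq w) (trans (sym R≡) (eq′ R w)))
          where
          eq : ∀ w → (w ℕ.+ 0 ℕ.* 0) ℕ.* (w ℕ.+ 0 ℕ.* 0) ≡ w ℕ.* w
          eq = ℕR.solve-∀
          eq′ : ∀ R w → R ℕ.+ 4 ℕ.* w ℕ.* (0 ℕ.* 0) ℕ.+ 4 ℕ.* (0 ℕ.* 0) ℕ.* (0 ℕ.* 0) ≡ R
          eq′ = ℕR.solve-∀
      absurd (suc s) s≤b b² R≡ (inj₁ (n₁ , n₂)) = no-solution b (suc s) w R (s≤s z≤n) s≤b u₀≤b b² R≡ n₁ n₂
      absurd (suc s) s≤b b² R≡ (inj₂ n) = ℕ.<⇒≱ E<6uvw (begin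
          6 ℕ.* (u₀ ℕ.* w₀) ≤⟨ ℕ.*-mono-≤ (ℕ.m≤n+m 6 c) (ℕ.*-mono-≤ S.u₀≤uv S.w₀≤w) ⟩
          (c ℕ.+ 6) ℕ.* (b ℕ.* suc s ℕ.* w) ≡⟨ cong (ℕ._* (b ℕ.* suc s ℕ.* w)) (sym 4κ≡c+6) ⟩
          4 ℕ.* κ ℕ.* (b ℕ.* suc s ℕ.* w) ≡⟨ eq κ (b ℕ.* suc s) w ⟩
          κ ℕ.* (4 ℕ.* (b ℕ.* suc s) ℕ.* w) ≤⟨ ℕ.≤-trans (ℕ.m≤n+m _ R) n ⟩
          E ∎)
        where
        open ℕ.≤-Reasoning
        module S = Sector b (suc s) w R (s≤s z≤n) s≤b u₀≤b b² R≡
        eq : ∀ k x w → 4 ℕ.* k ℕ.* (x ℕ.* w) ≡ k ℕ.* (4 ℕ.* x ℕ.* w)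
        eq = ℕR.solve-∀

    near-of : ∀ b s w R e → ∣ + R - + (κ ℕ.* (4 ℕ.* (b ℕ.* s) ℕ.* w)) ∣ ℕ.≤ e ⊎ ∣ + R + + (κ ℕ.* (4 ℕ.* (b ℕ.* s) ℕ.* w)) ∣ ℕ.≤ e → Near b s w R e
    near-of b s w R e (inj₁ h) = inj₁
      ( ℕ.≤-trans (ℕ.m≤n+∣m-n∣ S R) (ℕ.+-monoʳ-≤ R (subst (ℕ._≤ e) (trans (∣+-+∣ R S) (ℕ.∣-∣-comm R S)) h))
      , ℕ.≤-trans (ℕ.m≤n+∣m-n∣ R S) (ℕ.+-monoʳ-≤ S (subst (ℕ._≤ e) (∣+-+∣ R S) h)))
      where S = κ ℕ.* (4 ℕ.* (b ℕ.* s) ℕ.* w)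
    near-of b s w R e (inj₂ h) = inj₂ h

    -- When ρ < 0 the pair is rotated by 45°, which multiplies it by 1 - i and ρ, σ by -4.
    bounded : ∀ b s w (ρ σ : ℤ) → s ℕ.≤ b → b ℕ.* b ≡ w ℕ.+ s ℕ.* s →
      ρ + + 4 * + w * (+ s * + s) + + 4 * (+ s * + s) * (+ s * + s) ≡ + w * + w →
      ∣ σ ∣ ≡ 4 ℕ.* (b ℕ.* s) ℕ.* w → ∣ ρ - + κ * σ ∣ ≡ e₀ → b ℕ.< u₀
    bounded b s w (+ R) σ s≤b b² ρ≡ σ≡ G≡ = small-b b s w R s≤b b² R≡ (near-of b s w R E (signs σ σ≡ G≡))
      where
      e₀≤E : e₀ ℕ.≤ E
      e₀≤E = ℕ.≤-trans (ℕ.m≤n*m e₀ 4) (ℕ.≤-reflexive (sym E≡4e₀))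
      R≡ : R ℕ.+ 4 ℕ.* w ℕ.* (s ℕ.* s) ℕ.+ 4 ℕ.* (s ℕ.* s) ℕ.* (s ℕ.* s) ≡ w ℕ.* w
      R≡ = ℤ.+-injective (trans (cong₂ (λ x y → + R + x + y)
          (trans (ℤ.pos-* (4 ℕ.* w) (s ℕ.* s)) (cong₂ _*_ (ℤ.pos-* 4 w) (ℤ.pos-* s s)))
          (trans (ℤ.pos-* (4 ℕ.* (s ℕ.* s)) (s ℕ.* s)) (cong₂ _*_ (trans (ℤ.pos-* 4 (s ℕ.* s)) (cong (+ 4 *_) (ℤ.pos-* s s))) (ℤ.pos-* s s))))
        (trans ρ≡ (sym (ℤ.pos-* w w))))
      S = 4 ℕ.* (b ℕ.* s) ℕ.* w
      signs : ∀ σ → ∣ σ ∣ ≡ S → ∣ + R - + κ * σ ∣ ≡ e₀ → ∣ + R - + (κ ℕ.* S) ∣ ℕ.≤ E ⊎ ∣ + R + + (κ ℕ.* S) ∣ ℕ.≤ E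
      signs (+ n) σ≡ G≡ = inj₁ (subst (ℕ._≤ E) (trans (sym G≡) (cong (λ x → ∣ + R - x ∣) (trans (cong (λ n → + κ * + n) σ≡) (sym (ℤ.pos-* κ S))))) e₀≤E)
      signs -[1+ n ] σ≡ G≡ = inj₂ (subst (ℕ._≤ E) (trans (sym G≡) (cong (λ x → ∣ + R + x ∣) (trans (ℤ.neg-distribʳ-* (+ κ) -[1+ n ]) (trans (cong (λ n → + κ * + n) σ≡) (sym (ℤ.pos-* κ S)))))) e₀≤E)
    bounded b s w ρ@(-[1+ r ]) σ s≤b b² ρ≡ σ≡ G≡ = ℕ.≤-<-trans (ℕ.m≤m+n b s) (small-b b′ s′ w′ R′ s′≤b′ b′² R′≡ (near-of b′ s′ w′ R′ E (signs σ σ≡ G≡)))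
      where
      b′ s′ w′ R′ S : ℕ
      b′ = b ℕ.+ s
      s′ = b ℕ.∸ s
      w′ = 4 ℕ.* (b ℕ.* s)
      R′ = 4 ℕ.* suc r
      S = 4 ℕ.* (b ℕ.* s) ℕ.* w
      b≡ : s ℕ.+ s′ ≡ b
      b≡ = ℕ.m+[n∸m]≡n s≤b
      s′≤b′ : s′ ℕ.≤ b′
      s′≤b′ = ℕ.≤-trans (ℕ.m∸n≤m b s) (ℕ.m≤m+n b s)
      b′² : b′ ℕ.* b′ ≡ w′ ℕ.+ s′ ℕ.* s′
      b′² = subst (λ b → (b ℕ.+ s) ℕ.* (b ℕ.+ s) ≡ 4 ℕ.* (b ℕ.* s) ℕ.+ s′ ℕ.* s′) b≡ (eq s s′)
        where
        eq : ∀ s d → (s ℕ.+ d ℕ.+ s) ℕ.* (s ℕ.+ d ℕ.+ s) ≡ 4 ℕ.* ((s ℕ.+ d) ℕ.* s) ℕ.+ d ℕ.* d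
        eq = ℕR.solve-∀
      w≡ : w ≡ s′ ℕ.* b′
      w≡ = ℕ.+-cancelʳ-≡ (s ℕ.* s) w (s′ ℕ.* b′) (trans (sym b²) (subst (λ b → b ℕ.* b ≡ s′ ℕ.* (b ℕ.+ s) ℕ.+ s ℕ.* s) b≡ (eq s s′)))
        where
        eq : ∀ s d → (s ℕ.+ d) ℕ.* (s ℕ.+ d) ≡ d ℕ.* (s ℕ.+ d ℕ.+ s) ℕ.+ s ℕ.* s
        eq = ℕR.solve-∀
      b²ᶻ : + b * + b ≡ + w + + s * + s
      b²ᶻ = trans (sym (ℤ.pos-* b b)) (trans (cong +_ b²) (cong (λ x → + w + x) (ℤ.pos-* s s)))
      bs′ : + s′ * + b′ ≡ + w
      bs′ = trans (sym (ℤ.pos-* s′ b′)) (cong +_ (sym w≡))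
      ss′ : + s′ * + s′ + + 4 * (+ b * + s) ≡ + b′ * + b′
      ss′ = trans (ℤ.+-comm (+ s′ * + s′) (+ 4 * (+ b * + s))) (sym (trans (sym (ℤ.pos-* b′ b′)) (trans (cong +_ b′²) (cong₂ _+_ (trans (ℤ.pos-* 4 (b ℕ.* s)) (cong (+ 4 *_) (ℤ.pos-* b s))) (ℤ.pos-* s′ s′)))))
      R′≡ : R′ ℕ.+ 4 ℕ.* w′ ℕ.* (s′ ℕ.* s′) ℕ.+ 4 ℕ.* (s′ ℕ.* s′) ℕ.* (s′ ℕ.* s′) ≡ w′ ℕ.* w′
      R′≡ = ℤ.+-injective (trans (cong₂ (λ x y → + R′ + x + y)
          (trans (ℤ.pos-* (4 ℕ.* w′) (s′ ℕ.* s′)) (cong₂ _*_ (trans (ℤ.pos-* 4 w′) (cong (+ 4 *_) w′≡)) (ℤ.pos-* s′ s′)))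
          (trans (ℤ.pos-* (4 ℕ.* (s′ ℕ.* s′)) (s′ ℕ.* s′)) (cong₂ _*_ (trans (ℤ.pos-* 4 (s′ ℕ.* s′)) (cong (+ 4 *_) (ℤ.pos-* s′ s′))) (ℤ.pos-* s′ s′))))
        (trans (cong (λ x → x + + 4 * (+ 4 * (+ b * + s)) * (+ s′ * + s′) + + 4 * (+ s′ * + s′) * (+ s′ * + s′)) R′ᶻ)
        (trans (eq₁ ρ (+ b * + s) (+ s′)) (trans (cong (λ x → -[1+ 3 ] * ρ + + 4 * (+ s′ * + s′ * x)) ss′)
          (trans (eq₂ ρ (+ s′) (+ b′)) (trans (cong (λ x → -[1+ 3 ] * ρ + + 4 * (x * x)) bs′)
            (trans (cong (λ x → -[1+ 3 ] * ρ + + 4 * x) (sym ρ≡)) (trans (eq₃ ρ (+ w) (+ s)) (trans (cong (λ x → + 16 * (x * (+ s * + s))) (sym b²ᶻ)) (trans (eq₄ (+ b) (+ s)) (trans (sym (cong₂ _*_ w′≡ w′≡)) (sym (ℤ.pos-* w′ w′)))))))))))) )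
        where
        w′≡ : + w′ ≡ + 4 * (+ b * + s)
        w′≡ = trans (ℤ.pos-* 4 (b ℕ.* s)) (cong (+ 4 *_) (ℤ.pos-* b s))
        R′ᶻ : + R′ ≡ -[1+ 3 ] * ρ
        R′ᶻ = refl
        eq₁ : ∀ ρ x d → -[1+ 3 ] * ρ + + 4 * (+ 4 * x) * (d * d) + + 4 * (d * d) * (d * d) ≡ -[1+ 3 ] * ρ + + 4 * (d * d * (d * d + + 4 * x))
        eq₁ = solve-∀
        eq₂ : ∀ ρ d b → -[1+ 3 ] * ρ + + 4 * (d * d * (b * b)) ≡ -[1+ 3 ] * ρ + + 4 * (d * b * (d * b))
        eq₂ = solve-∀
        eq₃ : ∀ ρ w s → -[1+ 3 ] * ρ + + 4 * (ρ + + 4 * w * (s * s) + + 4 * (s * s) * (s * s)) ≡ + 16 * ((w + s * s) * (s * s))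
        eq₃ = solve-∀
        eq₄ : ∀ b s → + 16 * (b * b * (s * s)) ≡ + 4 * (b * s) * (+ 4 * (b * s))
        eq₄ = solve-∀
      S′≡ : 4 ℕ.* (b′ ℕ.* s′) ℕ.* w′ ≡ 4 ℕ.* S
      S′≡ = trans (eq b′ s′ (b ℕ.* s)) (cong (λ x → 4 ℕ.* (4 ℕ.* (b ℕ.* s) ℕ.* x)) (sym w≡))
        where
        eq : ∀ x y z → 4 ℕ.* (x ℕ.* y) ℕ.* (4 ℕ.* z) ≡ 4 ℕ.* (4 ℕ.* z ℕ.* (y ℕ.* x))
        eq = ℕR.solve-∀
      four : ∀ i → ∣ i ∣ ≡ e₀ → ∣ -[1+ 3 ] * i ∣ ℕ.≤ E
      four i h = ℕ.≤-reflexive (trans (ℤ.abs-* -[1+ 3 ] i) (trans (cong (4 ℕ.*_) h) (sym E≡4e₀)))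
      κS′ : + (κ ℕ.* (4 ℕ.* (b′ ℕ.* s′) ℕ.* w′)) ≡ + 4 * (+ κ * + S)
      κS′ = trans (ℤ.pos-* κ _) (trans (cong (λ x → + κ * x) (trans (cong +_ S′≡) (ℤ.pos-* 4 S))) (eq (+ κ) (+ S)))
        where
        eq : ∀ k s → k * (+ 4 * s) ≡ + 4 * (k * s)
        eq = solve-∀
      signs : ∀ σ → ∣ σ ∣ ≡ S → ∣ ρ - + κ * σ ∣ ≡ e₀ → ∣ + R′ - + (κ ℕ.* (4 ℕ.* (b′ ℕ.* s′) ℕ.* w′)) ∣ ℕ.≤ E ⊎ ∣ + R′ + + (κ ℕ.* (4 ℕ.* (b′ ℕ.* s′) ℕ.* w′)) ∣ ℕ.≤ E
      signs (+ n) σ≡ G≡ = inj₂ (subst (λ x → ∣ x ∣ ℕ.≤ E) (trans (cong (λ n → -[1+ 3 ] * (ρ - + κ * + n)) σ≡) (trans (eq ρ (+ κ * + S)) (cong (λ x → -[1+ 3 ] * ρ + x) (sym κS′)))) (four (ρ - + κ * + n) G≡))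
        where
        eq : ∀ ρ x → -[1+ 3 ] * (ρ - x) ≡ -[1+ 3 ] * ρ + + 4 * x
        eq = solve-∀
      signs -[1+ n ] σ≡ G≡ = inj₁ (subst (λ x → ∣ x ∣ ℕ.≤ E) (trans (cong (λ n → -[1+ 3 ] * (ρ - + κ * - + n)) σ≡) (trans (eq ρ (+ κ) (+ S)) (cong (λ x → -[1+ 3 ] * ρ - x) (sym κS′)))) (four (ρ - + κ * -[1+ n ]) G≡))
        where
        eq : ∀ ρ k s → -[1+ 3 ] * (ρ - k * - s) ≡ -[1+ 3 ] * ρ - + 4 * (k * s)
        eq = solve-∀

    -- Real and imaginary part of (u + vi)⁴.
    ρ-of σ-of : ℤ → ℤ → ℤ
    ρ-of u v = (u * u - v * v) * (u * u - v * v) - + 2 * (u * v) * (+ 2 * (u * v))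
    σ-of u v = + 2 * (u * u - v * v) * (+ 2 * (u * v))

    ordered : ∀ u v → ∣ v ∣ ℕ.≤ ∣ u ∣ → ∣ ρ-of u v - + κ * σ-of u v ∣ ≡ e₀ → ∣ u ∣ ℕ.< u₀
    ordered u v v≤u = bounded b s w (ρ-of u v) (σ-of u v) v≤u b² ρ≡ σ≡
      where
      b = ∣ u ∣
      s = ∣ v ∣
      w = b ℕ.* b ℕ.∸ s ℕ.* s
      b² : b ℕ.* b ≡ w ℕ.+ s ℕ.* s
      b² = sym (ℕ.m∸n+n≡m (ℕ.*-mono-≤ v≤u v≤u))
      w≡ : u * u - v * v ≡ + w
      w≡ = trans (cong₂ _-_ (trans (square≡ u) (cong +_ b²)) (square≡ v)) (eq (+ w) (+ (s ℕ.* s)))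
        where
        eq : ∀ w y → w + y - y ≡ w
        eq = solve-∀
      s² : + s * + s ≡ v * v
      s² = trans (sym (ℤ.pos-* s s)) (sym (square≡ v))
      ρ≡ : ρ-of u v + + 4 * + w * (+ s * + s) + + 4 * (+ s * + s) * (+ s * + s) ≡ + w * + w
      ρ≡ = trans (cong₂ (λ W V → ρ-of u v + + 4 * W * V + + 4 * V * V) (sym w≡) s²) (trans (eq u v) (cong₂ _*_ w≡ w≡))
        where
        eq : ∀ u v → (u * u - v * v) * (u * u - v * v) - + 2 * (u * v) * (+ 2 * (u * v)) + + 4 * (u * u - v * v) * (v * v) + + 4 * (v * v) * (v * v) ≡ (u * u - v * v) * (u * u - v * v)
        eq = solve-∀
      σ≡ : ∣ σ-of u v ∣ ≡ 4 ℕ.* (b ℕ.* s) ℕ.* w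
      σ≡ = trans (cong ∣_∣ (trans (eq u v) (cong (λ W → + 4 * (u * v) * W) w≡))) (trans (ℤ.abs-* (+ 4 * (u * v)) (+ w)) (cong (ℕ._* w) (trans (ℤ.abs-* (+ 4) (u * v)) (cong (4 ℕ.*_) (ℤ.abs-* u v)))))
        where
        eq : ∀ u v → + 2 * (u * u - v * v) * (+ 2 * (u * v)) ≡ + 4 * (u * v) * (u * u - v * v)
        eq = solve-∀

    -- If |v| is the larger coordinate, multiplication by -i exchanges the two up to sign and keeps
    -- the fourth power.
    pair-bounded : ∀ u v → ∣ ρ-of u v - + κ * σ-of u v ∣ ≡ e₀ → ∣ u ∣ ℕ.< u₀ × ∣ v ∣ ℕ.< u₀
    pair-bounded u v h with ℕ.≤-total ∣ v ∣ ∣ u ∣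
    ... | inj₁ le = ordered u v le h , ℕ.≤-<-trans le (ordered u v le h)
    ... | inj₂ le = ℕ.≤-<-trans le lt , lt
      where
      lt : ∣ v ∣ ℕ.< u₀
      lt = ordered v (- u) (subst (ℕ._≤ ∣ v ∣) (sym (ℤ.∣-i∣≡∣i∣ u)) le) (trans (cong ∣_∣ (eq u v (+ κ))) h)
        where
        eq : ∀ u v k → (v * v - - u * - u) * (v * v - - u * - u) - + 2 * (v * - u) * (+ 2 * (v * - u)) - k * (+ 2 * (v * v - - u * - u) * (+ 2 * (v * - u)))
          ≡ (u * u - v * v) * (u * u - v * v) - + 2 * (u * v) * (+ 2 * (u * v)) - k * (+ 2 * (u * u - v * v) * (+ 2 * (u * v)))
        eq = solve-∀

  -- The real part plus the imaginary part of (x + yi)⁴.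
  F : ℤ → ℤ → ℤ
  F x y = (x * x - y * y) * (x * x - y * y) - + 2 * (x * y) * (+ 2 * (x * y)) + + 2 * (x * x - y * y) * (+ 2 * (x * y))

  private
    shifted : ∀ {x} → ∣ x ∣ ℕ.≤ 11 → ∃ λ a → a ℕ.< 23 × x ≡ + a - + 11
    shifted {+ n} h = n ℕ.+ 11 , s≤s (ℕ.+-monoˡ-≤ 11 h) , eq (+ n)
      where
      eq : ∀ x → x ≡ x + + 11 - + 11
      eq = solve-∀
    shifted { -[1+ n ]} h = 11 ℕ.∸ suc n , s≤s (ℕ.≤-trans (ℕ.m∸n≤m 11 (suc n)) (ℕ.m≤m+n 11 11)) , trans (eq (+ suc n) (+ (11 ℕ.∸ suc n))) (cong (λ y → + (11 ℕ.∸ suc n) - + y) (ℕ.m+[n∸m]≡n h))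
      where
      eq : ∀ x y → - x ≡ y - (x + y)
      eq = solve-∀

    Small : ℤ → ℤ → Set
    Small x y = x * x + y * y ≡ + 1 ⊎ x * x + y * y ≡ + 13

    search : ∀ {a} → a ℕ.< 23 → ∀ {b} → b ℕ.< 23 → ∣ F (+ a - + 11) (+ b - + 11) ∣ ≡ 1 → Small (+ a - + 11) (+ b - + 11)
    search = toWitness {a? = ℕ.allUpTo? (λ a → ℕ.allUpTo? (λ b → (∣ F (+ a - + 11) (+ b - + 11) ∣ ℕ.≟ 1) →-dec
        (((+ a - + 11) * (+ a - + 11) + (+ b - + 11) * (+ b - + 11) ℤ.≟ + 1) ⊎-dec ((+ a - + 11) * (+ a - + 11) + (+ b - + 11) * (+ b - + 11) ℤ.≟ + 13))) 23) 23} _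

  ljunggren : ∀ x y → IsSign (F x y) → x * x + y * y ≡ + 1 ⊎ x * x + y * y ≡ + 13
  ljunggren x y sgn = conclude (shifted ∣x∣≤11) (shifted ∣y∣≤11)
    where
    abs1 : ∀ {z} → IsSign z → ∣ z ∣ ≡ 1
    abs1 (inj₁ refl) = refl
    abs1 (inj₂ refl) = refl
    -- u + vi = (3 - 2i)(x + yi), where 3 - 2i has norm 13.
    u v : ℤ
    u = + 3 * x + + 2 * y
    v = + 3 * y - + 2 * x
    G : ∣ ρ-of u v - + κ * σ-of u v ∣ ≡ e₀
    G = trans (cong ∣_∣ value) (trans (ℤ.abs-* (+ e₀) (F x y)) (trans (cong (e₀ ℕ.*_) (abs1 sgn)) (ℕ.*-identityʳ e₀)))
      where
      r t : ℤ
      r = x * x - y * y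
      t = + 2 * (x * y)
      uu : u * u - v * v ≡ + 5 * r + + 12 * t
      uu = eq x y
        where
        eq : ∀ x y → (+ 3 * x + + 2 * y) * (+ 3 * x + + 2 * y) - (+ 3 * y - + 2 * x) * (+ 3 * y - + 2 * x) ≡ + 5 * (x * x - y * y) + + 12 * (+ 2 * (x * y))
        eq = solve-∀
      uv : + 2 * (u * v) ≡ + 5 * t - + 12 * r
      uv = eq x y
        where
        eq : ∀ x y → + 2 * ((+ 3 * x + + 2 * y) * (+ 3 * y - + 2 * x)) ≡ + 5 * (+ 2 * (x * y)) - + 12 * (x * x - y * y)
        eq = solve-∀
      value : ρ-of u v - + κ * σ-of u v ≡ + e₀ * F x y
      value = trans (cong₂ (λ p q → p * p - q * q - + κ * (+ 2 * p * q)) uu uv)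
        (trans (eq (+ κ) r t) (trans (cong₂ (λ a b → a * (r * r - t * t) + b * (+ 2 * r * t)) 120κ≡ 119κ≡) (eq′ (+ e₀) r t)))
        where
        eq : ∀ k r t → (+ 5 * r + + 12 * t) * (+ 5 * r + + 12 * t) - (+ 5 * t - + 12 * r) * (+ 5 * t - + 12 * r) - k * (+ 2 * (+ 5 * r + + 12 * t) * (+ 5 * t - + 12 * r))
          ≡ (+ 120 * k - + 119) * (r * r - t * t) + (+ 119 * k + + 120) * (+ 2 * r * t)
        eq = solve-∀
        eq′ : ∀ e r t → e * (r * r - t * t) + e * (+ 2 * r * t) ≡ e * (r * r - t * t + + 2 * r * t)
        eq′ = solve-∀
    29≥ : ∀ {n} → n ℕ.< u₀ → n ℕ.≤ 29
    29≥ {n} h = ℕ.≤-pred (subst (n ℕ.<_) u₀≡30 h)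
    -- Division by 3 - 2i again: 13x = 3u - 2v and 13y = 3v + 2u are at most 5 · 29 = 145 < 13 · 12
    -- in absolute value, which leaves the finite range of `search`.
    combination : ∀ a b z → + 13 * z ≡ + 3 * a + + 2 * b → ∣ a ∣ ℕ.≤ 29 → ∣ b ∣ ℕ.≤ 29 → ∣ z ∣ ℕ.≤ 11
    combination a b z e ha hb = ℕ.≤-pred (ℕ.*-cancelˡ-< 13 ∣ z ∣ 12 (ℕ.≤-<-trans (ℕ.≤-trans (ℕ.≤-reflexive (trans (sym (ℤ.abs-* (+ 13) z)) (cong ∣_∣ e)))
        (ℕ.≤-trans (ℤ.∣i+j∣≤∣i∣+∣j∣ (+ 3 * a) (+ 2 * b)) (ℕ.+-mono-≤ (ℕ.≤-trans (ℕ.≤-reflexive (ℤ.abs-* (+ 3) a)) (ℕ.*-monoʳ-≤ 3 ha)) (ℕ.≤-trans (ℕ.≤-reflexive (ℤ.abs-* (+ 2) b)) (ℕ.*-monoʳ-≤ 2 hb)))))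
        (ℕ.≤ᵇ⇒≤ 146 156 _)))
    bounds = pair-bounded u v G
    ∣x∣≤11 : ∣ x ∣ ℕ.≤ 11
    ∣x∣≤11 = combination u (- v) x (eq x y) (29≥ (proj₁ bounds)) (subst (ℕ._≤ 29) (sym (ℤ.∣-i∣≡∣i∣ v)) (29≥ (proj₂ bounds)))
      where
      eq : ∀ x y → + 13 * x ≡ + 3 * (+ 3 * x + + 2 * y) + + 2 * - (+ 3 * y - + 2 * x)
      eq = solve-∀
    ∣y∣≤11 : ∣ y ∣ ℕ.≤ 11
    ∣y∣≤11 = combination v u y (eq x y) (29≥ (proj₂ bounds)) (29≥ (proj₁ bounds))
      where
      eq : ∀ x y → + 13 * y ≡ + 3 * (+ 3 * y - + 2 * x) + + 2 * (+ 3 * x + + 2 * y)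
      eq = solve-∀
    conclude : (∃ λ a → a ℕ.< 23 × x ≡ + a - + 11) → (∃ λ b → b ℕ.< 23 × y ≡ + b - + 11) → Small x y
    conclude (a , a< , x≡) (b , b< , y≡) = subst₂ Small (sym x≡) (sym y≡) (search a< b< (trans (cong ∣_∣ (sym (cong₂ F x≡ y≡))) (abs1 sgn)))

-- X² + 1 = 2yⁿ in the Gaussian integers

module Equation1 where

  open import Data.Integer using (+_; -[1+_]; _+_; _*_; -_; _-_; _^_)
  open import Data.Integer.Tactic.RingSolver using (solve-∀)
  open import Data.Fin using (zero; suc)
  open import Data.Vec using (_∷_; [])
  open Arith
  open SmallValues
  open Congruences
  open Units
  open QuadraticRing (+ 1) hiding (_:+_; _:*_)
  open Divisibility (+ 1)
  open Powers (+ 1)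
  open Ljunggren using (ljunggren)
  module R = Representation (+ 1) (+ 1) (+ 2) (+ 1) refl

  private
    x₀ : ∀ {n} → Expr (1 ℕ.+ n)
    x₀ = var zero
    x₁ : ∀ {n} → Expr (2 ℕ.+ n)
    x₁ = var (suc zero)

  conj-⊛ : ∀ z n → conj (z ⊛ n) ≡ conj z ⊛ n
  conj-⊛ z zero = ext (re-conj (ι (+ 1))) (im-conj (ι (+ 1)))
  conj-⊛ z (suc n) = trans (conj-⊗ z (z ⊛ n)) (cong (conj z ⊗_) (conj-⊛ z n))

  norm-unit : ∀ κ → norm κ ≡ + 1 → im κ ≡ + 0 × IsSign (re κ) ⊎ re κ ≡ + 0 × IsSign (im κ)
  norm-unit κ h with sum-of-squares 1 (re κ) (im κ) (s≤s z≤n) (trans (sym (norm≡ κ)) h)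
  ... | inj₁ r = inj₁ r
  ... | inj₂ (r , s , _) = inj₂ (r , s)

  re-real : ∀ g κ → im κ ≡ + 0 → re (g ⊗ κ) ≡ re κ * re g
  re-real g κ h = trans (re-⊗ g κ) (trans (cong (λ x → re g * re κ - + 1 * (im g * x)) h) (eq (re g) (re κ) (im g)))
    where
    eq : ∀ r k i → r * k - + 1 * (i * + 0) ≡ k * r
    eq = solve-∀

  im-real : ∀ g κ → im κ ≡ + 0 → im (g ⊗ κ) ≡ re κ * im g
  im-real g κ h = trans (im-⊗ g κ) (trans (cong (λ x → re g * x + im g * re κ) h) (eq (re g) (re κ) (im g)))
    where
    eq : ∀ r k i → r * + 0 + i * k ≡ k * i
    eq = solve-∀

  re-imaginary : ∀ g κ → re κ ≡ + 0 → re (g ⊗ κ) ≡ - (im κ * im g)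
  re-imaginary g κ h = trans (re-⊗ g κ) (trans (cong (λ x → re g * x - + 1 * (im g * im κ)) h) (eq (re g) (im κ) (im g)))
    where
    eq : ∀ r k i → r * + 0 - + 1 * (i * k) ≡ - (k * i)
    eq = solve-∀

  im-imaginary : ∀ g κ → re κ ≡ + 0 → im (g ⊗ κ) ≡ im κ * re g
  im-imaginary g κ h = trans (im-⊗ g κ) (trans (cong (λ x → re g * im κ + im g * x) h) (eq (re g) (im κ) (im g)))
    where
    eq : ∀ r k i → r * k + i * + 0 ≡ k * r
    eq = solve-∀

  im-multiple : ∀ g a b → im g ≡ a * b → ∀ m → ∃ λ w → im (g ⊛ m) ≡ a * w
  im-multiple g a b h zero = + 0 , sym (ℤ.*-zeroʳ a)
  im-multiple g a b h (suc m) = extend (im-multiple g a b h m)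
    where
    extend : (∃ λ w → im (g ⊛ m) ≡ a * w) → ∃ λ w → im (g ⊛ suc m) ≡ a * w
    extend (w , e) = re g * w + b * re (g ⊛ m) , trans (im-⊗ g (g ⊛ m)) (trans (cong₂ (λ x y → re g * x + y * re (g ⊛ m)) e h) (eq (re g) a w b (re (g ⊛ m))))
      where
      eq : ∀ r a w b x → r * (a * w) + a * b * x ≡ a * (r * w + b * x)
      eq = solve-∀

  module Factored (X y Y s b : ℤ) (equation : + 1 * (X * X) + + 1 ≡ + 2 * (y * Y)) (value : form (+ 1 * + 2 * y) (+ 1 * X) Y s b ≡ + 1)
    (y-odd : ∃ λ t → y ≡ + 1 + + 2 * t) where
    private
      coprime : Coprime (+ 2) y
      coprime = coprime-2 y-odd
    open R.Factor X y Y s b equation value (proj₁ coprime) (proj₁ (proj₂ coprime)) (proj₂ (proj₂ coprime)) public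

    a²+b² : a * a + b * b ≡ + 2 * y
    a²+b² = trans (eq a b) (trans a-b (cong (+ 2 *_) (ℤ.*-identityʳ y)))
      where
      eq : ∀ a b → a * a + b * b ≡ + 1 * (a * a) + + 1 * (b * b)
      eq = solve-∀

  module Setup (x y : ℤ) (k : ℕ) (y≡ : y ≡ + suc k) (Y w : ℤ) (w² : y * Y ≡ y * y * w)
    (equation : + 1 * ((+ 2 * x + + 3) * (+ 2 * x + + 3)) + + 1 ≡ + 2 * (y * Y)) where
    X : ℤ
    X = + 2 * x + + 3

    y-odd : ∃ λ t → y ≡ + 1 + + 2 * t
    y-odd = half (implies 4 (# 1 :* ((# 2 :* x₀ :+ # 3) :* (# 2 :* x₀ :+ # 3)) :+ # 1 :+ # 2 :* (x₁ :* x₁ :* var (suc (suc zero)))) (# 2 :* (x₁ :+ # 1)) _ (x ∷ y ∷ w ∷ [])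
        (y * y * w , trans (cong (_+ + 2 * (y * y * w)) (trans equation (cong (+ 2 *_) w²))) (eq (y * y * w))))
      where
      eq : ∀ w → + 2 * w + + 2 * w ≡ + 4 * w
      eq = solve-∀
      half : 4 ∣ᶻ + 2 * (y + + 1) → ∃ λ t → y ≡ + 1 + + 2 * t
      half (u , h) = odd⇒ (u , ℤ.*-cancelˡ-≡ (+ 2) (y + + 1) (+ 2 * u) (trans h (eq′ u)))
        where
        eq′ : ∀ u → + 4 * u ≡ + 2 * (+ 2 * u)
        eq′ = solve-∀

    A≡ : + (2 ℕ.* suc k) ≡ + 2 * y
    A≡ = trans (ℤ.pos-* 2 (suc k)) (cong (+ 2 *_) (sym y≡))

    det : + (2 ℕ.* suc k) * Y - + 1 * X * (+ 1 * X) ≡ + 1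
    det = trans (cong (λ a → a * Y - + 1 * X * (+ 1 * X)) A≡) (trans (eq y Y X) (trans (cong (λ v → v - + 1 * X * (+ 1 * X)) (sym equation)) (eq′ X)))
      where
      eq : ∀ y Y X → + 2 * y * Y - + 1 * X * (+ 1 * X) ≡ + 2 * (y * Y) - + 1 * X * (+ 1 * X)
      eq = solve-∀
      eq′ : ∀ X → + 1 * (X * X) + + 1 - + 1 * X * (+ 1 * X) ≡ + 1
      eq′ = solve-∀

    represents-one : SmallValue 1 (+ (2 ℕ.* suc k)) (+ 1 * X) Y → ∃₂ λ s b → form (+ 1 * + 2 * y) (+ 1 * X) Y s b ≡ + 1
    represents-one (small s b g h 1 prim val pos bnd) = s , b , trans (cong (λ A → form A (+ 1 * X) Y s b) (sym A≡)) val
    represents-one (small s b g h (suc (suc j)) prim val pos bnd) =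
      contradiction (ℕ.≤-trans (ℕ.*-monoʳ-≤ 3 (ℕ.*-mono-≤ (ℕ.m≤m+n 2 j) (ℕ.m≤m+n 2 j))) bnd) (ℕ.<⇒≱ {4} {12} (ℕ.≤ᵇ⇒≤ 5 12 _))

    one : ∃₂ λ s b → form (+ 1 * + 2 * y) (+ 1 * X) Y s b ≡ + 1
    one = represents-one (smallValue 1 (2 ℕ.* suc k) (s≤s z≤n) (+ 1 * X) Y det)

  -- The case of a power γ^m with h² = 1 + 8j, up to replacing γ by -γ̄.
  odd-end : ∀ (y h : ℤ) m → h * h + + 1 ≡ + 2 * y → (∃ λ t → y ≡ + 1 + + 2 * t) →
    IsSign (re (((y - + 1) +√ h) ⊛ suc m) + h * im (((y - + 1) +√ h) ⊛ suc m)) → y ≡ + 1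
  odd-end y h m e (t , y-odd) sgn = conclude (odd-square′ h-odd)
    where
    open Functional1
    h-odd : ∃ λ t → h ≡ + 1 + + 2 * t
    h-odd = odd⇒ (implies 2 (var {1} zero :* var zero :+ # 1) (var zero :+ # 1) _ (h ∷ []) (y , e))
    conclude : (∃ λ j → h * h ≡ + 1 + + 8 * j) → y ≡ + 1
    conclude (j , h²) = trans y-value (trans (cong (λ j → + 1 + + 4 * j) j≡0) refl)
      where
      open Functional h using (φ; φ≡)
      G = (y - + 1) +√ h
      y-value : y ≡ + 1 + + 4 * j
      y-value = ℤ.*-cancelˡ-≡ (+ 2) y (+ 1 + + 4 * j) (trans (sym e) (trans (cong (_+ + 1) h²) (eq j)))
        where
        eq : ∀ j → + 1 + + 8 * j + + 1 ≡ + 2 * (+ 1 + + 4 * j)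
        eq = solve-∀
      G≡ : G ≡ ι (+ 4 * j) ⊕ (+ 0 +√ h)
      G≡ = ext (trans (cong (_- + 1) y-value) (trans (eq j) (sym (re-⊕ (ι (+ 4 * j)) (+ 0 +√ h)))))
          (trans (eq′ h) (sym (im-⊕ (ι (+ 4 * j)) (+ 0 +√ h))))
        where
        eq : ∀ j → + 1 + + 4 * j - + 1 ≡ + 4 * j + + 0
        eq = solve-∀
        eq′ : ∀ h → h ≡ + 0 + h
        eq′ = solve-∀
      j≡0 : j ≡ + 0
      j≡0 = Functional1.gaussian-power h j h² (suc m) (s≤s z≤n) (subst IsSign (trans (sym (φ≡ (G ⊛ suc m))) (cong (λ x → φ (x ⊛ suc m)) G≡)) sgn)

  module Cases (a b y : ℤ) (γ τ : Z√) (m : ℕ) (y-odd : ∃ λ t → y ≡ + 1 + + 2 * t) (ab : a * a + b * b ≡ + 2 * y)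
    (re-γ : re γ ≡ y - b * b) (im-γ : im γ ≡ a * b) (b-re+a-im : b * re τ + a * im τ ≡ + 1) where
    private
      g : Z√
      g = γ ⊛ suc m

      a-part : ∃ λ w → im g ≡ a * w
      a-part = im-multiple γ a b im-γ (suc m)

      b-part : ∃ λ w → im g ≡ b * w
      b-part = im-multiple γ b a (trans im-γ (ℤ.*-comm a b)) (suc m)

    -- For κ = ±1 the divisor b of im γᵐ is a unit, and h = ab.
    real-case : ∀ κ → τ ≡ g ⊗ κ → im κ ≡ + 0 → IsSign (re κ) → y ≡ + 1
    real-case κ τ≡ i0 κ-sign = odd-end y (a * b) m hh y-odd (subst (λ G → IsSign (re (G ⊛ suc m) + a * b * im (G ⊛ suc m))) γ≡ (subst IsSign value₂ (sign-* b-sign (subst IsSign (sym bbv) v-sign))))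
      where
      v = b * re g + a * im g
      κv : re κ * v ≡ + 1
      κv = trans (eq (re κ) b (re g) a (im g)) (trans (sym (cong₂ (λ p q → b * p + a * q) (trans (cong re τ≡) (re-real g κ i0)) (trans (cong im τ≡) (im-real g κ i0)))) b-re+a-im)
        where
        eq : ∀ k b r a i → k * (b * r + a * i) ≡ b * (k * r) + a * (k * i)
        eq = solve-∀
      v-sign : IsSign v
      v-sign = unit-sign v (re κ) (trans (ℤ.*-comm v (re κ)) κv)
      b-sign : IsSign b
      b-sign = unit-sign b (re κ * (re g + a * proj₁ (b-part))) (trans (eq (re κ) b (re g) a (proj₁ (b-part))) (trans (cong (λ i → re κ * (b * re g + a * i)) (sym (proj₂ (b-part)))) κv))
        where
        eq : ∀ k b r a w → b * (k * (r + a * w)) ≡ k * (b * r + a * (b * w))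
        eq = solve-∀
      bbv : b * (b * v) ≡ v
      bbv = trans (sym (ℤ.*-assoc b b v)) (trans (cong (_* v) (sign-square b-sign)) (ℤ.*-identityˡ v))
      value₂ : b * v ≡ re g + a * b * im g
      value₂ = trans (eq b (re g) a (im g)) (trans (cong (λ q → q * re g + a * b * im g) (sign-square b-sign)) (cong (_+ a * b * im g) (ℤ.*-identityˡ (re g))))
        where
        eq : ∀ b r a i → b * (b * r + a * i) ≡ b * b * r + a * b * i
        eq = solve-∀
      γ≡ : γ ≡ (y - + 1) +√ a * b
      γ≡ = ext (trans re-γ (cong (λ p → y - p) (sign-square b-sign))) im-γ
      hh : a * b * (a * b) + + 1 ≡ + 2 * y
      hh = trans (eq a b) (trans (cong (λ q → a * a * q + + 1) (sign-square b-sign)) (trans (eq′ (a * a)) (trans (cong (λ q → a * a + q) (sym (sign-square b-sign))) ab)))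
        where
        eq : ∀ a b → a * b * (a * b) + + 1 ≡ a * a * (b * b) + + 1
        eq = solve-∀
        eq′ : ∀ p → p * + 1 + + 1 ≡ p + + 1
        eq′ = solve-∀

    -- For κ = ±i the roles of a and b are exchanged, so a = ±1. Then b² = 2y - 1, and γ is minus
    -- the conjugate of (y - 1) + hi with h = ab; the conjugation is undone by the changed sign in
    -- v, the minus signs are collected in `e`.
    imaginary-case : ∀ κ → τ ≡ g ⊗ κ → re κ ≡ + 0 → IsSign (im κ) → y ≡ + 1
    imaginary-case κ τ≡ r0 κ-sign = odd-end y (a * b) m hh y-odd (sign-* (-1^ (suc m)) (subst IsSign value₃ (sign-* a-sign (subst IsSign (sym aav) v-sign))))
      where
      v = a * re g - b * im g
      κv : im κ * v ≡ + 1
      κv = trans (eq (im κ) b (re g) a (im g)) (trans (sym (cong₂ (λ p q → b * p + a * q) (trans (cong re τ≡) (re-imaginary g κ r0)) (trans (cong im τ≡) (im-imaginary g κ r0)))) b-re+a-im)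
        where
        eq : ∀ k b r a i → k * (a * r - b * i) ≡ b * - (k * i) + a * (k * r)
        eq = solve-∀
      v-sign : IsSign v
      v-sign = unit-sign v (im κ) (trans (ℤ.*-comm v (im κ)) κv)
      a-sign : IsSign a
      a-sign = unit-sign a (im κ * (re g - b * proj₁ (a-part))) (trans (eq (im κ) b (re g) a (proj₁ (a-part))) (trans (cong (λ i → im κ * (a * re g - b * i)) (sym (proj₂ (a-part)))) κv))
        where
        eq : ∀ k b r a w → a * (k * (r - b * w)) ≡ k * (a * r - b * (a * w))
        eq = solve-∀
      aav : a * (a * v) ≡ v
      aav = trans (sym (ℤ.*-assoc a a v)) (trans (cong (_* v) (sign-square a-sign)) (ℤ.*-identityˡ v))
      hh : a * b * (a * b) + + 1 ≡ + 2 * y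
      hh = trans (eq a b) (trans (cong (λ q → q * (b * b) + + 1) (sign-square a-sign)) (trans (eq′ (b * b)) (trans (cong (_+ b * b) (sym (sign-square a-sign))) ab)))
        where
        eq : ∀ a b → a * b * (a * b) + + 1 ≡ a * a * (b * b) + + 1
        eq = solve-∀
        eq′ : ∀ p → + 1 * p + + 1 ≡ + 1 + p
        eq′ = solve-∀
      G : Z√
      G = (y - + 1) +√ a * b
      e : ℤ
      e = -[1+ 0 ] ^ suc m
      re-scale : ∀ k z → re (ι k ⊗ z) ≡ k * re z
      re-scale k z = trans (re-⊗ (ι k) z) (eq″ k (re z) (im z))
        where
        eq″ : ∀ k r i → k * r - + 1 * (+ 0 * i) ≡ k * r
        eq″ = solve-∀
      im-scale : ∀ k z → im (ι k ⊗ z) ≡ k * im z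
      im-scale k z = trans (im-⊗ (ι k) z) (eq″ k (re z) (im z))
        where
        eq″ : ∀ k r i → k * i + + 0 * r ≡ k * i
        eq″ = solve-∀
      b²≡ : b * b ≡ + 2 * y - + 1
      b²≡ = trans (eq (a * a) (b * b)) (cong₂ _-_ ab (sign-square a-sign))
        where
        eq : ∀ A B → B ≡ A + B - A
        eq = solve-∀
      γ≡ : γ ≡ ι -[1+ 0 ] ⊗ conj G
      γ≡ = ext (trans re-γ (trans (cong (λ q → y - q) b²≡) (trans (eq y) (sym (trans (re-scale -[1+ 0 ] (conj G)) (cong (-[1+ 0 ] *_) (re-conj G)))))))
          (trans im-γ (trans (eq′ (a * b)) (sym (trans (im-scale -[1+ 0 ] (conj G)) (cong (-[1+ 0 ] *_) (im-conj G))))))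
        where
        eq : ∀ y → y - (+ 2 * y - + 1) ≡ -[1+ 0 ] * (y - + 1)
        eq = solve-∀
        eq′ : ∀ h → h ≡ -[1+ 0 ] * - h
        eq′ = solve-∀
      g≡ : g ≡ ι e ⊗ conj (G ⊛ suc m)
      g≡ = trans (cong (_⊛ suc m) γ≡) (trans (⊛-⊗ (ι -[1+ 0 ]) (conj G) (suc m)) (cong₂ _⊗_ (ι-⊛ -[1+ 0 ] (suc m)) (sym (conj-⊛ G (suc m)))))
      value₃ : a * v ≡ e * (re (G ⊛ suc m) + a * b * im (G ⊛ suc m))
      value₃ = trans (eq a (re g) b (im g)) (trans (cong (λ q → q * re g - a * b * im g) (sign-square a-sign))
        (trans (cong₂ (λ r i → + 1 * r - a * b * i) re-g im-g) (eq′ e (re (G ⊛ suc m)) (a * b) (im (G ⊛ suc m)))))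
        where
        re-g : re g ≡ e * re (G ⊛ suc m)
        re-g = trans (cong re g≡) (trans (re-scale e (conj (G ⊛ suc m))) (cong (e *_) (re-conj (G ⊛ suc m))))
        im-g : im g ≡ e * - im (G ⊛ suc m)
        im-g = trans (cong im g≡) (trans (im-scale e (conj (G ⊛ suc m))) (cong (e *_) (im-conj (G ⊛ suc m))))
        eq : ∀ a r b i → a * (a * r - b * i) ≡ a * a * r - a * b * i
        eq = solve-∀
        eq′ : ∀ e r h i → + 1 * (e * r) - h * (e * - i) ≡ e * (r + h * i)
        eq′ = solve-∀

  module OddPower (x y : ℤ) (k m : ℕ) (y≡ : y ≡ + suc k)
    (equation : + 1 * ((+ 2 * x + + 3) * (+ 2 * x + + 3)) + + 1 ≡ + 2 * (y * (y * y) ^ suc m)) where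
    private
      X Y : ℤ
      X = + 2 * x + + 3
      Y = (y * y) ^ suc m
      square-factor : ∀ y p → y * (y * y * p) ≡ y * y * (y * p)
      square-factor = solve-∀
      module S = Setup x y k y≡ Y (y * (y * y) ^ m) (square-factor y ((y * y) ^ m)) equation

      unit-value : (∃₂ λ s b → form (+ 1 * + 2 * y) (+ 1 * X) Y s b ≡ + 1) → y ≡ + 1
      unit-value (s , b , value) = conclude (power (suc m) (subst (λ x → ℤ.NonZero (x ^ suc m)) (sym norm-γ) (subst (λ x → ℤ.NonZero ((x * x) ^ suc m)) (sym y≡) (nonZero-^ k (suc m)))) (cong (_^ suc m) (sym norm-γ)))
        where
        open Factored X y Y s b equation value S.y-odd

        re-γ : re γ ≡ y - b * b
        re-γ = eq y b
          where
          eq : ∀ y b → y - + 1 * + 1 * (b * b) ≡ y - b * b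
          eq = solve-∀

        1≡′ : b * re τ + a * im τ ≡ + 1
        1≡′ = trans (eq b (re τ) a (im τ)) 1≡
          where
          eq : ∀ b r a i → b * r + a * i ≡ b * r + + 1 * a * i
          eq = solve-∀

        module C = Cases a b y γ τ m S.y-odd a²+b² re-γ (ℤ.*-identityˡ (a * b)) 1≡′

        conclude : (∃ λ κ → τ ≡ γ ⊛ suc m ⊗ κ × norm κ ≡ + 1) → y ≡ + 1
        conclude (κ , τ≡ , nκ) = [ (λ p → C.real-case κ τ≡ (proj₁ p) (proj₂ p)) , (λ p → C.imaginary-case κ τ≡ (proj₁ p) (proj₂ p)) ]′ (norm-unit κ nκ)

    y≡1 : y ≡ + 1
    y≡1 = unit-value S.one

  module FourthCases (A a b X y t : ℤ) (k : ℕ) (τ : Z√) (y≡ : y ≡ + suc k) (y-odd : y ≡ + 1 + + 2 * t) (a≡ : a ≡ + 2 * A - b) (a²+b² : a * a + b * b ≡ + 2 * y)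
    (equation : + 1 * (X * X) + + 1 ≡ + 2 * (y * y ^ 3)) (X≡ : a * re τ - + 1 * b * im τ ≡ X) (1≡ : b * re τ + + 1 * a * im τ ≡ + 1) (norm-τ : norm τ ≡ y ^ 3) where
    private
      Y : ℤ
      Y = y ^ 3

      B : ℤ
      B = b - A

      -- π = (a + bi)/(1 + i), integral because a + b is even. The third power y³ is not a power of
      -- norm γ = y², whereas π has norm y and π² = -iγ. It turns X + i = (a + bi)τ into (1 + i)πτ,
      -- so `δ` = πτ has coordinate sum 1, and it becomes π⁴κ once τ = π³κ is known.
      π : Z√
      π = A +√ B

      norm-π : norm π ≡ y
      norm-π = trans (norm≡ π) (ℤ.*-cancelˡ-≡ (+ 2) _ y (trans (eq A b) (trans (cong (λ a → a * a + b * b) (sym a≡)) a²+b²)))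
        where
        eq : ∀ A b → + 2 * (A * A + + 1 * ((b - A) * (b - A))) ≡ (+ 2 * A - b) * (+ 2 * A - b) + b * b
        eq = solve-∀

      δ : Z√
      δ = π ⊗ τ

      re+im : re δ + im δ ≡ + 1
      re+im = trans (cong₂ _+_ (re-⊗ π τ) (im-⊗ π τ)) (trans (eq A b (re τ) (im τ)) (trans (cong (λ a → b * re τ + + 1 * a * im τ) (sym a≡)) 1≡))
        where
        eq : ∀ A b r i → A * r - + 1 * ((b - A) * i) + (A * i + (b - A) * r) ≡ b * r + + 1 * (+ 2 * A - b) * i
        eq = solve-∀

      2re : + 2 * re δ ≡ X + + 1
      2re = trans (cong (+ 2 *_) (re-⊗ π τ)) (trans (eq A b (re τ) (im τ)) (trans (cong (λ a → a * re τ - + 1 * b * im τ + (b * re τ + + 1 * a * im τ)) (sym a≡)) (cong₂ _+_ X≡ 1≡)))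
        where
        eq : ∀ A b r i → + 2 * (A * r - + 1 * ((b - A) * i)) ≡ (+ 2 * A - b) * r - + 1 * b * i + (b * r + + 1 * (+ 2 * A - b) * i)
        eq = solve-∀

      -- (1 - X)(1 + X) + 2y⁴ = 2 and y is odd
      unit : - (t * (+ 1 - X)) * (+ 2 * re δ) + (+ 1 - + 2 * (t * Y)) * norm π ≡ + 1
      unit = trans (cong₂ (λ p q → - (t * (+ 1 - X)) * p + (+ 1 - + 2 * (t * Y)) * q) 2re norm-π)
        (trans (eq t X y Y) (trans (cong (λ p → y - t * (+ 2 + (p - (+ 1 * (X * X) + + 1)))) (sym equation)) (trans (eq′ y t (+ 1 * (X * X) + + 1)) (trans (cong (_- + 2 * t) y-odd) (eq″ t)))))
        where
        eq : ∀ t X y Y → - (t * (+ 1 - X)) * (X + + 1) + (+ 1 - + 2 * (t * Y)) * y ≡ y - t * (+ 2 + (+ 2 * (y * Y) - (+ 1 * (X * X) + + 1)))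
        eq = solve-∀
        eq′ : ∀ y t p → y - t * (+ 2 + (p - p)) ≡ y - + 2 * t
        eq′ = solve-∀
        eq″ : ∀ t → + 1 + + 2 * t - + 2 * t ≡ + 1
        eq″ = solve-∀

      q : Z√
      q = π ⊛ 4

      R I : ℤ
      R = (A * A - B * B) * (A * A - B * B) - + 2 * (A * B) * (+ 2 * (A * B))
      I = + 2 * (A * A - B * B) * (+ 2 * (A * B))

      q≡ : q ≡ R +√ I
      q≡ = trans (⊛-* π 2 2) (trans (cong (_⊛ 2) square) (trans (two (u +√ v)) (ext (trans (re-⊗ (u +√ v) (u +√ v)) (eq₁ u v)) (trans (im-⊗ (u +√ v) (u +√ v)) (eq₂ u v)))))
        where
        u v : ℤ
        u = A * A - B * B
        v = + 2 * (A * B)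
        two : ∀ z → z ⊛ 2 ≡ z ⊗ z
        two z = cong (z ⊗_) (⊗-identityʳ z)
        square : π ⊛ 2 ≡ u +√ v
        square = trans (two π) (ext (trans (re-⊗ π π) (eq₃ A B)) (trans (im-⊗ π π) (eq₄ A B)))
          where
          eq₃ : ∀ A B → A * A - + 1 * (B * B) ≡ A * A - B * B
          eq₃ = solve-∀
          eq₄ : ∀ A B → A * B + B * A ≡ + 2 * (A * B)
          eq₄ = solve-∀
        eq₁ : ∀ r s → r * r - + 1 * (s * s) ≡ r * r - s * s
        eq₁ = solve-∀
        eq₂ : ∀ r s → r * s + s * r ≡ + 2 * r * s
        eq₂ = solve-∀

      A²+B² : A * A + B * B ≡ y
      A²+B² = trans (eq A B) (trans (sym (norm≡ π)) norm-π)
        where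
        eq : ∀ A B → A * A + B * B ≡ A * A + + 1 * (B * B)
        eq = solve-∀

      conclude : (∃ λ κ → τ ≡ π ⊛ 3 ⊗ κ × norm κ ≡ + 1) → y ≡ + 1 ⊎ y ≡ + 13
      conclude (κ , τ≡ , nκ) = [ real , imaginary ]′ (norm-unit κ nκ)
        where
        δ≡ : δ ≡ q ⊗ κ
        δ≡ = trans (cong (π ⊗_) τ≡) (sym (⊗-assoc π (π ⊛ 3) κ))
        real : im κ ≡ + 0 × IsSign (re κ) → y ≡ + 1 ⊎ y ≡ + 13
        real (i0 , _) = subst (λ z → z ≡ + 1 ⊎ z ≡ + 13) A²+B² (ljunggren A B (unit-sign (R + I) (re κ) (trans (ℤ.*-comm (R + I) (re κ)) (trans (ℤ.*-distribˡ-+ (re κ) R I)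
          (trans (sym (cong₂ _+_ (trans (cong re δ≡) (trans (re-real q κ i0) (cong (re κ *_) (cong re q≡)))) (trans (cong im δ≡) (trans (im-real q κ i0) (cong (re κ *_) (cong im q≡)))))) re+im)))))
        -- A factor ±i replaces R + I by R - I, and the conjugate of π restores the sum.
        imaginary : re κ ≡ + 0 × IsSign (im κ) → y ≡ + 1 ⊎ y ≡ + 13
        imaginary (r0 , _) = subst (λ z → z ≡ + 1 ⊎ z ≡ + 13) (trans (eq₀ A B) A²+B²) (ljunggren A (- B) (subst IsSign (eq A B) (unit-sign (R - I) (im κ) (trans (eq₁ R I (im κ))
          (trans (sym (cong₂ _+_ (trans (cong re δ≡) (trans (re-imaginary q κ r0) (cong (λ i → - (im κ * i)) (cong im q≡)))) (trans (cong im δ≡) (trans (im-imaginary q κ r0) (cong (im κ *_) (cong re q≡)))))) re+im)))))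
          where
          eq₀ : ∀ A B → A * A + - B * - B ≡ A * A + B * B
          eq₀ = solve-∀
          eq₁ : ∀ R I k → (R - I) * k ≡ - (k * I) + k * R
          eq₁ = solve-∀
          eq : ∀ A B → (A * A - B * B) * (A * A - B * B) - + 2 * (A * B) * (+ 2 * (A * B)) - + 2 * (A * A - B * B) * (+ 2 * (A * B))
            ≡ (A * A - - B * - B) * (A * A - - B * - B) - + 2 * (A * - B) * (+ 2 * (A * - B)) + + 2 * (A * A - - B * - B) * (+ 2 * (A * - B))
          eq = solve-∀

    y≡1∨13 : y ≡ + 1 ⊎ y ≡ + 13
    y≡1∨13 = conclude (power-up-to-unit π τ (- (t * (+ 1 - X))) (+ 1 - + 2 * (t * Y)) unit 3 {{subst (λ x → ℤ.NonZero (x ^ 3)) (sym (trans norm-π y≡)) _}} (trans norm-τ (cong (_^ 3) (sym norm-π))))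

  module FourthPower (x y : ℤ) (k : ℕ) (y≡ : y ≡ + suc k)
    (equation : + 1 * ((+ 2 * x + + 3) * (+ 2 * x + + 3)) + + 1 ≡ + 2 * (y * y ^ 3)) where
    private
      X Y : ℤ
      X = + 2 * x + + 3
      Y = y ^ 3
      fourth-power : ∀ y → y * (y * (y * (y * + 1))) ≡ y * y * (y * y)
      fourth-power = solve-∀
      module S = Setup x y k y≡ Y (y * y) (fourth-power y) equation

      unit-value : (∃₂ λ s b → form (+ 1 * + 2 * y) (+ 1 * X) Y s b ≡ + 1) → y ≡ + 1 ⊎ y ≡ + 13
      unit-value (s , b , value) = FourthCases.y≡1∨13 (proj₁ half) a b X y (proj₁ S.y-odd) k τ y≡ (proj₂ S.y-odd) (trans (eq a b) (cong (_- b) (proj₂ half))) a²+b² equation X≡ 1≡ norm-τ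
        where
        open Factored X y Y s b equation value S.y-odd using (a; a²+b²; τ; 1≡; X≡; norm-τ)

        half : ∃ λ A → a + b ≡ + 2 * A
        half = implies 2 (x₀ :* x₀ :+ x₁ :* x₁) (x₀ :+ x₁) _ (a ∷ b ∷ []) (y , a²+b²)

        eq : ∀ a b → a ≡ a + b - b
        eq = solve-∀

    y≡1∨13 : y ≡ + 1 ⊎ y ≡ + 13
    y≡1∨13 = unit-value S.one

-- The negative Pell equation

module Pell where

  open import Data.Nat.Induction using (<-rec)
  open import Data.Nat.Tactic.RingSolver using () renaming (solve-∀ to solveℕ-∀)
  open import Data.Integer using (+_; -[1+_]; _+_; _*_; -_; _-_; ∣_∣)
  open import Data.Integer.Tactic.RingSolver using (solve-∀)
  open import Defs
  open Arith
  open SmallValues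
  open Binomials using (halve)

  -- Descent by division by 1 + √2, that is, (a, b) ↦ (2b - a, a - b). The norm changes sign each
  -- time, so 1 and -1 are treated together; b ≤ a ≤ 2b keeps the coordinates natural.
  power-coordinates : ∀ a b → a ℕ.* a ℕ.+ 1 ≡ 2 ℕ.* (b ℕ.* b) ⊎ a ℕ.* a ≡ 1 ℕ.+ 2 ℕ.* (b ℕ.* b) → ∃ λ k → (+ a , + b) ≡ powℕ ε k
  power-coordinates a b = <-rec (λ b → ∀ a → norm±1 a b → ∃ λ k → (+ a , + b) ≡ powℕ ε k) step b a
    where
    norm±1 : ℕ → ℕ → Set
    norm±1 a b = a ℕ.* a ℕ.+ 1 ≡ 2 ℕ.* (b ℕ.* b) ⊎ a ℕ.* a ≡ 1 ℕ.+ 2 ℕ.* (b ℕ.* b)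

    square-≤ : ∀ {a b} → a ℕ.* a ℕ.≤ b ℕ.* b → a ℕ.≤ b
    square-≤ {a} {b} h = ℕ.≮⇒≥ λ b<a → ℕ.<⇒≱ (ℕ.*-mono-< b<a b<a) h

    lower : ∀ a b → norm±1 a (suc b) → suc b ℕ.≤ a
    lower a b n = square-≤ (ℕ.≤-pred (bound n))
      where
      q = suc b ℕ.* suc b
      two : suc q ℕ.≤ 2 ℕ.* q
      two = ℕ.m<m+n q (s≤s z≤n)
      bound : norm±1 a (suc b) → suc q ℕ.≤ suc (a ℕ.* a)
      bound (inj₁ e) = ℕ.≤-trans two (ℕ.≤-reflexive (trans (sym e) (ℕ.+-comm (a ℕ.* a) 1)))
      bound (inj₂ e) = ℕ.≤-trans two (ℕ.≤-trans (ℕ.n≤1+n (2 ℕ.* q)) (ℕ.≤-trans (ℕ.≤-reflexive (sym e)) (ℕ.n≤1+n (a ℕ.* a))))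

    upper : ∀ a b → norm±1 a (suc b) → a ℕ.≤ 2 ℕ.* suc b
    upper a b n = square-≤ (ℕ.≤-trans (bound n) (ℕ.≤-trans (ℕ.+-monoˡ-≤ (2 ℕ.* q) {1} {2 ℕ.* q} (s≤s z≤n)) (ℕ.≤-reflexive (eq (suc b)))))
      where
      q = suc b ℕ.* suc b
      eq : ∀ b → 2 ℕ.* (b ℕ.* b) ℕ.+ 2 ℕ.* (b ℕ.* b) ≡ 2 ℕ.* b ℕ.* (2 ℕ.* b)
      eq = solveℕ-∀
      bound : norm±1 a (suc b) → a ℕ.* a ℕ.≤ 1 ℕ.+ 2 ℕ.* q
      bound (inj₁ e) = ℕ.≤-trans (ℕ.m≤m+n (a ℕ.* a) 1) (ℕ.≤-trans (ℕ.≤-reflexive e) (ℕ.n≤1+n (2 ℕ.* q)))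
      bound (inj₂ e) = ℕ.≤-reflexive e

    norm-step : ∀ e c → norm±1 (2 ℕ.* c ℕ.+ e) (c ℕ.+ e) → norm±1 e c
    norm-step e c (inj₁ h) = inj₂ (sym (ℕ.+-cancelʳ-≡ (2 ℕ.* c ℕ.* c ℕ.+ 4 ℕ.* c ℕ.* e ℕ.+ e ℕ.* e) (1 ℕ.+ 2 ℕ.* (c ℕ.* c)) (e ℕ.* e) (trans (eq c e) (trans h (eq′ c e)))))
      where
      eq : ∀ c e → 1 ℕ.+ 2 ℕ.* (c ℕ.* c) ℕ.+ (2 ℕ.* c ℕ.* c ℕ.+ 4 ℕ.* c ℕ.* e ℕ.+ e ℕ.* e) ≡ (2 ℕ.* c ℕ.+ e) ℕ.* (2 ℕ.* c ℕ.+ e) ℕ.+ 1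
      eq = solveℕ-∀
      eq′ : ∀ c e → 2 ℕ.* ((c ℕ.+ e) ℕ.* (c ℕ.+ e)) ≡ e ℕ.* e ℕ.+ (2 ℕ.* c ℕ.* c ℕ.+ 4 ℕ.* c ℕ.* e ℕ.+ e ℕ.* e)
      eq′ = solveℕ-∀
    norm-step e c (inj₂ h) = inj₁ (sym (ℕ.+-cancelʳ-≡ (2 ℕ.* c ℕ.* c ℕ.+ 4 ℕ.* c ℕ.* e ℕ.+ e ℕ.* e) (2 ℕ.* (c ℕ.* c)) (e ℕ.* e ℕ.+ 1) (trans (eq c e) (trans h (eq′ c e)))))
      where
      eq : ∀ c e → 2 ℕ.* (c ℕ.* c) ℕ.+ (2 ℕ.* c ℕ.* c ℕ.+ 4 ℕ.* c ℕ.* e ℕ.+ e ℕ.* e) ≡ (2 ℕ.* c ℕ.+ e) ℕ.* (2 ℕ.* c ℕ.+ e)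
      eq = solveℕ-∀
      eq′ : ∀ c e → 1 ℕ.+ 2 ℕ.* ((c ℕ.+ e) ℕ.* (c ℕ.+ e)) ≡ e ℕ.* e ℕ.+ 1 ℕ.+ (2 ℕ.* c ℕ.* c ℕ.+ 4 ℕ.* c ℕ.* e ℕ.+ e ℕ.* e)
      eq′ = solveℕ-∀

    nonzero : ∀ c → norm±1 0 c → c ≢ 0 → c ≡ 0
    nonzero zero n c≢0 = refl
    nonzero (suc c) (inj₁ h) _ = contradiction (ℕ.m*n≡1⇒m≡1 2 (suc c ℕ.* suc c) (sym h)) λ ()

    step : ∀ b → (∀ {c} → c ℕ.< b → ∀ e → norm±1 e c → ∃ λ k → (+ e , + c) ≡ powℕ ε k) → ∀ a → norm±1 a b → ∃ λ k → (+ a , + b) ≡ powℕ ε k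
    step zero rec a (inj₁ h) = contradiction (ℕ.m+n≡0⇒n≡0 (a ℕ.* a) h) λ ()
    step zero rec a (inj₂ h) = 0 , cong (λ a → + a , + 0) (ℕ.m*n≡1⇒m≡1 a a h)
    step (suc b) rec a n = descend (a ℕ.∸ suc b) (suc b ℕ.∸ (a ℕ.∸ suc b)) refl b≡ n
      where
      a≡ : a ≡ suc b ℕ.+ (a ℕ.∸ suc b)
      a≡ = sym (ℕ.m+[n∸m]≡n (lower a b n))
      b≡ : suc b ≡ (a ℕ.∸ suc b) ℕ.+ (suc b ℕ.∸ (a ℕ.∸ suc b))
      b≡ = sym (ℕ.m+[n∸m]≡n (ℕ.m≤n+o⇒m∸n≤o a (suc b) (ℕ.≤-trans (upper a b n) (ℕ.≤-reflexive (cong (suc b ℕ.+_) (ℕ.+-identityʳ (suc b)))))))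
      descend : ∀ c e → c ≡ a ℕ.∸ suc b → suc b ≡ c ℕ.+ e → norm±1 a (suc b) → ∃ λ k → (+ a , + suc b) ≡ powℕ ε k
      descend c e c≡ b≡ n = lift (rec c<b e n′)
        where
        a≡′ : a ≡ 2 ℕ.* c ℕ.+ e
        a≡′ = trans a≡ (trans (cong₂ ℕ._+_ b≡ (sym c≡)) (eq c e))
          where
          eq : ∀ c e → c ℕ.+ e ℕ.+ c ≡ 2 ℕ.* c ℕ.+ e
          eq = solveℕ-∀
        n′ : norm±1 e c
        n′ = norm-step e c (subst₂ norm±1 a≡′ b≡ n)
        c<b : c ℕ.< suc b
        c<b = e-pos e refl n′
          where
          e-pos : ∀ f → f ≡ e → norm±1 f c → c ℕ.< suc b
          e-pos zero _ (inj₁ h) = contradiction (ℕ.m*n≡1⇒m≡1 2 (c ℕ.* c) (sym h)) λ ()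
          e-pos (suc f) f≡ _ = ℕ.≤-trans (ℕ.≤-trans (ℕ.≤-reflexive (ℕ.+-comm 1 c)) (ℕ.+-monoʳ-≤ c {1} {suc f} (s≤s z≤n))) (ℕ.≤-reflexive (trans (cong (c ℕ.+_) f≡) (sym b≡)))
        lift : (∃ λ k → (+ e , + c) ≡ powℕ ε k) → ∃ λ k → (+ a , + suc b) ≡ powℕ ε k
        lift (k , h) = suc k , trans (cong₂ _,_ (trans (cong +_ (trans a≡′ (ℕ.+-comm (2 ℕ.* c) e))) (trans (cong (λ p → + e + p) (ℤ.pos-* 2 c)) (eq (+ e) (+ c)))) (trans (cong +_ b≡) (eq′ (+ e) (+ c)))) (cong (ε ·_) h)
          where
          eq : ∀ e c → e + + 2 * c ≡ + 1 * e + + 2 * (+ 1 * c)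
          eq = solve-∀
          eq′ : ∀ e c → c + e ≡ + 1 * c + + 1 * e
          eq′ = solve-∀

  private
    odd-step : ∀ (u : ℤ√2) j → powℕ u (1 ℕ.+ 2 ℕ.* suc j) ≡ u · (u · powℕ u (1 ℕ.+ 2 ℕ.* j))
    odd-step u j = cong (λ n → u · powℕ u n) (ℕ.*-suc 2 j)

  abs-sign : ∀ x → x ≡ + ∣ x ∣ ⊎ x ≡ - + ∣ x ∣
  abs-sign (+ n) = inj₁ refl
  abs-sign -[1+ n ] = inj₂ refl

  norm : ℤ√2 → ℤ
  norm (a , b) = a * a - + 2 * (b * b)

  norm-· : ∀ u v → norm (u · v) ≡ norm u * norm v
  norm-· (a , b) (c , d) = eq a b c d
    where
    eq : ∀ a b c d → (a * c + + 2 * (b * d)) * (a * c + + 2 * (b * d)) - + 2 * ((a * d + b * c) * (a * d + b * c)) ≡ (a * a - + 2 * (b * b)) * (c * c - + 2 * (d * d))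
    eq = solve-∀

  norm-neg : ∀ u → norm (neg u) ≡ norm u
  norm-neg (a , b) = eq a b
    where
    eq : ∀ a b → - a * - a - + 2 * (- b * - b) ≡ a * a - + 2 * (b * b)
    eq = solve-∀

  norm-even : ∀ u j → norm u ≡ -[1+ 0 ] → norm (powℕ u (2 ℕ.* j)) ≡ + 1
  norm-even u zero h = refl
  norm-even u (suc j) h = trans (cong (λ n → norm (powℕ u n)) (ℕ.*-suc 2 j)) (trans (norm-· u (u · powℕ u (2 ℕ.* j))) (cong₂ _*_ h (trans (norm-· u (powℕ u (2 ℕ.* j))) (cong₂ _*_ h (norm-even u j h)))))

  norm-odd : ∀ u j → norm u ≡ -[1+ 0 ] → norm (powℕ u (1 ℕ.+ 2 ℕ.* j)) ≡ -[1+ 0 ]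
  norm-odd u j h = trans (norm-· u (powℕ u (2 ℕ.* j))) (cong₂ _*_ h (norm-even u j h))

  -- ε⁻¹ is minus the conjugate of ε, and an odd power keeps the minus sign.
  ε⁻¹-odd : ∀ j a b → (a , b) ≡ powℕ ε (1 ℕ.+ 2 ℕ.* j) → (- a , b) ≡ powℕ ε⁻¹ (1 ℕ.+ 2 ℕ.* j)
  ε⁻¹-odd zero a b h = cong₂ (λ a b → - a , b) (cong proj₁ h) (cong proj₂ h)
  ε⁻¹-odd (suc j) a b h = trans (cong₂ (λ a b → - a , b) (cong proj₁ h′) (cong proj₂ h′)) (trans (cong₂ _,_ (eq c d) (eq′ c d))
      (trans (cong (λ z → ε⁻¹ · (ε⁻¹ · z)) (ε⁻¹-odd j c d refl)) (sym (odd-step ε⁻¹ j))))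
    where
    c = proj₁ (powℕ ε (1 ℕ.+ 2 ℕ.* j))
    d = proj₂ (powℕ ε (1 ℕ.+ 2 ℕ.* j))
    h′ : (a , b) ≡ ε · (ε · (c , d))
    h′ = trans h (odd-step ε j)
    eq : ∀ c d → - (+ 1 * (+ 1 * c + + 2 * (+ 1 * d)) + + 2 * (+ 1 * (+ 1 * d + + 1 * c)))
      ≡ -[1+ 0 ] * (-[1+ 0 ] * - c + + 2 * (+ 1 * d)) + + 2 * (+ 1 * (-[1+ 0 ] * d + + 1 * - c))
    eq = solve-∀
    eq′ : ∀ c d → + 1 * (+ 1 * d + + 1 * c) + + 1 * (+ 1 * c + + 2 * (+ 1 * d))
      ≡ -[1+ 0 ] * (-[1+ 0 ] * d + + 1 * - c) + + 1 * (-[1+ 0 ] * - c + + 2 * (+ 1 * d))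
    eq′ = solve-∀

  εpow-odd⁺ : ∀ j → εpow (+ 2 * + j + + 1) ≡ powℕ ε (1 ℕ.+ 2 ℕ.* j)
  εpow-odd⁺ j = cong εpow (trans (cong (λ x → x + + 1) (sym (ℤ.pos-* 2 j))) (ℤ.+-comm (+ (2 ℕ.* j)) (+ 1)))

  εpow-odd⁻ : ∀ j → εpow (+ 2 * -[1+ j ] + + 1) ≡ powℕ ε⁻¹ (1 ℕ.+ 2 ℕ.* j)
  εpow-odd⁻ j = cong εpow {x = + 2 * -[1+ j ] + + 1} {y = -[1+ 2 ℕ.* j ]} (trans (eq (+ j)) (cong (λ x → - (+ 1 + x)) (sym (ℤ.pos-* 2 j))))
    where
    eq : ∀ j → + 2 * - (+ 1 + j) + + 1 ≡ - (+ 1 + + 2 * j)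
    eq = solve-∀

  IsPower : ℤ → ℤ → Set
  IsPower X y = ∃ λ r → (X , y) ≡ εpow (+ 2 * r + + 1) ⊎ (X , y) ≡ neg (εpow (+ 2 * r + + 1))

  pell : ∀ X y → X * X + + 1 ≡ + 2 * (y * y) → IsPower X y
  pell X y h = signs (odd-exponent (power-coordinates ∣ X ∣ ∣ y ∣ (inj₁ nat)))
    where
    nat : ∣ X ∣ ℕ.* ∣ X ∣ ℕ.+ 1 ≡ 2 ℕ.* (∣ y ∣ ℕ.* ∣ y ∣)
    nat = ℤ.+-injective (trans (cong (_+ + 1) (sym (square≡ X))) (trans h (trans (cong (+ 2 *_) (square≡ y)) (sym (ℤ.pos-* 2 (∣ y ∣ ℕ.* ∣ y ∣))))))

    norm-X-y : norm (+ ∣ X ∣ , + ∣ y ∣) ≡ -[1+ 0 ]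
    norm-X-y = trans (cong₂ (λ p q → p - + 2 * q) (trans (sym (ℤ.pos-* ∣ X ∣ ∣ X ∣)) (sym (square≡ X))) (trans (sym (ℤ.pos-* ∣ y ∣ ∣ y ∣)) (sym (square≡ y))))
      (trans (cong (λ q → X * X - q) (sym h)) (eq (X * X)))
      where
      eq : ∀ p → p - (p + + 1) ≡ -[1+ 0 ]
      eq = solve-∀

    Odd : Set
    Odd = ∃ λ j → (+ ∣ X ∣ , + ∣ y ∣) ≡ powℕ ε (1 ℕ.+ 2 ℕ.* j)

    odd-exponent : (∃ λ k → (+ ∣ X ∣ , + ∣ y ∣) ≡ powℕ ε k) → Odd
    odd-exponent (k , e) = parity (halve k)
      where
      parity : (∃ λ j → k ≡ 2 ℕ.* j ⊎ k ≡ 1 ℕ.+ 2 ℕ.* j) → Odd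
      parity (j , inj₁ k≡) = contradiction (trans (sym norm-X-y) (trans (cong norm (trans e (cong (powℕ ε) k≡))) (norm-even ε j refl))) λ ()
      parity (j , inj₂ k≡) = j , trans e (cong (powℕ ε) k≡)

    -- The four sign patterns of (X, y) are ± the powers of ε with exponents 2j + 1 and -(2j + 1),
    -- the latter being r = -(j + 1).
    signs : Odd → IsPower X y
    signs (j , e) = go (abs-sign X) (abs-sign y)
      where
      plus : (+ ∣ X ∣ , + ∣ y ∣) ≡ εpow (+ 2 * + j + + 1)
      plus = trans e (sym (εpow-odd⁺ j))
      minus : (- + ∣ X ∣ , + ∣ y ∣) ≡ εpow (+ 2 * -[1+ j ] + + 1)
      minus = trans (ε⁻¹-odd j (+ ∣ X ∣) (+ ∣ y ∣) e) (sym (εpow-odd⁻ j))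
      go : X ≡ + ∣ X ∣ ⊎ X ≡ - + ∣ X ∣ → y ≡ + ∣ y ∣ ⊎ y ≡ - + ∣ y ∣ → IsPower X y
      go (inj₁ p) (inj₁ q) = + j , inj₁ (trans (cong₂ _,_ p q) plus)
      go (inj₁ p) (inj₂ q) = -[1+ j ] , inj₂ (trans (cong₂ _,_ (trans p (sym (ℤ.neg-involutive (+ ∣ X ∣)))) q) (cong neg minus))
      go (inj₂ p) (inj₁ q) = -[1+ j ] , inj₁ (trans (cong₂ _,_ p q) minus)
      go (inj₂ p) (inj₂ q) = + j , inj₂ (trans (cong₂ _,_ p q) (cong neg plus))

  norm-εpow : ∀ r → norm (εpow (+ 2 * r + + 1)) ≡ -[1+ 0 ]
  norm-εpow (+ j) = trans (cong norm (εpow-odd⁺ j)) (norm-odd ε j refl)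
  norm-εpow -[1+ j ] = trans (cong norm (εpow-odd⁻ j)) (norm-odd ε⁻¹ j refl)

  pell⁻¹ : ∀ X y → IsPower X y → X * X + + 1 ≡ + 2 * (y * y)
  pell⁻¹ X y (r , h) = trans (eq (X * X) (+ 2 * (y * y))) (trans (cong (λ v → v + + 2 * (y * y) + + 1) (norm-X-y h)) (eq′ (+ 2 * (y * y))))
    where
    norm-X-y : (X , y) ≡ εpow (+ 2 * r + + 1) ⊎ (X , y) ≡ neg (εpow (+ 2 * r + + 1)) → norm (X , y) ≡ -[1+ 0 ]
    norm-X-y (inj₁ e) = trans (cong norm e) (norm-εpow r)
    norm-X-y (inj₂ e) = trans (cong norm e) (trans (norm-neg (εpow (+ 2 * r + + 1))) (norm-εpow r))
    eq : ∀ p q → p + + 1 ≡ p - q + q + + 1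
    eq = solve-∀
    eq′ : ∀ q → -[1+ 0 ] + q + + 1 ≡ q
    eq′ = solve-∀

-- The cases d = 2, ..., 10 and their assembly

open import Defs
open import Data.Nat.Divisibility using (_∣_; divides)
open import Data.Nat.Primality using (Prime; prime?; prime⇒irreducible)
open import Data.Integer using (+_; -[1+_]; _+_; _*_; -_; _-_; _^_; ∣_∣)
open import Data.Integer.Tactic.RingSolver using (solve-∀)
open import Data.Fin using (zero; suc)
open import Data.Vec using (_∷_; [])
open import Function using (_∘_)
open import Function.Bundles using (_⇔_; mk⇔)
open import Relation.Nullary.Decidable using (toWitness)
open Arith
open SmallValues
open Congruences
open Units
open Binomials using (halve)
open Equation6 using (no-solution-6)
open Equation105 using (no-solution-105; prime-2; prime-3; prime-5; prime-7)
open Equation1 using (module OddPower; module FourthPower)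
open Pell using (abs-sign; IsPower; pell; pell⁻¹)

linear constant : ℕ → ℕ
linear zero = 0
linear (suc d) = linear d ℕ.+ (suc d ℕ.+ suc d)
constant zero = 0
constant (suc d) = constant d ℕ.+ suc d ℕ.* suc d

quadratic : ∀ {n} → ℕ → Expr (1 ℕ.+ n)
quadratic d = # d :* (var zero :* var zero) :+ # (linear d) :* var zero :+ # (constant d)

sumSq≡ : ∀ d x → sumSq d x ≡ + d * (x * x) + + linear d * x + + constant d
sumSq≡ zero x = eq x
  where
  eq : ∀ x → + 0 ≡ + 0 * (x * x) + + 0 * x + + 0
  eq = solve-∀
sumSq≡ (suc d) x = trans (cong (λ s → s + (x + + suc d) * ((x + + suc d) * + 1)) (sumSq≡ d x))
  (trans (eq (+ d) (+ linear d) (+ constant d) x) (cong (λ q → + suc d * (x * x) + + linear (suc d) * x + (+ constant d + q)) (sym (ℤ.pos-* (suc d) (suc d)))))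
  where
  eq : ∀ d a b x → d * (x * x) + a * x + b + (x + (+ 1 + d)) * ((x + (+ 1 + d)) * + 1)
    ≡ (+ 1 + d) * (x * x) + (a + ((+ 1 + d) + (+ 1 + d))) * x + (b + (+ 1 + d) * (+ 1 + d))
  eq = solve-∀

^-even : ∀ y j → y ^ (2 ℕ.* j) ≡ (y * y) ^ j
^-even y j = trans (sym (ℤ.^-*-assoc y 2 j)) (cong (λ z → (y * z) ^ j) (ℤ.*-identityʳ y))

^-∣ : ∀ p y → p ∣ᶻ y → ∀ e n → p ℕ.^ e ∣ᶻ y ^ (e ℕ.+ n)
^-∣ p y (u , h) zero n = y ^ n , sym (ℤ.*-identityˡ (y ^ n))
^-∣ p y (u , h) (suc e) n = extend (^-∣ p y (u , h) e n)
  where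
  extend : p ℕ.^ e ∣ᶻ y ^ (e ℕ.+ n) → p ℕ.^ suc e ∣ᶻ y ^ (suc e ℕ.+ n)
  extend (w , g) = u * w , trans (cong₂ _*_ h g) (trans (eq (+ p) u (+ (p ℕ.^ e)) w) (cong (_* (u * w)) (sym (ℤ.pos-* p (p ℕ.^ e)))))
    where
    eq : ∀ p u q w → p * u * (q * w) ≡ p * q * (u * w)
    eq = solve-∀

-- p divides the sum at least once and fewer than e times, whereas a power with exponent at least e
-- that is divisible by p is divisible by p^e.
no-power-locally : ∀ p e d → Prime p → (∀ x → p ∣ᶻ sumSq d x) → (∀ x → p ℕ.^ e ∣ᶻ sumSq d x → ⊥) → ∀ x y n → sumSq d x ≡ y ^ (e ℕ.+ n) → ⊥
no-power-locally p e d pr divisible not-divisible x y n h =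
  not-divisible x (subst (p ℕ.^ e ∣ᶻ_) (sym h) (^-∣ p y (prime-∣-^ pr y (e ℕ.+ n) (subst (p ∣ᶻ_) h (divisible x))) e n))

no-power-4 : ∀ x y n → sumSq 4 x ≡ y ^ (2 ℕ.+ n) → ⊥
no-power-4 = no-power-locally 2 2 4 prime-2
  (λ x → subst (2 ∣ᶻ_) (sym (sumSq≡ 4 x)) (implies 2 (# 0) (quadratic 4) _ (x ∷ []) (+ 0 , refl)))
  (λ x h → never 4 (quadratic 4) _ (x ∷ []) (subst (4 ∣ᶻ_) (sumSq≡ 4 x) h))

no-power-5 : ∀ x y n → sumSq 5 x ≡ y ^ (2 ℕ.+ n) → ⊥
no-power-5 = no-power-locally 5 2 5 prime-5
  (λ x → subst (5 ∣ᶻ_) (sym (sumSq≡ 5 x)) (implies 5 (# 0) (quadratic 5) _ (x ∷ []) (+ 0 , refl)))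
  (λ x h → never 25 (quadratic 5) _ (x ∷ []) (subst (25 ∣ᶻ_) (sumSq≡ 5 x) h))

no-power-7 : ∀ x y n → sumSq 7 x ≡ y ^ (2 ℕ.+ n) → ⊥
no-power-7 = no-power-locally 7 2 7 prime-7
  (λ x → subst (7 ∣ᶻ_) (sym (sumSq≡ 7 x)) (implies 7 (# 0) (quadratic 7) _ (x ∷ []) (+ 0 , refl)))
  (λ x h → never 49 (quadratic 7) _ (x ∷ []) (subst (49 ∣ᶻ_) (sumSq≡ 7 x) h))

no-power-9 : ∀ x y n → sumSq 9 x ≡ y ^ (2 ℕ.+ n) → ⊥
no-power-9 = no-power-locally 3 2 9 prime-3
  (λ x → subst (3 ∣ᶻ_) (sym (sumSq≡ 9 x)) (implies 3 (# 0) (quadratic 9) _ (x ∷ []) (+ 0 , refl)))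
  (λ x h → never 9 (quadratic 9) _ (x ∷ []) (subst (9 ∣ᶻ_) (sumSq≡ 9 x) h))

no-power-10 : ∀ x y n → sumSq 10 x ≡ y ^ (2 ℕ.+ n) → ⊥
no-power-10 = no-power-locally 5 2 10 prime-5
  (λ x → subst (5 ∣ᶻ_) (sym (sumSq≡ 10 x)) (implies 5 (# 0) (quadratic 10) _ (x ∷ []) (+ 0 , refl)))
  (λ x h → never 25 (quadratic 10) _ (x ∷ []) (subst (25 ∣ᶻ_) (sumSq≡ 10 x) h))

-- S ≡ z² modulo m + 1, written with + m z² because Expr has no subtraction.
square-residue : ∀ m d x z → sumSq d x ≡ z * z → suc m ∣ᶻ + d * (x * x) + + linear d * x + + constant d + + m * (z * z)
square-residue m d x z h = z * z , trans (cong (λ s → s + + m * (z * z)) (trans (sym (sumSq≡ d x)) h)) (eq (z * z) (+ m))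
  where
  eq : ∀ s m → s + m * s ≡ (+ 1 + m) * s
  eq = solve-∀

never-square : ∀ m d → (∀ x z → suc m ∣ᶻ + d * (x * x) + + linear d * x + + constant d + + m * (z * z) → ⊥) → ∀ x y j → sumSq d x ≡ y ^ (2 ℕ.* j) → ⊥
never-square m d c x y j h = c x (y ^ j) (square-residue m d x (y ^ j) (trans h (trans (^-even y j) (pow-square y j))))

z : Expr 2
z = var (suc zero)

never-square-3 : ∀ x y j → sumSq 3 x ≡ y ^ (2 ℕ.* j) → ⊥
never-square-3 = never-square 2 3 (λ x y → never 3 (quadratic 3 :+ # 2 :* (z :* z)) _ (x ∷ y ∷ []))

never-square-6 : ∀ x y j → sumSq 6 x ≡ y ^ (2 ℕ.* j) → ⊥
never-square-6 = never-square 3 6 (λ x y → never 4 (quadratic 6 :+ # 3 :* (z :* z)) _ (x ∷ y ∷ []))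

never-square-8 : ∀ x y j → sumSq 8 x ≡ y ^ (2 ℕ.* j) → ⊥
never-square-8 = never-square 8 8 (λ x y → never 9 (quadratic 8 :+ # 8 :* (z :* z)) _ (x ∷ y ∷ []))

-- The sum is always even but never a multiple of 8, which excludes exponents from 3 on. For squares
-- the modulus 9 leaves x² + z² ≡ 6, which has no solution.
no-power-8 : ∀ x y n → sumSq 8 x ≡ y ^ (2 ℕ.+ n) → ⊥
no-power-8 x y zero = never-square-8 x y 1
no-power-8 x y (suc n) = no-power-locally 2 3 8 prime-2
  (λ x → subst (2 ∣ᶻ_) (sym (sumSq≡ 8 x)) (implies 2 (# 0) (quadratic 8) _ (x ∷ []) (+ 0 , refl)))
  (λ x h → never 8 (quadratic 8) _ (x ∷ []) (subst (8 ∣ᶻ_) (sumSq≡ 8 x) h)) x y n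

positive-base : ∀ p q c X y w → + p * (X * X) + + suc q ≡ + suc c * (y * (w * w)) → ∃ λ k → y ≡ + suc k
positive-base p q c X y w h = factor y refl
  where
  n : ℕ
  n = p ℕ.* (∣ X ∣ ℕ.* ∣ X ∣) ℕ.+ q
  value : + suc c * y * (w * w) ≡ + suc n
  value = trans (ℤ.*-assoc (+ suc c) y (w * w)) (trans (sym h) (trans (cong (_+ + suc q) (trans (cong (+ p *_) (square≡ X)) (sym (ℤ.pos-* p (∣ X ∣ ℕ.* ∣ X ∣)))))
    (cong +_ (ℕ.+-suc (p ℕ.* (∣ X ∣ ℕ.* ∣ X ∣)) q))))
  multiple : ∃ λ k → + suc c * y ≡ + suc k
  multiple = positive (+ suc c * y) w n value
  factor : ∀ v → v ≡ y → ∃ λ k → v ≡ + suc k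
  factor (+ zero) v≡ = contradiction (trans (sym (proj₂ multiple)) (trans (cong (+ suc c *_) (sym v≡)) (ℤ.*-zeroʳ (+ suc c)))) λ ()
  factor (+ suc k) v≡ = k , refl
  factor -[1+ k ] v≡ = contradiction (trans (sym (proj₂ multiple)) (cong (+ suc c *_) (sym v≡))) λ ()

^-odd : ∀ y j → y ^ (1 ℕ.+ 2 ℕ.* j) ≡ y * (y * y) ^ j
^-odd y j = cong (y *_) (^-even y j)

^-odd-base : ∀ p q c X y j → + p * (X * X) + + suc q ≡ + suc c * (y * (y * y) ^ j) → ∃ λ k → y ≡ + suc k
^-odd-base p q c X y j h = positive-base p q c X y (y ^ j) (trans h (cong (λ w → + suc c * (y * w)) (pow-square y j)))

complete-3 : ∀ x s → sumSq 3 x ≡ s → + 3 * ((x + + 2) * (x + + 2)) + + 2 ≡ + 1 * s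
complete-3 x s h = trans (eq x) (cong (+ 1 *_) (trans (sym (sumSq≡ 3 x)) h))
  where
  eq : ∀ x → + 3 * ((x + + 2) * (x + + 2)) + + 2 ≡ + 1 * (+ 3 * (x * x) + + 12 * x + + 14)
  eq = solve-∀

complete-6 : ∀ x s → sumSq 6 x ≡ s → + 3 * ((+ 2 * x + + 7) * (+ 2 * x + + 7)) + + 35 ≡ + 2 * s
complete-6 x s h = trans (eq x) (cong (+ 2 *_) (trans (sym (sumSq≡ 6 x)) h))
  where
  eq : ∀ x → + 3 * ((+ 2 * x + + 7) * (+ 2 * x + + 7)) + + 35 ≡ + 2 * (+ 6 * (x * x) + + 42 * x + + 91)
  eq = solve-∀

complete-2 : ∀ x s → sumSq 2 x ≡ s → + 1 * ((+ 2 * x + + 3) * (+ 2 * x + + 3)) + + 1 ≡ + 2 * s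
complete-2 x s h = trans (eq x) (cong (+ 2 *_) (trans (sym (sumSq≡ 2 x)) h))
  where
  eq : ∀ x → + 1 * ((+ 2 * x + + 3) * (+ 2 * x + + 3)) + + 1 ≡ + 2 * (+ 2 * (x * x) + + 6 * x + + 5)
  eq = solve-∀

no-power-3 : ∀ x y n → sumSq 3 x ≡ y ^ (2 ℕ.+ n) → ⊥
no-power-3 x y n h = parity (halve (2 ℕ.+ n))
  where
  odd : ∀ j → 2 ℕ.+ n ≡ 1 ℕ.+ 2 ℕ.* j → sumSq 3 x ≡ y * (y * y) ^ j → ⊥
  odd (suc j) n≡ e = no-solution-6 (x + + 2) y (proj₁ base) j (proj₂ base) equation
    where
    equation = complete-3 x (y * (y * y) ^ suc j) e
    base = ^-odd-base 3 1 0 (x + + 2) y (suc j) equation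
  parity : (∃ λ j → 2 ℕ.+ n ≡ 2 ℕ.* j ⊎ 2 ℕ.+ n ≡ 1 ℕ.+ 2 ℕ.* j) → ⊥
  parity (j , inj₁ e) = never-square-3 x y j (trans h (cong (y ^_) e))
  parity (j , inj₂ e) = odd j e (trans h (trans (cong (y ^_) e) (^-odd y j)))

no-power-6 : ∀ x y n → sumSq 6 x ≡ y ^ (2 ℕ.+ n) → ⊥
no-power-6 x y n h = parity (halve (2 ℕ.+ n))
  where
  X-odd : ∃ λ t → + 2 * x + + 7 ≡ + 1 + + 2 * t
  X-odd = x + + 3 , eq x
    where
    eq : ∀ x → + 2 * x + + 7 ≡ + 1 + + 2 * (x + + 3)
    eq = solve-∀
  odd : ∀ j → 2 ℕ.+ n ≡ 1 ℕ.+ 2 ℕ.* j → sumSq 6 x ≡ y * (y * y) ^ j → ⊥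
  odd (suc j) n≡ e = no-solution-105 (+ 2 * x + + 7) y (proj₁ base) j (proj₂ base) X-odd equation
    where
    equation = complete-6 x (y * (y * y) ^ suc j) e
    base = ^-odd-base 3 34 1 (+ 2 * x + + 7) y (suc j) equation
  parity : (∃ λ j → 2 ℕ.+ n ≡ 2 ℕ.* j ⊎ 2 ℕ.+ n ≡ 1 ℕ.+ 2 ℕ.* j) → ⊥
  parity (j , inj₁ e) = never-square-6 x y j (trans h (cong (y ^_) e))
  parity (j , inj₂ e) = odd j e (trans h (trans (cong (y ^_) e) (^-odd y j)))

-- The difference of the two sums is 2(x - a)(x + a + 3); the second factor reflects the symmetry x
-- ↦ -x - 3.
sumSq-2-injective : ∀ x a → sumSq 2 x ≡ sumSq 2 a → x ≡ a ⊎ x ≡ - a - + 3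
sumSq-2-injective x a h = [ (λ e → inj₁ (ℤ.i-j≡0⇒i≡j x a e)) , (λ e → inj₂ (trans (eq′ x a) (trans (cong (λ v → v - a - + 3) e) (eq″ a)))) ]′ (ℤ.i*j≡0⇒i≡0∨j≡0 (x - a) product)
  where
  eq : ∀ x a → + 2 * ((x - a) * (x + a + + 3)) ≡ + 2 * (x * x) + + 6 * x + + 5 - (+ 2 * (a * a) + + 6 * a + + 5)
  eq = solve-∀
  product : (x - a) * (x + a + + 3) ≡ + 0
  product = ℤ.*-cancelˡ-≡ (+ 2) ((x - a) * (x + a + + 3)) (+ 0) (trans (eq x a) (ℤ.i≡j⇒i-j≡0 (trans (sym (sumSq≡ 2 x)) (trans h (sumSq≡ 2 a)))))
  eq′ : ∀ x a → x ≡ x + a + + 3 - a - + 3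
  eq′ = solve-∀
  eq″ : ∀ a → + 0 - a - + 3 ≡ - a - + 3
  eq″ = solve-∀

Solution : ℤ → ℤ → ℕ → Set
Solution x y n = (x ≡ - + 1 ⊎ x ≡ - + 2) × (y ≡ + 1 ⊎ (y ≡ - + 1 × 2 ∣ n))
               ⊎ (x ≡ + 118 ⊎ x ≡ - + 121) × (y ≡ + 13 ⊎ y ≡ - + 13) × n ≡ 4

odd-exponent : ∀ x y m → sumSq 2 x ≡ y * (y * y) ^ suc m → y ≡ + 1
odd-exponent x y m h = OddPower.y≡1 x y (proj₁ base) m (proj₂ base) equation
  where
  equation = complete-2 x (y * (y * y) ^ suc m) h
  base = ^-odd-base 1 0 1 (+ 2 * x + + 3) y (suc m) equation

fourth-power : ∀ x w → sumSq 2 x ≡ w * w * (w * w) → ∣ w ∣ ≡ 1 ⊎ ∣ w ∣ ≡ 13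
fourth-power x w h = [ inj₁ ∘ ℤ.+-injective , inj₂ ∘ ℤ.+-injective ]′ (FourthPower.y≡1∨13 x (+ ∣ w ∣) (proj₁ base) (proj₂ base) equation)
  where
  eq : ∀ v → v * v * (v * v) ≡ v * (v * (v * (v * + 1)))
  eq = solve-∀
  eq′ : ∀ v → v * (v * (v * (v * + 1))) ≡ v * (v * v * v)
  eq′ = solve-∀
  equation : + 1 * ((+ 2 * x + + 3) * (+ 2 * x + + 3)) + + 1 ≡ + 2 * (+ ∣ w ∣ * (+ ∣ w ∣) ^ 3)
  equation = complete-2 x (+ ∣ w ∣ * (+ ∣ w ∣) ^ 3) (trans h (trans (cong₂ _*_ square square) (eq (+ ∣ w ∣))))
    where
    square : w * w ≡ + ∣ w ∣ * + ∣ w ∣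
    square = trans (square≡ w) (ℤ.pos-* ∣ w ∣ ∣ w ∣)
  base : ∃ λ k → + ∣ w ∣ ≡ + suc k
  base = nonzero ∣ w ∣ refl
    where
    nonzero : ∀ n → n ≡ ∣ w ∣ → ∃ λ k → + n ≡ + suc k
    nonzero zero n≡ = contradiction (subst (λ v → + 1 * ((+ 2 * x + + 3) * (+ 2 * x + + 3)) + + 1 ≡ + 2 * (+ v * (+ v) ^ 3)) (sym n≡) equation)
      (λ e → contradiction (trans (sym (cong (λ v → + 1 * v + + 1) (square≡ (+ 2 * x + + 3)))) e) (nonzero-sum (∣ + 2 * x + + 3 ∣ ℕ.* ∣ + 2 * x + + 3 ∣)))
      where
      nonzero-sum : ∀ s → + 1 * + s + + 1 ≢ + 0
      nonzero-sum s e = contradiction (trans (ℤ.+-comm (+ 1) (+ s)) (trans (cong (_+ + 1) (sym (ℤ.*-identityˡ (+ s)))) e)) λ ()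
    nonzero (suc k) n≡ = k , refl

sumSq-1 : ∀ x → sumSq 2 x ≡ + 1 → x ≡ - + 1 ⊎ x ≡ - + 2
sumSq-1 x h = sumSq-2-injective x (- + 1) h

sumSq-28561 : ∀ x → sumSq 2 x ≡ sumSq 2 (+ 118) → x ≡ + 118 ⊎ x ≡ - + 121
sumSq-28561 x h = sumSq-2-injective x (+ 118) h

abs≡⇒± : ∀ y {n} → ∣ y ∣ ≡ n → y ≡ + n ⊎ y ≡ - + n
abs≡⇒± y refl = abs-sign y

even-unit : ∀ x y j → sumSq 2 x ≡ + 1 → ∣ y ∣ ≡ 1 → Solution x y (2 ℕ.* j)
even-unit x y j s h = inj₁ (sumSq-1 x s , [ inj₁ , (λ e → inj₂ (e , divides j (ℕ.*-comm 2 j))) ]′ (abs≡⇒± y h))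

^-13 : ∀ a i → a ℕ.^ suc i ≡ 13 → a ≡ 13 × i ≡ 0
^-13 a i h = go (prime-13 a i h)
  where
  prime-13 : ∀ a i → a ℕ.^ suc i ≡ 13 → a ≡ 1 ⊎ a ≡ 13
  prime-13 a i h = prime⇒irreducible {13} (toWitness {a? = prime? 13} _) (divides (a ℕ.^ i) (trans (sym h) (ℕ.*-comm a (a ℕ.^ i))))
  exponent : ∀ i → 13 ℕ.^ suc i ≡ 13 → i ≡ 0
  exponent zero e = refl
  exponent (suc i) e = contradiction (ℕ.m*n≡1⇒m≡1 13 (13 ℕ.^ i) (ℕ.*-cancelˡ-≡ (13 ℕ.* 13 ℕ.^ i) 1 13 e)) λ ()
  go : a ≡ 1 ⊎ a ≡ 13 → a ≡ 13 × i ≡ 0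
  go (inj₁ a≡1) = contradiction (trans (sym h) (trans (cong (ℕ._^ suc i) a≡1) (ℕ.^-zeroˡ (suc i)))) λ ()
  go (inj₂ a≡13) = a≡13 , exponent i (trans (cong (ℕ._^ suc i) (sym a≡13)) h)

abs-^ : ∀ y i → ∣ y ^ i ∣ ≡ ∣ y ∣ ℕ.^ i
abs-^ y zero = refl
abs-^ y (suc i) = trans (ℤ.abs-* y (y ^ i)) (cong (∣ y ∣ ℕ.*_) (abs-^ y i))

square-square : ∀ y i → (y * y) ^ (2 ℕ.* i) ≡ y ^ i * y ^ i * (y ^ i * y ^ i)
square-square y i = trans (^-even (y * y) i) (trans (pow-square (y * y) i) (cong₂ _*_ (pow-square y i) (pow-square y i)))

-- The right side is the fourth power of y^(i+1), whose absolute value is 1 or 13. Since 13 is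
-- prime, the latter leaves only exponent 4.
multiple-of-4 : ∀ x y i → sumSq 2 x ≡ (y * y) ^ (2 ℕ.* suc i) → Solution x y (2 ℕ.* (2 ℕ.* suc i))
multiple-of-4 x y i h = [ one , thirteen ]′ (fourth-power x (y ^ suc i) e)
  where
  e : sumSq 2 x ≡ y ^ suc i * y ^ suc i * (y ^ suc i * y ^ suc i)
  e = trans h (square-square y (suc i))
  value : sumSq 2 x ≡ + (∣ y ^ suc i ∣ ℕ.* ∣ y ^ suc i ∣) * + (∣ y ^ suc i ∣ ℕ.* ∣ y ^ suc i ∣)
  value = trans e (cong₂ _*_ (square≡ (y ^ suc i)) (square≡ (y ^ suc i)))
  one : ∣ y ^ suc i ∣ ≡ 1 → Solution x y (2 ℕ.* (2 ℕ.* suc i))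
  one a = even-unit x y (2 ℕ.* suc i) (trans value (cong (λ a → + (a ℕ.* a) * + (a ℕ.* a)) a)) (ℕ.m*n≡1⇒m≡1 ∣ y ∣ (∣ y ∣ ℕ.^ i) (trans (sym (abs-^ y (suc i))) a))
  thirteen : ∣ y ^ suc i ∣ ≡ 13 → Solution x y (2 ℕ.* (2 ℕ.* suc i))
  thirteen a = inj₂ (sumSq-28561 x (trans value (cong (λ a → + (a ℕ.* a) * + (a ℕ.* a)) a)) , abs≡⇒± y (proj₁ a′) , cong (λ i → 2 ℕ.* (2 ℕ.* suc i)) (proj₂ a′))
    where
    a′ : ∣ y ∣ ≡ 13 × i ≡ 0
    a′ = ^-13 ∣ y ∣ i (trans (sym (abs-^ y (suc i))) a)

-- Odd exponents give y = 1. An exponent 2j with odd j is an odd power of y², so the same result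
-- gives y² = 1; this needs j > 1, which is where n ≥ 3 enters. Multiples of 4 are left.
solution : ∀ x y n → sumSq 2 x ≡ y ^ (3 ℕ.+ n) → Solution x y (3 ℕ.+ n)
solution x y n h = parity (halve (3 ℕ.+ n))
  where
  odd : ∀ j → 3 ℕ.+ n ≡ 1 ℕ.+ 2 ℕ.* j → sumSq 2 x ≡ y * (y * y) ^ j → Solution x y (3 ℕ.+ n)
  odd (suc j) n≡ e = inj₁ (sumSq-1 x (trans h (trans (cong (_^ (3 ℕ.+ n)) y≡1) (ℤ.^-zeroˡ (3 ℕ.+ n)))) , inj₁ y≡1)
    where
    y≡1 : y ≡ + 1
    y≡1 = odd-exponent x y j e
  even : ∀ j → 3 ℕ.+ n ≡ 2 ℕ.* j → (∃ λ i → j ≡ 2 ℕ.* i ⊎ j ≡ 1 ℕ.+ 2 ℕ.* i) → sumSq 2 x ≡ (y * y) ^ j → Solution x y (2 ℕ.* j)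
  even j n≡ (zero , inj₁ j≡) e = contradiction (trans n≡ (cong (2 ℕ.*_) j≡)) λ ()
  even j n≡ (suc i , inj₁ j≡) e = subst (λ j → Solution x y (2 ℕ.* j)) (sym j≡) (multiple-of-4 x y i (trans e (cong ((y * y) ^_) j≡)))
  even j n≡ (zero , inj₂ j≡) e = contradiction (trans n≡ (cong (2 ℕ.*_) j≡)) λ ()
  even j n≡ (suc i , inj₂ j≡) e = even-unit x y j (trans e (trans (cong (_^ j) y²≡1) (ℤ.^-zeroˡ j))) (ℕ.m*n≡1⇒m≡1 ∣ y ∣ ∣ y ∣ (trans (sym (ℤ.abs-* y y)) (cong ∣_∣ y²≡1)))
    where
    y²≡1 : y * y ≡ + 1
    y²≡1 = odd-exponent x (y * y) i (trans e (trans (cong ((y * y) ^_) j≡) (^-odd (y * y) (suc i))))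
  parity : (∃ λ j → 3 ℕ.+ n ≡ 2 ℕ.* j ⊎ 3 ℕ.+ n ≡ 1 ℕ.+ 2 ℕ.* j) → Solution x y (3 ℕ.+ n)
  parity (j , inj₁ e) = subst (Solution x y) (sym e) (even j e (halve j) (trans h (trans (cong (y ^_) e) (^-even y j))))
  parity (j , inj₂ e) = odd j e (trans h (trans (cong (y ^_) e) (^-odd y j)))

is-solution : ∀ x y n → Solution x y n → sumSq 2 x ≡ y ^ n
is-solution x y n (inj₁ (x≡ , y≡)) = trans (left x≡) (sym (right y≡))
  where
  left : x ≡ - + 1 ⊎ x ≡ - + 2 → sumSq 2 x ≡ + 1
  left (inj₁ e) = cong (sumSq 2) e
  left (inj₂ e) = cong (sumSq 2) e
  right : y ≡ + 1 ⊎ (y ≡ - + 1 × 2 ∣ n) → y ^ n ≡ + 1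
  right (inj₁ e) = trans (cong (_^ n) e) (ℤ.^-zeroˡ n)
  right (inj₂ (e , divides q n≡)) = trans (cong₂ _^_ e (trans n≡ (ℕ.*-comm q 2))) (trans (^-even (- + 1) q) (ℤ.^-zeroˡ q))
is-solution x y n (inj₂ (x≡ , y≡ , n≡)) = trans (left x≡) (sym (trans (cong (y ^_) n≡) (right y≡)))
  where
  left : x ≡ + 118 ⊎ x ≡ - + 121 → sumSq 2 x ≡ sumSq 2 (+ 118)
  left (inj₁ e) = cong (sumSq 2) e
  left (inj₂ e) = cong (sumSq 2) e
  right : y ≡ + 13 ⊎ y ≡ - + 13 → y ^ 4 ≡ sumSq 2 (+ 118)
  right (inj₁ e) = cong (_^ 4) e
  right (inj₂ e) = cong (_^ 4) e

square⇒power : ∀ x y → sumSq 2 x ≡ y ^ 2 → IsPower (+ 2 * x + + 3) y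
square⇒power x y h = pell (+ 2 * x + + 3) y (trans (cong (_+ + 1) (sym (ℤ.*-identityˡ ((+ 2 * x + + 3) * (+ 2 * x + + 3))))) (complete-2 x (y * y) (trans h (cong (y *_) (ℤ.*-identityʳ y)))))

power⇒square : ∀ x y → IsPower (+ 2 * x + + 3) y → sumSq 2 x ≡ y ^ 2
power⇒square x y p = trans (ℤ.*-cancelˡ-≡ (+ 2) (sumSq 2 x) (y * y) (trans (sym (complete-2 x (sumSq 2 x) refl)) (trans (cong (_+ + 1) (ℤ.*-identityˡ ((+ 2 * x + + 3) * (+ 2 * x + + 3)))) (pell⁻¹ (+ 2 * x + + 3) y p)))) (cong (y *_) (sym (ℤ.*-identityʳ y)))

Classified : ℕ → ℤ → ℤ → ℕ → Set
Classified d x y n = 3 ℕ.≤ n × d ≡ 2 × Solution x y n ⊎ n ≡ 2 × d ≡ 2 × IsPower (+ 2 * x + + 3) y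

classified : ∀ d x y n → 2 ℕ.≤ d → d ℕ.≤ 10 → 2 ℕ.≤ n → sumSq d x ≡ y ^ n → Classified d x y n
classified 0 x y n () _ _ _
classified 1 x y n (s≤s ()) _ _ _
classified d x y 0 _ _ () _
classified d x y 1 _ _ (s≤s ()) _
classified 2 x y 2 _ _ _ h = inj₂ (refl , refl , square⇒power x y h)
classified 2 x y (suc (suc (suc n))) _ _ _ h = inj₁ (s≤s (s≤s (s≤s z≤n)) , refl , solution x y n h)
classified 3 x y (suc (suc n)) _ _ _ h = ⊥-elim (no-power-3 x y n h)
classified 4 x y (suc (suc n)) _ _ _ h = ⊥-elim (no-power-4 x y n h)
classified 5 x y (suc (suc n)) _ _ _ h = ⊥-elim (no-power-5 x y n h)
classified 6 x y (suc (suc n)) _ _ _ h = ⊥-elim (no-power-6 x y n h)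
classified 7 x y (suc (suc n)) _ _ _ h = ⊥-elim (no-power-7 x y n h)
classified 8 x y (suc (suc n)) _ _ _ h = ⊥-elim (no-power-8 x y n h)
classified 9 x y (suc (suc n)) _ _ _ h = ⊥-elim (no-power-9 x y n h)
classified 10 x y (suc (suc n)) _ _ _ h = ⊥-elim (no-power-10 x y n h)
classified (suc (suc (suc (suc (suc (suc (suc (suc (suc (suc (suc d))))))))))) x y (suc (suc n)) _ d≤10 _ h =
  contradiction d≤10 (ℕ.<⇒≱ (ℕ.m≤m+n 11 d))

theorem1 : (d : ℕ) (x y : ℤ) (n : ℕ) → 2 ℕ.≤ d → d ℕ.≤ 10 → 2 ℕ.≤ n →
    (sumSq d x ≡ y ^ n) ⇔
      ((3 ℕ.≤ n × d ≡ 2 ×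
          (((x ≡ - + 1 ⊎ x ≡ - + 2) × (y ≡ + 1 ⊎ (y ≡ - + 1 × 2 ∣ n)))
          ⊎ ((x ≡ + 118 ⊎ x ≡ - + 121) × (y ≡ + 13 ⊎ y ≡ - + 13) × n ≡ 4)))
      ⊎ (n ≡ 2 × d ≡ 2 ×
          ∃ λ (r : ℤ) → ((+ 2 * x + + 3 , y) ≡ εpow (+ 2 * r + + 1))
                      ⊎ ((+ 2 * x + + 3 , y) ≡ neg (εpow (+ 2 * r + + 1)))))
theorem1 d x y n 2≤d d≤10 2≤n = mk⇔ (classified d x y n 2≤d d≤10 2≤n) back
  where
  back : Classified d x y n → sumSq d x ≡ y ^ n
  back (inj₁ (_ , refl , s)) = is-solution x y n s
  back (inj₂ (refl , refl , p)) = power⇒square x y p
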